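{- Let $\lambda/\mu$ be a skew shape with $n$ cells which is not a connected ribbon. Then all coefficients in the (unique) expansion of the skew Schur function $s_{\lambda/\mu}$ in the basis $\{\hat F^{\mathrm{cyc}}_{n,A}: A \text{ a cyclic orbit of nonempty subsets of } [n]\}$ of $\mathrm{cQSym}_n$ are nonnegative integers.
   Context: A ribbon is a skew shape containing no $2\times2$ square. For $n\ge1$ and $J\subseteq[n]$, let $P^{\mathrm{cyc}}_{n,J}$ be the set of pairs $(w,k)$ with $w\in\{1,2,\dots\}^n$, $k\in[n]$, such that (i) $w_k\le w_{k+1}\le\cdots\le w_n\le w_1\le\cdots\le w_{k-1}$, and (ii) $w_j<w_{j+1}$ for every $j\in J\setminus\{k-1\}$, indices modulo $n$. Define $F^{\mathrm{cyc}}_{n,J}:=\sum_{(w,k)\in P^{\mathrm{cyc}}_{n,J}}x_{w_1}\cdots x_{w_n}$. The group $\mathbb{Z}/n\mathbb{Z}$ acts on subsets of $[n]$ by cyclic shifts $J\mapsto J+i=\{j+i \bmod n: j\in J\}$; let $d_J$ be the order of the stabilizer of $J$. The normalized function $\hat F^{\mathrm{cyc}}_{n,J}:=F^{\mathrm{cyc}}_{n,J}/d_J$ depends only on the orbit $A$ of $J$ and is denoted $\hat F^{\mathrm{cyc}}_{n,A}$. $\mathrm{cQSym}_n$ is the abelian group of homogeneous degree-$n$ formal power series $f\in\mathbb{Z}[[x_1,x_2,\dots]]$ such that for any $t\ge1$, any $i_1<\dots<i_t$ and $i'_1<\dots<i'_t$, any positive integers $m=(m_1,\dots,m_t)$ and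 any cyclic shift $m'$ of $m$, the coefficients of $x_{i_1}^{m_1}\cdots x_{i_t}^{m_t}$ and $x_{i'_1}^{m'_1}\cdots x_{i'_t}^{m'_t}$ in $f$ agree. The set $\{\hat F^{\mathrm{cyc}}_{n,A}\}$ over nonempty orbits $A$ is a $\mathbb{Z}$-basis of $\mathrm{cQSym}_n$, which contains all symmetric functions of degree $n$. -}

module Defs where

open import Data.Nat using (ℕ; zero; suc; _+_; _*_; _∸_; _≤_; _<_; _≥_; NonZero)
open import Data.Nat.Properties using () renaming (_≟_ to _≟ℕ_; _≤?_ to _≤ℕ?_)
open import Data.Nat.DivMod using (_mod_; _/_)
open import Data.Bool using (Bool; true; false; if_then_else_)
open import Data.Fin using (Fin; toℕ) renaming (_≤_ to _≤F_; _<_ to _<F_)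
open import Data.Fin.Properties using (all?; any?) renaming (_≤?_ to _≤F?_; _<?_ to _<F?_; _≟_ to _≟F_)
open import Data.List using (List; []; _∷_; map; concatMap; length; filter; upTo; allFin)
open import Data.Nat.ListAction using (sum)
open import Data.Vec using (Vec; []; _∷_; lookup; fromList)
open import Data.Vec.Properties using (≡-dec)
open import Data.Bool.Properties using () renaming (_≟_ to _≟B_)
open import Data.Product using (Σ; ∃; _×_; _,_; proj₁; proj₂)
open import Relation.Nullary using (¬_; Dec)
open import Relation.Nullary.Decidable using (_×-dec_; _→-dec_; ¬?)
open import Relation.Unary using (Decidable)
open import Relation.Binary.PropositionalEquality using (_≡_)

count : ∀ {n} {P : Fin n → Set} → Decidable P → ℕ
count {n} P? = length (filter P? (allFin n))

allVecs : (N n : ℕ) → List (Vec (Fin N) n)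
allVecs N zero    = [] ∷ []
allVecs N (suc n) = concatMap (λ a → map (a ∷_) (allVecs N n)) (allFin N)

-- all subsets of [n], as characteristic vectors (position i ↔ element i+1)
allSubsets : (n : ℕ) → List (Vec Bool n)
allSubsets zero    = [] ∷ []
allSubsets (suc n) = concatMap (λ b → map (b ∷_) (allSubsets n)) (true ∷ false ∷ [])

-- Partitions and skew shapes (English convention, 0-indexed rows/cols)

row : List ℕ → ℕ → ℕ
row []       _       = 0
row (x ∷ xs) zero    = x
row (x ∷ xs) (suc i) = row xs i

IsPartition : List ℕ → Set
IsPartition λ′ = ∀ i → row λ′ (suc i) ≤ row λ′ i

_⊆P_ : List ℕ → List ℕ → Set
μ ⊆P λ′ = ∀ i → row μ i ≤ row λ′ i

InShape : List ℕ → List ℕ → ℕ → ℕ → Set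
InShape λ′ μ i j = (row μ i ≤ j) × (j < row λ′ i)

cells : List ℕ → List ℕ → List (ℕ × ℕ)
cells λ′ μ = concatMap (λ i → map (λ t → (i , row μ i + t)) (upTo (row λ′ i ∸ row μ i)))
                       (upTo (Data.List.length λ′))

IsRibbon : List ℕ → List ℕ → Set
IsRibbon λ′ μ = ∀ i j → ¬ (InShape λ′ μ i j × InShape λ′ μ (suc i) j
                          × InShape λ′ μ i (suc j) × InShape λ′ μ (suc i) (suc j))

data Adj : ℕ × ℕ → ℕ × ℕ → Set where
  right : ∀ i j → Adj (i , j) (i , suc j)
  left  : ∀ i j → Adj (i , suc j) (i , j)
  down  : ∀ i j → Adj (i , j) (suc i , j)
  up    : ∀ i j → Adj (suc i , j) (i , j)

-- a path of edge-adjacent cells of λ/μ from a to b (a itself is assumed in the shape)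
data Path (λ′ μ : List ℕ) : ℕ × ℕ → ℕ × ℕ → Set where
  here : ∀ {a} → Path λ′ μ a a
  step : ∀ {a b c} → Adj a b → InShape λ′ μ (proj₁ b) (proj₂ b) → Path λ′ μ b c → Path λ′ μ a c

IsConnected : List ℕ → List ℕ → Set
IsConnected λ′ μ = (∃ λ c → InShape λ′ μ (proj₁ c) (proj₂ c))
  × (∀ a b → InShape λ′ μ (proj₁ a) (proj₂ a) → InShape λ′ μ (proj₁ b) (proj₂ b) → Path λ′ μ a b)

IsConnectedRibbon : List ℕ → List ℕ → Set
IsConnectedRibbon λ′ μ = IsRibbon λ′ μ × IsConnected λ′ μ

-- Semistandard tableaux of shape λ/μ with entries in {1..N} (encoded by Fin N)
-- A filling is a vector T indexed by the positions of the list `cells λ μ`.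

module _ (λ′ μ : List ℕ) (N : ℕ) where
  private
    L  = length (cells λ′ μ)
    cs : Vec (ℕ × ℕ) L
    cs = fromList (cells λ′ μ)

  SSYTCond : Vec (Fin N) L → Fin L → Fin L → Set
  SSYTCond T p q =
      (proj₁ (lookup cs p) ≡ proj₁ (lookup cs q) → proj₂ (lookup cs p) < proj₂ (lookup cs q)
         → lookup T p ≤F lookup T q)
    × (proj₂ (lookup cs p) ≡ proj₂ (lookup cs q) → proj₁ (lookup cs p) < proj₁ (lookup cs q)
         → lookup T p <F lookup T q)

  ssytCond? : ∀ T p q → Dec (SSYTCond T p q)
  ssytCond? T p q =
       ((proj₁ (lookup cs p) ≟ℕ proj₁ (lookup cs q)) →-dec
          ((suc (proj₂ (lookup cs p)) ≤ℕ? proj₂ (lookup cs q)) →-dec (lookup T p ≤F? lookup T q)))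
    ×-dec
       ((proj₂ (lookup cs p) ≟ℕ proj₂ (lookup cs q)) →-dec
          ((suc (proj₁ (lookup cs p)) ≤ℕ? proj₁ (lookup cs q)) →-dec (lookup T p <F? lookup T q)))

  IsSSYT : Vec (Fin N) L → Set
  IsSSYT T = ∀ p q → SSYTCond T p q

  HasContentT : (Fin N → ℕ) → Vec (Fin N) L → Set
  HasContentT e T = ∀ a → count (λ p → lookup T p ≟F a) ≡ e a

  ssytWithContent? : (e : Fin N → ℕ) → Decidable (λ T → IsSSYT T × HasContentT e T)
  ssytWithContent? e T =
    all? (λ p → all? (λ q → ssytCond? T p q))
    ×-dec all? (λ a → count (λ p → lookup T p ≟F a) ≟ℕ e a)

  -- coefficient of x^e = x_1^{e 0} ... x_N^{e (N-1)} in s_{λ/μ}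
  skewSchurCoeff : (Fin N → ℕ) → ℕ
  skewSchurCoeff e = length (filter (ssytWithContent? e) (allVecs N L))

-- Cyclic fundamental quasisymmetric functions, n = suc m.
-- Positions 0..m of Fin (suc m) stand for 1..n.

module _ (m : ℕ) where
  private
    n = suc m

  nextP : Fin n → Fin n
  nextP j = (toℕ j + 1) mod n

  prevP : Fin n → Fin n
  prevP j = (toℕ j + m) mod n

  -- cyclic shift J + i = { j + i mod n : j ∈ J }
  shift : Vec Bool n → Fin n → Vec Bool n
  shift J i = Data.Vec.tabulate (λ x → lookup J ((toℕ x + (n ∸ toℕ i)) mod n))

  -- d_J : order of the stabilizer of J (shift 0 always stabilizes; others counted)
  stab : Vec Bool n → ℕ
  stab J = suc (count {m} (λ i → ≡-dec _≟B_ (shift J (Data.Fin.suc i)) J))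

  PcycCond : ∀ {N} → Vec Bool n → Vec (Fin N) n → Fin n → Fin n → Set
  PcycCond J w k j = (¬ (j ≡ prevP k) → lookup w j ≤F lookup w (nextP j))
                   × (¬ (j ≡ prevP k) → lookup J j ≡ true → lookup w j <F lookup w (nextP j))

  pcycCond? : ∀ {N} J (w : Vec (Fin N) n) k j → Dec (PcycCond J w k j)
  pcycCond? J w k j =
      (¬? (j ≟F prevP k) →-dec (lookup w j ≤F? lookup w (nextP j)))
    ×-dec (¬? (j ≟F prevP k) →-dec ((lookup J j ≟B true) →-dec (lookup w j <F? lookup w (nextP j))))

  HasContentW : ∀ {N} → (Fin N → ℕ) → Vec (Fin N) n → Set
  HasContentW e w = ∀ a → count (λ p → lookup w p ≟F a) ≡ e a

  pcycWithContent? : ∀ {N} (J : Vec Bool n) (e : Fin N → ℕ)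
    → Decidable (λ (wk : Vec (Fin N) n × Fin n) →
                   (∀ j → PcycCond J (proj₁ wk) (proj₂ wk) j) × HasContentW e (proj₁ wk))
  pcycWithContent? J e (w , k) =
    all? (λ j → pcycCond? J w k j) ×-dec all? (λ a → count (λ p → lookup w p ≟F a) ≟ℕ e a)

  FcycCoeff : (N : ℕ) → Vec Bool n → (Fin N → ℕ) → ℕ
  FcycCoeff N J e = length (filter (pcycWithContent? J e)
                      (concatMap (λ w → map (w ,_) (allFin n)) (allVecs N n)))

  -- coefficient of x^e in \hat F^cyc_{n,J} = F^cyc_{n,J} / d_J (division is exact)
  FcycHatCoeff : (N : ℕ) → Vec Bool n → (Fin N → ℕ) → ℕ
  FcycHatCoeff N J e = FcycCoeff N J e / stab J

  -- binary code of a subset, used to pick a canonical representative of each orbit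
  code : ∀ {k} → Vec Bool k → ℕ
  code []          = 0
  code (b ∷ J)     = (if b then 1 else 0) + 2 * code J

  IsOrbitRep : Vec Bool n → Set
  IsOrbitRep J = (∀ i → code J ≤ code (shift J i)) × (∃ λ j → lookup J j ≡ true)

  isOrbitRep? : Decidable IsOrbitRep
  isOrbitRep? J = all? (λ i → code J ≤ℕ? code (shift J i)) ×-dec any? (λ j → lookup J j ≟B true)

  orbitReps : List (Vec Bool n)
  orbitReps = filter isOrbitRep? (allSubsets n)

  cycExpansionCoeff : (Vec Bool n → ℕ) → (N : ℕ) → (Fin N → ℕ) → ℕ
  cycExpansionCoeff c N e = sum (map (λ J → c J * FcycHatCoeff N J e) orbitReps)

{-# OPTIONS --safe #-}
-- Let b D be the number of standard tableaux of the shape with descent set D ⊆ [n-1]. Since a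
-- cyclic fundamental function is the sum of the fundamental functions of the sets (J + i) ∩ [n-1],
-- it suffices to find numbers c J ≥ 0, invariant under rotation of J ⊆ [n] and with c ∅ = 0, such
-- that c D + c (D ∪ {n}) = b D for all D.
--
-- Let V be the skew representation of the symmetric group in Young's seminormal form, realised on
-- functions on words, and g = s₀ ⋯ s_{n-2}. The fixed spaces U_j of the s_j, completed by
-- U_{n-1} = g U_{n-2}, are permuted cyclically by g. Put V^J = ⋂_{j ∉ J} U_j; then b D is the
-- dimension of V^D modulo Σ_{y ∈ D} (V^D ∩ U_y), computed without the last position. Leaving out
-- any position, the remaining subspaces have a common adapted basis, hence satisfy distributivity.
--
-- If the shape contains a 2 × 2 square, no tableau has a final segment of [n-1] as descent set.
-- Hence V^∅ = 0, and the exactness which makes c J = dim V^J / Σ_{y ∈ J} (V^J ∩ U_y) additive holds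
-- when J is a final segment of [n]; distributivity carries it over to all J of the same size.
--
-- If the shape is cut into two parts sharing no column, give the letters two colours according to
-- the part. A word using both colours has a change of colour on the circle, where the comparison of
-- the neighbouring letters is forced; it can be reopened there, so c J counts words by their cyclic
-- descents. A shape of neither kind is a connected ribbon.
module Submission where

open import Defs

open import Data.Bool as Bool using (Bool; true; false; if_then_else_)
open import Data.Bool.Properties as BoolP using () renaming (_≟_ to _≟B_)
open import Data.Empty using (⊥; ⊥-elim)
open import Data.Fin as Fin using (Fin; toℕ; zero; suc)
import Data.Fin.Induction as FinI
open import Data.Fin.Properties as FinP using (toℕ-injective; toℕ<n; any?) renaming (_≟_ to _≟F_; all? to allF?)
open import Data.Fin.Relation.Unary.Top using (view; ‵fromℕ; ‵inject₁; view-inject₁; view-fromℕ)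
open import Data.List as List using (List; []; _∷_; length)
open import Data.List.Membership.Propositional using (_∈_; find)
import Data.List.Membership.Propositional.Properties as ∈P
open import Data.List.Properties as ListP using ()
open import Data.List.Relation.Unary.All as All using (All; []; _∷_)
import Data.List.Relation.Unary.All.Properties as AllP
open import Data.List.Relation.Unary.AllPairs as AllPairs using (AllPairs; []; _∷_)
import Data.List.Relation.Unary.AllPairs.Properties as AllPairsP
open import Data.List.Relation.Unary.Any as Any using (here; there)
import Data.List.Relation.Unary.Any.Properties as AnyP
open import Data.List.Relation.Unary.Unique.Propositional using (Unique)
import Data.List.Relation.Unary.Unique.Propositional.Properties as UniqueP
open import Data.Nat as ℕ using (ℕ; zero; suc; s≤s; z≤n)
open import Data.Nat.DivMod as DivMod using (_mod_)
open import Data.Nat.ListAction using (sum)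
open import Data.Nat.Properties as ℕP using ()
open import Data.Product using (Σ; ∃; _×_; _,_; proj₁; proj₂)
import Data.Product.Properties as ProdP
open import Data.Rational as ℚ using (ℚ; 0ℚ; 1ℚ; _+_; _*_; _-_; -_)
open import Data.Rational.Properties as ℚP using ()
open import Data.Rational.Solver using (module +-*-Solver)
open import Data.Sum using (_⊎_; inj₁; inj₂)
open import Data.Unit using (⊤; tt)
open import Data.Vec as Vec using (Vec; []; _∷_)
import Data.Vec.Functional as VF
import Data.Vec.Functional.Properties as VFP
import Data.Vec.Properties as VecP
open import Function using (_∘_)
open import Function.Bundles using (Equivalence)
open import Relation.Binary.Definitions using (tri<; tri≈; tri>)
open import Relation.Binary.PropositionalEquality
open import Relation.Nullary using (¬_; Dec; yes; no; does)
open import Relation.Nullary.Decidable using (_×-dec_; _→-dec_; _⊎-dec_; ¬?)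
open import Algebra.Properties.CommutativeSemigroup ℕP.+-commutativeSemigroup using (x∙yz≈y∙xz) renaming (interchange to ℕ-interchange)

open +-*-Solver using (solve; con; _:+_; _:*_; _:-_; :-_; _:=_)

-- Rotation invariance, `c ∅ = 0` and `c D + c (D ∪ {n}) = b D` already determine `c`: rotate an
-- element of J to n and recurse on the size. The result is an alternating sum of tableau numbers,
-- so the whole difficulty is its sign, and `c J` is therefore exhibited as a dimension or a
-- cardinality. A tableau compares only n - 1 neighbouring pairs; the rotation acts on functions,
-- through g, and not on tableaux. The seminormal form is scaled so that a function is fixed by s_j
-- exactly when its values agree at words which differ by exchanging two neighbouring letters; no
-- axial distance enters. Hence, within one colour, indicator functions `x T` of classes of words,
-- triangular for the lexicographic order, are adapted to all linear U_j at once: `x T` lies in U_j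
-- if T has no ascent at j, and vectors of U_j involve no other `x T`. The circle enters only
-- through g, which turns any omitted position into the last. Between colours the inverse axial
-- distance is set to 0, as if the two parts of the shape were infinitely far apart; g then rotates
-- colour words.

-- Rational arithmetic behind the seminormal form.

⌜_⌝ : ℕ → ℚ
⌜ zero ⌝  = 0ℚ
⌜ suc k ⌝ = 1ℚ + ⌜ k ⌝

⌜⌝-+ : ∀ j k → ⌜ j ℕ.+ k ⌝ ≡ ⌜ j ⌝ + ⌜ k ⌝
⌜⌝-+ zero    k = sym (ℚP.+-identityˡ ⌜ k ⌝)
⌜⌝-+ (suc j) k = trans (cong (1ℚ +_) (⌜⌝-+ j k)) (sym (ℚP.+-assoc 1ℚ ⌜ j ⌝ ⌜ k ⌝))

0≤⌜⌝ : ∀ k → 0ℚ ℚ.≤ ⌜ k ⌝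
0≤⌜⌝ zero    = ℚP.≤-refl
0≤⌜⌝ (suc k) = ℚP.≤-trans (0≤⌜⌝ k)
  (subst (ℚ._≤ 1ℚ + ⌜ k ⌝) (ℚP.+-identityˡ ⌜ k ⌝) (ℚP.+-monoˡ-≤ ⌜ k ⌝ (ℚP.nonNegative⁻¹ 1ℚ)))

⌜suc⌝≢0 : ∀ k → ⌜ suc k ⌝ ≢ 0ℚ
⌜suc⌝≢0 k eq = ℚP.<⇒≢ (ℚP.<-≤-trans (ℚP.positive⁻¹ 1ℚ)
  (subst (ℚ._≤ 1ℚ + ⌜ k ⌝) (ℚP.+-identityʳ 1ℚ) (ℚP.+-monoʳ-≤ 1ℚ (0≤⌜⌝ k)))) (sym eq)

abstract
  -- Totalised by `inv 0ℚ ≡ 0ℚ`, which keeps `inv` odd. Thus the operators built from it are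
  -- involutions with no condition on the distances; only the braid relation has to exclude distance
  -- 0.
  inv : ℚ → ℚ
  inv q with q ℚP.≟ 0ℚ
  ... | yes _  = 0ℚ
  ... | no q≢0 = ℚ.1/_ q {{ℚ.≢-nonZero q≢0}}

  inv-* : ∀ {q} → q ≢ 0ℚ → q * inv q ≡ 1ℚ
  inv-* {q} q≢0 with q ℚP.≟ 0ℚ
  ... | yes q≡0 = ⊥-elim (q≢0 q≡0)
  ... | no q≢0′ = ℚP.*-inverseʳ q {{ℚ.≢-nonZero q≢0′}}

  inv-0 : inv 0ℚ ≡ 0ℚ
  inv-0 = refl

*-cancel-0 : ∀ {p q} → p ≢ 0ℚ → p * q ≡ 0ℚ → q ≡ 0ℚ
*-cancel-0 {p} {q} p≢0 eq = begin
  q               ≡⟨ sym (ℚP.*-identityˡ q) ⟩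
  1ℚ * q          ≡⟨ cong (_* q) (sym (inv-* p≢0)) ⟩
  p * inv p * q   ≡⟨ solve 3 (λ p i q → p :* i :* q := i :* (p :* q)) refl p (inv p) q ⟩
  inv p * (p * q) ≡⟨ cong (inv p *_) eq ⟩
  inv p * 0ℚ      ≡⟨ ℚP.*-zeroʳ (inv p) ⟩
  0ℚ              ∎
  where open ≡-Reasoning

inv-unique : ∀ {q r} → q ≢ 0ℚ → q * r ≡ 1ℚ → inv q ≡ r
inv-unique {q} {r} q≢0 eq = begin
  inv q           ≡⟨ sym (ℚP.*-identityʳ (inv q)) ⟩
  inv q * 1ℚ      ≡⟨ cong (inv q *_) (sym eq) ⟩
  inv q * (q * r) ≡⟨ solve 3 (λ i q r → i :* (q :* r) := q :* i :* r) refl (inv q) q r ⟩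
  q * inv q * r   ≡⟨ cong (_* r) (inv-* q≢0) ⟩
  1ℚ * r          ≡⟨ ℚP.*-identityˡ r ⟩
  r               ∎
  where open ≡-Reasoning

neg-≢0 : ∀ {q} → q ≢ 0ℚ → - q ≢ 0ℚ
neg-≢0 {q} q≢0 eq = q≢0 (trans (solve 1 (λ q → q := :- (:- q)) refl q) (cong -_ eq))

inv-neg : ∀ q → inv (- q) ≡ - inv q
inv-neg q with q ℚP.≟ 0ℚ
... | yes refl = trans inv-0 (cong -_ (sym inv-0))
... | no q≢0 = inv-unique (neg-≢0 q≢0)
  (trans (solve 2 (λ q i → (:- q) :* (:- i) := q :* i) refl q (inv q)) (inv-* q≢0))

inv-1 : inv 1ℚ ≡ 1ℚ
inv-1 = inv-unique (λ ()) refl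

-- The three distances between letters a, b, c satisfy (a - b) + (b - c) = a - c; this identity of
-- their inverses is all that the braid relation uses for distinct letters.
inv-add : ∀ {p q} → p ≢ 0ℚ → q ≢ 0ℚ → p + q ≢ 0ℚ → inv p * inv q ≡ inv (p + q) * (inv p + inv q)
inv-add {p} {q} p≢0 q≢0 r≢0 = sym (begin
  k * (i + j)                     ≡⟨ cong (k *_) (cong₂ _+_ (unit i (inv-* q≢0)) (unit j (inv-* p≢0))) ⟩
  k * (i * (q * j) + j * (p * i)) ≡⟨ solve 5 (λ k i j p q → k :* (i :* (q :* j) :+ j :* (p :* i)) := (p :+ q) :* k :* (i :* j)) refl k i j p q ⟩
  (p + q) * k * (i * j)           ≡⟨ cong (_* (i * j)) (inv-* r≢0) ⟩
  1ℚ * (i * j)                    ≡⟨ ℚP.*-identityˡ (i * j) ⟩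
  i * j                           ∎)
  where
    open ≡-Reasoning
    i = inv p
    j = inv q
    k = inv (p + q)
    unit : ∀ x {z} → z ≡ 1ℚ → x ≡ x * z
    unit x eq = sym (trans (cong (x *_) eq) (ℚP.*-identityʳ x))

-- Young's seminormal form: if x and y are the values of a function at a word and at the word with
-- two neighbouring letters exchanged, and i is the inverse of the axial distance of these letters,
-- then mix i x y is the value of its image at the first word.
abstract
  mix : ℚ → ℚ → ℚ → ℚ
  mix i x y = y + i * (y - x)

  mix-refl : ∀ i x → mix i x x ≡ x
  mix-refl = solve 2 (λ i x → x :+ i :* (x :- x) := x) refl

  mix-affine : ∀ i x y → mix i x y ≡ (1ℚ + i) * y + (- i) * x
  mix-affine = solve 3 (λ i x y → y :+ i :* (y :- x) := (con 1ℚ :+ i) :* y :+ (:- i) :* x) refl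

  mix-invol : ∀ i x y → mix i (mix i x y) (mix (- i) y x) ≡ x
  mix-invol = solve 3 (λ i x y → let t = λ i x y → y :+ i :* (y :- x) in
    t i (t i x y) (t (:- i) y x) := x) refl

  mix-+ : ∀ i x y x′ y′ → mix i (x + x′) (y + y′) ≡ mix i x y + mix i x′ y′
  mix-+ = solve 5 (λ i x y x′ y′ → let t = λ i x y → y :+ i :* (y :- x) in
    t i (x :+ x′) (y :+ y′) := t i x y :+ t i x′ y′) refl

  mix-* : ∀ i k x y → mix i (k * x) (k * y) ≡ k * mix i x y
  mix-* = solve 4 (λ i k x y → let t = λ i x y → y :+ i :* (y :- x) in
    t i (k :* x) (k :* y) := k :* t i x y) refl

  -- The coefficient `i` cancels between the two equations and leaves 2(y - x) = 0. This is what
  -- makes the fixed spaces independent of the axial distances.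
  mix-fixed : ∀ i x y → mix i x y ≡ x → mix (- i) y x ≡ y → y ≡ x
  mix-fixed i x y p q = begin
    y           ≡⟨ solve 2 (λ x y → y := x :+ (y :- x)) refl x y ⟩
    x + (y - x) ≡⟨ cong (x +_) (*-cancel-0 (⌜suc⌝≢0 1) twice) ⟩
    x + 0ℚ      ≡⟨ ℚP.+-identityʳ x ⟩
    x           ∎
    where
      open ≡-Reasoning
      twice : ⌜ 2 ⌝ * (y - x) ≡ 0ℚ
      twice = begin
        ⌜ 2 ⌝ * (y - x)                         ≡⟨ solve 3 (λ i x y → let t = λ i x y → y :+ i :* (y :- x) in
                                                    con ⌜ 2 ⌝ :* (y :- x) := (t i x y :- x) :- (t (:- i) y x :- y)) refl i x y ⟩
        (mix i x y - x) - (mix (- i) y x - y)   ≡⟨ cong₂ (λ s t → (s - x) - (t - y)) p q ⟩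
        (x - x) - (y - y)                       ≡⟨ solve 2 (λ x y → (x :- x) :- (y :- y) := con 0ℚ) refl x y ⟩
        0ℚ                                      ∎

  -- A polynomial identity modulo the hypothesis: the two sides differ by `C * (A + B) - A * B`
  -- times the linear form `z` in the values.
  mix-braid : ∀ A B C abc acb bac bca cab cba → A * B ≡ C * (A + B) →
      mix A (mix B (mix A abc bac) (mix C acb cab)) (mix C (mix (- A) bac abc) (mix B bca cba))
    ≡ mix B (mix A (mix B abc acb) (mix C bac bca)) (mix C (mix (- B) acb abc) (mix A cab cba))
  mix-braid A B C abc acb bac bca cab cba rel = begin
    _                  ≡⟨ solve 9 (λ A B C abc acb bac bca cab cba →
                            let t = λ i x y → y :+ i :* (y :- x) in
                            t A (t B (t A abc bac) (t C acb cab)) (t C (t (:- A) bac abc) (t B bca cba))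
                            := t B (t A (t B abc acb) (t C bac bca)) (t C (t (:- B) acb abc) (t A cab cba))
                             :+ (C :* (A :+ B) :- A :* B) :* ((A :- B) :* abc :+ (con 1ℚ :+ B) :* acb :- (con 1ℚ :+ A) :* bac))
                            refl A B C abc acb bac bca cab cba ⟩
    rhs + (C * (A + B) - A * B) * z  ≡⟨ cong (λ t → rhs + (C * (A + B) - t) * z) rel ⟩
    rhs + (C * (A + B) - C * (A + B)) * z ≡⟨ solve 3 (λ r c z → r :+ (c :- c) :* z := r) refl rhs (C * (A + B)) z ⟩
    rhs                ∎
    where
      open ≡-Reasoning
      rhs z : ℚ
      rhs = mix B (mix A (mix B abc acb) (mix C bac bca)) (mix C (mix (- B) acb abc) (mix A cab cba))
      z = (A - B) * abc + (1ℚ + B) * acb - (1ℚ + A) * bac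

  mix-0 : ∀ i → mix i 0ℚ 0ℚ ≡ 0ℚ
  mix-0 i = mix-refl i 0ℚ

  mix-zero : ∀ x → mix 0ℚ x 0ℚ ≡ 0ℚ
  mix-zero = solve 1 (λ x → con 0ℚ :+ con 0ℚ :* (con 0ℚ :- x) := con 0ℚ) refl

  -- At `i = -1` the coefficient `1 + i` of the exchanged word vanishes, so a value at a valid word
  -- cannot leak into an invalid one.
  mix-wall : ∀ z → mix (- 1ℚ) 0ℚ z ≡ 0ℚ
  mix-wall = solve 1 (λ z → z :+ con (- 1ℚ) :* (z :- con 0ℚ) := con 0ℚ) refl

  -- Here, as in the next two identities, the defect is written as ρ = P - Q - P Q times function
  -- values: at the exceptional distance it is not ρ but the values that vanish.
  mix-aab : ∀ P Q p q r → mix Q p (mix P q r) ≡ mix Q (mix Q p q) (mix P (mix (- Q) q p) r)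
    + ((1ℚ + Q) * ((P - Q - P * Q) * p) + (- (1ℚ + Q)) * ((P - Q - P * Q) * q))
  mix-aab = solve 5 (λ P Q p q r → let t = λ i x y → y :+ i :* (y :- x) ; ρ = P :- Q :- P :* Q in
    t Q p (t P q r) := t Q (t Q p q) (t P (t (:- Q) q p) r)
      :+ ((con 1ℚ :+ Q) :* (ρ :* p) :+ (:- (con 1ℚ :+ Q)) :* (ρ :* q))) refl

  mix-aba : ∀ P Q p q r → mix P (mix (- Q) (mix P q r) p) (mix (- P) r q) ≡ mix (- Q) (mix P (mix (- Q) q p) r) (mix Q p q)
    + ((- (1ℚ - Q)) * ((P - Q - P * Q) * p) + (- (P + Q)) * ((P - Q - P * Q) * q))
    + ((1ℚ + P) * ((P - Q - P * Q) * r) + 0ℚ * ((P - Q - P * Q) * q))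
  mix-aba = solve 5 (λ P Q p q r → let t = λ i x y → y :+ i :* (y :- x) ; ρ = P :- Q :- P :* Q in
    t P (t (:- Q) (t P q r) p) (t (:- P) r q) := t (:- Q) (t P (t (:- Q) q p) r) (t Q p q)
      :+ ((:- (con 1ℚ :- Q)) :* (ρ :* p) :+ (:- (P :+ Q)) :* (ρ :* q))
      :+ ((con 1ℚ :+ P) :* (ρ :* r) :+ con 0ℚ :* (ρ :* q))) refl

  mix-baa : ∀ P Q p q r → mix (- P) (mix (- P) r q) (mix (- Q) (mix P q r) p) ≡ mix (- P) r (mix (- Q) q p)
    + ((1ℚ - P) * ((P - Q - P * Q) * q) + (- (1ℚ - P)) * ((P - Q - P * Q) * r))
  mix-baa = solve 5 (λ P Q p q r → let t = λ i x y → y :+ i :* (y :- x) ; ρ = P :- Q :- P :* Q in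
    t (:- P) (t (:- P) r q) (t (:- Q) (t P q r) p) := t (:- P) r (t (:- Q) q p)
      :+ ((con 1ℚ :- P) :* (ρ :* q) :+ (:- (con 1ℚ :- P)) :* (ρ :* r))) refl

-- Both sides of the braid relation at a word beginning with letters a, b, c; the arguments are the
-- mixing coefficients (primed: after one letter) and the values at the six rearrangements.
braidˡ braidʳ : (ab ba ac bc bc′ cb′ ac′ ab′ abc acb bac bca cab cba : ℚ) → ℚ
braidˡ ab ba ac bc bc′ cb′ ac′ ab′ abc acb bac bca cab cba =
  mix ab (mix bc′ (mix ab abc bac) (mix ac acb cab)) (mix ac′ (mix ba bac abc) (mix bc bca cba))
braidʳ ab ba ac bc bc′ cb′ ac′ ab′ abc acb bac bca cab cba =
  mix bc′ (mix ab (mix bc′ abc acb) (mix ac′ bac bca)) (mix ac (mix cb′ acb abc) (mix ab′ cab cba))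

braid-distinct : ∀ {ab ba ac bc bc′ cb′ ac′ ab′} abc acb bac bca cab cba →
  ba ≡ - ab → bc′ ≡ bc → cb′ ≡ - bc → ac′ ≡ ac → ab′ ≡ ab → ab * bc ≡ ac * (ab + bc) →
  braidˡ ab ba ac bc bc′ cb′ ac′ ab′ abc acb bac bca cab cba ≡
  braidʳ ab ba ac bc bc′ cb′ ac′ ab′ abc acb bac bca cab cba
braid-distinct {ab} {ac = ac} {bc = bc} abc acb bac bca cab cba refl refl refl refl refl rel =
  mix-braid ab bc ac abc acb bac bca cab cba rel

private
  drop-zero : ∀ {x y} ρ k l p q → ρ * p ≡ 0ℚ → ρ * q ≡ 0ℚ → x ≡ y + (k * (ρ * p) + l * (ρ * q)) → x ≡ y
  drop-zero {x} {y} ρ k l p q ρp ρq eq = trans eq (trans (cong₂ (λ s t → y + (k * s + l * t)) ρp ρq)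
    (solve 3 (λ y k l → y :+ (k :* con 0ℚ :+ l :* con 0ℚ) := y) refl y k l))

-- With a repeated letter the relation holds modulo ρ = P - Q - P Q.
module _ {P Q p q r : ℚ}
  (ρp : (P - Q - P * Q) * p ≡ 0ℚ) (ρq : (P - Q - P * Q) * q ≡ 0ℚ) (ρr : (P - Q - P * Q) * r ≡ 0ℚ) where

  private
    ρ = P - Q - P * Q

  braid-aab : ∀ e e′ {Q′} → Q′ ≡ - Q → braidˡ e e P P Q Q′ Q e′ p q p q r r ≡ braidʳ e e P P Q Q′ Q e′ p q p q r r
  braid-aab e e′ refl = trans
    (trans (mix-refl e (mix Q (mix e p p) (mix P q r))) (cong (λ t → mix Q t (mix P q r)) (mix-refl e p)))
    (trans (drop-zero ρ (1ℚ + Q) (- (1ℚ + Q)) p q ρp ρq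
      (mix-aab P Q p q r))
    (sym (cong₂ (λ s t → mix Q s (mix P (mix (- Q) q p) t)) (mix-refl e (mix Q p q)) (mix-refl e′ r))))

  braid-aba : ∀ e e′ {P′ Q′} → P′ ≡ - P → Q′ ≡ - Q →
    braidˡ P P′ e P′ Q′ Q e′ Q q p r r p q ≡ braidʳ P P′ e P′ Q′ Q e′ Q q p r r p q
  braid-aba e e′ refl refl = trans
    (cong₂ (mix P) (cong (mix (- Q) (mix P q r)) (mix-refl e p)) (mix-refl e′ (mix (- P) r q)))
    (trans (drop-zero ρ (- (1ℚ - Q)) (- (P + Q)) p q ρp ρq
      (drop-zero ρ (1ℚ + P) 0ℚ r q ρr ρq
      (mix-aba P Q p q r)))
    (sym (cong₂ (mix (- Q)) (cong (mix P (mix (- Q) q p)) (mix-refl e′ r)) (mix-refl e (mix Q p q)))))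

  braid-baa : ∀ e e′ {P′ Q′} → P′ ≡ - P → Q′ ≡ - Q →
    braidˡ P′ P P′ e e′ e′ Q′ Q′ r r q p q p ≡ braidʳ P′ P P′ e e′ e′ Q′ Q′ r r q p q p
  braid-baa e e′ refl refl = trans
    (cong₂ (mix (- P)) (mix-refl e′ (mix (- P) r q)) (cong (mix (- Q) (mix P q r)) (mix-refl e p)))
    (trans (drop-zero ρ (1ℚ - P) (- (1ℚ - P)) q r ρq ρr
      (mix-baa P Q p q r))
    (sym (trans (mix-refl e′ (mix (- P) (mix e′ r r) (mix (- Q) q p))) (cong (λ t → mix (- P) t (mix (- Q) q p)) (mix-refl e′ r)))))

-- Cyclic successor and predecessor of positions.

nextF prevF : ∀ {m} → Fin (suc m) → Fin (suc m)
nextF j with view j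
... | ‵fromℕ     = zero
... | ‵inject₁ i = suc i
prevF zero    = Fin.fromℕ _
prevF (suc i) = Fin.inject₁ i

next-prev : ∀ {m} (j : Fin (suc m)) → nextF (prevF j) ≡ j
next-prev {m} zero rewrite view-fromℕ m = refl
next-prev (suc i)  rewrite view-inject₁ i = refl

next-inject : ∀ {m} (i : Fin m) → nextF (Fin.inject₁ i) ≡ suc i
next-inject i rewrite view-inject₁ i = refl

next-fromℕ : ∀ m → nextF (Fin.fromℕ m) ≡ zero
next-fromℕ m rewrite view-fromℕ m = refl

prev-next : ∀ {m} (j : Fin (suc m)) → prevF (nextF j) ≡ j
prev-next j with view j
... | ‵fromℕ     = refl
... | ‵inject₁ i = refl

-- Backward induction along the circle. In this form a fact proved at the last position, the only
-- one that linear words do not see, is spread to every position by rotation.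
to-top : ∀ {m} (P : Fin (suc m) → Set) → (∀ l → P (nextF l) → P l) → P (Fin.fromℕ m) → ∀ l → P l
to-top {m} P back ptop l = go (m ℕ.∸ toℕ l) l (ℕP.m∸n+n≡m (ℕP.≤-pred (toℕ<n l)))
  where
    go : ∀ k l → k ℕ.+ toℕ l ≡ m → P l
    go zero    l eq = subst P (toℕ-injective (trans (FinP.toℕ-fromℕ m) (sym eq))) ptop
    go (suc k) l eq = back l (go k (nextF l) (trans (cong (k ℕ.+_) toℕ-next) (trans (ℕP.+-suc k (toℕ l)) eq)))
      where
        toℕ-next : toℕ (nextF l) ≡ suc (toℕ l)
        toℕ-next with view l
        ... | ‵fromℕ     = ⊥-elim (ℕP.<-irrefl (trans (FinP.toℕ-fromℕ m) (sym eq)) (ℕP.m<n+m (toℕ (Fin.fromℕ m)) {suc k} (s≤s z≤n)))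
        ... | ‵inject₁ i = cong suc (sym (FinP.toℕ-inject₁ i))

-- Linear algebra over the rationals: dimensions of quotients.

∑ : ∀ {d} → (Fin d → ℚ) → ℚ
∑ {zero}  f = 0ℚ
∑ {suc d} f = f zero + ∑ (f ∘ suc)

∑-cong : ∀ {d} {f f′ : Fin d → ℚ} → f ≗ f′ → ∑ f ≡ ∑ f′
∑-cong {zero}  eq = refl
∑-cong {suc d} eq = cong₂ _+_ (eq zero) (∑-cong (eq ∘ suc))

∑-zero : ∀ {d} {f : Fin d → ℚ} → (∀ j → f j ≡ 0ℚ) → ∑ f ≡ 0ℚ
∑-zero {zero}  eq = refl
∑-zero {suc d} eq = cong₂ _+_ (eq zero) (∑-zero (eq ∘ suc))

∑-+ : ∀ {d} (f f′ : Fin d → ℚ) → ∑ (λ j → f j + f′ j) ≡ ∑ f + ∑ f′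
∑-+ {zero}  f f′ = refl
∑-+ {suc d} f f′ = trans (cong (f zero + f′ zero +_) (∑-+ (f ∘ suc) (f′ ∘ suc)))
  (solve 4 (λ a b s t → a :+ b :+ (s :+ t) := a :+ s :+ (b :+ t)) refl (f zero) (f′ zero) (∑ (f ∘ suc)) (∑ (f′ ∘ suc)))

∑-* : ∀ {d} k (f : Fin d → ℚ) → ∑ (λ j → k * f j) ≡ k * ∑ f
∑-* {zero}  k f = sym (ℚP.*-zeroʳ k)
∑-* {suc d} k f = trans (cong (k * f zero +_) (∑-* k (f ∘ suc))) (sym (ℚP.*-distribˡ-+ k (f zero) (∑ (f ∘ suc))))

∑-punchIn : ∀ {d} (i : Fin (suc d)) (f : Fin (suc d) → ℚ) → ∑ f ≡ f i + ∑ (f ∘ Fin.punchIn i)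
∑-punchIn zero f = refl
∑-punchIn {suc d} (suc i) f = trans (cong (f zero +_) (∑-punchIn i (f ∘ suc)))
  (solve 3 (λ a b s → a :+ (b :+ s) := b :+ (a :+ s)) refl (f zero) (f (suc i)) (∑ (f ∘ suc ∘ Fin.punchIn i)))

∑-only : ∀ {d} (f : Fin d → ℚ) j → (∀ i → i ≢ j → f i ≡ 0ℚ) → ∑ f ≡ f j
∑-only {suc d} f j h = trans (∑-punchIn j f) (trans (cong (f j +_) (∑-zero (λ i → h (Fin.punchIn j i) (FinP.punchInᵢ≢i j i)))) (ℚP.+-identityʳ (f j)))

module LinearAlgebra (A : Set) where

  V : Set
  V = A → ℚ

  record Subspace (P : V → Set) : Set where
    field
      sub-cong : ∀ {v w} → v ≗ w → P v → P w
      sub-zero : P (λ _ → 0ℚ)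
      sub-+    : ∀ {v w} → P v → P w → P (λ u → v u + w u)
      sub-*    : ∀ k {v} → P v → P (λ u → k * v u)

    sub-- : ∀ {v w} → P v → P w → P (λ u → v u - w u)
    sub-- {v} {w} pv pw = sub-cong (λ u → cong (v u +_) (solve 1 (λ x → con (- 1ℚ) :* x := :- x) refl (w u)))
      (sub-+ pv (sub-* (- 1ℚ) pw))

  open Subspace public

  -- Scalars need no constructor, since `Q` will be a union of subspaces. The equations are
  -- pointwise because vectors are functions.
  data Span (Q : V → Set) : V → Set where
    base : ∀ {v} → Q v → Span Q v
    none : ∀ {v} → (∀ u → v u ≡ 0ℚ) → Span Q v
    both : ∀ {v w x} → Span Q v → Span Q w → (∀ u → x u ≡ v u + w u) → Span Q x

  span-cong : ∀ {Q} → (∀ {v w} → v ≗ w → Q v → Q w) → ∀ {v w} → v ≗ w → Span Q v → Span Q w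
  span-cong qc eq (base q)     = base (qc eq q)
  span-cong qc eq (none z)     = none (λ u → trans (sym (eq u)) (z u))
  span-cong qc eq (both s t h) = both s t (λ u → trans (sym (eq u)) (h u))

  span-mono : ∀ {Q Q′ : V → Set} → (∀ {v} → Q v → Q′ v) → ∀ {v} → Span Q v → Span Q′ v
  span-mono f (base q)     = base (f q)
  span-mono f (none z)     = none z
  span-mono f (both s t h) = both (span-mono f s) (span-mono f t) h

  span-elim : ∀ {Q P : V → Set} → Subspace P → (∀ {v} → Q v → P v) → ∀ {v} → Span Q v → P v
  span-elim sp f (base q)     = f q
  span-elim sp f (none z)     = sub-cong sp (λ u → sym (z u)) (sub-zero sp)
  span-elim sp f (both s t h) = sub-cong sp (λ u → sym (h u)) (sub-+ sp (span-elim sp f s) (span-elim sp f t))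

  span-scale : ∀ {Q : V → Set} → (∀ k {v} → Q v → Q (λ u → k * v u)) → ∀ k {v} → Span Q v → Span Q (λ u → k * v u)
  span-scale q* k (base q)     = base (q* k q)
  span-scale q* k (none z)     = none (λ u → trans (cong (k *_) (z u)) (ℚP.*-zeroʳ k))
  span-scale q* k (both {v} {w} s t h) = both (span-scale q* k s) (span-scale q* k t)
    (λ u → trans (cong (k *_) (h u)) (ℚP.*-distribˡ-+ k (v u) (w u)))

  span-subspace : ∀ {Q : V → Set} → (∀ {v w} → v ≗ w → Q v → Q w) → (∀ k {v} → Q v → Q (λ u → k * v u)) → Subspace (Span Q)
  span-subspace qc q* = record
    { sub-cong = span-cong qc ; sub-zero = none (λ _ → refl) ; sub-+ = λ s t → both s t (λ _ → refl) ; sub-* = span-scale q* }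

  Zero : V → Set
  Zero v = ∀ u → v u ≡ 0ℚ

  zero-subspace : Subspace Zero
  zero-subspace = record
    { sub-cong = λ eq z u → trans (sym (eq u)) (z u) ; sub-zero = λ _ → refl
    ; sub-+ = λ z z′ u → cong₂ _+_ (z u) (z′ u) ; sub-* = λ k z u → trans (cong (k *_) (z u)) (ℚP.*-zeroʳ k) }

  comb : ∀ {d} → (Fin d → ℚ) → (Fin d → V) → V
  comb a z u = ∑ (λ j → a j * z j u)

  comb-+ : ∀ {d} (a b : Fin d → ℚ) z u → comb (λ j → a j + b j) z u ≡ comb a z u + comb b z u
  comb-+ a b z u = trans (∑-cong (λ j → ℚP.*-distribʳ-+ (z j u) (a j) (b j))) (∑-+ (λ j → a j * z j u) (λ j → b j * z j u))

  comb-* : ∀ {d} k (a : Fin d → ℚ) z u → comb (λ j → k * a j) z u ≡ k * comb a z u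
  comb-* k a z u = trans (∑-cong (λ j → ℚP.*-assoc k (a j) (z j u))) (∑-* k (λ j → a j * z j u))

  comb-cong : ∀ {d} {a b : Fin d → ℚ} z → a ≗ b → comb a z ≗ comb b z
  comb-cong z eq u = ∑-cong (λ j → cong (_* z j u) (eq j))

  comb-zero : ∀ {d} {a : Fin d → ℚ} z → (∀ j → a j ≡ 0ℚ) → ∀ u → comb a z u ≡ 0ℚ
  comb-zero z eq u = ∑-zero (λ j → trans (cong (_* z j u) (eq j)) (ℚP.*-zeroˡ (z j u)))

  comb-punchIn : ∀ {d} i (a : Fin (suc d) → ℚ) z u → comb a z u ≡ a i * z i u + comb (a ∘ Fin.punchIn i) (z ∘ Fin.punchIn i) u
  comb-punchIn i a z u = ∑-punchIn i (λ j → a j * z j u)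

  comb-in : ∀ {P} → Subspace P → ∀ {d} a {z : Fin d → V} → (∀ j → P (z j)) → P (comb a z)
  comb-in sp {zero}  a pz = sub-zero sp
  comb-in sp {suc d} a pz = sub-+ sp (sub-* sp (a zero) (pz zero)) (comb-in sp (a ∘ suc) (pz ∘ suc))

  Indep : (V → Set) → ∀ {d} → (Fin d → V) → Set
  Indep W z = ∀ a → W (comb a z) → ∀ j → a j ≡ 0ℚ

  -- P / W has dimension d
  record HasDim (P W : V → Set) (d : ℕ) : Set where
    field
      vec   : Fin d → V
      vec∈  : ∀ j → P (vec j)
      indep : Indep W vec
      spans : ∀ {v} → P v → ∃ λ a → W (λ u → v u - comb a vec u)

  open HasDim public

  _+⟨_⟩ : (V → Set) → ∀ {d} → (Fin d → V) → V → Set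
  (W +⟨ z ⟩) v = ∃ λ a → W (λ u → v u - comb a z u)

  dim-cong : ∀ {P W W′ d} → (∀ {v} → W v → W′ v) → (∀ {v} → W′ v → W v) → HasDim P W d → HasDim P W′ d
  dim-cong to from h = record
    { vec = vec h ; vec∈ = vec∈ h ; indep = λ a w → indep h a (from w) ; spans = λ p → let a , w = spans h p in a , to w }

  private
    pivot : ∀ {d} (a : Fin d → ℚ) → (∃ λ j → a j ≢ 0ℚ) ⊎ (∀ j → a j ≡ 0ℚ)
    pivot {zero} a = inj₂ (λ ())
    pivot {suc d} a with a zero ℚP.≟ 0ℚ
    ... | no nz = inj₁ (zero , nz)
    ... | yes z with pivot (a ∘ suc)
    ...   | inj₁ (j , nz) = inj₁ (suc j , nz)
    ...   | inj₂ zs       = inj₂ λ { zero → z ; (suc j) → zs j }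

    one : ∀ (y : V) → Fin 1 → V
    one y _ = y

    comb-one : ∀ a y u → comb a (one y) u ≡ a zero * y u
    comb-one a y u = ℚP.+-identityʳ (a zero * y u)

  exchange₁ : ∀ {P W b} → Subspace P → Subspace W → HasDim P W b → ∀ y → P y → Indep W (one y) →
    ∃ λ b′ → b ≡ suc b′ × HasDim P (W +⟨ one y ⟩) b′
  exchange₁ {b = b} sP sW h y py ind with spans h py
  ... | a , w with pivot a
  exchange₁ {b = b} sP sW h y py ind | a , w | inj₂ zs = ⊥-elim (1≢0 (ind (λ _ → 1ℚ) (sub-cong sW (λ u → begin
      y u - comb a (vec h) u ≡⟨ cong (λ t → y u - t) (comb-zero (vec h) zs u) ⟩
      y u - 0ℚ ≡⟨ solve 1 (λ y → y :- con 0ℚ := con 1ℚ :* y :+ con 0ℚ) refl (y u) ⟩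
      comb (λ _ → 1ℚ) (one y) u ∎) w) zero))
    where
      open ≡-Reasoning
      1≢0 : 1ℚ ≢ 0ℚ
      1≢0 ()
  exchange₁ {P} {W} {suc b} sP sW h y py ind | a , w | inj₁ (i , nz) = b , refl , record
    { vec = z′ ; vec∈ = λ j → vec∈ h (Fin.punchIn i j) ; indep = ind′ ; spans = spans′ }
    where
      open ≡-Reasoning
      z = vec h
      z′ = z ∘ Fin.punchIn i
      a′ = a ∘ Fin.punchIn i
      ind′ : Indep (W +⟨ one y ⟩) z′
      ind′ c (k , wk) j = begin
        c j ≡⟨ sym (VFP.insertAt-punchIn c i (- (k₀ * a i)) j) ⟩
        e (Fin.punchIn i j) ≡⟨ solve 2 (λ e x → e := e :- con 0ℚ :* x) refl (e (Fin.punchIn i j)) (a′ j) ⟩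
        e (Fin.punchIn i j) - 0ℚ * a′ j ≡⟨ cong (λ t → e (Fin.punchIn i j) - t * a′ j) (sym k₀≡0) ⟩
        e (Fin.punchIn i j) - k₀ * a′ j ≡⟨ cong (_- k₀ * a′ j) (VFP.insertAt-punchIn c i (- (k₀ * a i)) j) ⟩
        c j - k₀ * a′ j ≡⟨ sym (cong (_- k₀ * a′ j) (VFP.insertAt-punchIn c i 0ℚ j)) ⟩
        f (Fin.punchIn i j) ≡⟨ all0 (Fin.punchIn i j) ⟩
        0ℚ ∎
        where
          k₀ = k zero
          e c₀ f : Fin (suc b) → ℚ
          e  = VF.insertAt c i (- (k₀ * a i))
          c₀ = VF.insertAt c i 0ℚ
          -- Substituting the expansion of `y` turns the relation modulo W and `y` into one on the
          -- old basis. Its coordinate at `i` is `- k₀ * a i`, which forces `k₀` to vanish.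
          f j = c₀ j - k₀ * a j
          fw : W (comb f z)
          fw = sub-cong sW (λ u → begin
            ((comb c z′ u - comb k (one y) u) + k₀ * (y u - comb a z u)) ≡⟨ cong (λ t → comb c z′ u - t + k₀ * (y u - comb a z u)) (comb-one k y u) ⟩
            (comb c z′ u - k₀ * y u) + k₀ * (y u - comb a z u)
              ≡⟨ solve 4 (λ s k y t → (s :- k :* y) :+ k :* (y :- t) := s :+ (:- k) :* t) refl (comb c z′ u) k₀ (y u) (comb a z u) ⟩
            comb c z′ u + (- k₀) * comb a z u ≡⟨ cong₂ _+_ (sym (c₀≡ u)) (sym (comb-* (- k₀) a z u)) ⟩
            comb c₀ z u + comb (λ j → (- k₀) * a j) z u ≡⟨ sym (comb-+ c₀ (λ j → (- k₀) * a j) z u) ⟩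
            comb (λ j → c₀ j + (- k₀) * a j) z u ≡⟨ comb-cong z (λ j → solve 3 (λ c k a → c :+ (:- k) :* a := c :- k :* a) refl (c₀ j) k₀ (a j)) u ⟩
            comb f z u ∎) (sub-+ sW wk (sub-* sW k₀ w))
            where
              c₀≡ : ∀ u → comb c₀ z u ≡ comb c z′ u
              c₀≡ u = begin
                comb c₀ z u ≡⟨ comb-punchIn i c₀ z u ⟩
                c₀ i * z i u + comb (c₀ ∘ Fin.punchIn i) z′ u ≡⟨ cong₂ (λ s t → s * z i u + t) (VFP.insertAt-lookup c i 0ℚ) (comb-cong z′ (VFP.insertAt-punchIn c i 0ℚ) u) ⟩
                0ℚ * z i u + comb c z′ u ≡⟨ solve 2 (λ z s → con 0ℚ :* z :+ s := s) refl (z i u) (comb c z′ u) ⟩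
                comb c z′ u ∎
          all0 : ∀ j → f j ≡ 0ℚ
          all0 = indep h f fw
          k₀≡0 : k₀ ≡ 0ℚ
          k₀≡0 = *-cancel-0 nz (begin
            a i * k₀ ≡⟨ solve 2 (λ a k → a :* k := :- (con 0ℚ :- k :* a)) refl (a i) k₀ ⟩
            - (0ℚ - k₀ * a i) ≡⟨ cong (λ t → - (t - k₀ * a i)) (sym (VFP.insertAt-lookup c i 0ℚ)) ⟩
            - f i ≡⟨ cong -_ (all0 i) ⟩
            0ℚ ∎)
      spans′ : ∀ {v} → P v → ∃ λ c → (W +⟨ one y ⟩) (λ u → v u - comb c z′ u)
      spans′ {v} pv with spans h pv
      ... | c , wv = c′ ∘ Fin.punchIn i , (λ _ → k) , sub-cong sW (λ u → begin
          (v u - comb c z u) - k * (y u - comb a z u)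
            ≡⟨ solve 5 (λ v s k y t → (v :- s) :- k :* (y :- t) := (v :- (s :+ (:- k) :* t)) :- k :* y) refl (v u) (comb c z u) k (y u) (comb a z u) ⟩
          (v u - (comb c z u + (- k) * comb a z u)) - k * y u
            ≡⟨ cong₂ (λ s t → (v u - s) - t) (eq u) (sym (comb-one (λ _ → k) y u)) ⟩
          (v u - comb (c′ ∘ Fin.punchIn i) z′ u) - comb (λ _ → k) (one y) u ∎)
          (sub-- sW wv (sub-* sW k w))
        where
          -- Chosen so that the coordinate of `c′` at the dropped vector is 0.
          k = c i * inv (a i)
          c′ : Fin (suc b) → ℚ
          c′ j = c j + (- k) * a j
          c′i : c′ i ≡ 0ℚ
          c′i = begin
            c i + (- (c i * inv (a i))) * a i ≡⟨ solve 3 (λ c n a → c :+ (:- (c :* n)) :* a := c :+ (:- c) :* (a :* n)) refl (c i) (inv (a i)) (a i) ⟩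
            c i + (- c i) * (a i * inv (a i)) ≡⟨ cong (λ t → c i + (- c i) * t) (inv-* nz) ⟩
            c i + (- c i) * 1ℚ ≡⟨ solve 1 (λ c → c :+ (:- c) :* con 1ℚ := con 0ℚ) refl (c i) ⟩
            0ℚ ∎
          eq : ∀ u → comb c z u + (- k) * comb a z u ≡ comb (c′ ∘ Fin.punchIn i) z′ u
          eq u = begin
            comb c z u + (- k) * comb a z u ≡⟨ cong (comb c z u +_) (sym (comb-* (- k) a z u)) ⟩
            comb c z u + comb (λ j → (- k) * a j) z u ≡⟨ sym (comb-+ c (λ j → (- k) * a j) z u) ⟩
            comb c′ z u ≡⟨ comb-punchIn i c′ z u ⟩
            c′ i * z i u + comb (c′ ∘ Fin.punchIn i) z′ u ≡⟨ cong (λ t → t * z i u + comb (c′ ∘ Fin.punchIn i) z′ u) c′i ⟩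
            0ℚ * z i u + comb (c′ ∘ Fin.punchIn i) z′ u ≡⟨ solve 2 (λ z s → con 0ℚ :* z :+ s := s) refl (z i u) (comb (c′ ∘ Fin.punchIn i) z′ u) ⟩
            comb (c′ ∘ Fin.punchIn i) z′ u ∎

  +⟨⟩-subspace : ∀ {W} → Subspace W → ∀ {d} (z : Fin d → V) → Subspace (W +⟨ z ⟩)
  +⟨⟩-subspace {W} sW z = record
    { sub-cong = λ eq (a , w) → a , sub-cong sW (λ u → cong (_- comb a z u) (eq u)) w
    ; sub-zero = (λ _ → 0ℚ) , sub-cong sW (λ u → trans (sym (ℚP.+-identityʳ 0ℚ)) (cong (λ t → 0ℚ - t) (sym (comb-zero z (λ _ → refl) u)))) (sub-zero sW)
    ; sub-+ = λ {v} {w} (a , wa) (b , wb) → (λ j → a j + b j) , sub-cong sW (λ u → trans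
        (solve 4 (λ v s w t → (v :- s) :+ (w :- t) := (v :+ w) :- (s :+ t)) refl (v u) (comb a z u) (w u) (comb b z u))
        (cong (λ t → (v u + w u) - t) (sym (comb-+ a b z u)))) (sub-+ sW wa wb)
    ; sub-* = λ k {v} (a , wa) → (λ j → k * a j) , sub-cong sW (λ u → trans
        (solve 3 (λ k v s → k :* (v :- s) := k :* v :- k :* s) refl k (v u) (comb a z u))
        (cong (λ t → k * v u - t) (sym (comb-* k a z u)))) (sub-* sW k wa) }

  -- Dimension count for a short exact sequence: `y` is a basis of the subobject, and the vectors
  -- that survive the exchange represent the quotient.
  exchange : ∀ {P W b} → Subspace P → Subspace W → HasDim P W b → ∀ {d} (y : Fin d → V) → (∀ j → P (y j)) → Indep W y →
    ∃ λ d′ → d ℕ.+ d′ ≡ b × HasDim P (W +⟨ y ⟩) d′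
  exchange {b = b} sP sW h {zero} y py ind = b , refl , dim-cong
    (λ {v} w → (λ ()) , sub-cong sW (λ u → solve 1 (λ v → v := v :- con 0ℚ) refl (v u)) w)
    (λ {v} (a , w) → sub-cong sW (λ u → solve 1 (λ v → v :- con 0ℚ := v) refl (v u)) w) h
  exchange {W = W} sP sW h {suc d} y py ind
    with exchange₁ sP sW h (y zero) (py zero) ind₀
    where
      ind₀ : Indep W (one (y zero))
      ind₀ a w zero = ind (λ { zero → a zero ; (suc j) → 0ℚ }) (sub-cong sW (λ u →
        cong (a zero * y zero u +_) (sym (comb-zero (y ∘ suc) (λ _ → refl) u))) w) zero
  ... | b′ , refl , h′ with exchange sP (+⟨⟩-subspace sW (one (y zero))) h′ (y ∘ suc) (py ∘ suc) ind₁
    where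
      ind₁ : Indep (W +⟨ one (y zero) ⟩) (y ∘ suc)
      ind₁ a (k , w) j = ind (λ { zero → - k zero ; (suc j) → a j }) (sub-cong sW (λ u → trans
        (cong (λ t → comb a (y ∘ suc) u - t) (comb-one k (y zero) u))
        (solve 3 (λ s k y → s :- k :* y := (:- k) :* y :+ s) refl (comb a (y ∘ suc) u) (k zero) (y zero u))) w) (suc j)
  ...   | d′ , refl , h″ = d′ , refl , dim-cong
    (λ {v} (a , k , w) → (λ { zero → k zero ; (suc j) → a j }) , sub-cong sW (λ u → trans
      (cong (λ t → (v u - comb a (y ∘ suc) u) - t) (comb-one k (y zero) u))
      (solve 3 (λ v s t → (v :- s) :- t := v :- (t :+ s)) refl (v u) (comb a (y ∘ suc) u) (k zero * y zero u))) w)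
    (λ {v} (a , w) → a ∘ suc , (λ _ → a zero) , sub-cong sW (λ u → trans
      (solve 3 (λ v s t → v :- (t :+ s) := (v :- s) :- t) refl (v u) (comb (a ∘ suc) (y ∘ suc) u) (a zero * y zero u))
      (cong (λ t → (v u - comb (a ∘ suc) (y ∘ suc) u) - t) (sym (comb-one (λ _ → a zero) (y zero) u)))) w) h″

  dim-unique : ∀ {P W d d′} → Subspace P → Subspace W → HasDim P W d → HasDim P W d′ → d ≡ d′
  dim-unique sP sW h h′ = ℕP.≤-antisym (le h h′) (le h′ h)
    where
      le : ∀ {d d′} → HasDim _ _ d → HasDim _ _ d′ → d ℕ.≤ d′
      le {d} h h′ with exchange sP sW h′ (vec h) (vec∈ h) (indep h)
      ... | x , refl , _ = ℕP.m≤m+n d x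

  dim-map : ∀ {P W P′ W′ d} (f f⁻¹ : V → V) → Subspace W′ →
    (∀ a b v w u → f (λ u → a * v u + b * w u) u ≡ a * f v u + b * f w u) → (∀ {v w} → v ≗ w → f v ≗ f w) →
    (∀ {v} → P v → P′ (f v)) → (∀ {v} → W v → W′ (f v)) → (∀ {v} → P v → W′ (f v) → W v) →
    (∀ {v} → P′ v → P (f⁻¹ v)) → (∀ v → f (f⁻¹ v) ≗ v) → Subspace P →
    HasDim P W d → HasDim P′ W′ d
  dim-map {P} {W} {P′} {W′} f f⁻¹ sW′ flin fcong fP fW fW⁻ fP⁻ ff⁻ sP h = record
    { vec = f ∘ vec h ; vec∈ = fP ∘ vec∈ h
    ; indep = λ a w → indep h a (fW⁻ (comb-in sP a (vec∈ h)) (sub-cong sW′ (fcomb a (vec h)) w))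
    ; spans = λ {v} p → let a , w = spans h (fP⁻ p) in a , sub-cong sW′ (λ u → begin
        f (λ u → f⁻¹ v u - comb a (vec h) u) u ≡⟨ fcong (λ u → solve 2 (λ x y → x :- y := con 1ℚ :* x :+ con (- 1ℚ) :* y) refl (f⁻¹ v u) (comb a (vec h) u)) u ⟩
        f (λ u → 1ℚ * f⁻¹ v u + (- 1ℚ) * comb a (vec h) u) u ≡⟨ flin 1ℚ (- 1ℚ) (f⁻¹ v) (comb a (vec h)) u ⟩
        1ℚ * f (f⁻¹ v) u + (- 1ℚ) * f (comb a (vec h)) u ≡⟨ cong₂ (λ s t → 1ℚ * s + (- 1ℚ) * t) (ff⁻ v u) (sym (fcomb a (vec h) u)) ⟩
        1ℚ * v u + (- 1ℚ) * comb a (f ∘ vec h) u ≡⟨ solve 2 (λ x y → con 1ℚ :* x :+ con (- 1ℚ) :* y := x :- y) refl (v u) (comb a (f ∘ vec h) u) ⟩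
        v u - comb a (f ∘ vec h) u ∎) (fW w) }
    where
      open ≡-Reasoning
      fcomb : ∀ {d} a (z : Fin d → V) u → comb a (f ∘ z) u ≡ f (comb a z) u
      fcomb {zero} a z u = sym (begin
        f (λ _ → 0ℚ) u ≡⟨ fcong {w = λ u → 0ℚ * 0ℚ + 0ℚ * 0ℚ} (λ _ → refl) u ⟩
        f (λ u → 0ℚ * 0ℚ + 0ℚ * 0ℚ) u ≡⟨ flin 0ℚ 0ℚ (λ _ → 0ℚ) (λ _ → 0ℚ) u ⟩
        0ℚ * x + 0ℚ * x ≡⟨ solve 1 (λ x → con 0ℚ :* x :+ con 0ℚ :* x := con 0ℚ) refl x ⟩
        0ℚ ∎)
        where x = f (λ _ → 0ℚ) u
      fcomb {suc d} a z u = sym (begin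
        f (λ u → a zero * z zero u + comb (a ∘ suc) (z ∘ suc) u) u
          ≡⟨ fcong (λ u → cong (a zero * z zero u +_) (sym (ℚP.*-identityˡ (comb (a ∘ suc) (z ∘ suc) u)))) u ⟩
        f (λ u → a zero * z zero u + 1ℚ * comb (a ∘ suc) (z ∘ suc) u) u ≡⟨ flin (a zero) 1ℚ (z zero) (comb (a ∘ suc) (z ∘ suc)) u ⟩
        a zero * f (z zero) u + 1ℚ * f (comb (a ∘ suc) (z ∘ suc)) u
          ≡⟨ cong (a zero * f (z zero) u +_) (trans (ℚP.*-identityˡ _) (sym (fcomb (a ∘ suc) (z ∘ suc) u))) ⟩
        a zero * f (z zero) u + comb (a ∘ suc) (f ∘ z ∘ suc) u ∎)

-- Counting in finite lists.

unique-⊆-length : ∀ {A : Set} {xs ys : List A} → Unique xs → (∀ {a} → a ∈ xs → a ∈ ys) → List.length xs ℕ.≤ List.length ys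
unique-⊆-length [] h = z≤n
unique-⊆-length {xs = x ∷ xs} {ys} (x∉ ∷ uq) h with ∈P.∈-∃++ (h (here refl))
... | as , bs , refl = subst (suc (List.length xs) ℕ.≤_) (sym len) (s≤s (unique-⊆-length uq sub))
  where
    len : List.length (as List.++ x ∷ bs) ≡ suc (List.length (as List.++ bs))
    len = trans (ListP.length-++ as) (trans (ℕP.+-suc (List.length as) (List.length bs)) (cong suc (sym (ListP.length-++ as))))
    sub : ∀ {a} → a ∈ xs → a ∈ as List.++ bs
    sub {a} a∈ with ∈P.∈-++⁻ as (h (there a∈))
    ... | inj₁ l            = ∈P.∈-++⁺ˡ l
    ... | inj₂ (here refl)  = ⊥-elim (All.lookup x∉ a∈ refl)
    ... | inj₂ (there r)    = ∈P.∈-++⁺ʳ as r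

-- The map receives the proof of `P`, because fillings and words are translated into each other only
-- when they satisfy the defining conditions; injectivity concerns the objects and not these proofs.
filter-≤ : ∀ {A B : Set} {P : A → Set} {Q : B → Set} (P? : ∀ a → Dec (P a)) (Q? : ∀ b → Dec (Q b)) {xs : List A} {ys : List B} →
  Unique xs → (∀ b → b ∈ ys) → (f : ∀ a → P a → B) → (∀ a p → Q (f a p)) → (∀ a a′ p p′ → f a p ≡ f a′ p′ → a ≡ a′) →
  List.length (List.filter P? xs) ℕ.≤ List.length (List.filter Q? ys)
filter-≤ {P = P} {Q} P? Q? {xs} {ys} uq all f fQ inj = subst (ℕ._≤ List.length (List.filter Q? ys)) (len xs) (unique-⊆-length (uniq xs uq) sub)
  where
    image : List _ → List _
    image []       = []
    image (a ∷ xs) with P? a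
    ... | yes p = f a p ∷ image xs
    ... | no _  = image xs
    len : ∀ xs → List.length (image xs) ≡ List.length (List.filter P? xs)
    len []       = refl
    len (a ∷ xs) with P? a
    ... | yes p = cong suc (len xs)
    ... | no _  = len xs
    mem : ∀ xs {b} → b ∈ image xs → Σ _ λ a → Σ (P a) λ p → a ∈ xs × b ≡ f a p
    mem (a ∷ xs) h with P? a
    mem (a ∷ xs) (here refl) | yes p = a , p , here refl , refl
    mem (a ∷ xs) (there h)   | yes p = let a′ , p′ , m , e = mem xs h in a′ , p′ , there m , e
    mem (a ∷ xs) h           | no _  = let a′ , p′ , m , e = mem xs h in a′ , p′ , there m , e
    uniq : ∀ xs → Unique xs → Unique (image xs)
    uniq [] [] = []
    uniq (a ∷ xs) (a∉ ∷ uq) with P? a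
    ... | no _  = uniq xs uq
    ... | yes p = All.tabulate (λ {b} b∈ eq → let a′ , p′ , m , e = mem xs b∈ in
                    All.lookup a∉ m (inj a a′ p p′ (trans eq e))) ∷ uniq xs uq
    sub : ∀ {b} → b ∈ image xs → b ∈ List.filter Q? ys
    sub {b} h = let a , p , _ , e = mem xs h in ∈P.∈-filter⁺ Q? (all b) (subst Q (sym e) (fQ a p))

filter-≡ : ∀ {A : Set} {P : A → Set} (P? : ∀ a → Dec (P a)) {xs ys : List A} → Unique xs → Unique ys → (∀ a → a ∈ xs) → (∀ a → a ∈ ys) →
  List.length (List.filter P? xs) ≡ List.length (List.filter P? ys)
filter-≡ P? ux uy ax ay = ℕP.≤-antisym
  (filter-≤ P? P? ux ay (λ a _ → a) (λ a p → p) (λ _ _ _ _ e → e)) (filter-≤ P? P? uy ax (λ a _ → a) (λ a p → p) (λ _ _ _ _ e → e))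

∑ℕ : ∀ {A : Set} → List A → (A → ℕ) → ℕ
∑ℕ xs f = sum (List.map f xs)

∑ℕ-cong : ∀ {A : Set} (xs : List A) {f f′ : A → ℕ} → (∀ a → f a ≡ f′ a) → ∑ℕ xs f ≡ ∑ℕ xs f′
∑ℕ-cong xs eq = cong sum (ListP.map-cong eq xs)

∑ℕ-+ : ∀ {A : Set} (xs : List A) (f f′ : A → ℕ) → ∑ℕ xs (λ a → f a ℕ.+ f′ a) ≡ ∑ℕ xs f ℕ.+ ∑ℕ xs f′
∑ℕ-+ []       f f′ = refl
∑ℕ-+ (a ∷ xs) f f′ = trans (cong (f a ℕ.+ f′ a ℕ.+_) (∑ℕ-+ xs f f′)) (ℕ-interchange (f a) (f′ a) (∑ℕ xs f) (∑ℕ xs f′))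

∑ℕ-zero : ∀ {A : Set} (xs : List A) {f : A → ℕ} → (∀ a → f a ≡ 0) → ∑ℕ xs f ≡ 0
∑ℕ-zero []       h = refl
∑ℕ-zero (a ∷ xs) h = cong₂ ℕ._+_ (h a) (∑ℕ-zero xs h)

∑ℕ-* : ∀ {A : Set} (xs : List A) k (f : A → ℕ) → ∑ℕ xs (λ a → k ℕ.* f a) ≡ k ℕ.* ∑ℕ xs f
∑ℕ-* []       k f = sym (ℕP.*-zeroʳ k)
∑ℕ-* (a ∷ xs) k f = trans (cong (k ℕ.* f a ℕ.+_) (∑ℕ-* xs k f)) (sym (ℕP.*-distribˡ-+ k (f a) (∑ℕ xs f)))

∑ℕ-swap : ∀ {A B : Set} (xs : List A) (ys : List B) (f : A → B → ℕ) → ∑ℕ xs (λ a → ∑ℕ ys (f a)) ≡ ∑ℕ ys (λ b → ∑ℕ xs (λ a → f a b))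
∑ℕ-swap []       ys f = sym (∑ℕ-zero ys (λ _ → refl))
∑ℕ-swap (a ∷ xs) ys f = trans (cong (∑ℕ ys (f a) ℕ.+_) (∑ℕ-swap xs ys f)) (sym (∑ℕ-+ ys (f a) (λ b → ∑ℕ xs (λ a → f a b))))

𝟙 : {P : Set} → Dec P → ℕ
𝟙 (yes _) = 1
𝟙 (no _)  = 0

length-filter : ∀ {A : Set} {P : A → Set} (P? : ∀ a → Dec (P a)) (xs : List A) → List.length (List.filter P? xs) ≡ ∑ℕ xs (λ a → 𝟙 (P? a))
length-filter P? []       = refl
length-filter P? (a ∷ xs) with P? a
... | yes _ = cong suc (length-filter P? xs)
... | no _  = length-filter P? xs

∑ℕ-pick : ∀ {A : Set} {xs : List A} → Unique xs → ∀ {a} → a ∈ xs → (f : A → ℕ) → (∀ b → b ≢ a → f b ≡ 0) → ∑ℕ xs f ≡ f a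
∑ℕ-pick {xs = a ∷ xs} (a∉ ∷ uq) (here refl) f h = trans (cong (f a ℕ.+_) (none xs a∉)) (ℕP.+-identityʳ (f a))
  where
    none : ∀ xs → All (a ≢_) xs → ∑ℕ xs f ≡ 0
    none []       []         = refl
    none (b ∷ xs) (ne ∷ nes) = cong₂ ℕ._+_ (h b (ne ∘ sym)) (none xs nes)
∑ℕ-pick {xs = b ∷ xs} (b∉ ∷ uq) (there a∈) f h = cong₂ ℕ._+_ (h b (λ { refl → All.lookup b∉ a∈ refl })) (∑ℕ-pick uq a∈ f h)

∑ℕ-fibre : ∀ {A B : Set} {P : A → Set} (P? : ∀ a → Dec (P a)) (_≟_ : ∀ (b b′ : B) → Dec (b ≡ b′)) (k : A → B) {ys : List B} →
  Unique ys → (∀ b → b ∈ ys) → ∀ xs → ∑ℕ ys (λ b → List.length (List.filter (λ a → P? a ×-dec (k a ≟ b)) xs)) ≡ List.length (List.filter P? xs)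
∑ℕ-fibre P? _≟_ k {ys} uq all xs = begin
  ∑ℕ ys (λ b → List.length (List.filter (λ a → P? a ×-dec (k a ≟ b)) xs)) ≡⟨ ∑ℕ-cong ys (λ b → length-filter (λ a → P? a ×-dec (k a ≟ b)) xs) ⟩
  ∑ℕ ys (λ b → ∑ℕ xs (λ a → 𝟙 (P? a ×-dec (k a ≟ b))))                     ≡⟨ ∑ℕ-swap ys xs (λ b a → 𝟙 (P? a ×-dec (k a ≟ b))) ⟩
  ∑ℕ xs (λ a → ∑ℕ ys (λ b → 𝟙 (P? a ×-dec (k a ≟ b))))                     ≡⟨ ∑ℕ-cong xs pick ⟩
  ∑ℕ xs (λ a → 𝟙 (P? a))                                                   ≡⟨ sym (length-filter P? xs) ⟩
  List.length (List.filter P? xs) ∎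
  where
    open ≡-Reasoning
    pick : ∀ a → ∑ℕ ys (λ b → 𝟙 (P? a ×-dec (k a ≟ b))) ≡ 𝟙 (P? a)
    pick a = trans (∑ℕ-pick uq (all (k a)) (λ b → 𝟙 (P? a ×-dec (k a ≟ b))) off) on
      where
        off : ∀ b → b ≢ k a → 𝟙 (P? a ×-dec (k a ≟ b)) ≡ 0
        off b ne with P? a | k a ≟ b
        ... | yes _ | yes eq = ⊥-elim (ne (sym eq))
        ... | yes _ | no _   = refl
        ... | no _  | yes _  = refl
        ... | no _  | no _   = refl
        on : 𝟙 (P? a ×-dec (k a ≟ k a)) ≡ 𝟙 (P? a)
        on with P? a | k a ≟ k a
        ... | yes _ | yes _ = refl
        ... | yes _ | no ne = ⊥-elim (ne refl)
        ... | no _  | yes _ = refl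
        ... | no _  | no ne = ⊥-elim (ne refl)

∑ℕ-reindex : ∀ {A : Set} {xs : List A} → Unique xs → (∀ a → a ∈ xs) → (_≟_ : ∀ (a b : A) → Dec (a ≡ b)) → (σ τ : A → A) →
  (∀ a → σ (τ a) ≡ a) → (∀ a → τ (σ a) ≡ a) → ∀ f → ∑ℕ xs (f ∘ σ) ≡ ∑ℕ xs f
∑ℕ-reindex {xs = xs} uq all _≟_ σ τ στ τσ f = begin
  ∑ℕ xs (f ∘ σ)                                  ≡⟨ ∑ℕ-cong xs (λ a → sym (trans (∑ℕ-pick uq (all (σ a)) (term a) (off a)) (on a (σ a) refl))) ⟩
  ∑ℕ xs (λ a → ∑ℕ xs (term a))                   ≡⟨ ∑ℕ-swap xs xs term ⟩
  ∑ℕ xs (λ b → ∑ℕ xs (λ a → term a b))           ≡⟨ ∑ℕ-cong xs (λ b → trans (∑ℕ-pick uq (all (τ b)) (λ a → term a b) (off′ b)) (on (τ b) b (στ b))) ⟩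
  ∑ℕ xs f                                        ∎
  where
    open ≡-Reasoning
    term : _ → _ → ℕ
    term a b = 𝟙 (σ a ≟ b) ℕ.* f b
    off : ∀ a b → b ≢ σ a → term a b ≡ 0
    off a b ne with σ a ≟ b
    ... | yes eq = ⊥-elim (ne (sym eq))
    ... | no _   = refl
    off′ : ∀ b a → a ≢ τ b → term a b ≡ 0
    off′ b a ne with σ a ≟ b
    ... | yes refl = ⊥-elim (ne (sym (τσ a)))
    ... | no _     = refl
    on : ∀ a b → σ a ≡ b → term a b ≡ f b
    on a b eq with σ a ≟ b
    ... | yes _ = ℕP.+-identityʳ (f b)
    ... | no ne = ⊥-elim (ne eq)

concatMap-unique : ∀ {A : Set} {k} {xs : List A} {ys : List (Vec A k)} → Unique xs → Unique ys → Unique (List.concatMap (λ a → List.map (a ∷_) ys) xs)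
concatMap-unique ux uy = AllPairsP.concat⁺
  (AllP.map⁺ (All.tabulate (λ _ → AllPairsP.map⁺ (AllPairs.map (λ ne eq → ne (VecP.∷-injectiveʳ eq)) uy))))
  (AllPairsP.map⁺ (AllPairs.map
    (λ ne → AllP.map⁺ (All.tabulate (λ _ → AllP.map⁺ (All.tabulate (λ _ eq → ne (VecP.∷-injectiveˡ eq)))))) ux))

concatMap-complete : ∀ {A : Set} {k} {xs : List A} {ys : List (Vec A k)} → (∀ a → a ∈ xs) → (∀ u → u ∈ ys) →
  ∀ u → u ∈ List.concatMap (λ a → List.map (a ∷_) ys) xs
concatMap-complete ax ay (a ∷ u) = ∈P.∈-concatMap⁺ _ (Any.map (λ { refl → ∈P.∈-map⁺ (a ∷_) (ay u) }) (ax a))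

allVecs-unique : ∀ N k → Unique (allVecs N k)
allVecs-unique N zero    = [] ∷ []
allVecs-unique N (suc k) = concatMap-unique (UniqueP.allFin⁺ N) (allVecs-unique N k)

allVecs-complete : ∀ {N k} (u : Vec (Fin N) k) → u ∈ allVecs N k
allVecs-complete []      = here refl
allVecs-complete (a ∷ u) = concatMap-complete ∈P.∈-allFin allVecs-complete (a ∷ u)

allSubsets-unique : ∀ k → Unique (allSubsets k)
allSubsets-unique zero    = [] ∷ []
allSubsets-unique (suc k) = concatMap-unique (((λ ()) ∷ []) ∷ [] ∷ []) (allSubsets-unique k)

allSubsets-complete : ∀ {k} (u : Vec Bool k) → u ∈ allSubsets k
allSubsets-complete []      = here refl
allSubsets-complete (a ∷ u) = concatMap-complete {xs = true ∷ false ∷ []} (λ { true → here refl ; false → there (here refl) }) allSubsets-complete (a ∷ u)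

filter-⇔ : ∀ {A : Set} {P Q : A → Set} (P? : ∀ a → Dec (P a)) (Q? : ∀ a → Dec (Q a)) → (∀ a → P a → Q a) → (∀ a → Q a → P a) →
  ∀ xs → List.length (List.filter P? xs) ≡ List.length (List.filter Q? xs)
filter-⇔ P? Q? to from [] = refl
filter-⇔ P? Q? to from (a ∷ xs) with P? a | Q? a
... | yes _ | yes _ = cong suc (filter-⇔ P? Q? to from xs)
... | no _  | no _  = filter-⇔ P? Q? to from xs
... | yes p | no ¬q = ⊥-elim (¬q (to a p))
... | no ¬p | yes q = ⊥-elim (¬p (from a q))

filter-none : ∀ {A : Set} {P : A → Set} (P? : ∀ a → Dec (P a)) → (∀ a → ¬ P a) → ∀ xs → List.length (List.filter P? xs) ≡ 0
filter-none P? h [] = refl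
filter-none P? h (a ∷ xs) with P? a
... | yes p = ⊥-elim (h a p)
... | no _  = filter-none P? h xs

filter-split : ∀ {A : Set} {P Q R : A → Set} (P? : ∀ a → Dec (P a)) (Q? : ∀ a → Dec (Q a)) (R? : ∀ a → Dec (R a)) →
  (∀ a → P a → Q a ⊎ R a) → (∀ a → Q a → P a × ¬ R a) → (∀ a → R a → P a × ¬ Q a) →
  ∀ xs → List.length (List.filter P? xs) ≡ List.length (List.filter Q? xs) ℕ.+ List.length (List.filter R? xs)
filter-split P? Q? R? h q r [] = refl
filter-split P? Q? R? h q r (a ∷ xs) with P? a | Q? a | R? a
... | yes _ | yes _ | no _  = cong suc (filter-split P? Q? R? h q r xs)
... | yes _ | no _  | yes _ = trans (cong suc (filter-split P? Q? R? h q r xs)) (sym (ℕP.+-suc _ _))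
... | no _  | no _  | no _  = filter-split P? Q? R? h q r xs
... | yes p | no ¬q | no ¬r with h a p
...   | inj₁ qa = ⊥-elim (¬q qa)
...   | inj₂ ra = ⊥-elim (¬r ra)
filter-split P? Q? R? h q r (a ∷ xs) | _ | yes qa | yes ra = ⊥-elim (proj₂ (q a qa) ra)
filter-split P? Q? R? h q r (a ∷ xs) | no ¬p | yes qa | _ = ⊥-elim (¬p (proj₁ (q a qa)))
filter-split P? Q? R? h q r (a ∷ xs) | no ¬p | _ | yes ra = ⊥-elim (¬p (proj₁ (r a ra)))

-- Descents, and rotation of vectors.

vec-ext : ∀ {A : Set} {k} {u v : Vec A k} → (∀ i → Vec.lookup u i ≡ Vec.lookup v i) → u ≡ v
vec-ext {u = u} {v} h = trans (sym (VecP.tabulate∘lookup u)) (trans (VecP.tabulate-cong h) (VecP.tabulate∘lookup v))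

-- A standard tableau is encoded by the word of the rows of its successive entries, so an increase is a descent.
des : ∀ {N k} → Vec (Fin N) (suc k) → Vec Bool k
des (a ∷ [])    = []
des (a ∷ b ∷ u) = (toℕ a ℕ.<ᵇ toℕ b) ∷ des (b ∷ u)

des-at : ∀ {N k} (u : Vec (Fin N) (suc k)) i → Vec.lookup (des u) i ≡ (toℕ (Vec.lookup u (Fin.inject₁ i)) ℕ.<ᵇ toℕ (Vec.lookup u (suc i)))
des-at (a ∷ b ∷ u) zero    = refl
des-at (a ∷ b ∷ u) (suc i) = des-at (b ∷ u) i

rotV : ∀ {A : Set} {k} → Vec A (suc k) → Vec A (suc k)
rotV J = Vec.last J ∷ Vec.init J

rotV-∷ʳ : ∀ {A : Set} {k} (D : Vec A k) b → rotV (D Vec.∷ʳ b) ≡ b ∷ D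
rotV-∷ʳ D b = cong₂ _∷_ (VecP.last-∷ʳ b D) (VecP.init-∷ʳ b D)

ones : ∀ {k} → Vec Bool k → ℕ
ones []          = 0
ones (true  ∷ J) = suc (ones J)
ones (false ∷ J) = ones J

ones-∷ʳ : ∀ {k} (D : Vec Bool k) b → ones (D Vec.∷ʳ b) ≡ ones (b ∷ D)
ones-∷ʳ []          b     = refl
ones-∷ʳ (true ∷ D)  true  = cong suc (ones-∷ʳ D true)
ones-∷ʳ (true ∷ D)  false = cong suc (ones-∷ʳ D false)
ones-∷ʳ (false ∷ D) true  = ones-∷ʳ D true
ones-∷ʳ (false ∷ D) false = ones-∷ʳ D false

ones-rotV : ∀ {k} (J : Vec Bool (suc k)) → ones (rotV J) ≡ ones J
ones-rotV J with Vec.initLast J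
... | D , b , refl = sym (ones-∷ʳ D b)

ones-zero : ∀ {k} (J : Vec Bool k) → ones J ≡ 0 → ∀ i → Vec.lookup J i ≡ false
ones-zero (false ∷ J) eq zero    = refl
ones-zero (false ∷ J) eq (suc i) = ones-zero J eq i

ones-suc : ∀ {k l} (J : Vec Bool k) → ones J ≡ suc l → ∃ λ i → Vec.lookup J i ≡ true
ones-suc (true  ∷ J) eq = zero , refl
ones-suc (false ∷ J) eq = let i , t = ones-suc J eq in suc i , t

lookup-last : ∀ {A : Set} {k} (J : Vec A (suc k)) → Vec.lookup J (Fin.fromℕ k) ≡ Vec.last J
lookup-last {k = k} J with Vec.initLast J
... | D , b , refl = go D
  where
    go : ∀ {k} (D : Vec _ k) → Vec.lookup (D Vec.∷ʳ b) (Fin.fromℕ k) ≡ b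
    go []      = refl
    go (_ ∷ D) = go D

lookup-init : ∀ {A : Set} {k} (J : Vec A (suc k)) i → Vec.lookup J (Fin.inject₁ i) ≡ Vec.lookup (Vec.init J) i
lookup-init J i with Vec.initLast J
... | D , b , refl = go D i
  where
    go : ∀ {k} (D : Vec _ k) i → Vec.lookup (D Vec.∷ʳ b) (Fin.inject₁ i) ≡ Vec.lookup D i
    go (_ ∷ D) zero    = refl
    go (_ ∷ D) (suc i) = go D i

lookup-rotV : ∀ {A : Set} {k} (J : Vec A (suc k)) j → Vec.lookup (rotV J) j ≡ Vec.lookup J (prevF j)
lookup-rotV J zero    = sym (lookup-last J)
lookup-rotV J (suc i) = sym (lookup-init J i)

rotV⁻¹ : ∀ {A : Set} {k} → Vec A (suc k) → Vec A (suc k)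
rotV⁻¹ (c ∷ C) = C Vec.∷ʳ c

rotV-rotV⁻¹ : ∀ {A : Set} {k} (C : Vec A (suc k)) → rotV (rotV⁻¹ C) ≡ C
rotV-rotV⁻¹ (c ∷ C) = rotV-∷ʳ C c

rotV⁻¹-rotV : ∀ {A : Set} {k} (C : Vec A (suc k)) → rotV⁻¹ (rotV C) ≡ C
rotV⁻¹-rotV C with Vec.initLast C
... | D , b , refl = refl

rotVs : ∀ {A : Set} {k} → ℕ → Vec A (suc k) → Vec A (suc k)
rotVs zero    C = C
rotVs (suc r) C = rotV (rotVs r C)

pr nx : ∀ {k} → ℕ → Fin (suc k) → Fin (suc k)
pr zero    j = j
pr (suc r) j = pr r (prevF j)
nx zero    j = j
nx (suc r) j = nextF (nx r j)

lookup-rotVs : ∀ {A : Set} {k} r (C : Vec A (suc k)) j → Vec.lookup (rotVs r C) j ≡ Vec.lookup C (pr r j)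
lookup-rotVs zero    C j = refl
lookup-rotVs (suc r) C j = trans (lookup-rotV (rotVs r C) j) (lookup-rotVs r C (prevF j))

pr-nx : ∀ {k} r (j : Fin (suc k)) → pr r (nx r j) ≡ j
pr-nx zero    j = refl
pr-nx (suc r) j = trans (cong (pr r) (prev-next (nx r j))) (pr-nx r j)

pr-injective : ∀ {k} r {i j : Fin (suc k)} → pr r i ≡ pr r j → i ≡ j
pr-injective zero    eq = eq
pr-injective (suc r) {i} {j} eq = trans (sym (next-prev i)) (trans (cong nextF (pr-injective r eq)) (next-prev j))

prev-pr : ∀ {k} r (j : Fin (suc k)) → prevF (pr r j) ≡ pr r (prevF j)
prev-pr zero    j = refl
prev-pr (suc r) j = prev-pr r (prevF j)

pr-next : ∀ {k} r (j : Fin (suc k)) → pr r (nextF j) ≡ nextF (pr r j)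
pr-next r j = trans (sym (next-prev (pr r (nextF j)))) (cong nextF (trans (prev-pr r (nextF j)) (cong (pr r) (prev-next j))))

rotVs-comm : ∀ {A : Set} {k} r (C : Vec A (suc k)) → rotVs r (rotV C) ≡ rotV (rotVs r C)
rotVs-comm zero    C = refl
rotVs-comm (suc r) C = cong rotV (rotVs-comm r C)

-- Words as growing shapes: letter a adds a cell to row a; valid words run from a given shape to hi.
module Shapes (ℓ : ℕ) (hi : ℕ → ℕ) where

  State : Set
  State = ℕ → ℕ

  δ : Fin ℓ → ℕ → ℕ
  δ a i with toℕ a ℕP.≟ i
  ... | yes _ = 1
  ... | no _  = 0

  δ-same : ∀ a {i} → toℕ a ≡ i → δ a i ≡ 1
  δ-same a {i} eq with toℕ a ℕP.≟ i
  ... | yes _  = refl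
  ... | no neq = ⊥-elim (neq eq)

  δ-diff : ∀ a {i} → toℕ a ≢ i → δ a i ≡ 0
  δ-diff a {i} neq with toℕ a ℕP.≟ i
  ... | yes eq = ⊥-elim (neq eq)
  ... | no _   = refl

  bump : State → Fin ℓ → State
  bump y a i = δ a i ℕ.+ y i

  bump-cong : ∀ {y y′} a → y ≗ y′ → bump y a ≗ bump y′ a
  bump-cong a eq i = cong (δ a i ℕ.+_) (eq i)

  bump-comm : ∀ y a b → bump (bump y a) b ≗ bump (bump y b) a
  bump-comm y a b i = begin
    δ b i ℕ.+ (δ a i ℕ.+ y i) ≡⟨ sym (ℕP.+-assoc (δ b i) (δ a i) (y i)) ⟩
    δ b i ℕ.+ δ a i ℕ.+ y i   ≡⟨ cong (ℕ._+ y i) (ℕP.+-comm (δ b i) (δ a i)) ⟩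
    δ a i ℕ.+ δ b i ℕ.+ y i   ≡⟨ ℕP.+-assoc (δ a i) (δ b i) (y i) ⟩
    δ a i ℕ.+ (δ b i ℕ.+ y i) ∎
    where open ≡-Reasoning

  Ok End : State → Set
  Ok y  = ∀ (i : Fin ℓ) → y (suc (toℕ i)) ℕ.≤ y (toℕ i)
  End y = ∀ (i : Fin ℓ) → y (toℕ i) ≡ hi (toℕ i)

  Word : ℕ → Set
  Word m = Vec (Fin ℓ) m

  Valid : ∀ {m} → State → Word m → Set
  Valid y []      = End y
  Valid y (a ∷ u) = Ok (bump y a) × Valid (bump y a) u

  ok? : ∀ y → Dec (Ok y)
  ok? y = allF? (λ i → y (suc (toℕ i)) ℕP.≤? y (toℕ i))

  valid? : ∀ {m} y (u : Word m) → Dec (Valid y u)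
  valid? y []      = allF? (λ i → y (toℕ i) ℕP.≟ hi (toℕ i))
  valid? y (a ∷ u) = ok? (bump y a) ×-dec valid? (bump y a) u

  ok-cong : ∀ {y y′} → y ≗ y′ → Ok y → Ok y′
  ok-cong eq ok i = subst₂ ℕ._≤_ (eq (suc (toℕ i))) (eq (toℕ i)) (ok i)

  valid-cong : ∀ {m y y′} (u : Word m) → y ≗ y′ → Valid y u → Valid y′ u
  valid-cong []      eq e i        = trans (sym (eq (toℕ i))) (e i)
  valid-cong (a ∷ u) eq (ok , val) = ok-cong (bump-cong a eq) ok , valid-cong u (bump-cong a eq) val

  bump-other : ∀ y {c a} → c ≢ a → bump y c (toℕ a) ≡ y (toℕ a)
  bump-other y {c} {a} c≢a = cong (ℕ._+ y (toℕ a)) (δ-diff c (c≢a ∘ toℕ-injective))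

  bump-self : ∀ y a → bump y a (toℕ a) ≡ suc (y (toℕ a))
  bump-self y a = cong (ℕ._+ y (toℕ a)) (δ-same a refl)

  valid-≤ : ∀ {m} y (u : Word m) → Valid y u → ∀ (a : Fin ℓ) → y (toℕ a) ℕ.≤ hi (toℕ a)
  valid-≤ y []      e a         = ℕP.≤-reflexive (e a)
  valid-≤ y (b ∷ u) (_ , val) a = ℕP.≤-trans (ℕP.m≤n+m _ (δ b (toℕ a))) (valid-≤ (bump y b) u val a)

  ok-mono : ∀ y → Ok y → ∀ i k → i ℕ.+ k ℕ.≤ ℓ → y (i ℕ.+ k) ℕ.≤ y i
  ok-mono y ok i zero    le = ℕP.≤-reflexive (cong y (ℕP.+-identityʳ i))
  ok-mono y ok i (suc k) le = ℕP.≤-trans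
    (subst₂ ℕ._≤_ (trans (cong (y ∘ suc) eq) (cong y (sym (ℕP.+-suc i k)))) (cong y eq) (ok (Fin.fromℕ< lt)))
    (ok-mono y ok i k (ℕP.<⇒≤ lt))
    where
      lt : i ℕ.+ k ℕ.< ℓ
      lt = subst (ℕ._≤ ℓ) (ℕP.+-suc i k) le
      eq = FinP.toℕ-fromℕ< lt

-- Young's seminormal form on functions on words.

module Seminormal (ℓ : ℕ) (κ : Fin ℓ → Bool) (lo hi : ℕ → ℕ)
  (sep : ∀ a b → toℕ b ≡ suc (toℕ a) → κ a ≢ κ b → hi (toℕ b) ℕ.≤ lo (toℕ a)) where

  open Shapes ℓ hi public

  Fun : ℕ → Set
  Fun m = Word m → ℚ

  Inv : State → Set
  Inv y = Ok y × (∀ i → lo i ℕ.≤ y i)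

  inv-bump : ∀ {y} a → Inv y → Ok (bump y a) → Inv (bump y a)
  inv-bump a (_ , ge) ok = ok , λ i → ℕP.≤-trans (ge i) (ℕP.m≤n+m _ (δ a i))

  -- The content, column minus row, of the cell that letter `a` would add next. Differences of these
  -- are the axial distances.
  X : State → Fin ℓ → ℚ
  X y a = ⌜ y (toℕ a) ⌝ - ⌜ toℕ a ⌝

  -- Row lengths weakly decrease while row indices increase, so the distance is the positive integer
  -- 1 + `s` + `r`.
  X-<-≢ : ∀ y → Ok y → ∀ {a b} → toℕ a ℕ.< toℕ b → X y a - X y b ≢ 0ℚ
  X-<-≢ y ok {a} {b} a<b eq = ⌜suc⌝≢0 (s ℕ.+ r) (trans (sym dist) eq)
    where
      open ≡-Reasoning
      r = toℕ b ℕ.∸ suc (toℕ a)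
      b≡ : toℕ b ≡ toℕ a ℕ.+ suc r
      b≡ = trans (sym (ℕP.m+[n∸m]≡n a<b)) (sym (ℕP.+-suc (toℕ a) r))
      le : y (toℕ b) ℕ.≤ y (toℕ a)
      le = subst (λ k → y k ℕ.≤ y (toℕ a)) (sym b≡)
             (ok-mono y ok (toℕ a) (suc r) (subst (ℕ._≤ ℓ) b≡ (ℕP.<⇒≤ (toℕ<n b))))
      s = y (toℕ a) ℕ.∸ y (toℕ b)
      dist : X y a - X y b ≡ ⌜ suc (s ℕ.+ r) ⌝
      dist = begin
        (⌜ y (toℕ a) ⌝ - ⌜ toℕ a ⌝) - (⌜ y (toℕ b) ⌝ - ⌜ toℕ b ⌝)
          ≡⟨ cong₂ (λ p q → (p - ⌜ toℕ a ⌝) - (⌜ y (toℕ b) ⌝ - q))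
               (trans (cong ⌜_⌝ (sym (ℕP.m∸n+n≡m le))) (⌜⌝-+ s (y (toℕ b))))
               (trans (cong ⌜_⌝ b≡) (⌜⌝-+ (toℕ a) (suc r))) ⟩
        ((⌜ s ⌝ + ⌜ y (toℕ b) ⌝) - ⌜ toℕ a ⌝) - (⌜ y (toℕ b) ⌝ - (⌜ toℕ a ⌝ + (1ℚ + ⌜ r ⌝)))
          ≡⟨ solve 4 (λ s t a r → ((s :+ t) :- a) :- (t :- (a :+ (con 1ℚ :+ r))) := con 1ℚ :+ (s :+ r)) refl
               ⌜ s ⌝ ⌜ y (toℕ b) ⌝ ⌜ toℕ a ⌝ ⌜ r ⌝ ⟩
        1ℚ + (⌜ s ⌝ + ⌜ r ⌝) ≡⟨ cong (1ℚ +_) (sym (⌜⌝-+ s r)) ⟩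
        ⌜ suc (s ℕ.+ r) ⌝ ∎

  -‿swap : ∀ p q → p - q ≡ - (q - p)
  -‿swap = solve 2 (λ p q → p :- q := :- (q :- p)) refl

  X-≢ : ∀ y → Ok y → ∀ {a b} → a ≢ b → X y a - X y b ≢ 0ℚ
  X-≢ y ok {a} {b} a≢b with ℕP.<-cmp (toℕ a) (toℕ b)
  ... | tri< lt _ _ = X-<-≢ y ok lt
  ... | tri≈ _ eq _ = λ _ → a≢b (toℕ-injective eq)
  ... | tri> _ _ gt = λ eq → neg-≢0 (X-<-≢ y ok gt) (trans (sym (-‿swap (X y a) (X y b))) eq)

  -- The coefficient 0 between colours makes the transposition exchange the two letters outright, as
  -- in an induced product of two representations.
  ι : State → Fin ℓ → Fin ℓ → ℚ
  ι y a b = if does (κ a ≟B κ b) then inv (X y a - X y b) else 0ℚ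

  ι-anti : ∀ y a b → ι y b a ≡ - ι y a b
  ι-anti y a b with κ a | κ b
  ... | false | false = trans (cong inv (-‿swap (X y b) (X y a))) (inv-neg (X y a - X y b))
  ... | false | true  = refl
  ... | true  | false = refl
  ... | true  | true  = trans (cong inv (-‿swap (X y b) (X y a))) (inv-neg (X y a - X y b))

  ι-cross : ∀ y {a b} → κ a ≢ κ b → ι y a b ≡ 0ℚ
  ι-cross y {a} {b} κ≢ with κ a ≟B κ b
  ... | yes eq = ⊥-elim (κ≢ eq)
  ... | no _   = refl

  ι-cong : ∀ {y y′} a b → y (toℕ a) ≡ y′ (toℕ a) → y (toℕ b) ≡ y′ (toℕ b) → ι y a b ≡ ι y′ a b
  ι-cong a b p q = cong₂ (λ s t → if does (κ a ≟B κ b) then inv ((⌜ s ⌝ - ⌜ toℕ a ⌝) - (⌜ t ⌝ - ⌜ toℕ b ⌝)) else 0ℚ) p q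

  ι-bump : ∀ y {c a b} → c ≢ a → c ≢ b → ι (bump y c) a b ≡ ι y a b
  ι-bump y {c} {a} {b} c≢a c≢b = ι-cong {bump y c} {y} a b (bump-other y c≢a) (bump-other y c≢b)

  -- In one colour this is `inv-add`. If a colour differs, at least two of the three coefficients
  -- are 0 and both sides vanish.
  ι-triangle : ∀ y → Ok y → ∀ {a b c} → a ≢ b → b ≢ c → a ≢ c →
    ι y a b * ι y b c ≡ ι y a c * (ι y a b + ι y b c)
  ι-triangle y ok {a} {b} {c} a≢b b≢c a≢c with κ a | κ b | κ c
  ... | false | false | false = same
    where
      sum≡ : (X y a - X y b) + (X y b - X y c) ≡ X y a - X y c
      sum≡ = solve 3 (λ a b c → (a :- b) :+ (b :- c) := a :- c) refl (X y a) (X y b) (X y c)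
      same = trans (inv-add (X-≢ y ok a≢b) (X-≢ y ok b≢c) (λ eq → X-≢ y ok a≢c (trans (sym sum≡) eq)))
                   (cong (λ t → inv t * (inv (X y a - X y b) + inv (X y b - X y c))) sum≡)
  ... | true | true | true = same
    where
      sum≡ : (X y a - X y b) + (X y b - X y c) ≡ X y a - X y c
      sum≡ = solve 3 (λ a b c → (a :- b) :+ (b :- c) := a :- c) refl (X y a) (X y b) (X y c)
      same = trans (inv-add (X-≢ y ok a≢b) (X-≢ y ok b≢c) (λ eq → X-≢ y ok a≢c (trans (sym sum≡) eq)))
                   (cong (λ t → inv t * (inv (X y a - X y b) + inv (X y b - X y c))) sum≡)
  ... | false | false | true  = solve 1 (λ t → t :* con 0ℚ := con 0ℚ :* (t :+ con 0ℚ)) refl (inv (X y a - X y b))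
  ... | true  | true  | false = solve 1 (λ t → t :* con 0ℚ := con 0ℚ :* (t :+ con 0ℚ)) refl (inv (X y a - X y b))
  ... | false | true  | true  = solve 1 (λ t → con 0ℚ :* t := con 0ℚ :* (con 0ℚ :+ t)) refl (inv (X y b - X y c))
  ... | true  | false | false = solve 1 (λ t → con 0ℚ :* t := con 0ℚ :* (con 0ℚ :+ t)) refl (inv (X y b - X y c))
  ... | false | true  | false = sym (ℚP.*-zeroʳ (inv (X y a - X y c)))
  ... | true  | false | true  = sym (ℚP.*-zeroʳ (inv (X y a - X y c)))

  X-bump : ∀ y {a b} → a ≢ b → X (bump y a) a - X (bump y a) b ≡ (X y a - X y b) + 1ℚ
  X-bump y {a} {b} a≢b = trans
    (cong₂ (λ s t → (⌜ s ⌝ - ⌜ toℕ a ⌝) - (⌜ t ⌝ - ⌜ toℕ b ⌝)) (bump-self y a) (bump-other y a≢b))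
    (solve 4 (λ s a t b → ((con 1ℚ :+ s) :- a) :- (t :- b) := ((s :- a) :- (t :- b)) :+ con 1ℚ) refl
       ⌜ y (toℕ a) ⌝ ⌜ toℕ a ⌝ ⌜ y (toℕ b) ⌝ ⌜ toℕ b ⌝)

  -- With d the distance before the letter `a` is added, this says 1/d - 1/(d + 1) = 1/d · 1/(d +
  -- 1), which is `inv-add` for d and 1.
  ι-step : ∀ y → Ok y → ∀ {a b} → a ≢ b → (X y a - X y b) + 1ℚ ≢ 0ℚ →
    (ι y a b - ι (bump y a) a b) - ι y a b * ι (bump y a) a b ≡ 0ℚ
  ι-step y ok {a} {b} a≢b nz with κ a ≟B κ b
  ... | no _  = refl
  ... | yes _ = begin
    (p - inv (X (bump y a) a - X (bump y a) b)) - p * inv (X (bump y a) a - X (bump y a) b)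
      ≡⟨ cong (λ t → (p - inv t) - p * inv t) (X-bump y a≢b) ⟩
    (p - q) - p * q ≡⟨ cong (λ t → (t - q) - p * q) (trans (sym (ℚP.*-identityʳ p)) (cong (p *_) (sym inv-1))) ⟩
    (p * inv 1ℚ - q) - p * q ≡⟨ cong (λ t → (t - q) - p * q) (inv-add (X-≢ y ok a≢b) (λ ()) nz) ⟩
    (q * (p + inv 1ℚ) - q) - p * q ≡⟨ cong (λ t → (q * (p + t) - q) - p * q) inv-1 ⟩
    (q * (p + 1ℚ) - q) - p * q ≡⟨ solve 2 (λ p q → (q :* (p :+ con 1ℚ) :- q) :- p :* q := con 0ℚ) refl p q ⟩
    0ℚ ∎
    where
      open ≡-Reasoning
      p = inv (X y a - X y b)
      q = inv ((X y a - X y b) + 1ℚ)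

  -- Exchanging two letters of a valid word destroys validity only in front of a wall, where ι = -1.
  ι-wall : ∀ {m y} → Inv y → ∀ a b (w : Word m) → ¬ Valid y (a ∷ b ∷ w) → Valid y (b ∷ a ∷ w) → ι y a b ≡ - 1ℚ
  ι-wall {y = y} (ok , ge) a b w ¬ab (okb , okba , val)
    with toℕ a ℕP.≟ suc (toℕ b) | y (toℕ a) ℕP.≟ y (toℕ b)
  ... | yes a≡sb | yes ya≡yb = wall
    where
      wall : ι y a b ≡ - 1ℚ
      wall with κ a ≟B κ b
      ... | yes _ = trans (cong inv (trans
              (cong₂ (λ s t → (⌜ s ⌝ - ⌜ t ⌝) - (⌜ y (toℕ b) ⌝ - ⌜ toℕ b ⌝)) ya≡yb a≡sb)
              (solve 2 (λ t b → (t :- (con 1ℚ :+ b)) :- (t :- b) := con (- 1ℚ)) refl ⌜ y (toℕ b) ⌝ ⌜ toℕ b ⌝)))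
              (trans (inv-neg 1ℚ) (cong -_ inv-1))
      -- If the colours differed, `sep` would give hi a ≤ lo b ≤ y b = y a, although the valid word
      -- still adds a cell to row `a`.
      ... | no κ≢ = ⊥-elim (ℕP.<-irrefl refl (ℕP.≤-trans
              (ℕP.≤-trans (ℕP.≤-trans (ℕP.≤-reflexive (sym (bump-self y a)))
                 (ℕP.≤-trans (ℕP.≤-reflexive (cong (δ a (toℕ a) ℕ.+_) (refl {x = y (toℕ a)})))
                   (ℕP.+-monoʳ-≤ (δ a (toℕ a)) (ℕP.m≤n+m (y (toℕ a)) (δ b (toℕ a))))))
                 (valid-≤ (bump (bump y b) a) w val a))
              (ℕP.≤-trans (sep b a a≡sb (κ≢ ∘ sym)) (ℕP.≤-trans (ge (toℕ b)) (ℕP.≤-reflexive (sym ya≡yb))))))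
  ... | yes a≡sb | no ya≢yb = ⊥-elim (¬ab (oka , ok-cong (bump-comm y b a) okba , valid-cong w (bump-comm y b a) val))
    where
      oka : Ok (bump y a)
      oka i with toℕ a ℕP.≟ suc (toℕ i)
      ... | no _     = ℕP.≤-trans (ok i) (ℕP.m≤n+m _ (δ a (toℕ i)))
      ... | yes a≡si = ℕP.≤-trans (ℕP.≤∧≢⇒< (ok i) (λ eq → ya≢yb (trans (cong y a≡si) (trans eq (cong y i≡b)))))
                                  (ℕP.m≤n+m _ (δ a (toℕ i)))
        where i≡b = ℕP.suc-injective (trans (sym a≡si) a≡sb)
  ... | no a≢sb | _ = ⊥-elim (¬ab (oka , ok-cong (bump-comm y b a) okba , valid-cong w (bump-comm y b a) val))
    where
      oka : Ok (bump y a)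
      oka i with toℕ a ℕP.≟ suc (toℕ i) | okba i
      ... | no _     | _  = ℕP.≤-trans (ok i) (ℕP.m≤n+m _ (δ a (toℕ i)))
      ... | yes a≡si | le = ℕP.≤-trans (ℕP.≤-trans (s≤s (ℕP.m≤n+m _ (δ b (suc (toℕ i)))))
              (ℕP.≤-trans le (ℕP.≤-reflexive (cong (δ a (toℕ i) ℕ.+_) (cong (ℕ._+ y (toℕ i)) (δ-diff b b≢i))))))
              ℕP.≤-refl
        where
          b≢i : toℕ b ≢ toℕ i
          b≢i eq = a≢sb (trans a≡si (cong suc (sym eq)))

  Supp : ∀ {m} → State → Fun m → Set
  Supp y v = ∀ u → ¬ Valid y u → v u ≡ 0ℚ

  supp-bump : ∀ {m y} {v : Fun (suc m)} → Supp y v → ∀ a → Supp (bump y a) (v ∘ (a ∷_))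
  supp-bump sv a u ¬val = sv (a ∷ u) (¬val ∘ proj₂)

  supp-¬ok : ∀ {m y} {v : Fun (suc m)} → Supp y v → ∀ a → ¬ Ok (bump y a) → ∀ u → v (a ∷ u) ≡ 0ℚ
  supp-¬ok sv a ¬ok u = sv (a ∷ u) (¬ok ∘ proj₁)

  swp : ∀ {A : Set} {m} → Fin m → Vec A (suc m) → Vec A (suc m)
  swp zero    (a ∷ b ∷ u) = b ∷ a ∷ u
  swp (suc i) (a ∷ u)     = a ∷ swp i u

  -- Defined on all functions. Being an involution and having simple fixed vectors needs no
  -- condition; the braid relation is proved for functions supported on valid words.
  S : ∀ {m} → State → Fin m → Fun (suc m) → Fun (suc m)
  S y zero    v (a ∷ b ∷ u) = mix (ι y a b) (v (a ∷ b ∷ u)) (v (b ∷ a ∷ u))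
  S y (suc i) v (a ∷ u)     = S (bump y a) i (v ∘ (a ∷_)) u

  S-cong : ∀ {m y y′} (i : Fin m) {v v′ : Fun (suc m)} → y ≗ y′ → v ≗ v′ → S y i v ≗ S y′ i v′
  S-cong {y = y} {y′} zero {v} ey ev (a ∷ b ∷ u) = trans
    (cong (λ t → mix t (v (a ∷ b ∷ u)) (v (b ∷ a ∷ u))) (ι-cong {y} {y′} a b (ey (toℕ a)) (ey (toℕ b))))
    (cong₂ (mix (ι y′ a b)) (ev (a ∷ b ∷ u)) (ev (b ∷ a ∷ u)))
  S-cong (suc i) ey ev (a ∷ u) = S-cong i (bump-cong a ey) (λ u → ev (a ∷ u)) u

  S-congᵛ : ∀ {m} y (i : Fin m) {v v′ : Fun (suc m)} → v ≗ v′ → S y i v ≗ S y i v′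
  S-congᵛ y i = S-cong {y = y} {y} i (λ _ → refl)

  S-+ : ∀ {m} y (i : Fin m) (v w : Fun (suc m)) u → S y i (λ u → v u + w u) u ≡ S y i v u + S y i w u
  S-+ y zero    v w (a ∷ b ∷ u) = mix-+ (ι y a b) _ _ _ _
  S-+ y (suc i) v w (a ∷ u)     = S-+ (bump y a) i (v ∘ (a ∷_)) (w ∘ (a ∷_)) u

  S-* : ∀ {m} y (i : Fin m) k (v : Fun (suc m)) u → S y i (λ u → k * v u) u ≡ k * S y i v u
  S-* y zero    k v (a ∷ b ∷ u) = mix-* (ι y a b) k _ _
  S-* y (suc i) k v (a ∷ u)     = S-* (bump y a) i k (v ∘ (a ∷_)) u

  S-zero : ∀ {m} y (i : Fin m) {v : Fun (suc m)} → (∀ u → v u ≡ 0ℚ) → ∀ u → S y i v u ≡ 0ℚ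
  S-zero y zero    ev (a ∷ b ∷ u) = trans (cong₂ (mix (ι y a b)) (ev (a ∷ b ∷ u)) (ev (b ∷ a ∷ u))) (mix-0 (ι y a b))
  S-zero y (suc i) ev (a ∷ u)     = S-zero (bump y a) i (λ u → ev (a ∷ u)) u

  S-invol : ∀ {m} y (i : Fin m) (v : Fun (suc m)) → S y i (S y i v) ≗ v
  S-invol y zero    v (a ∷ b ∷ u) = trans
    (cong (λ t → mix (ι y a b) (mix (ι y a b) x z) (mix t z x)) (ι-anti y a b)) (mix-invol (ι y a b) x z)
    where
      x = v (a ∷ b ∷ u)
      z = v (b ∷ a ∷ u)
  S-invol y (suc i) v (a ∷ u)     = S-invol (bump y a) i (v ∘ (a ∷_)) u

  -- At an invalid word either the exchanged word is invalid too, or the two letters face a wall and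
  -- its coefficient -1 removes the value at the valid one.
  S-supp : ∀ {m y} → Inv y → ∀ (i : Fin m) {v} → Supp y v → Supp y (S y i v)
  S-supp {y = y} iy zero {v} sv (a ∷ b ∷ u) ¬val with valid? y (b ∷ a ∷ u)
  ... | no ¬val′ = trans (cong₂ (mix (ι y a b)) (sv _ ¬val) (sv _ ¬val′)) (mix-0 (ι y a b))
  ... | yes val  = trans (cong₂ (λ i x → mix i x (v (b ∷ a ∷ u))) (ι-wall iy a b u ¬val val) (sv _ ¬val))
    (mix-wall (v (b ∷ a ∷ u)))
  S-supp {y = y} iy (suc i) sv (a ∷ u) ¬val with ok? (bump y a)
  ... | yes ok = S-supp (inv-bump a iy ok) i (supp-bump sv a) u (¬val ∘ (ok ,_))
  ... | no ¬ok = S-zero (bump y a) i (supp-¬ok sv a ¬ok) u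

  S-fixed⇒ : ∀ {m} y (i : Fin m) {v} → S y i v ≗ v → v ∘ swp i ≗ v
  S-fixed⇒ y zero    {v} fix (a ∷ b ∷ u) = mix-fixed (ι y a b) (v (a ∷ b ∷ u)) (v (b ∷ a ∷ u)) (fix (a ∷ b ∷ u))
    (trans (cong (λ t → mix t _ _) (sym (ι-anti y a b))) (fix (b ∷ a ∷ u)))
  S-fixed⇒ y (suc i) fix (a ∷ u) = S-fixed⇒ (bump y a) i (λ u → fix (a ∷ u)) u

  S-fixed⇐ : ∀ {m} y (i : Fin m) {v} → v ∘ swp i ≗ v → S y i v ≗ v
  S-fixed⇐ y zero    inv (a ∷ b ∷ u) = trans (cong (mix (ι y a b) _) (inv (a ∷ b ∷ u))) (mix-refl (ι y a b) _)
  S-fixed⇐ y (suc i) inv (a ∷ u) = S-fixed⇐ (bump y a) i (λ u → inv (a ∷ u)) u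

  private
    -- If the distance of a and b passes through 0, the words aab, aba, baa are all invalid.
    ρ-zero : ∀ {m} y → Ok y → ∀ {a b} → a ≢ b → (u : Word m) → ∀ x →
      (¬ Valid y (a ∷ a ∷ b ∷ u) × ¬ Valid y (a ∷ b ∷ a ∷ u) × ¬ Valid y (b ∷ a ∷ a ∷ u) → x ≡ 0ℚ) →
      ((ι y a b - ι (bump y a) a b) - ι y a b * ι (bump y a) a b) * x ≡ 0ℚ
    ρ-zero y ok {a} {b} a≢b u x h with (X y a - X y b) + 1ℚ ℚP.≟ 0ℚ
    ... | no nz = trans (cong (_* x) (ι-step y ok a≢b nz)) (ℚP.*-zeroˡ x)
    ... | yes z = trans (cong (ρ *_) (h (bad₁ , bad₁ , bad₂))) (ℚP.*-zeroʳ ρ)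
      where
        ρ = (ι y a b - ι (bump y a) a b) - ι y a b * ι (bump y a) a b
        bad₁ : ∀ {A} → Ok (bump y a) × A → ⊥
        bad₁ (ok′ , _) = X-≢ (bump y a) ok′ a≢b (trans (X-bump y a≢b) z)
        -- After b, a, a the distance has changed by 2 - 1, so it is again the vanishing d + 1,
        -- which no partition allows.
        bad₂ : ¬ Valid y (b ∷ a ∷ a ∷ u)
        bad₂ (_ , _ , ok″ , _) = X-≢ (bump (bump (bump y b) a) a) ok″ a≢b (trans
          (cong₂ (λ s t → (⌜ s ⌝ - ⌜ toℕ a ⌝) - (⌜ t ⌝ - ⌜ toℕ b ⌝))
            (trans (bump-self (bump (bump y b) a) a) (cong suc (trans (bump-self (bump y b) a) (cong suc (bump-other y (a≢b ∘ sym))))))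
            (trans (bump-other (bump (bump y b) a) a≢b) (trans (bump-other (bump y b) a≢b) (bump-self y b))))
          (trans (solve 4 (λ s a t b → ((con 1ℚ :+ (con 1ℚ :+ s)) :- a) :- ((con 1ℚ :+ t) :- b) := ((s :- a) :- (t :- b)) :+ con 1ℚ) refl
             ⌜ y (toℕ a) ⌝ ⌜ toℕ a ⌝ ⌜ y (toℕ b) ⌝ ⌜ toℕ b ⌝) z))

  -- Three distinct letters use `ι-triangle`. With exactly two equal letters only three
  -- rearrangements remain, and the three cases are one relation between the distances before and
  -- after the first repeated letter, read at different words.
  S-braid : ∀ {m y} → Inv y → ∀ {v : Fun (suc (suc (suc m)))} → Supp y v →
    S y zero (S y (suc zero) (S y zero v)) ≗ S y (suc zero) (S y zero (S y (suc zero) v))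
  S-braid {y = y} (ok , _) {v} sv (a ∷ b ∷ c ∷ u) with a ≟F b | b ≟F c | a ≟F c
  ... | yes refl | yes refl | _ = trans
    (cong₂ (λ s t → mix e (mix e′ s t) (mix e′ s t)) (mix-refl e x) (mix-refl e x))
    (trans (mix-refl e _) (sym (trans (cong₂ (λ s t → mix e′ (mix e s t) (mix e s t)) (mix-refl e′ x) (mix-refl e′ x))
      (trans (mix-refl e′ _) (trans (mix-refl e x) (sym (mix-refl e′ x)))))))
    where
      x  = v (a ∷ a ∷ a ∷ u)
      e  = ι y a a
      e′ = ι (bump y a) a a
  ... | yes refl | no b≢c | _ = braid-aab {P = ι y a c} {Q = ι (bump y a) a c}
      {p = v (a ∷ a ∷ c ∷ u)} {q = v (a ∷ c ∷ a ∷ u)} {r = v (c ∷ a ∷ a ∷ u)}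
      (ρ-zero y ok b≢c u _ (λ (p , q , r) → sv _ p)) (ρ-zero y ok b≢c u _ (λ (p , q , r) → sv _ q))
      (ρ-zero y ok b≢c u _ (λ (p , q , r) → sv _ r)) (ι y a a) (ι (bump y c) a a) (ι-anti (bump y a) a c)
  ... | no a≢b | yes refl | _ = braid-baa {P = ι y b a} {Q = ι (bump y b) b a}
      {p = v (b ∷ b ∷ a ∷ u)} {q = v (b ∷ a ∷ b ∷ u)} {r = v (a ∷ b ∷ b ∷ u)}
      (ρ-zero y ok (a≢b ∘ sym) u _ (λ (p , q , r) → sv _ p)) (ρ-zero y ok (a≢b ∘ sym) u _ (λ (p , q , r) → sv _ q))
      (ρ-zero y ok (a≢b ∘ sym) u _ (λ (p , q , r) → sv _ r)) (ι y b b) (ι (bump y a) b b) (ι-anti y b a) (ι-anti (bump y b) b a)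
  ... | no a≢b | no b≢c | yes refl = braid-aba {P = ι y a b} {Q = ι (bump y a) a b}
      {p = v (a ∷ a ∷ b ∷ u)} {q = v (a ∷ b ∷ a ∷ u)} {r = v (b ∷ a ∷ a ∷ u)}
      (ρ-zero y ok a≢b u _ (λ (p , q , r) → sv _ p)) (ρ-zero y ok a≢b u _ (λ (p , q , r) → sv _ q))
      (ρ-zero y ok a≢b u _ (λ (p , q , r) → sv _ r)) (ι y a a) (ι (bump y b) a a) (ι-anti y a b) (ι-anti (bump y a) a b)
  ... | no a≢b | no b≢c | no a≢c = braid-distinct
      (v (a ∷ b ∷ c ∷ u)) (v (a ∷ c ∷ b ∷ u)) (v (b ∷ a ∷ c ∷ u)) (v (b ∷ c ∷ a ∷ u)) (v (c ∷ a ∷ b ∷ u)) (v (c ∷ b ∷ a ∷ u))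
      (ι-anti y a b) (ι-bump y a≢b a≢c) (trans (ι-anti (bump y a) b c) (cong -_ (ι-bump y a≢b a≢c)))
      (ι-bump y (a≢b ∘ sym) b≢c) (ι-bump y (a≢c ∘ sym) (b≢c ∘ sym)) (ι-triangle y ok a≢b b≢c a≢c)

  later : ∀ {m} → (State → Fun m → Fun m) → State → Fun (suc m) → Fun (suc m)
  later H y v (a ∷ u) = H (bump y a) (v ∘ (a ∷_)) u

  -- g = s₀ s₁ ⋯ s_{m-1}
  g g⁻¹ : ∀ {m} → State → Fun (suc m) → Fun (suc m)
  g {zero}    y v = v
  g {suc m}   y v = S y zero (later g y v)
  g⁻¹ {zero}  y v = v
  g⁻¹ {suc m} y v = later g⁻¹ y (S y zero v)

  record Linear {m} (H : State → Fun m → Fun m) : Set where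
    field
      congˡ : ∀ {y y′ v v′} → y ≗ y′ → v ≗ v′ → H y v ≗ H y′ v′
      plus  : ∀ y v w u → H y (λ u → v u + w u) u ≡ H y v u + H y w u
      scale : ∀ y k v u → H y (λ u → k * v u) u ≡ k * H y v u
      supp  : ∀ {y v} → Inv y → Supp y v → Supp y (H y v)

    congᵛ : ∀ y {v v′} → v ≗ v′ → H y v ≗ H y v′
    congᵛ y = congˡ {y} {y} (λ _ → refl)

    vanish : ∀ y {v} → (∀ u → v u ≡ 0ℚ) → ∀ u → H y v u ≡ 0ℚ
    vanish y {v} ev u = trans (congᵛ y {v} {λ u → 0ℚ * v u} (λ u → trans (ev u) (sym (ℚP.*-zeroˡ (v u)))) u)
      (trans (scale y 0ℚ v u) (ℚP.*-zeroˡ (H y v u)))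

  open Linear public

  S-linear : ∀ {m} (i : Fin m) → Linear (λ y → S y i)
  S-linear i = record
    { congˡ = λ {y} {y′} → S-cong {y = y} {y′} i
    ; plus = λ y → S-+ y i ; scale = λ y → S-* y i ; supp = λ iy → S-supp iy i }

  later-linear : ∀ {m} {H : State → Fun m → Fun m} → Linear H → Linear (later H)
  later-linear {H = H} lin = record { congˡ = cg ; plus = pl ; scale = sc ; supp = sp }
    where
      cg : ∀ {y y′ v v′} → y ≗ y′ → v ≗ v′ → later H y v ≗ later H y′ v′
      cg {y} {y′} ey ev (a ∷ u) = congˡ lin {bump y a} {bump y′ a} (bump-cong a ey) (λ u → ev (a ∷ u)) u
      pl : ∀ y v w u → later H y (λ u → v u + w u) u ≡ later H y v u + later H y w u
      pl y v w (a ∷ u) = plus lin (bump y a) (v ∘ (a ∷_)) (w ∘ (a ∷_)) u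
      sc : ∀ y k v u → later H y (λ u → k * v u) u ≡ k * later H y v u
      sc y k v (a ∷ u) = scale lin (bump y a) k (v ∘ (a ∷_)) u
      sp : ∀ {y v} → Inv y → Supp y v → Supp y (later H y v)
      sp {y} iy sv (a ∷ u) ¬val with ok? (bump y a)
      ... | yes ok = supp lin (inv-bump a iy ok) (supp-bump sv a) u (¬val ∘ (ok ,_))
      ... | no ¬ok = vanish lin (bump y a) (supp-¬ok sv a ¬ok) u

  ∘-linear : ∀ {m} {H K : State → Fun m → Fun m} → Linear H → Linear K → Linear (λ y → H y ∘ K y)
  ∘-linear {H = H} {K} lh lk = record
    { congˡ = λ {y} {y′} ey ev → congˡ lh {y} {y′} ey (congˡ lk {y} {y′} ey ev)
    ; plus  = λ y v w u → trans (congᵛ lh y (plus lk y v w) u) (plus lh y (K y v) (K y w) u)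
    ; scale = λ y k v u → trans (congᵛ lh y (scale lk y k v) u) (scale lh y k (K y v) u)
    ; supp  = λ iy sv → supp lh iy (supp lk iy sv) }

  g-linear : ∀ {m} → Linear (g {m})
  g-linear {zero}  = record { congˡ = λ _ ev → ev ; plus = λ _ _ _ _ → refl ; scale = λ _ _ _ _ → refl ; supp = λ _ sv → sv }
  g-linear {suc m} = ∘-linear (S-linear zero) (later-linear g-linear)

  g⁻¹-linear : ∀ {m} → Linear (g⁻¹ {m})
  g⁻¹-linear {zero}  = record { congˡ = λ _ ev → ev ; plus = λ _ _ _ _ → refl ; scale = λ _ _ _ _ → refl ; supp = λ _ sv → sv }
  g⁻¹-linear {suc m} = ∘-linear (later-linear g⁻¹-linear) (S-linear zero)

  g-g⁻¹ : ∀ {m} y (v : Fun (suc m)) → g y (g⁻¹ y v) ≗ v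
  g-g⁻¹ {zero}  y v u = refl
  g-g⁻¹ {suc m} y v u = trans (S-congᵛ y zero {later g y (g⁻¹ y v)} {S y zero v} back u) (S-invol y zero v u)
    where
      back : later g y (later g⁻¹ y (S y zero v)) ≗ S y zero v
      back (a ∷ u) = g-g⁻¹ (bump y a) (S y zero v ∘ (a ∷_)) u

  g⁻¹-g : ∀ {m} y (v : Fun (suc m)) → g⁻¹ y (g y v) ≗ v
  g⁻¹-g {zero}  y v u = refl
  g⁻¹-g {suc m} y v u = trans (congᵛ (later-linear g⁻¹-linear) y (S-invol y zero (later g y v)) u) (back u)
    where
      back : later g⁻¹ y (later g y v) ≗ v
      back (a ∷ u) = g⁻¹-g (bump y a) (v ∘ (a ∷_)) u

  -- Both orders of the first two letters lead to the same shape, so the operator on the remaining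
  -- letters is the same at both words and linearity suffices.
  S₀-comm : ∀ {m} {H : State → Fun m → Fun m} → Linear H → ∀ y v →
    S y zero (later (later H) y v) ≗ later (later H) y (S y zero v)
  S₀-comm {H = H} lin y v (a ∷ b ∷ u) = sym (begin
    H yab (λ u → mix i (p u) (q u)) u     ≡⟨ congᵛ lin yab (λ u → mix-affine i (p u) (q u)) u ⟩
    H yab (λ u → (1ℚ + i) * q u + (- i) * p u) u
      ≡⟨ plus lin yab (λ u → (1ℚ + i) * q u) (λ u → (- i) * p u) u ⟩
    H yab (λ u → (1ℚ + i) * q u) u + H yab (λ u → (- i) * p u) u
      ≡⟨ cong₂ _+_ (scale lin yab (1ℚ + i) q u) (scale lin yab (- i) p u) ⟩
    (1ℚ + i) * H yab q u + (- i) * H yab p u ≡⟨ sym (mix-affine i (H yab p u) (H yab q u)) ⟩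
    mix i (H yab p u) (H yab q u)
      ≡⟨ cong (mix i (H yab p u)) (congˡ lin {yab} {bump (bump y b) a} (bump-comm y a b) (λ _ → refl) u) ⟩
    mix i (H yab p u) (H (bump (bump y b) a) q u) ∎)
    where
      open ≡-Reasoning
      yab = bump (bump y a) b
      i = ι y a b
      p q : Fun _
      p u = v (a ∷ b ∷ u)
      q u = v (b ∷ a ∷ u)

  -- Let g″ be g acting from the third letter on. Then g s₀ = s₀ s₁ g″ s₀ = s₀ s₁ s₀ g″ = s₁ s₀ s₁
  -- g″ = s₁ g. For larger indices s₀ commutes past and the claim recurs on the word without its
  -- first letter.
  g-S : ∀ {m y} → Inv y → ∀ (i : Fin m) {v : Fun (suc (suc m))} → Supp y v →
    g y (S y (Fin.inject₁ i) v) ≗ S y (suc i) (g y v)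
  g-S {suc m} {y} iy zero {v} sv u = begin
    S y zero (later g y (S y zero v)) u
      ≡⟨ S-congᵛ y zero (split (S y zero v)) u ⟩
    S y zero (S y (suc zero) (later (later g) y (S y zero v))) u
      ≡⟨ S-congᵛ y zero (S-congᵛ y (suc zero) (λ u → sym (S₀-comm g-linear y v u))) u ⟩
    S y zero (S y (suc zero) (S y zero (later (later g) y v))) u
      ≡⟨ S-braid iy (supp (later-linear (later-linear g-linear)) iy sv) u ⟩
    S y (suc zero) (S y zero (S y (suc zero) (later (later g) y v))) u
      ≡⟨ S-congᵛ y (suc zero) (S-congᵛ y zero (λ u → sym (split v u))) u ⟩
    S y (suc zero) (S y zero (later g y v)) u ∎
    where
      open ≡-Reasoning
      split : ∀ w → later g y w ≗ S y (suc zero) (later (later g) y w)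
      split w (a ∷ b ∷ u) = refl
  g-S {suc m} {y} iy (suc i) {v} sv u = begin
    S y zero (later g y (S y (suc (Fin.inject₁ i)) v)) u
      ≡⟨ S-congᵛ y zero inner u ⟩
    S y zero (later (later (λ y → S y i)) y (later g y v)) u
      ≡⟨ S₀-comm (S-linear i) y (later g y v) u ⟩
    later (later (λ y → S y i)) y (S y zero (later g y v)) u
      ≡⟨ sym (two (S y zero (later g y v)) u) ⟩
    S y (suc (suc i)) (S y zero (later g y v)) u ∎
    where
      open ≡-Reasoning
      two : ∀ w → S y (suc (suc i)) w ≗ later (later (λ y → S y i)) y w
      two w (a ∷ b ∷ u) = refl
      inner : later g y (S y (suc (Fin.inject₁ i)) v) ≗ later (later (λ y → S y i)) y (later g y v)
      inner (a ∷ u) with ok? (bump y a)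
      ... | yes ok = trans (g-S (inv-bump a iy ok) i (supp-bump sv a) u) (two (later g y v) (a ∷ u))
      ... | no ¬ok = trans (vanish g-linear (bump y a) (S-zero (bump y a) (Fin.inject₁ i) (supp-¬ok sv a ¬ok)) u)
        (sym (trans (sym (two (later g y v) (a ∷ u)))
          (S-zero (bump y a) (suc i) (vanish g-linear (bump y a) (supp-¬ok sv a ¬ok)) u)))

  -- The recursion for `g` splits off the first factor; as a product over a list it can also be
  -- split at the last factor, as `S₀-g²` requires.
  prod : ∀ {m} → List (Fin m) → State → Fun (suc m) → Fun (suc m)
  prod []       y v = v
  prod (i ∷ is) y v = S y i (prod is y v)

  prod-linear : ∀ {m} (is : List (Fin m)) → Linear (prod is)
  prod-linear []       = record { congˡ = λ _ ev → ev ; plus = λ _ _ _ _ → refl ; scale = λ _ _ _ _ → refl ; supp = λ _ sv → sv }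
  prod-linear (i ∷ is) = ∘-linear (S-linear i) (prod-linear is)

  later-prod : ∀ {m} (is : List (Fin m)) y v → later (prod is) y v ≗ prod (List.map suc is) y v
  later-prod []       y v (a ∷ u) = refl
  later-prod (i ∷ is) y v (a ∷ u) = S-congᵛ (bump y a) i (λ u → later-prod is y v (a ∷ u)) u

  inits : ∀ m → List (Fin m)
  inits zero    = []
  inits (suc m) = zero ∷ List.map suc (inits m)

  g-prod : ∀ m y (v : Fun (suc m)) → g y v ≗ prod (inits m) y v
  later-g-prod : ∀ m y (v : Fun (suc (suc m))) → later g y v ≗ prod (List.map suc (inits m)) y v
  g-prod zero    y v u = refl
  g-prod (suc m) y v u = S-congᵛ y zero (later-g-prod m y v) u
  later-g-prod m y v (a ∷ u) = trans (g-prod m (bump y a) (v ∘ (a ∷_)) u) (later-prod (inits m) y v (a ∷ u))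

  inits-last : ∀ m → inits (suc m) ≡ List.map Fin.inject₁ (inits m) List.++ (Fin.fromℕ m ∷ [])
  inits-last zero    = refl
  inits-last (suc m) = cong (zero ∷_) (begin
    List.map suc (inits (suc m)) ≡⟨ cong (List.map suc) (inits-last m) ⟩
    List.map suc (List.map Fin.inject₁ (inits m) List.++ (Fin.fromℕ m ∷ [])) ≡⟨ ListP.map-++ suc (List.map Fin.inject₁ (inits m)) _ ⟩
    List.map suc (List.map Fin.inject₁ (inits m)) List.++ (suc (Fin.fromℕ m) ∷ [])
      ≡⟨ cong (List._++ (suc (Fin.fromℕ m) ∷ [])) (trans (sym (ListP.map-∘ (inits m))) (ListP.map-∘ (inits m))) ⟩
    List.map Fin.inject₁ (List.map suc (inits m)) List.++ (suc (Fin.fromℕ m) ∷ []) ∎)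
    where open ≡-Reasoning

  prod-++ : ∀ {m} (is js : List (Fin m)) y v → prod (is List.++ js) y v ≡ prod is y (prod js y v)
  prod-++ []       js y v = refl
  prod-++ (i ∷ is) js y v = cong (S y i) (prod-++ is js y v)

  g-prod-comm : ∀ {m y} → Inv y → ∀ (is : List (Fin m)) {v} → Supp y v →
    g y (prod (List.map Fin.inject₁ is) y v) ≗ prod (List.map suc is) y (g y v)
  g-prod-comm iy []       sv u = refl
  g-prod-comm {y = y} iy (i ∷ is) sv u = trans
    (g-S iy i (supp (prod-linear (List.map Fin.inject₁ is)) iy sv) u)
    (S-congᵛ y (suc i) (g-prod-comm iy is sv) u)

  -- With h = s₀ ⋯ s_{m-2} we have g = h s_{m-1} and g h = s₁ ⋯ s_{m-1} g, hence s₀ g² = s₀ g h s_{m-1} = g² s_{m-1}.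
  S₀-g² : ∀ {m y} → Inv y → ∀ {v : Fun (suc (suc m))} → Supp y v →
    S y zero (g y (g y v)) ≗ g y (g y (S y (Fin.fromℕ m) v))
  S₀-g² {m} {y} iy {v} sv u = begin
    S y zero (g y (g y v)) u ≡⟨ S-congᵛ y zero (congᵛ g-linear y g-split) u ⟩
    S y zero (g y (prod (List.map Fin.inject₁ (inits m)) y (S y (Fin.fromℕ m) v))) u
      ≡⟨ S-congᵛ y zero (g-prod-comm iy (inits m) (S-supp iy (Fin.fromℕ m) sv)) u ⟩
    S y zero (prod (List.map suc (inits m)) y (g y (S y (Fin.fromℕ m) v))) u
      ≡⟨ S-congᵛ y zero (λ u → sym (later-g-prod m y (g y (S y (Fin.fromℕ m) v)) u)) u ⟩
    g y (g y (S y (Fin.fromℕ m) v)) u ∎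
    where
      open ≡-Reasoning
      g-split : g y v ≗ prod (List.map Fin.inject₁ (inits m)) y (S y (Fin.fromℕ m) v)
      g-split u = trans (g-prod (suc m) y v u) (cong (λ f → f u) (trans
        (cong (λ is → prod is y v) (inits-last m)) (prod-++ (List.map Fin.inject₁ (inits m)) _ y v)))

  -- The last space is the image under `g` of the one before it, so that step of the cycle holds by
  -- definition. The earlier steps are `g-S`, and the return from the last space to the first is
  -- `S₀-g²`.
  U : ∀ {m} → State → Fin (suc (suc m)) → Fun (suc (suc m)) → Set
  U {m} y j v with view j
  ... | ‵fromℕ     = g⁻¹ y v ∘ swp (Fin.fromℕ m) ≗ g⁻¹ y v
  ... | ‵inject₁ i = v ∘ swp i ≗ v

  private
    transfer : ∀ {m} {v w : Fun (suc m)} (i : Fin m) → v ≗ w → v ∘ swp i ≗ v → w ∘ swp i ≗ w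
    transfer i vw h u = trans (sym (vw (swp i u))) (trans (h u) (vw u))

  U-next : ∀ {m y} → Inv y → ∀ j {v : Fun (suc (suc m))} → Supp y v → U y j v → U y (nextF j) (g y v)
  U-next {m} {y} iy j {v} sv h with view j
  ... | ‵fromℕ = S-fixed⇒ y zero (λ u → begin
          S y zero (g y v) u ≡⟨ S-congᵛ y zero (congᵛ g-linear y (λ u → sym (g-g⁻¹ y v u))) u ⟩
          S y zero (g y (g y w)) u ≡⟨ S₀-g² iy (supp g⁻¹-linear iy sv) u ⟩
          g y (g y (S y (Fin.fromℕ m) w)) u ≡⟨ congᵛ g-linear y (congᵛ g-linear y (S-fixed⇐ y (Fin.fromℕ m) h)) u ⟩
          g y (g y w) u ≡⟨ congᵛ g-linear y (g-g⁻¹ y v) u ⟩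
          g y v u ∎)
        where
          open ≡-Reasoning
          w = g⁻¹ y v
  ... | ‵inject₁ i with view i
  ...   | ‵fromℕ      = transfer (Fin.fromℕ m) (λ u → sym (g⁻¹-g y v u)) h
  ...   | ‵inject₁ i′ = S-fixed⇒ y (suc i′) (λ u → trans (sym (g-S iy i′ sv u)) (congᵛ g-linear y (S-fixed⇐ y (Fin.inject₁ i′) h) u))

  U-prev : ∀ {m y} → Inv y → ∀ j {v : Fun (suc (suc m))} → Supp y v → U y (nextF j) (g y v) → U y j v
  U-prev {m} {y} iy j {v} sv h with view j
  ... | ‵fromℕ = S-fixed⇒ y (Fin.fromℕ m) (λ u → begin
          S y top w u ≡⟨ sym (g⁻¹-g y (S y top w) u) ⟩
          g⁻¹ y (g y (S y top w)) u ≡⟨ congᵛ g⁻¹-linear y (λ u → sym (g⁻¹-g y (g y (S y top w)) u)) u ⟩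
          g⁻¹ y (g⁻¹ y (g y (g y (S y top w)))) u
            ≡⟨ congᵛ g⁻¹-linear y (congᵛ g⁻¹-linear y (λ u → sym (S₀-g² iy (supp g⁻¹-linear iy sv) u))) u ⟩
          g⁻¹ y (g⁻¹ y (S y zero (g y (g y w)))) u
            ≡⟨ congᵛ g⁻¹-linear y (congᵛ g⁻¹-linear y (S-congᵛ y zero (congᵛ g-linear y (g-g⁻¹ y v)))) u ⟩
          g⁻¹ y (g⁻¹ y (S y zero (g y v))) u ≡⟨ congᵛ g⁻¹-linear y (congᵛ g⁻¹-linear y (S-fixed⇐ y zero h)) u ⟩
          g⁻¹ y (g⁻¹ y (g y v)) u ≡⟨ congᵛ g⁻¹-linear y (g⁻¹-g y v) u ⟩
          w u ∎)
        where
          open ≡-Reasoning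
          w = g⁻¹ y v
          top = Fin.fromℕ m
  ... | ‵inject₁ i with view i
  ...   | ‵fromℕ      = transfer (Fin.fromℕ m) (g⁻¹-g y v) h
  ...   | ‵inject₁ i′ = S-fixed⇒ y (Fin.inject₁ i′) (λ u → begin
          S y (Fin.inject₁ i′) v u ≡⟨ sym (g⁻¹-g y (S y (Fin.inject₁ i′) v) u) ⟩
          g⁻¹ y (g y (S y (Fin.inject₁ i′) v)) u ≡⟨ congᵛ g⁻¹-linear y (g-S iy i′ sv) u ⟩
          g⁻¹ y (S y (suc i′) (g y v)) u ≡⟨ congᵛ g⁻¹-linear y (S-fixed⇐ y (suc i′) h) u ⟩
          g⁻¹ y (g y v) u ≡⟨ g⁻¹-g y v u ⟩
          v u ∎)
        where open ≡-Reasoning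

  U-cong : ∀ {m y} j {v w : Fun (suc (suc m))} → v ≗ w → U y j v → U y j w
  U-cong {m} {y} j vw h with view j
  ... | ‵fromℕ     = transfer (Fin.fromℕ m) (congᵛ g⁻¹-linear y vw) h
  ... | ‵inject₁ i = transfer i vw h

  U-+ : ∀ {m y} j {v w : Fun (suc (suc m))} → U y j v → U y j w → U y j (λ u → v u + w u)
  U-+ {m} {y} j {v} {w} hv hw with view j
  ... | ‵fromℕ     = transfer (Fin.fromℕ m) (λ u → sym (plus g⁻¹-linear y v w u))
                       (λ u → cong₂ _+_ (hv u) (hw u))
  ... | ‵inject₁ i = λ u → cong₂ _+_ (hv u) (hw u)

  U-* : ∀ {m y} j k {v : Fun (suc (suc m))} → U y j v → U y j (λ u → k * v u)
  U-* {m} {y} j k {v} hv with view j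
  ... | ‵fromℕ     = transfer (Fin.fromℕ m) (λ u → sym (scale g⁻¹-linear y k v u)) (λ u → cong (k *_) (hv u))
  ... | ‵inject₁ i = λ u → cong (k *_) (hv u)

  U-zero : ∀ {m} y j → U {m} y j (λ _ → 0ℚ)
  U-zero {m} y j with view j
  ... | ‵fromℕ     = λ u → trans (vanish g⁻¹-linear y (λ _ → refl) (swp (Fin.fromℕ m) u)) (sym (vanish g⁻¹-linear y (λ _ → refl) u))
  ... | ‵inject₁ i = λ u → refl

  -- Classes of words and their largest elements.

  _≈_ : State → State → Set
  y ≈ y′ = ∀ (i : Fin ℓ) → y (toℕ i) ≡ y′ (toℕ i)

  Bd : Fin ℓ → Fin ℓ → Set
  Bd a b = (toℕ a ℕ.< toℕ b) ⊎ (κ a ≢ κ b)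

  bd? : ∀ a b → Dec (Bd a b)
  bd? a b = (suc (toℕ a) ℕP.≤? toℕ b) ⊎-dec ¬? (κ a ≟B κ b)

  ¬bd-≤ : ∀ {a b} → ¬ Bd a b → toℕ b ℕ.≤ toℕ a
  ¬bd-≤ ¬bd = ℕP.≮⇒≥ (¬bd ∘ inj₁)

  ¬bd-κ : ∀ {a b} → ¬ Bd a b → κ a ≡ κ b
  ¬bd-κ {a} {b} ¬bd with κ a ≟B κ b
  ... | yes eq = eq
  ... | no neq = ⊥-elim (¬bd (inj₂ neq))

  -- u has the colours of T, and the same letters as T in each maximal boundary-free factor of T;
  -- b is the letter of T before the current position.
  Cls′ : ∀ {m} → State → State → Fin ℓ → Word m → Word m → Set
  Cls′ yT yu b []      []      = yT ≈ yu
  Cls′ yT yu b (a ∷ T) (c ∷ u) = κ a ≡ κ c × (Bd b a → yT ≈ yu) × Cls′ (bump yT a) (bump yu c) a T u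

  Cls : ∀ {m} → State → Word (suc m) → Word (suc m) → Set
  Cls y (a ∷ T) (c ∷ u) = κ a ≡ κ c × Cls′ (bump y a) (bump y c) a T u

  ≈? : ∀ y y′ → Dec (y ≈ y′)
  ≈? y y′ = allF? (λ i → y (toℕ i) ℕP.≟ y′ (toℕ i))

  cls′? : ∀ {m} yT yu b (T u : Word m) → Dec (Cls′ yT yu b T u)
  cls′? yT yu b []      []      = ≈? yT yu
  cls′? yT yu b (a ∷ T) (c ∷ u) =
    (κ a ≟B κ c) ×-dec ((bd? b a →-dec ≈? yT yu) ×-dec cls′? (bump yT a) (bump yu c) a T u)

  cls? : ∀ {m} y (T u : Word (suc m)) → Dec (Cls y T u)
  cls? y (a ∷ T) (c ∷ u) = (κ a ≟B κ c) ×-dec cls′? (bump y a) (bump y c) a T u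

  cls′-cong : ∀ {m} yT {yu yu′} b (T u : Word m) → yu ≗ yu′ → Cls′ yT yu b T u → Cls′ yT yu′ b T u
  cls′-cong yT b []      []      eq h i         = trans (h i) (eq (toℕ i))
  cls′-cong yT b (a ∷ T) (c ∷ u) eq (k , h , t) = k , (λ bd i → trans (h bd i) (eq (toℕ i)))
    , cls′-cong (bump yT a) a T u (bump-cong c eq) t

  cls′-refl : ∀ {m} y b (T : Word m) → Cls′ y y b T T
  cls′-refl y b []      i = refl
  cls′-refl y b (a ∷ T)   = refl , (λ _ _ → refl) , cls′-refl (bump y a) a T

  cls-refl : ∀ {m} y (T : Word (suc m)) → Cls y T T
  cls-refl y (a ∷ T) = refl , cls′-refl (bump y a) a T

  NonBd : ∀ {m} → Fin m → Word (suc m) → Set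
  NonBd zero    (a ∷ b ∷ T) = ¬ Bd a b
  NonBd (suc i) (a ∷ T)     = NonBd i T

  private
    swap-head : ∀ {m} yT yu a b c d (T u : Word m) → ¬ Bd a b → κ a ≡ κ c →
      Cls′ (bump yT a) (bump yu c) a (b ∷ T) (d ∷ u) → κ a ≡ κ d × Cls′ (bump yT a) (bump yu d) a (b ∷ T) (c ∷ u)
    swap-head yT yu a b c d T u ¬bd ac (bd , h , t) = trans (¬bd-κ ¬bd) bd , trans (sym (¬bd-κ ¬bd)) ac
      , (λ isbd → ⊥-elim (¬bd isbd)) , cls′-cong _ b T u (bump-comm yu c d) t

  cls′-swp : ∀ {m} yT yu b (i : Fin m) (T u : Word (suc m)) → NonBd i T → Cls′ yT yu b T u → Cls′ yT yu b T (swp i u)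
  cls′-swp yT yu b zero    (a ∷ a′ ∷ T) (c ∷ d ∷ u) nb (k , h , t) =
    let k′ , t′ = swap-head yT yu a a′ c d T u nb k t in k′ , h , t′
  cls′-swp yT yu b (suc i) (a ∷ T)      (c ∷ u)     nb (k , h , t) = k , h , cls′-swp _ _ a i T u nb t

  cls-swp : ∀ {m} y (i : Fin m) (T u : Word (suc m)) → NonBd i T → Cls y T u → Cls y T (swp i u)
  cls-swp y zero    (a ∷ b ∷ T) (c ∷ d ∷ u) nb (k , t) = swap-head y y a b c d T u nb k t
  cls-swp y (suc i) (a ∷ T)     (c ∷ u)     nb (k , t) = k , cls′-swp _ _ a i T u nb t

  private
    -- s is the state at the beginning of the current factor; within a factor T adds a horizontal strip to s.
    valid-cls′ : ∀ {m} (s yT yu : State) b (T u : Word m) → Ok yT →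
      (∀ (i : Fin ℓ) → yT (suc (toℕ i)) ℕ.≤ s (toℕ i)) → (∀ i → i ℕ.< toℕ b → yT i ≡ s i) →
      (∀ (i : Fin ℓ) → s (toℕ i) ℕ.≤ yu (toℕ i)) → yT ℓ ≡ yu ℓ → Valid yT T → Cls′ yT yu b T u →
      Valid yu u × (∀ (i : Fin ℓ) → yu (suc (toℕ i)) ℕ.≤ s (toℕ i))
    restart : ∀ {m} (yT yu : State) a c (T u : Word m) → Ok yT → yT ≈ yu → yT ℓ ≡ yu ℓ → Valid yT (a ∷ T) →
      Cls′ (bump yT a) (bump yu c) a T u → Valid yu (c ∷ u)

    -- `≈` compares only the rows of the shape, while `Ok` also involves row ℓ below them; no letter
    -- changes that row, and `eqℓ` carries its value along.
    ext : ∀ {y y′} → y ≈ y′ → y ℓ ≡ y′ ℓ → ∀ i → i ℕ.≤ ℓ → y i ≡ y′ i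
    ext {y} {y′} eq eqℓ i i≤ℓ with i ℕP.≟ ℓ
    ... | yes refl = eqℓ
    ... | no i≢ℓ   = subst (λ k → y k ≡ y′ k) (FinP.toℕ-fromℕ< lt) (eq (Fin.fromℕ< lt))
      where lt = ℕP.≤∧≢⇒< i≤ℓ i≢ℓ

    bump-ℓ : ∀ y a → bump y a ℓ ≡ y ℓ
    bump-ℓ y a = cong (ℕ._+ y ℓ) (δ-diff a (λ eq → ℕP.<-irrefl eq (toℕ<n a)))

    below : ∀ y a i → i ℕ.< toℕ a → bump y a i ≡ y i
    below y a i lt = cong (ℕ._+ y i) (δ-diff a (λ eq → ℕP.<-irrefl (sym eq) lt))

    strip : ∀ s y a → (∀ (i : Fin ℓ) → y (suc (toℕ i)) ℕ.≤ s (toℕ i)) → (∀ i → i ℕ.< toℕ a → y i ≡ s i) → Ok (bump y a) →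
      ∀ (i : Fin ℓ) → bump y a (suc (toℕ i)) ℕ.≤ s (toℕ i)
    strip s y a f₁ f₂ ok i with toℕ a ℕP.≟ suc (toℕ i) | ok i
    ... | no _   | _  = f₁ i
    ... | yes eq | le = ℕP.≤-trans le (ℕP.≤-reflexive (trans (below y a (toℕ i) lt) (f₂ (toℕ i) lt)))
      where lt = subst (toℕ i ℕ.<_) (sym eq) ℕP.≤-refl

    valid-cls′ s yT yu b [] [] okT f₁ f₂ ge eqℓ val h = (λ i → trans (sym (h i)) (val i))
      , λ i → subst (ℕ._≤ s (toℕ i)) (ext {yT} {yu} h eqℓ (suc (toℕ i)) (toℕ<n i)) (f₁ i)
    valid-cls′ s yT yu b (a ∷ T) (c ∷ u) okT f₁ f₂ ge eqℓ (ok , val) (k , h , t) with bd? b a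
    ... | yes bd = restart yT yu a c T u okT (h bd) eqℓ (ok , val) t
      , λ i → subst (ℕ._≤ s (toℕ i)) (ext {yT} {yu} (h bd) eqℓ (suc (toℕ i)) (toℕ<n i)) (f₁ i)
    ... | no ¬bd = (oku , proj₁ rec) , λ i → ℕP.≤-trans (ℕP.m≤n+m _ (δ c (suc (toℕ i)))) (proj₂ rec i)
      where
        a≤b = ¬bd-≤ ¬bd
        rec : Valid (bump yu c) u × (∀ (i : Fin ℓ) → bump yu c (suc (toℕ i)) ℕ.≤ s (toℕ i))
        rec = valid-cls′ s (bump yT a) (bump yu c) a T u ok
          (strip s yT a f₁ (λ i lt → f₂ i (ℕP.<-≤-trans lt a≤b)) ok)
          (λ i lt → trans (below yT a i lt) (f₂ i (ℕP.<-≤-trans lt a≤b)))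
          (λ i → ℕP.≤-trans (ge i) (ℕP.m≤n+m _ (δ c (toℕ i))))
          (trans (bump-ℓ yT a) (trans eqℓ (sym (bump-ℓ yu c)))) val t
        -- The shape built by `u` contains `s`, and each of its rows is at most as long as the row
        -- of `s` above. Comparing through `s` shows that it is a partition.
        oku : Ok (bump yu c)
        oku i = ℕP.≤-trans (proj₂ rec i) (ℕP.≤-trans (ge i) (ℕP.m≤n+m _ (δ c (toℕ i))))

    restart yT yu a c T u okT eq eqℓ (ok , val) t = oku , proj₁ rec
      where
        bounded : ∀ (i : Fin ℓ) → yT (toℕ i) ℕ.≤ bump yu c (toℕ i)
        bounded i = ℕP.≤-trans (ℕP.≤-reflexive (eq i)) (ℕP.m≤n+m _ (δ c (toℕ i)))
        rec : Valid (bump yu c) u × (∀ (i : Fin ℓ) → bump yu c (suc (toℕ i)) ℕ.≤ yT (toℕ i))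
        rec = valid-cls′ yT (bump yT a) (bump yu c) a T u ok (strip yT yT a okT (λ _ _ → refl) ok)
          (below yT a) bounded (trans (bump-ℓ yT a) (trans eqℓ (sym (bump-ℓ yu c)))) val t
        oku : Ok (bump yu c)
        oku i = ℕP.≤-trans (proj₂ rec i) (bounded i)

  -- The cells of a horizontal strip may be added in any order, so validity passes from a tableau to
  -- its whole class.
  valid-cls : ∀ {m y} → Ok y → (T u : Word (suc m)) → Valid y T → Cls y T u → Valid y u
  valid-cls {y = y} oky (a ∷ T) (c ∷ u) val (k , t) = restart y y a c T u oky (λ _ → refl) refl val t

  data _<ₗ_ : ∀ {m} → Word m → Word m → Set where
    now   : ∀ {m a b} {u v : Word m} → toℕ a ℕ.< toℕ b → (a ∷ u) <ₗ (b ∷ v)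
    after : ∀ {m a} {u v : Word m} → u <ₗ v → (a ∷ u) <ₗ (a ∷ v)

  <ₗ-irrefl : ∀ {m} {u : Word m} → ¬ (u <ₗ u)
  <ₗ-irrefl (now lt)   = ℕP.<-irrefl refl lt
  <ₗ-irrefl (after lt) = <ₗ-irrefl lt

  <ₗ-asym : ∀ {m} {u v : Word m} → u <ₗ v → ¬ (v <ₗ u)
  <ₗ-asym (now lt)   (now gt)   = ℕP.<-asym lt gt
  <ₗ-asym (now lt)   (after _)  = ℕP.<-irrefl refl lt
  <ₗ-asym (after _)  (now gt)   = ℕP.<-irrefl refl gt
  <ₗ-asym (after lt) (after gt) = <ₗ-asym lt gt

  Asc : ∀ {m} → Fin m → Word (suc m) → Set
  Asc zero    (a ∷ b ∷ T) = toℕ a ℕ.< toℕ b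
  Asc (suc i) (a ∷ T)     = Asc i T

  swp-<ₗ : ∀ {m} (i : Fin m) (T : Word (suc m)) → Asc i T → T <ₗ swp i T
  swp-<ₗ zero    (a ∷ b ∷ T) lt  = now lt
  swp-<ₗ (suc i) (a ∷ T)     asc = after (swp-<ₗ i T asc)

  private
    -- Up to the next boundary the letters of `T` weakly decrease, so `T` cannot make up for a
    -- larger letter that `u` has already used, yet at the boundary both shapes must agree.
    excess : ∀ {m} yT yu b (c : Fin ℓ) (T u : Word m) → toℕ b ℕ.< toℕ c → yT (toℕ c) ℕ.< yu (toℕ c) → ¬ Cls′ yT yu b T u
    excess yT yu b c []      []      b<c lt h = ℕP.<-irrefl (h c) lt
    excess yT yu b c (a ∷ T) (d ∷ u) b<c lt (k , h , t) with bd? b a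
    ... | yes bd = ℕP.<-irrefl (h bd c) lt
    ... | no ¬bd = excess (bump yT a) (bump yu d) a c T u a<c
      (ℕP.<-≤-trans (subst (ℕ._< yu (toℕ c)) (sym (bump-other yT (λ eq → ℕP.<-irrefl (cong toℕ eq) a<c))) lt) (ℕP.m≤n+m _ (δ d (toℕ c)))) t
      where a<c = ℕP.≤-<-trans (¬bd-≤ ¬bd) b<c

    first-≤ : ∀ {m} y a c (T u : Word m) → Cls′ (bump y a) (bump y c) a T u → toℕ c ℕ.≤ toℕ a
    first-≤ y a c T u t = ℕP.≮⇒≥ (λ a<c → excess (bump y a) (bump y c) a c T u a<c
      (subst₂ ℕ._<_ (sym (bump-other y (λ eq → ℕP.<-irrefl (cong toℕ eq) a<c))) (sym (bump-self y c)) ℕP.≤-refl) t)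

    cls′-≤ : ∀ {m} y b (T u : Word m) → Cls′ y y b T u → u ≡ T ⊎ u <ₗ T
    compare : ∀ {m} y a c (T u : Word m) → Cls′ (bump y a) (bump y c) a T u → (c ∷ u) ≡ (a ∷ T) ⊎ (c ∷ u) <ₗ (a ∷ T)
    cls′-≤ y b []      []      h = inj₁ refl
    cls′-≤ y b (a ∷ T) (c ∷ u) (_ , _ , t) = compare y a c T u t
    compare y a c T u t with ℕP.m≤n⇒m<n∨m≡n (first-≤ y a c T u t)
    ... | inj₁ lt = inj₂ (now lt)
    ... | inj₂ eq with toℕ-injective eq
    ...   | refl with cls′-≤ (bump y a) a T u t
    ...     | inj₁ refl = inj₁ refl
    ...     | inj₂ lt   = inj₂ (after lt)

  -- A tableau writes each factor in weakly decreasing order and is therefore the lexicographically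
  -- largest word of its class. This is the source of unitriangularity.
  cls-≤ : ∀ {m} y (T u : Word (suc m)) → Cls y T u → u ≡ T ⊎ u <ₗ T
  cls-≤ y (a ∷ T) (c ∷ u) (_ , t) = compare y a c T u t

  _≟W_ : ∀ {m} (u v : Word m) → Dec (u ≡ v)
  _≟W_ = VecP.≡-dec _≟F_

  letters↓ : ∀ k → List (Fin k)
  letters↓ zero    = []
  letters↓ (suc k) = Fin.fromℕ k ∷ List.map Fin.inject₁ (letters↓ k)

  words↓ : ∀ m → List (Word m)
  words↓ zero    = [] ∷ []
  words↓ (suc m) = List.concatMap (λ a → List.map (a ∷_) (words↓ m)) (letters↓ ℓ)

  letters↓-complete : ∀ {k} (a : Fin k) → a ∈ letters↓ k
  letters↓-complete a with view a
  ... | ‵fromℕ     = here refl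
  ... | ‵inject₁ b = there (∈P.∈-map⁺ Fin.inject₁ (letters↓-complete b))

  letters↓-sorted : ∀ k → AllPairs (λ a b → toℕ b ℕ.< toℕ a) (letters↓ k)
  letters↓-sorted zero    = []
  letters↓-sorted (suc k) = AllP.map⁺ (All.tabulate (λ {b} _ → subst₂ ℕ._<_ (sym (FinP.toℕ-inject₁ b)) (sym (FinP.toℕ-fromℕ k)) (toℕ<n b)))
    ∷ AllPairsP.map⁺ (AllPairs.map (λ {a} {b} → subst₂ ℕ._<_ (sym (FinP.toℕ-inject₁ b)) (sym (FinP.toℕ-inject₁ a))) (letters↓-sorted k))

  words↓-complete : ∀ {m} (u : Word m) → u ∈ words↓ m
  words↓-complete []      = here refl
  words↓-complete (a ∷ u) = ∈P.∈-concatMap⁺ (λ a → List.map (a ∷_) (words↓ _))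
    (Any.map (λ { refl → ∈P.∈-map⁺ (a ∷_) (words↓-complete u) }) (letters↓-complete a))

  words↓-sorted : ∀ m → AllPairs (λ u v → v <ₗ u) (words↓ m)
  words↓-sorted zero    = [] ∷ []
  words↓-sorted (suc m) = AllPairsP.concat⁺
    (AllP.map⁺ (All.tabulate (λ {a} _ → AllPairsP.map⁺ (AllPairs.map after (words↓-sorted m)))))
    (AllPairsP.map⁺ (AllPairs.map
      (λ {a} {b} lt → AllP.map⁺ (All.tabulate (λ _ → AllP.map⁺ (All.tabulate (λ _ → now lt))))) (letters↓-sorted ℓ)))

  SameCol : ∀ {m} → Fin m → Word (suc m) → Set
  SameCol zero    (a ∷ b ∷ T) = κ a ≡ κ b
  SameCol (suc i) (a ∷ T)     = SameCol i T

  nonBd : ∀ {m} (i : Fin m) (T : Word (suc m)) → SameCol i T → ¬ Asc i T → NonBd i T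
  nonBd zero    (a ∷ b ∷ T) sc ¬asc (inj₁ lt) = ¬asc lt
  nonBd zero    (a ∷ b ∷ T) sc ¬asc (inj₂ nc) = nc sc
  nonBd (suc i) (a ∷ T)     sc ¬asc           = nonBd i T sc ¬asc

  asc? : ∀ {m} (i : Fin m) (T : Word (suc m)) → Dec (Asc i T)
  asc? zero    (a ∷ b ∷ T) = suc (toℕ a) ℕP.≤? toℕ b
  asc? (suc i) (a ∷ T)     = asc? i T

  swp-swp : ∀ {m} (i : Fin m) (u : Word (suc m)) → swp i (swp i u) ≡ u
  swp-swp zero    (a ∷ b ∷ u) = refl
  swp-swp (suc i) (a ∷ u)     = cong (a ∷_) (swp-swp i u)

  colours : ∀ {m} → Word m → Vec Bool m
  colours = Vec.map κ

  cls′-colours : ∀ {m} yT yu b (T u : Word m) → Cls′ yT yu b T u → colours T ≡ colours u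
  cls′-colours yT yu b []      []      h           = refl
  cls′-colours yT yu b (a ∷ T) (c ∷ u) (k , _ , t) = cong₂ _∷_ k (cls′-colours _ _ a T u t)

  cls-colours : ∀ {m} y (T u : Word (suc m)) → Cls y T u → colours T ≡ colours u
  cls-colours y (a ∷ T) (c ∷ u) (k , t) = cong₂ _∷_ k (cls′-colours _ _ a T u t)

  sameCol-colours : ∀ {m} (i : Fin m) (T u : Word (suc m)) → colours T ≡ colours u → SameCol i T → SameCol i u
  sameCol-colours zero    (a ∷ b ∷ T) (c ∷ d ∷ u) eq sc =
    trans (sym (VecP.∷-injectiveˡ eq)) (trans sc (VecP.∷-injectiveˡ (VecP.∷-injectiveʳ eq)))
  sameCol-colours (suc i) (a ∷ T)     (c ∷ u)     eq sc = sameCol-colours i T u (VecP.∷-injectiveʳ eq) sc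

  lookup-injective : ∀ {A : Set} {R : A → A → Set} → (∀ {a} → ¬ R a a) → ∀ {xs} → AllPairs R xs → ∀ i j →
    List.lookup xs i ≡ List.lookup xs j → i ≡ j
  lookup-injective irr (_ ∷ _)  zero    zero    eq = refl
  lookup-injective {R = R} irr (r ∷ _) zero (suc j) eq = ⊥-elim (irr (subst (R _) (sym eq) (All.lookup r (∈P.∈-lookup j))))
  lookup-injective {R = R} irr (r ∷ _) (suc i) zero eq = ⊥-elim (irr (subst (R _) eq (All.lookup r (∈P.∈-lookup i))))
  lookup-injective irr (_ ∷ rs) (suc i) (suc j) eq = cong suc (lookup-injective irr rs i j eq)

  -- The adapted basis and its coefficients.

  module Basis {m : ℕ} (y : State) (oky : Ok y) where
    open LinearAlgebra (Word (suc m)) public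

    private
      W = Word (suc m)

    -- The indicator function of the class of `T`, that is, the word `T` symmetrised over its
    -- boundary-free factors.
    x : W → V
    x T u = if does (cls? y T u) then 1ℚ else 0ℚ

    x-in : ∀ {T u} → Cls y T u → x T u ≡ 1ℚ
    x-in {T} {u} c with cls? y T u
    ... | yes _ = refl
    ... | no ¬c = ⊥-elim (¬c c)

    x-out : ∀ {T u} → ¬ Cls y T u → x T u ≡ 0ℚ
    x-out {T} {u} ¬c with cls? y T u
    ... | yes c = ⊥-elim (¬c c)
    ... | no _  = refl

    x-self : ∀ T → x T T ≡ 1ℚ
    x-self T = x-in (cls-refl y T)

    x-above : ∀ {T u} → T <ₗ u → x T u ≡ 0ℚ
    x-above {T} {u} lt = x-out λ c → case (cls-≤ y T u c)
      where
        case : u ≡ T ⊎ u <ₗ T → ⊥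
        case (inj₁ refl) = <ₗ-irrefl lt
        case (inj₂ gt)   = <ₗ-asym lt gt

    x-supp : ∀ {T} → Valid y T → Supp y (x T)
    x-supp {T} val u ¬val = x-out (λ c → ¬val (valid-cls oky T u val c))

    x-swp : ∀ {T} i → NonBd i T → x T ∘ swp i ≗ x T
    x-swp {T} i nb u with cls? y T u
    ... | yes c = x-in (cls-swp y i T u nb c)
    ... | no ¬c = x-out (λ c → ¬c (subst (Cls y T) (swp-swp i u) (cls-swp y i T (swp i u) nb c)))

    reduce : V → W → V
    reduce v T u = v u - v T * x T u

    -- Coefficients in the basis `x`, found by elimination from the largest word down: `x T`
    -- vanishes above `T` and is 1 at `T`, so the leading value is the leading coefficient.
    φ : List W → V → W → ℚ
    φ []       v T′ = 0ℚ
    φ (T ∷ Ts) v T′ = if does (T′ ≟W T) then v T else φ Ts (reduce v T) T′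

    φ-cong : ∀ Ts {v w} → v ≗ w → φ Ts v ≗ φ Ts w
    φ-cong []       eq T′ = refl
    φ-cong (T ∷ Ts) eq T′ with does (T′ ≟W T)
    ... | true  = eq T
    ... | false = φ-cong Ts (λ u → cong₂ (λ s t → s - t * x T u) (eq u) (eq T)) T′

    φ-+ : ∀ Ts v w T′ → φ Ts (λ u → v u + w u) T′ ≡ φ Ts v T′ + φ Ts w T′
    φ-+ []       v w T′ = refl
    φ-+ (T ∷ Ts) v w T′ with does (T′ ≟W T)
    ... | true  = refl
    ... | false = trans (φ-cong Ts (λ u → solve 5 (λ v w a b x → (v :+ w) :- (a :+ b) :* x := (v :- a :* x) :+ (w :- b :* x)) refl
                    (v u) (w u) (v T) (w T) (x T u)) T′) (φ-+ Ts (reduce v T) (reduce w T) T′)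

    φ-* : ∀ Ts k v T′ → φ Ts (λ u → k * v u) T′ ≡ k * φ Ts v T′
    φ-* []       k v T′ = sym (ℚP.*-zeroʳ k)
    φ-* (T ∷ Ts) k v T′ with does (T′ ≟W T)
    ... | true  = refl
    ... | false = trans (φ-cong Ts (λ u → solve 4 (λ k v a x → k :* v :- k :* a :* x := k :* (v :- a :* x)) refl
                    k (v u) (v T) (x T u)) T′) (φ-* Ts k (reduce v T) T′)

    φ-null : ∀ Ts {v} → (∀ u → v u ≡ 0ℚ) → ∀ T′ → φ Ts v T′ ≡ 0ℚ
    φ-null Ts {v} z T′ = trans (φ-cong Ts {v} {λ u → 0ℚ * v u} (λ u → trans (z u) (sym (ℚP.*-zeroˡ (v u)))) T′)
      (trans (φ-* Ts 0ℚ v T′) (ℚP.*-zeroˡ (φ Ts v T′)))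

    φ-later : ∀ T Ts v {T′} → T′ ≢ T → φ (T ∷ Ts) v T′ ≡ φ Ts (reduce v T) T′
    φ-later T Ts v {T′} neq with T′ ≟W T
    ... | yes eq = ⊥-elim (neq eq)
    ... | no _   = refl

    φ-vanishing : ∀ Ts (Q : W → Set) → Subspace (λ v → ∀ T → Q T → φ Ts v T ≡ 0ℚ)
    φ-vanishing Ts Q = record
      { sub-cong = λ eq h T q → trans (sym (φ-cong Ts eq T)) (h T q)
      ; sub-zero = λ T q → φ-null Ts (λ _ → refl) T
      ; sub-+ = λ {v} {w} h h′ T q → trans (φ-+ Ts v w T) (cong₂ _+_ (h T q) (h′ T q))
      ; sub-* = λ k {v} h T q → trans (φ-* Ts k v T) (trans (cong (k *_) (h T q)) (ℚP.*-zeroʳ k)) }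

    Sorted : List W → Set
    Sorted = AllPairs (λ u v → v <ₗ u)

    -- Ts is a tail of the decreasing list of valid words, and v vanishes at the words before Ts.
    record Tail (Ts : List W) (v : V) : Set where
      field
        sorted : Sorted Ts
        valid  : All (Valid y) Ts
        above  : ∀ u → Valid y u → ¬ (u ∈ Ts) → All (_<ₗ u) Ts
        done   : ∀ u → Valid y u → ¬ (u ∈ Ts) → v u ≡ 0ℚ
        supp   : Supp y v

    open Tail

    tail : ∀ {T Ts v} → Tail (T ∷ Ts) v → Tail Ts (reduce v T)
    tail {T} {Ts} {v} t with sorted t | valid t
    ... | lt ∷ srt | val ∷ vals = record
      { sorted = srt ; valid = vals ; above = above′ ; done = done′
      ; supp = λ u ¬val → trans (cong₂ (λ s r → s - v T * r) (supp t u ¬val) (x-supp val u ¬val)) (null (v T)) }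
      where
        null : ∀ k → 0ℚ - k * 0ℚ ≡ 0ℚ
        null = solve 1 (λ k → con 0ℚ :- k :* con 0ℚ := con 0ℚ) refl
        above′ : ∀ u → Valid y u → ¬ (u ∈ Ts) → All (_<ₗ u) Ts
        above′ u valu u∉ with u ≟W T
        ... | yes refl = lt
        ... | no neq with above t u valu (λ { (here eq) → neq eq ; (there h) → u∉ h })
        ...   | _ ∷ rest = rest
        done′ : ∀ u → Valid y u → ¬ (u ∈ Ts) → reduce v T u ≡ 0ℚ
        done′ u valu u∉ with u ≟W T
        ... | yes refl = trans (cong (λ t → v T - v T * t) (x-self T)) (solve 1 (λ k → k :- k :* con 1ℚ := con 0ℚ) refl (v T))
        ... | no neq = trans (cong₂ (λ s r → s - v T * r) (done t u valu u∉′) (x-above (All.head (above t u valu u∉′)))) (null (v T))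
          where
            u∉′ : ¬ (u ∈ T ∷ Ts)
            u∉′ (here eq) = neq eq
            u∉′ (there h) = u∉ h

    reduce-split : ∀ v T u → v u ≡ v T * x T u + reduce v T u
    reduce-split v T u = solve 3 (λ v k x → v := k :* x :+ (v :- k :* x)) refl (v u) (v T) (x T u)

    φ-head : ∀ T Ts v → φ (T ∷ Ts) v T ≡ v T
    φ-head T Ts v with T ≟W T
    ... | yes _  = refl
    ... | no neq = ⊥-elim (neq refl)

    -- The adapted basis at work: membership in a span is tested on the basis vectors that occur
    -- with a nonzero coefficient.
    expand : ∀ {Q : V → Set} Ts {v} → Tail Ts v →
      (∀ T → T ∈ Ts → φ Ts v T ≡ 0ℚ ⊎ (∀ k → Q (λ u → k * x T u))) → Span Q v
    expand [] {v} t h = none all0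
      where
        all0 : ∀ u → v u ≡ 0ℚ
        all0 u with valid? y u
        ... | yes val = done t u val (λ ())
        ... | no ¬val = supp t u ¬val
    expand {Q} (T ∷ Ts) {v} t h with sorted t
    ... | lt ∷ _ = both (head (h T (here refl)))
      (expand Ts (tail t) (λ T′ T′∈ → subst (λ s → s ≡ 0ℚ ⊎ _) (φ-later T Ts v (neq T′∈)) (h T′ (there T′∈))))
      (reduce-split v T)
      where
        neq : ∀ {T′} → T′ ∈ Ts → T′ ≢ T
        neq T′∈ refl = <ₗ-irrefl (All.lookup lt T′∈)
        head : φ (T ∷ Ts) v T ≡ 0ℚ ⊎ (∀ k → Q (λ u → k * x T u)) → Span Q (λ u → v T * x T u)
        head (inj₁ z) = none (λ u → trans (cong (_* x T u) (trans (sym (φ-head T Ts v)) z)) (ℚP.*-zeroˡ (x T u)))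
        head (inj₂ q) = base (q (v T))

    -- Exchanging an ascent yields a larger word, which is invalid or already eliminated; symmetry
    -- moves its value 0 to `T`.
    asc-head : ∀ {T Ts v} → Tail (T ∷ Ts) v → ∀ i → v ∘ swp i ≗ v → Asc i T → v T ≡ 0ℚ
    asc-head {T} {Ts} {v} t i inv asc = trans (sym (inv T)) (zero-above (valid? y (swp i T)))
      where
        notin : ¬ (swp i T ∈ T ∷ Ts)
        notin (here eq) = <ₗ-irrefl (subst (T <ₗ_) eq (swp-<ₗ i T asc))
        notin (there h) with sorted t
        ... | lt ∷ _ = <ₗ-asym (swp-<ₗ i T asc) (All.lookup lt h)
        zero-above : Dec (Valid y (swp i T)) → v (swp i T) ≡ 0ℚ
        zero-above (no ¬val) = supp t (swp i T) ¬val
        zero-above (yes val) = done t (swp i T) val notin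

    -- Elimination preserves symmetry at `i`: a tableau that is really subtracted has no ascent
    -- there, by `asc-head`, and no change of colour there, so its basis vector is symmetric too.
    φ-asc : ∀ Ts {v} → Tail Ts v → ∀ i → v ∘ swp i ≗ v → (∀ u → v u ≢ 0ℚ → SameCol i u) →
      ∀ T → Asc i T → φ Ts v T ≡ 0ℚ
    φ-asc []       t i inv sc T′ asc = refl
    φ-asc (T ∷ Ts) {v} t i inv sc T′ asc with T′ ≟W T
    ... | yes refl = asc-head t i inv asc
    ... | no neq = φ-asc Ts (tail t) i inv′ sc′ T′ asc
      where
        inv′ : reduce v T ∘ swp i ≗ reduce v T
        inv′ u with v T ℚP.≟ 0ℚ
        ... | yes z = cong₂ (λ s t → s - t) (inv u) (trans (kill (x T (swp i u))) (sym (kill (x T u))))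
          where
            kill : ∀ r → v T * r ≡ 0ℚ
            kill r = trans (cong (_* r) z) (ℚP.*-zeroˡ r)
        ... | no nz = cong₂ (λ s t → s - v T * t) (inv u) (x-swp i (nonBd i T (sc T nz) (λ ascT → nz (asc-head t i inv ascT))) u)
        zap : ∀ {s t r} → s ≡ 0ℚ → t ≡ 0ℚ → s - t * r ≡ 0ℚ
        zap {r = r} refl refl = solve 1 (λ r → con 0ℚ :- con 0ℚ :* r := con 0ℚ) refl r
        sc′ : ∀ u → reduce v T u ≢ 0ℚ → SameCol i u
        sc′ u nz with v u ℚP.≟ 0ℚ | v T ℚP.≟ 0ℚ | cls? y T u
        ... | no vu | _      | _     = sc u vu
        ... | yes z | yes z′ | _     = ⊥-elim (nz (zap z z′))
        ... | yes z | no vT  | yes c = sameCol-colours i T u (cls-colours y T u c) (sc T vT)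
        ... | yes z | no vT  | no _  = ⊥-elim (nz (trans (cong (_- v T * 0ℚ) z) (solve 1 (λ r → con 0ℚ :- r :* con 0ℚ := con 0ℚ) refl (v T))))

    φ-colours : ∀ Ts {v} S → (∀ u → colours u ≢ S → v u ≡ 0ℚ) → ∀ T → colours T ≢ S → φ Ts v T ≡ 0ℚ
    φ-colours []       S h T′ neq = refl
    φ-colours (T ∷ Ts) {v} S h T′ neq with T′ ≟W T
    ... | yes refl = h T neq
    ... | no _     = φ-colours Ts S h′ T′ neq
      where
        h′ : ∀ u → colours u ≢ S → reduce v T u ≡ 0ℚ
        h′ u ne with cls? y T u
        ... | yes c = trans (cong₂ (λ s t → s - t * 1ℚ) (h u ne) (h T (λ eq → ne (trans (sym (cls-colours y T u c)) eq)))) refl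
        ... | no _  = trans (cong (_- v T * 0ℚ) (h u ne)) (solve 1 (λ r → con 0ℚ :- r :* con 0ℚ := con 0ℚ) refl (v T))

    φ-x-self : ∀ Ts {T} → Sorted Ts → T ∈ Ts → φ Ts (x T) T ≡ 1ℚ
    reduce-x : ∀ {T T₀} → T <ₗ T₀ → reduce (x T) T₀ ≗ x T
    reduce-x {T} {T₀} lt u = trans (cong (λ t → x T u - t * x T₀ u) (x-above lt))
      (solve 2 (λ a b → a :- con 0ℚ :* b := a) refl (x T u) (x T₀ u))
    φ-x-self (T ∷ Ts) (lt ∷ srt) (here refl) = trans (φ-head T Ts (x T)) (x-self T)
    φ-x-self (T₀ ∷ Ts) {T} (lt ∷ srt) (there h) = trans (φ-later T₀ Ts (x T) neq)
      (trans (φ-cong Ts (reduce-x T<) T) (φ-x-self Ts srt h))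
      where
        T< = All.lookup lt h
        neq : T ≢ T₀
        neq refl = <ₗ-irrefl T<

    φ-x-other : ∀ Ts {T T′} → Sorted Ts → T ∈ Ts → T′ ≢ T → φ Ts (x T) T′ ≡ 0ℚ
    φ-x-other (T ∷ Ts) {T′ = T′} (lt ∷ srt) (here refl) neq = trans (φ-later T Ts (x T) neq)
      (φ-null Ts (λ u → trans (cong (λ t → x T u - t * x T u) (x-self T)) (solve 1 (λ a → a :- con 1ℚ :* a := con 0ℚ) refl (x T u))) T′)
    φ-x-other (T₀ ∷ Ts) {T} {T′} (lt ∷ srt) (there h) neq with T′ ≟W T₀
    ... | yes refl = x-above (All.lookup lt h)
    ... | no _     = trans (φ-cong Ts (reduce-x (All.lookup lt h)) T′) (φ-x-other Ts srt h neq)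

    tableaux : List W
    tableaux = List.filter (valid? y) (words↓ (suc m))

    tableaux-valid : ∀ {T} → T ∈ tableaux → Valid y T
    tableaux-valid = proj₂ ∘ ∈P.∈-filter⁻ (valid? y) {xs = words↓ (suc m)}

    valid-tableaux : ∀ {T} → Valid y T → T ∈ tableaux
    valid-tableaux {T} = ∈P.∈-filter⁺ (valid? y) (words↓-complete T)

    tableaux-sorted : Sorted tableaux
    tableaux-sorted = AllPairsP.filter⁺ (valid? y) (words↓-sorted (suc m))

    start : ∀ {v} → Supp y v → Tail tableaux v
    start sv = record
      { sorted = tableaux-sorted ; valid = All.tabulate tableaux-valid
      ; above = λ u val u∉ → ⊥-elim (u∉ (valid-tableaux val)) ; done = λ u val u∉ → ⊥-elim (u∉ (valid-tableaux val)) ; supp = sv }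

    φ-comb : ∀ {d} Ts (a : Fin d → ℚ) z T → φ Ts (comb a z) T ≡ ∑ (λ j → a j * φ Ts (z j) T)
    φ-comb {zero}  Ts a z T = φ-null Ts (λ _ → refl) T
    φ-comb {suc d} Ts a z T = trans (φ-+ Ts (λ u → a zero * z zero u) (comb (a ∘ suc) (z ∘ suc)) T)
      (cong₂ _+_ (φ-* Ts (a zero) (z zero) T) (φ-comb Ts (a ∘ suc) (z ∘ suc) T))

    module Selection (sel : List W) (srt : Sorted sel) (sel⊆ : ∀ {T} → T ∈ sel → T ∈ tableaux) where
      T_ : Fin (List.length sel) → W
      T_ = List.lookup sel

      T∈ : ∀ j → T_ j ∈ tableaux
      T∈ j = sel⊆ (∈P.∈-lookup j)

      coeff : ∀ a j → φ tableaux (comb a (x ∘ T_)) (T_ j) ≡ a j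
      coeff a j = trans (φ-comb tableaux a (x ∘ T_) (T_ j)) (trans
        (∑-only (λ i → a i * φ tableaux (x (T_ i)) (T_ j)) j
          (λ i ne → trans (cong (a i *_) (φ-x-other tableaux tableaux-sorted (T∈ i)
            (λ eq → ne (sym (lookup-injective <ₗ-irrefl srt j i eq))))) (ℚP.*-zeroʳ (a i))))
        (trans (cong (a j *_) (φ-x-self tableaux tableaux-sorted (T∈ j))) (ℚP.*-identityʳ (a j))))

      rest : V → V
      rest v u = v u - comb (λ j → φ tableaux v (T_ j)) (x ∘ T_) u

      rest-null : ∀ v {T} → T ∈ sel → φ tableaux (rest v) T ≡ 0ℚ
      rest-null v {T} mem = trans (φ-cong tableaux (λ u → cong (v u +_) (solve 1 (λ x → :- x := con (- 1ℚ) :* x) refl (c u))) T)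
        (trans (φ-+ tableaux v (λ u → (- 1ℚ) * c u) T) (trans (cong (φ tableaux v T +_) (φ-* tableaux (- 1ℚ) c T))
        (trans (cong (λ t → φ tableaux v T + (- 1ℚ) * t)
          (trans (cong (φ tableaux c) T≡) (trans (coeff (λ j → φ tableaux v (T_ j)) j) (cong (φ tableaux v) (sym T≡)))))
          (solve 1 (λ x → x :+ con (- 1ℚ) :* x := con 0ℚ) refl (φ tableaux v T)))))
        where
          c = comb (λ j → φ tableaux v (T_ j)) (x ∘ T_)
          j = Any.index mem
          T≡ : T ≡ T_ j
          T≡ = AnyP.lookup-index mem

-- Shapes with a 2 × 2 square: distributivity and exactness.

module Square (ℓ : ℕ) (lo hi : ℕ → ℕ) (oklo : ∀ (i : Fin ℓ) → lo (suc (toℕ i)) ℕ.≤ lo (toℕ i)) (m : ℕ) where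
  open Seminormal ℓ (λ _ → false) lo hi (λ _ _ _ ne → ⊥-elim (ne refl))
  open Basis {suc m} lo oklo

  M n : ℕ
  M = suc m
  n = suc M

  top : Fin n
  top = Fin.fromℕ M

  inv₀ : Inv lo
  inv₀ = oklo , λ _ → ℕP.≤-refl

  𝕌 : Fin n → V → Set
  𝕌 = U lo

  𝕌-sub : ∀ j → Subspace (𝕌 j)
  𝕌-sub j = record { sub-cong = U-cong {y = lo} j ; sub-zero = U-zero lo j ; sub-+ = U-+ {y = lo} j ; sub-* = λ k → U-* {y = lo} j k }

  Set′ : Set
  Set′ = Fin n → Bool

  In : Set′ → V → Set
  In J v = Supp lo v × (∀ i → J i ≡ false → 𝕌 i v)

  In-sub : ∀ J → Subspace (In J)
  In-sub J = record
    { sub-cong = λ eq (s , h) → (λ u ¬val → trans (sym (eq u)) (s u ¬val)) , λ i f → sub-cong (𝕌-sub i) eq (h i f)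
    ; sub-zero = (λ _ _ → refl) , λ i f → sub-zero (𝕌-sub i)
    ; sub-+ = λ (s , h) (s′ , h′) → (λ u ¬val → cong₂ _+_ (s u ¬val) (s′ u ¬val)) , λ i f → sub-+ (𝕌-sub i) (h i f) (h′ i f)
    ; sub-* = λ k (s , h) → (λ u ¬val → trans (cong (k *_) (s u ¬val)) (ℚP.*-zeroʳ k)) , λ i f → sub-* (𝕌-sub i) k (h i f) }

  -- Qu J Y is the union of the V^J ∩ U_y with y ∈ Y, and Qu₂ J b Y of the V^J ∩ U_b ∩ U_y.
  Qu : Set′ → Set′ → V → Set
  Qu J Y v = ∃ λ y → Y y ≡ true × In J v × 𝕌 y v

  Qu₂ : Set′ → Fin n → Set′ → V → Set
  Qu₂ J b Y v = ∃ λ y → Y y ≡ true × In J v × 𝕌 b v × 𝕌 y v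

  SQu-sub : ∀ J Y → Subspace (Span (Qu J Y))
  SQu-sub J Y = span-subspace
    (λ eq (y , t , h , h′) → y , t , sub-cong (In-sub J) eq h , sub-cong (𝕌-sub y) eq h′)
    (λ k (y , t , h , h′) → y , t , sub-* (In-sub J) k h , sub-* (𝕌-sub y) k h′)

  SQu₂-sub : ∀ J b Y → Subspace (Span (Qu₂ J b Y))
  SQu₂-sub J b Y = span-subspace
    (λ eq (y , t , h , hb , h′) → y , t , sub-cong (In-sub J) eq h , sub-cong (𝕌-sub b) eq hb , sub-cong (𝕌-sub y) eq h′)
    (λ k (y , t , h , hb , h′) → y , t , sub-* (In-sub J) k h , sub-* (𝕌-sub b) k hb , sub-* (𝕌-sub y) k h′)

  Φ : V → Word n → ℚ
  Φ = φ tableaux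

  trivial-colours : ∀ {k} (i : Fin k) (u : Word (suc k)) → SameCol i u
  trivial-colours zero    (a ∷ b ∷ u) = refl
  trivial-colours (suc i) (a ∷ u)     = trivial-colours i u

  AscP : Fin n → Word n → Set
  AscP j T with view j
  ... | ‵fromℕ     = ⊥
  ... | ‵inject₁ i = Asc i T

  ascP? : ∀ j T → Dec (AscP j T)
  ascP? j T with view j
  ... | ‵fromℕ     = no (λ ())
  ... | ‵inject₁ i = asc? i T

  Φ-asc : ∀ {v} → Supp lo v → ∀ j → 𝕌 j v → ∀ T → AscP j T → Φ v T ≡ 0ℚ
  Φ-asc sv j h T asc with view j
  ... | ‵inject₁ i = φ-asc tableaux (start sv) i h (λ u _ → trivial-colours i u) T asc

  x-𝕌 : ∀ {T} j → j ≢ top → ¬ AscP j T → ∀ k → 𝕌 j (λ u → k * x T u)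
  x-𝕌 {T} j j≢ ¬asc k with view j
  ... | ‵fromℕ     = ⊥-elim (j≢ refl)
  ... | ‵inject₁ i = λ u → cong (k *_) (x-swp i (nonBd i T (trivial-colours i T) ¬asc) u)

  x-In : ∀ {T} J → J top ≡ true → T ∈ tableaux → (∀ j → J j ≡ false → ¬ AscP j T) → ∀ k → In J (λ u → k * x T u)
  x-In {T} J J∋ T∈ h k = (λ u ¬val → trans (cong (k *_) (x-supp (tableaux-valid T∈) u ¬val)) (ℚP.*-zeroʳ k))
    , λ j f → x-𝕌 j (λ { refl → true≢false (trans (sym J∋) f) }) (h j f) k
    where
      true≢false : true ≢ false
      true≢false ()

  -- Distributivity of U_b over a sum of spaces U_y inside V^L. The family is required to leave out
  -- the position `l`, so that rotation can move it to the linear positions, which have an adapted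
  -- basis.
  Dist : Fin n → Set
  Dist l = ∀ L b Y → L l ≡ true → b ≢ l → Y l ≡ false → ∀ {v} → In L v → 𝕌 b v → Span (Qu L Y) v → Span (Qu₂ L b Y) v

  -- A tableau occurring in `v` has no ascent at b or outside L. It also lacks an ascent at some y
  -- of Y, since otherwise its coefficient would vanish on the whole sum. Hence its basis vector
  -- lies in V^L ∩ U_b ∩ U_y.
  dist-top : Dist top
  dist-top L b Y L∋ b≢ Y∌ {v} inL ub sp = expand tableaux (start (proj₁ inL)) good
    where
      good : ∀ T → T ∈ tableaux → Φ v T ≡ 0ℚ ⊎ (∀ k → Qu₂ L b Y (λ u → k * x T u))
      good T T∈ with Φ v T ℚP.≟ 0ℚ
      ... | yes z = inj₁ z
      ... | no nz with any? (λ y → (Y y ≟B true) ×-dec ¬? (ascP? y T))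
      ...   | yes (y , Yy , ¬asc) = inj₂ λ k → y , Yy
              , x-In L L∋ T∈ (λ j f asc → nz (Φ-asc (proj₁ inL) j (proj₂ inL j f) T asc)) k
              , x-𝕌 b b≢ (λ asc → nz (Φ-asc (proj₁ inL) b ub T asc)) k
              , x-𝕌 y (λ { refl → true≢false (trans (sym Yy) Y∌) }) ¬asc k
        where
          true≢false : true ≢ false
          true≢false ()
      ...   | no none′ = ⊥-elim (nz (span-elim (φ-vanishing tableaux (λ T → ∀ y → Y y ≡ true → AscP y T))
              (λ (y , Yy , h , h′) T′ asc → Φ-asc (proj₁ h) y h′ T′ (asc y Yy)) sp T all-asc))
        where
          all-asc : ∀ y → Y y ≡ true → AscP y T
          all-asc y Yy with ascP? y T
          ... | yes asc = asc
          ... | no ¬asc = ⊥-elim (none′ (y , Yy , ¬asc))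

  rotate : Set′ → Set′
  rotate J = J ∘ prevF

  g-In : ∀ {J v} → In J v → In (rotate J) (g lo v)
  g-In {J} {v} (s , h) = supp g-linear inv₀ s , λ i f →
    subst (λ i → 𝕌 i (g lo v)) (next-prev i) (U-next inv₀ (prevF i) s (h (prevF i) f))

  g-𝕌 : ∀ {j v} → Supp lo v → 𝕌 j v → 𝕌 (nextF j) (g lo v)
  g-𝕌 {j} s h = U-next inv₀ j s h

  g⁻¹-𝕌 : ∀ {j v} → Supp lo v → 𝕌 (nextF j) v → 𝕌 j (g⁻¹ lo v)
  g⁻¹-𝕌 {j} {v} s h = U-prev inv₀ j (supp g⁻¹-linear inv₀ s)
    (sub-cong (𝕌-sub (nextF j)) (λ u → sym (g-g⁻¹ lo v u)) h)

  g⁻¹-In : ∀ {J v} → In (rotate J) v → In J (g⁻¹ lo v)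
  g⁻¹-In {J} {v} (s , h) = supp g⁻¹-linear inv₀ s , λ i f →
    g⁻¹-𝕌 s (h (nextF i) (trans (cong J (prev-next i)) f))

  span-map : ∀ {Q Q′ : V → Set} {H : State → V → V} → Linear H → (∀ {v} → Q v → Q′ (H lo v)) → ∀ {v} → Span Q v → Span Q′ (H lo v)
  span-map lin f (base q)     = base (f q)
  span-map lin f (none z)     = none (vanish lin lo z)
  span-map {H = H} lin f (both {v} {w} {x} s t h) = both (span-map lin f s) (span-map lin f t)
    (λ u → trans (congᵛ lin lo h u) (plus lin lo v w u))

  dist-prev : ∀ l → Dist (nextF l) → Dist l
  dist-prev l dist L b Y L∋ b≢ Y∌ {v} inL ub sp = sub-cong (SQu₂-sub L b Y) (g⁻¹-g lo v)
    (span-map g⁻¹-linear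
      (λ (y , Yy , h , hb , h′) → prevF y , Yy , g⁻¹-In h , g⁻¹-𝕌 (proj₁ h) hb
        , g⁻¹-𝕌 (proj₁ h) (subst (λ i → 𝕌 i _) (sym (next-prev y)) h′))
      (dist (rotate L) (nextF b) (rotate Y) (trans (cong L (prev-next l)) L∋)
        (λ eq → b≢ (trans (sym (prev-next b)) (trans (cong prevF eq) (prev-next l)))) (trans (cong Y (prev-next l)) Y∌)
        (g-In inL) (g-𝕌 (proj₁ inL) ub)
        (span-map g-linear (λ (y , Yy , h , h′) → nextF y , trans (cong Y (prev-next y)) Yy , g-In h , g-𝕌 (proj₁ h) h′) sp)))

  dist : ∀ l → Dist l
  dist = to-top Dist dist-prev dist-top

  infixl 6 _⊖_ _⊕_
  _⊖_ _⊕_ : Set′ → Fin n → Set′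
  (J ⊖ j) i = if does (i ≟F j) then false else J i
  (J ⊕ j) i = if does (i ≟F j) then true  else J i

  ⊖-self : ∀ J j → (J ⊖ j) j ≡ false
  ⊖-self J j with j ≟F j
  ... | yes _ = refl
  ... | no ne = ⊥-elim (ne refl)

  ⊖-other : ∀ J {j i} → i ≢ j → (J ⊖ j) i ≡ J i
  ⊖-other J {j} {i} ne with i ≟F j
  ... | yes eq = ⊥-elim (ne eq)
  ... | no _   = refl

  ⊕-self : ∀ J j → (J ⊕ j) j ≡ true
  ⊕-self J j with j ≟F j
  ... | yes _ = refl
  ... | no ne = ⊥-elim (ne refl)

  ⊕-other : ∀ J {j i} → i ≢ j → (J ⊕ j) i ≡ J i
  ⊕-other J {j} {i} ne with i ≟F j
  ... | yes eq = ⊥-elim (ne eq)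
  ... | no _   = refl

  t≢f : ∀ {b : Bool} → b ≡ true → b ≢ false
  t≢f refl ()

  ⊖-∈ : ∀ J j i → (J ⊖ j) i ≡ true → J i ≡ true × i ≢ j
  ⊖-∈ J j i h with i ≟F j
  ... | no ne = h , ne

  ⊕-∉ : ∀ J j i → (J ⊕ j) i ≡ false → J i ≡ false × i ≢ j
  ⊕-∉ J j i h with i ≟F j
  ... | no ne = h , ne

  In-mono : ∀ {J J′ v} → (∀ i → J′ i ≡ false → J i ≡ false) → In J v → In J′ v
  In-mono sub (s , h) = s , λ i f → h i (sub i f)

  split : ∀ {J Y} j {v} → Span (Qu J Y) v →
    Σ V λ w → Σ V λ r → (In J w × 𝕌 j w) × Span (Qu J (Y ⊖ j)) r × (∀ u → v u ≡ w u + r u)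
  split {J} {Y} j {v} (base (y , Yy , h , h′)) with y ≟F j
  ... | yes refl = v , (λ _ → 0ℚ) , (h , h′) , none (λ _ → refl) , λ u → sym (ℚP.+-identityʳ (v u))
  ... | no ne    = (λ _ → 0ℚ) , v , (sub-zero (In-sub J) , sub-zero (𝕌-sub j)) , base (y , trans (⊖-other Y ne) Yy , h , h′)
    , λ u → sym (ℚP.+-identityˡ (v u))
  split {J} j (none z) = (λ _ → 0ℚ) , (λ _ → 0ℚ) , (sub-zero (In-sub J) , sub-zero (𝕌-sub j)) , none (λ _ → refl) , z
  split {J} j (both {v} {v′} s s′ eq) with split j s | split j s′
  ... | w , r , (h , k) , sp , e | w′ , r′ , (h′ , k′) , sp′ , e′ =
    (λ u → w u + w′ u) , (λ u → r u + r′ u) , (sub-+ (In-sub J) h h′ , sub-+ (𝕌-sub j) k k′) , both sp sp′ (λ _ → refl)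
    , λ u → trans (eq u) (trans (cong₂ _+_ (e u) (e′ u))
        (solve 4 (λ a b c d → (a :+ b) :+ (c :+ d) := (a :+ c) :+ (b :+ d)) refl (w u) (r u) (w′ u) (r′ u)))

  split₂ : ∀ {J b Y} j {v} → Span (Qu₂ J b Y) v →
    Σ V λ w → Σ V λ r → (In J w × 𝕌 b w × 𝕌 j w) × Span (Qu₂ J b (Y ⊖ j)) r × (∀ u → v u ≡ w u + r u)
  split₂ {J} {b} {Y} j {v} (base (y , Yy , h , hb , h′)) with y ≟F j
  ... | yes refl = v , (λ _ → 0ℚ) , (h , hb , h′) , none (λ _ → refl) , λ u → sym (ℚP.+-identityʳ (v u))
  ... | no ne    = (λ _ → 0ℚ) , v , (sub-zero (In-sub J) , sub-zero (𝕌-sub b) , sub-zero (𝕌-sub j))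
    , base (y , trans (⊖-other Y ne) Yy , h , hb , h′) , λ u → sym (ℚP.+-identityˡ (v u))
  split₂ {J} {b} j (none z) = (λ _ → 0ℚ) , (λ _ → 0ℚ) , (sub-zero (In-sub J) , sub-zero (𝕌-sub b) , sub-zero (𝕌-sub j)) , none (λ _ → refl) , z
  split₂ {J} {b} j (both {v} {v′} s s′ eq) with split₂ j s | split₂ j s′
  ... | w , r , (h , hb , k) , sp , e | w′ , r′ , (h′ , hb′ , k′) , sp′ , e′ =
    (λ u → w u + w′ u) , (λ u → r u + r′ u)
    , (sub-+ (In-sub J) h h′ , sub-+ (𝕌-sub b) hb hb′ , sub-+ (𝕌-sub j) k k′) , both sp sp′ (λ _ → refl)
    , λ u → trans (eq u) (trans (cong₂ _+_ (e u) (e′ u))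
        (solve 4 (λ a b c d → (a :+ b) :+ (c :+ d) := (a :+ c) :+ (b :+ d)) refl (w u) (r u) (w′ u) (r′ u)))

  -- The relation v ∈ V^K ∩ Σ_{y∈K} V^{K+j-y} ⇒ v ∈ Σ_{y∈K} V^{K-y}, written for J = K + j.
  St : Set′ → Fin n → Set
  St J j = ∀ {v} → In J v → 𝕌 j v → Span (Qu J (J ⊖ j)) v → Span (Qu₂ J j (J ⊖ j)) v

  -- Split v as vj + r with vj in U_j. The known relation applies to vj = v - r, and from its
  -- outcome the part wi in U_i ∩ U_j is taken out. The remainder v - wi lies in U_i and in the sum
  -- over J without i and j, so distributivity leaving out j treats it.
  st-swap : ∀ {J i j} → J i ≡ true → J j ≡ true → i ≢ j → St J j → St J i
  st-swap {J} {i} {j} Ji Jj i≢j st {v} inJ ui sp =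
    let vj , r , (injJ , uj) , spr , e = split j sp
        vj∈ : Span (Qu J (J ⊖ j)) vj
        vj∈ = sub-cong (SQu-sub J (J ⊖ j)) (λ u → trans (cong (_- r u) (e u))
           (solve 2 (λ a b → (a :+ b) :- b := a) refl (vj u) (r u)))
           (sub-- (SQu-sub J (J ⊖ j)) (base (i , trans (⊖-other J i≢j) Ji , inJ , ui)) (span-mono drop spr))
        wi , w , (inw , wj , wii) , spw , e′ = split₂ i (st injJ uj vj∈)
        w+r : Span (Qu J (J ⊖ i ⊖ j)) (λ u → v u - wi u)
        w+r = both (span-mono flip spw) spr (λ u → trans (cong (_- wi u) (trans (e u) (cong (_+ r u) (e′ u))))
                (solve 3 (λ a b c → ((a :+ b) :+ c) :- a := b :+ c) refl (wi u) (w u) (r u)))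
    in both (base (j , trans (⊖-other J (i≢j ∘ sym)) Jj , inw , wii , wj))
         (span-mono (λ (y , t , h) → y , proj₁ (⊖-∈ (J ⊖ i) j y t) , h)
           (dist j J i (J ⊖ i ⊖ j) Jj i≢j (⊖-self (J ⊖ i) j) (sub-- (In-sub J) inJ inw) (sub-- (𝕌-sub i) ui wii) w+r))
         (λ u → solve 2 (λ v w → v := w :+ (v :- w)) refl (v u) (wi u))
    where
      drop : ∀ {x} → Qu J (J ⊖ i ⊖ j) x → Qu J (J ⊖ j) x
      drop (y , t , h) = let t′ , y≢j = ⊖-∈ (J ⊖ i) j y t ; t″ , _ = ⊖-∈ J i y t′ in y , trans (⊖-other J y≢j) t″ , h
      flip : ∀ {x} → Qu₂ J j (J ⊖ j ⊖ i) x → Qu J (J ⊖ i ⊖ j) x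
      flip (y , t , h , _ , h′) = let t′ , y≢i = ⊖-∈ (J ⊖ j) i y t ; t″ , y≢j = ⊖-∈ J j y t′ in
        y , trans (⊖-other (J ⊖ i) y≢j) (trans (⊖-other J y≢i) t″) , h , h′

  -- Regard v inside V^(K+a+b). Distributivity leaving out `a` intersects each summand with U_b and
  -- so brings it into V^(K+a). There v is also in U_a, so the relation for `a` applies.
  st-move : ∀ {K a b} → K a ≡ false → K b ≡ false → a ≢ b → St (K ⊕ a) a → St (K ⊕ b) b
  st-move {K} {a} {b} Ka Kb a≢b st {v} inJ ub sp =
    span-mono (λ (y , t , h , ha , hy) → y , only y t , over h ha , proj₂ h b (trans (⊕-other K (a≢b ∘ sym)) Kb) , hy)
      (st inKa (proj₂ inJ a (trans (⊕-other K a≢b) Ka))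
        (span-mono (λ (y , Ky , h , hb , hy) → y
            , trans (⊖-other (K ⊕ a) (λ { refl → t≢f Ky Ka })) (trans (⊕-other K (λ { refl → t≢f Ky Ka })) Ky)
            , (proj₁ h , λ i f → back h hb i f) , hy)
          (dist a (K ⊕ a ⊕ b) b K (trans (⊕-other (K ⊕ a) a≢b) (⊕-self K a)) (a≢b ∘ sym) Ka
            (In-mono (λ i f → let f′ , i≢b = ⊕-∉ (K ⊕ a) b i f in trans (⊕-other K i≢b) (proj₁ (⊕-∉ K a i f′))) inJ) ub
            (span-mono (λ (y , t , h , h′) → y , onK b y t
              , In-mono (λ i f → let f′ , i≢b = ⊕-∉ (K ⊕ a) b i f in trans (⊕-other K i≢b) (proj₁ (⊕-∉ K a i f′))) h , h′) sp))))
    where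
      onK : ∀ c y → (K ⊕ c ⊖ c) y ≡ true → K y ≡ true
      onK c y t = let t′ , y≢c = ⊖-∈ (K ⊕ c) c y t in trans (sym (⊕-other K y≢c)) t′
      only : ∀ y → (K ⊕ a ⊖ a) y ≡ true → (K ⊕ b ⊖ b) y ≡ true
      only y t = trans (⊖-other (K ⊕ b) y≢b) (trans (⊕-other K y≢b) (onK a y t))
        where
          y≢b : y ≢ b
          y≢b refl = t≢f (onK a y t) Kb
      inKa : In (K ⊕ a) v
      inKa = proj₁ inJ , λ i f → let f′ , i≢a = ⊕-∉ K a i f in inK i f′
        where
          inK : ∀ i → K i ≡ false → 𝕌 i v
          inK i Ki with i ≟F b
          ... | yes refl = ub
          ... | no i≢b   = proj₂ inJ i (trans (⊕-other K i≢b) Ki)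
      over : ∀ {w} → In (K ⊕ a) w → 𝕌 a w → In (K ⊕ b) w
      over {w} (s , h) ha = s , λ i f → let f′ , i≢b = ⊕-∉ K b i f in go i f′
        where
          go : ∀ i → K i ≡ false → 𝕌 i w
          go i Ki with i ≟F a
          ... | yes refl = ha
          ... | no i≢a   = h i (trans (⊕-other K i≢a) Ki)
      back : ∀ {w} → In (K ⊕ a ⊕ b) w → 𝕌 b w → ∀ i → (K ⊕ a) i ≡ false → 𝕌 i w
      back (s , h) hb i f with i ≟F b
      ... | yes refl = hb
      ... | no i≢b   = h i (trans (⊕-other (K ⊕ a) i≢b) f)

  St-cong : ∀ {J J′ j} → J ≗ J′ → St J j → St J′ j
  St-cong {J} {J′} {j} eq st inJ uj sp = span-mono (λ (y , t , h , h′) → y , trans (sym (⊖-cong y)) t , to h , h′)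
    (st (from inJ) uj (span-mono (λ (y , t , h , h′) → y , trans (⊖-cong y) t , from h , h′) sp))
    where
      to : ∀ {v} → In J v → In J′ v
      to = In-mono (λ i f → trans (eq i) f)
      from : ∀ {v} → In J′ v → In J v
      from = In-mono (λ i f → trans (sym (eq i)) f)
      ⊖-cong : ∀ y → (J ⊖ j) y ≡ (J′ ⊖ j) y
      ⊖-cong y = cong (λ t → if does (y ≟F j) then false else t) (eq y)

  P : Set′ → Set
  P K = ∀ b → K b ≡ false → St (K ⊕ b) b

  P-cong : ∀ {K K′} → K ≗ K′ → P K → P K′
  P-cong {K} {K′} eq p b f = St-cong (λ i → cong (λ t → if does (i ≟F b) then true else t) (eq i)) (p b (trans (eq b) f))

  -- The old set with j and the new set with i are the same set. Inside it `st-swap` passes from j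
  -- to i, and `st-move` then reaches every other element outside the new set.
  P-move : ∀ {K i j} → K i ≡ true → K j ≡ false → P K → P (K ⊕ j ⊖ i)
  P-move {K} {i} {j} Ki Kj p b b∉ = finish (b ≟F i)
    where
      i≢j : i ≢ j
      i≢j refl = t≢f Ki Kj
      K′ = K ⊕ j ⊖ i
      same : K ⊕ j ≗ K′ ⊕ i
      same y with y ≟F i
      ... | no _     = refl
      ... | yes refl = trans (⊕-other K i≢j) Ki
      st-i : St (K′ ⊕ i) i
      st-i = St-cong same (st-swap (trans (⊕-other K i≢j) Ki) (⊕-self K j) i≢j (p j Kj))
      finish : Dec (b ≡ i) → St (K′ ⊕ b) b
      finish (yes refl) = st-i
      finish (no b≢i)   = st-move (⊖-self (K ⊕ j) i) b∉ (b≢i ∘ sym) st-i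

  lookup-swp : ∀ {k} (i : Fin k) (K : Vec Bool (suc k)) → Vec.lookup (swp i K) (Fin.inject₁ i) ≡ Vec.lookup K (suc i)
    × Vec.lookup (swp i K) (suc i) ≡ Vec.lookup K (Fin.inject₁ i)
    × (∀ y → y ≢ Fin.inject₁ i → y ≢ suc i → Vec.lookup (swp i K) y ≡ Vec.lookup K y)
  lookup-swp zero (a ∷ b ∷ K) = refl , refl , λ { zero ne _ → ⊥-elim (ne refl) ; (suc zero) _ ne → ⊥-elim (ne refl) ; (suc (suc y)) _ _ → refl }
  lookup-swp (suc i) (a ∷ K) = let p , q , r = lookup-swp i K in p , q
    , λ { zero _ _ → refl ; (suc y) ne ne′ → r y (ne ∘ cong suc) (ne′ ∘ cong suc) }

  P-swp : ∀ i (K : Vec Bool n) → P (Vec.lookup K) → P (Vec.lookup (swp i K))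
  P-swp i K p = go (Vec.lookup K (Fin.inject₁ i)) (Vec.lookup K (suc i)) refl refl
    where
      a b : Fin n
      a = Fin.inject₁ i
      b = suc i
      a≢b : a ≢ b
      a≢b eq = ℕP.<-irrefl (trans (sym (FinP.toℕ-inject₁ i)) (cong toℕ eq)) ℕP.≤-refl
      l₁ = proj₁ (lookup-swp i K)
      l₂ = proj₁ (proj₂ (lookup-swp i K))
      l₃ = proj₂ (proj₂ (lookup-swp i K))
      go : ∀ s t → Vec.lookup K a ≡ s → Vec.lookup K b ≡ t → P (Vec.lookup (swp i K))
      go false false ea eb = P-cong same p
        where
          same : Vec.lookup K ≗ Vec.lookup (swp i K)
          same y with y ≟F a | y ≟F b
          ... | yes refl | _        = trans ea (sym (trans l₁ eb))
          ... | no _     | yes refl = trans eb (sym (trans l₂ ea))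
          ... | no na    | no nb    = sym (l₃ y na nb)
      go true true ea eb = P-cong same p
        where
          same : Vec.lookup K ≗ Vec.lookup (swp i K)
          same y with y ≟F a | y ≟F b
          ... | yes refl | _        = trans ea (sym (trans l₁ eb))
          ... | no _     | yes refl = trans eb (sym (trans l₂ ea))
          ... | no na    | no nb    = sym (l₃ y na nb)
      go true false ea eb = P-cong same (P-move ea eb p)
        where
          same : Vec.lookup K ⊕ b ⊖ a ≗ Vec.lookup (swp i K)
          same y with y ≟F a | y ≟F b
          ... | yes refl | _        = sym (trans l₁ eb)
          ... | no _     | yes refl = sym (trans l₂ ea)
          ... | no na    | no nb    = sym (l₃ y na nb)
      go false true ea eb = P-cong same (P-move eb ea p)
        where
          same : Vec.lookup K ⊕ a ⊖ b ≗ Vec.lookup (swp i K)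
          same y with y ≟F b | y ≟F a
          ... | yes refl | _        = sym (trans l₂ ea)
          ... | no _     | yes refl = sym (trans l₁ eb)
          ... | no nb    | no na    = sym (l₃ y na nb)

  -- Reaching every set from a final segment, and exactness there.

  data Srt : ∀ {k} → Vec Bool k → Set where
    full : ∀ {k} {K : Vec Bool k} → (∀ i → Vec.lookup K i ≡ true) → Srt K
    cons : ∀ {k} {K : Vec Bool k} → Srt K → Srt (false ∷ K)

  srt-mono : ∀ {k} {K : Vec Bool k} → Srt K → ∀ i j → toℕ i ℕ.≤ toℕ j → Vec.lookup K i ≡ true → Vec.lookup K j ≡ true
  srt-mono (full h) i j _ _ = h j
  srt-mono (cons s) (suc i) (suc j) (s≤s le) t = srt-mono s i j le t

  insert-true : ∀ {k} (R : Vec Bool (suc k) → Set) → (∀ i K → R K → R (swp i K)) → ∀ {K} → Srt K →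
    ∃ λ Ks → Srt Ks × (R Ks → R (true ∷ K))
  insert-true R cl (full h) = _ , full (λ { zero → refl ; (suc i) → h i }) , λ r → r
  insert-true R cl (cons {K = K} s) =
    let Ks , sr , f = insert-true (λ X → R (false ∷ X)) (λ i X → cl (suc i) (false ∷ X)) s
    in false ∷ Ks , cons sr , λ r → cl zero (false ∷ true ∷ K) (f r)

  -- Insertion sort read backwards: the implications of the adjacent exchanges are composed from the
  -- sorted set to `K`.
  reach : ∀ {k} (R : Vec Bool (suc k) → Set) → (∀ i K → R K → R (swp i K)) → ∀ K → ∃ λ Ks → Srt Ks × (R Ks → R K)
  reach {zero}  R cl (true ∷ [])  = true ∷ [] , full (λ { zero → refl }) , λ r → r
  reach {zero}  R cl (false ∷ []) = false ∷ [] , cons (full (λ ())) , λ r → r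
  reach {suc k} R cl (b ∷ K) with reach (λ X → R (b ∷ X)) (λ i X → cl (suc i) (b ∷ X)) K
  reach {suc k} R cl (false ∷ K) | Ks , sr , f = false ∷ Ks , cons sr , f
  reach {suc k} R cl (true ∷ K)  | Ks , sr , f = let Ks′ , sr′ , f′ = insert-true R cl sr in Ks′ , sr′ , f ∘ f′

  ascP⇒ : ∀ i {T} → AscP (Fin.inject₁ i) T → Asc i T
  ascP⇒ i h rewrite view-inject₁ i = h

  ascP⇐ : ∀ i {T} → Asc i T → AscP (Fin.inject₁ i) T
  ascP⇐ i h rewrite view-inject₁ i = h

  ¬ascP-top : ∀ {T} → ¬ AscP top T
  ¬ascP-top h rewrite view-fromℕ M = h

  -- weakly decreasing, then strictly increasing
  Hook : Word n → Set
  Hook T = ∀ i j → toℕ i ℕ.≤ toℕ j → Asc i T → Asc j T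

  module _ (noHook : ∀ T → Valid lo T → ¬ Hook T) where

    not-asc : ∀ {v} T {J} → In J v → Φ v T ≢ 0ℚ → ∀ j → J j ≡ false → ¬ AscP j T
    not-asc T (s , h) nz j f asc = nz (Φ-asc s j (h j f) T asc)

    -- A tableau occurring in `v`, which lies in V^K, has no ascent outside K. If every linear
    -- position of K were an ascent, its descent set would be a final segment. So it has a
    -- non-ascent y in K, and its basis vector lies in the summand of y.
    P-sorted : ∀ {K} → Srt K → P (Vec.lookup K)
    P-sorted {K} sr b b∉ {v} inJ ub _ = expand tableaux (start (proj₁ inJ)) good
      where
        k = Vec.lookup K
        inK : In k v
        inK = proj₁ inJ , h
          where
            h : ∀ i → k i ≡ false → 𝕌 i v
            h i f with i ≟F b
            ... | yes refl = ub
            ... | no ne    = proj₂ inJ i (trans (⊕-other k ne) f)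
        good : ∀ T → T ∈ tableaux → Φ v T ≡ 0ℚ ⊎ (∀ c → Qu₂ (k ⊕ b) b (k ⊕ b ⊖ b) (λ u → c * x T u))
        good T T∈ with Φ v T ℚP.≟ 0ℚ
        ... | yes z = inj₁ z
        ... | no nz with any? (λ y → (k (Fin.inject₁ y) ≟B true) ×-dec ¬? (asc? y T))
        ...   | yes (y , ky , ¬asc) = inj₂ λ c → y′ , y∈
                , x-In (k ⊕ b) (trans (⊕-other k (b≢top ∘ sym)) top∈) T∈ (λ j f → not-asc T inJ nz j f) c
                , x-𝕌 b b≢top (not-asc T inK nz b b∉) c
                , x-𝕌 y′ (λ eq → ℕP.<-irrefl (trans (sym (FinP.toℕ-inject₁ y)) (trans (cong toℕ eq) (FinP.toℕ-fromℕ M))) (toℕ<n y)) (¬asc ∘ ascP⇒ y) c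
          where
            y′ = Fin.inject₁ y
            -- A final segment containing a linear position contains the last one; that frees the
            -- basis vector from any condition at the last position.
            top∈ : k top ≡ true
            top∈ = srt-mono sr y′ top (subst (toℕ y′ ℕ.≤_) (sym (FinP.toℕ-fromℕ M)) (ℕP.≤-pred (toℕ<n y′))) ky
            b≢top : b ≢ top
            b≢top refl = t≢f top∈ b∉
            y≢b : y′ ≢ b
            y≢b refl = t≢f ky b∉
            y∈ : (k ⊕ b ⊖ b) y′ ≡ true
            y∈ = trans (⊖-other (k ⊕ b) y≢b) (trans (⊕-other k y≢b) ky)
        ...   | no none′ = ⊥-elim (noHook T (tableaux-valid T∈) hook)
          where
            asc-of : ∀ j → k (Fin.inject₁ j) ≡ true → Asc j T
            asc-of j kj with asc? j T
            ... | yes asc = asc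
            ... | no ¬asc = ⊥-elim (none′ (j , kj , ¬asc))
            hook : Hook T
            hook i j le asc with k (Fin.inject₁ i) ≟B true
            ... | yes ki = asc-of j (srt-mono sr (Fin.inject₁ i) (Fin.inject₁ j) (subst₂ ℕ._≤_ (sym (FinP.toℕ-inject₁ i)) (sym (FinP.toℕ-inject₁ j)) le) ki)
            ... | no ki  = ⊥-elim (not-asc T inK nz (Fin.inject₁ i) (BoolP.¬-not ki) (ascP⇐ i asc))

    P-all : ∀ (K : Vec Bool n) → P (Vec.lookup K)
    P-all K = let Ks , sr , f = reach (P ∘ Vec.lookup) P-swp K in f (P-sorted sr)

    -- A tableau occurring here would have no descent, and the empty set is a final segment.
    In-∅ : ∀ {v} → In (λ _ → false) v → ∀ u → v u ≡ 0ℚ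
    In-∅ {v} (s , h) = span-elim {Q = λ _ → ⊥} zero-subspace (λ ()) (expand tableaux (start s)
      (λ T T∈ → good T T∈))
      where
        good : ∀ T → T ∈ tableaux → Φ v T ≡ 0ℚ ⊎ (∀ (c : ℚ) → ⊥)
        good T T∈ with Φ v T ℚP.≟ 0ℚ
        ... | yes z = inj₁ z
        ... | no nz = ⊥-elim (noHook T (tableaux-valid T∈) (λ i j le asc →
                ⊥-elim (not-asc T {λ _ → false} (s , h) nz (Fin.inject₁ i) refl (ascP⇐ i asc))))

  -- Descent numbers as dimensions.

  lookup-∷ʳ-top : ∀ {k} (D : Vec Bool k) b → Vec.lookup (D Vec.∷ʳ b) (Fin.fromℕ k) ≡ b
  lookup-∷ʳ-top []      b = refl
  lookup-∷ʳ-top (_ ∷ D) b = lookup-∷ʳ-top D b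

  lookup-∷ʳ : ∀ {k} (D : Vec Bool k) b i → Vec.lookup (D Vec.∷ʳ b) (Fin.inject₁ i) ≡ Vec.lookup D i
  lookup-∷ʳ (_ ∷ D) b zero    = refl
  lookup-∷ʳ (_ ∷ D) b (suc i) = lookup-∷ʳ D b i

  des-asc : ∀ {k} (T : Word (suc k)) i → Vec.lookup (des T) i ≡ true → Asc i T
  des-asc (a ∷ b ∷ T) zero    eq = ℕP.<ᵇ⇒< (toℕ a) (toℕ b) (subst Bool.T (sym eq) tt)
  des-asc (a ∷ b ∷ T) (suc i) eq = des-asc (b ∷ T) i eq

  asc-des : ∀ {k} (T : Word (suc k)) i → Asc i T → Vec.lookup (des T) i ≡ true
  asc-des (a ∷ b ∷ T) zero    lt  = Equivalence.to BoolP.T-≡ (ℕP.<⇒<ᵇ lt)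
  asc-des (a ∷ b ∷ T) (suc i) asc = asc-des (b ∷ T) i asc

  Wt : Set′ → V → Set
  Wt J = Span (Qu J J)

  Dim : Set′ → ℕ → Set
  Dim J = HasDim (In J) (Wt J)

  rows : Vec Bool M → List (Word n)
  rows D = List.filter (λ T → VecP.≡-dec _≟B_ (des T) D) tableaux

  module _ (D : Vec Bool M) where
    private
      J₀ J₁ : Set′
      J₀  = Vec.lookup (D Vec.∷ʳ false)
      J₁ = Vec.lookup (D Vec.∷ʳ true)
      A : V → Set
      A = Span (Qu J₁ J₀)
      d = List.length (rows D)
      open Selection (rows D) (AllPairsP.filter⁺ (λ T → VecP.≡-dec _≟B_ (des T) D) tableaux-sorted) (proj₁ ∘ ∈P.∈-filter⁻ _ {xs = tableaux})
      Tdes : ∀ j → des (T_ j) ≡ D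
      Tdes j = proj₂ (∈P.∈-filter⁻ (λ T → VecP.≡-dec _≟B_ (des T) D) {xs = tableaux} (∈P.∈-lookup {xs = rows D} j))

      J₁∋top : J₁ top ≡ true
      J₁∋top = lookup-∷ʳ-top D true

      cases : ∀ (R : Fin n → Set) → R top → (∀ i → R (Fin.inject₁ i)) → ∀ j → R j
      cases R r rs j with view j
      ... | ‵fromℕ     = r
      ... | ‵inject₁ i = rs i

      J₁∉ : ∀ {T} → des T ≡ D → ∀ j → J₁ j ≡ false → ¬ AscP j T
      J₁∉ {T} eq = cases (λ j → J₁ j ≡ false → ¬ AscP j T) (λ _ → ¬ascP-top)
        (λ i f asc → t≢f (trans (lookup-∷ʳ D true i) (trans (cong (λ D → Vec.lookup D i) (sym eq)) (asc-des T i (ascP⇒ i asc)))) f)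

      A-null : ∀ {v} → A v → ∀ T → des T ≡ D → Φ v T ≡ 0ℚ
      A-null = span-elim (φ-vanishing tableaux (λ T → des T ≡ D)) (λ {v} (y , Jy , h , h′) → null v y Jy h h′)
        where
          null : ∀ v y → J₀ y ≡ true → In J₁ v → 𝕌 y v → ∀ T → des T ≡ D → Φ v T ≡ 0ℚ
          null v = cases (λ y → J₀ y ≡ true → In J₁ v → 𝕌 y v → ∀ T → des T ≡ D → Φ v T ≡ 0ℚ)
            (λ Jy → ⊥-elim (t≢f Jy (lookup-∷ʳ-top D false)))
            (λ i Ji h h′ T eq → Φ-asc (proj₁ h) (Fin.inject₁ i) h′ T
              (ascP⇐ i (des-asc T i (trans (cong (λ D → Vec.lookup D i) eq) (trans (sym (lookup-∷ʳ D false i)) Ji)))))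

      xT-In : ∀ j → In J₁ (x (T_ j))
      xT-In j = sub-cong (In-sub J₁) (λ u → ℚP.*-identityˡ (x (T_ j) u)) (x-In J₁ J₁∋top (T∈ j) (J₁∉ (Tdes j)) 1ℚ)

      -- Tableaux occurring in V^(D ∪ {n}) have all descents in D. If one misses some y of D, its
      -- basis vector already lies in the summand of y; those with descent set exactly D remain and
      -- are independent modulo `A`.
      linear-dim : HasDim (In J₁) A d
      linear-dim = record
        { vec = x ∘ T_ ; vec∈ = xT-In
        ; indep = λ a w j → trans (sym (coeff a j)) (A-null w (T_ j) (Tdes j))
        ; spans = λ {v} inv → (λ j → Φ v (T_ j)) , rest∈ v inv }
        where
          rest∈ : ∀ v → In J₁ v → A (rest v)
          rest∈ v inv = expand tableaux (start (proj₁ inr)) good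
            where
              r = rest v
              inr : In J₁ r
              inr = sub-- (In-sub J₁) inv (comb-in (In-sub J₁) (λ j → Φ v (T_ j)) xT-In)
              good : ∀ T → T ∈ tableaux → Φ r T ≡ 0ℚ ⊎ (∀ k → Qu J₁ J₀ (λ u → k * x T u))
              good T T∈t with Φ r T ℚP.≟ 0ℚ
              ... | yes z = inj₁ z
              ... | no nz with any? (λ y → (Vec.lookup D y ≟B true) ×-dec ¬? (asc? y T))
              ...   | yes (y , Dy , ¬asc) = inj₂ λ k → Fin.inject₁ y , trans (lookup-∷ʳ D false y) Dy
                      , x-In J₁ J₁∋top T∈t (λ j f asc → nz (Φ-asc (proj₁ inr) j (proj₂ inr j f) T asc)) k
                      , x-𝕌 (Fin.inject₁ y) (λ eq → FinP.fromℕ≢inject₁ (sym eq)) (¬asc ∘ ascP⇒ y) k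
              ...   | no none′ = ⊥-elim (nz (rest-null v (∈P.∈-filter⁺ (λ T → VecP.≡-dec _≟B_ (des T) D) T∈t des≡)))
                where
                  same : ∀ i → Vec.lookup (des T) i ≡ Vec.lookup D i
                  same i with Vec.lookup D i in eqD | asc? i T
                  ... | true  | yes asc = asc-des T i asc
                  ... | true  | no ¬asc = ⊥-elim (none′ (i , eqD , ¬asc))
                  ... | false | yes asc = ⊥-elim (nz (Φ-asc (proj₁ inr) (Fin.inject₁ i) (proj₂ inr (Fin.inject₁ i) (trans (lookup-∷ʳ D true i) eqD)) T (ascP⇐ i asc)))
                  ... | false | no ¬asc = BoolP.¬-not (λ t → ¬asc (des-asc T i t))
                  des≡ : des T ≡ D
                  des≡ = vec-ext same

    -- The sequence from V^D / W_D through V^(D ∪ {n}) / A to V^(D ∪ {n}) / W_(D ∪ {n}) is short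
    -- exact. Its first map comes from V^D = V^(D ∪ {n}) ∩ U_n, and the injectivity of that map is
    -- the relation `St` at the last position.
    dim-step : P J₀ → ∀ {k} → Dim J₀ k → ∃ λ k′ → k ℕ.+ k′ ≡ d × Dim J₁ k′
    dim-step p {k} h =
      let k′ , eq , h′ = exchange (In-sub J₁) (SQu-sub J₁ J₀) linear-dim (vec h) (λ j → enlarge (vec∈ h j)) ind
      in k′ , eq , dim-cong fwd bwd h′
      where
        enlarge : ∀ {v} → In J₀ v → In J₁ v
        enlarge = In-mono (cases (λ i → J₁ i ≡ false → J₀ i ≡ false) (λ f → ⊥-elim (t≢f J₁∋top f))
          (λ i f → trans (lookup-∷ʳ D false i) (trans (sym (lookup-∷ʳ D true i)) f)))
        top-𝕌 : ∀ {v} → In J₀ v → 𝕌 top v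
        top-𝕌 (_ , h) = h top (lookup-∷ʳ-top D false)
        restrict : ∀ {v} → In J₁ v → 𝕌 top v → In J₀ v
        restrict {v} (s , h) ut = s , cases (λ i → J₀ i ≡ false → 𝕌 i v) (λ _ → ut)
          (λ i f → h (Fin.inject₁ i) (trans (lookup-∷ʳ D true i) (trans (sym (lookup-∷ʳ D false i)) f)))
        J₀⊂J₁ : ∀ i → J₀ i ≡ true → J₁ i ≡ true
        J₀⊂J₁ = cases (λ i → J₀ i ≡ true → J₁ i ≡ true) (λ _ → J₁∋top)
          (λ i t → trans (lookup-∷ʳ D true i) (trans (sym (lookup-∷ʳ D false i)) t))
        ext : J₀ ⊕ top ≗ J₁
        ext = cases (λ i → (J₀ ⊕ top) i ≡ J₁ i) (trans (⊕-self J₀ top) (sym J₁∋top))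
          (λ i → trans (⊕-other J₀ (λ eq → FinP.fromℕ≢inject₁ (sym eq))) (trans (lookup-∷ʳ D false i) (sym (lookup-∷ʳ D true i))))
        st : St J₁ top
        st = St-cong ext (p top (lookup-∷ʳ-top D false))
        minus : ∀ i → (J₁ ⊖ top) i ≡ J₀ i
        minus = cases (λ i → (J₁ ⊖ top) i ≡ J₀ i) (trans (⊖-self J₁ top) (sym (lookup-∷ʳ-top D false)))
          (λ i → trans (⊖-other J₁ (λ eq → FinP.fromℕ≢inject₁ (sym eq))) (trans (lookup-∷ʳ D true i) (sym (lookup-∷ʳ D false i))))
        comb-J : ∀ a → In J₀ (comb a (vec h))
        comb-J a = comb-in (In-sub J₀) a (vec∈ h)
        ind : Indep A (vec h)
        ind a w = indep h a (span-mono (λ (y , t , i , ut , uy) → y , trans (sym (minus y)) t , restrict i ut , uy)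
          (st (enlarge (comb-J a)) (top-𝕌 (comb-J a)) (span-mono (λ (y , t , i) → y , trans (minus y) t , i) w)))
        fwd : ∀ {v} → (A +⟨ vec h ⟩) v → Wt J₁ v
        fwd {v} (a , w) = both (span-mono (λ (y , t , i) → y , J₀⊂J₁ y t , i) w)
          (base (top , J₁∋top , enlarge (comb-J a) , top-𝕌 (comb-J a)))
          (λ u → solve 2 (λ v c → v := (v :- c) :+ c) refl (v u) (comb a (vec h) u))
        bwd : ∀ {v} → Wt J₁ v → (A +⟨ vec h ⟩) v
        bwd = span-elim (+⟨⟩-subspace (SQu-sub J₁ J₀) (vec h)) (λ {v} (y , t , i , uy) → one-by-one v y t i uy)
          where
            one-by-one : ∀ v y → J₁ y ≡ true → In J₁ v → 𝕌 y v → (A +⟨ vec h ⟩) v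
            one-by-one v = cases (λ y → J₁ y ≡ true → In J₁ v → 𝕌 y v → (A +⟨ vec h ⟩) v)
              (λ t i ut → let a , w = spans h (restrict i ut) in
                a , span-mono (λ (y , t , i , uy) → y , t , enlarge i , uy) w)
              (λ y t i uy → (λ _ → 0ℚ) , sub-cong (SQu-sub J₁ J₀)
                (λ u → trans (solve 1 (λ v → v := v :- con 0ℚ) refl (v u)) (cong (λ t → v u - t) (sym (comb-zero (vec h) (λ _ → refl) u))))
                (base (Fin.inject₁ y , trans (lookup-∷ʳ D false y) (trans (sym (lookup-∷ʳ D true y)) t) , i , uy)))

  dim-rotate : ∀ {J k} → Dim J k → Dim (rotate J) k
  dim-rotate {J} = dim-map (g lo) (g⁻¹ lo) (SQu-sub (rotate J) (rotate J))
    (λ a b v w u → trans (plus g-linear lo (λ u → a * v u) (λ u → b * w u) u) (cong₂ _+_ (scale g-linear lo a v u) (scale g-linear lo b w u)))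
    (congᵛ g-linear lo) g-In
    (span-map g-linear (λ (y , t , h , h′) → nextF y , trans (cong J (prev-next y)) t , g-In h , g-𝕌 (proj₁ h) h′))
    (λ {v} _ w → sub-cong (SQu-sub J J) (g⁻¹-g lo v) (span-map g⁻¹-linear
      (λ (y , t , h , h′) → prevF y , t , g⁻¹-In h , g⁻¹-𝕌 (proj₁ h) (subst (λ i → 𝕌 i _) (sym (next-prev y)) h′)) w))
    g⁻¹-In (g-g⁻¹ lo) (In-sub J)

  dim-unrotate : ∀ {J k} → Dim (rotate J) k → Dim J k
  dim-unrotate {J} = dim-map (g⁻¹ lo) (g lo) (SQu-sub J J)
    (λ a b v w u → trans (plus g⁻¹-linear lo (λ u → a * v u) (λ u → b * w u) u) (cong₂ _+_ (scale g⁻¹-linear lo a v u) (scale g⁻¹-linear lo b w u)))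
    (congᵛ g⁻¹-linear lo) g⁻¹-In
    (span-map g⁻¹-linear (λ (y , t , h , h′) → prevF y , t , g⁻¹-In h , g⁻¹-𝕌 (proj₁ h) (subst (λ i → 𝕌 i _) (sym (next-prev y)) h′)))
    (λ {v} _ w → sub-cong (SQu-sub (rotate J) (rotate J)) (g-g⁻¹ lo v) (span-map g-linear
      (λ (y , t , h , h′) → nextF y , trans (cong J (prev-next y)) t , g-In h , g-𝕌 (proj₁ h) h′) w))
    g-In (g⁻¹-g lo) (In-sub (rotate J))

  Dim-cong : ∀ {J J′ k} → J ≗ J′ → Dim J k → Dim J′ k
  Dim-cong {J} {J′} eq h = record
    { vec = vec h ; vec∈ = to ∘ vec∈ h
    ; indep = λ a w → indep h a (span-mono (λ (y , t , i , u) → y , trans (eq y) t , from i , u) w)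
    ; spans = λ p → let a , w = spans h (from p) in a , span-mono (λ (y , t , i , u) → y , trans (sym (eq y)) t , to i , u) w }
    where
      to : ∀ {v} → In J v → In J′ v
      to = In-mono (λ i f → trans (eq i) f)
      from : ∀ {v} → In J′ v → In J v
      from = In-mono (λ i f → trans (sym (eq i)) f)

  module _ (noHook : ∀ T → Valid lo T → ¬ Hook T) where

    -- Bases are produced by induction on the size and not by elimination: rotate an element of the
    -- set to the last position, then `dim-step` yields the basis for D ∪ {n} from that for D.
    dim-exists : ∀ k (J : Vec Bool n) → ones J ≡ k → ∃ (Dim (Vec.lookup J))
    dim-exists zero J eq = 0 , Dim-cong (λ i → sym (ones-zero J eq i)) (record
      { vec = λ () ; vec∈ = λ () ; indep = λ _ _ ()
      ; spans = λ {v} p → (λ ()) , none (λ u → trans (solve 1 (λ v → v :- con 0ℚ := v) refl (v u)) (In-∅ noHook p u)) })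
    dim-exists (suc k) J eq = let l , Jl = ones-suc J eq in to-top Q back atTop l J eq Jl
      where
        Q : Fin n → Set
        Q l = ∀ J → ones J ≡ suc k → Vec.lookup J l ≡ true → ∃ (Dim (Vec.lookup J))
        atTop : Q top
        atTop J eq Jt with Vec.initLast J
        ... | D , b , refl with trans (sym (lookup-∷ʳ-top D b)) Jt
        ...   | refl =
          let d , h = dim-exists k (D Vec.∷ʳ false)
                        (trans (ones-∷ʳ D false) (ℕP.suc-injective (trans (sym (ones-∷ʳ D true)) eq)))
              d′ , _ , h′ = dim-step D (P-all noHook (D Vec.∷ʳ false)) h
          in d′ , h′
        back : ∀ l → Q (nextF l) → Q l
        back l q J eq Jl =
          let d , h = q (rotV J) (trans (ones-rotV J) eq)
                        (trans (lookup-rotV J (nextF l)) (trans (cong (Vec.lookup J) (prev-next l)) Jl))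
          in d , dim-unrotate (Dim-cong (lookup-rotV J) h)

    c : Vec Bool n → ℕ
    c J = proj₁ (dim-exists (ones J) J refl)

    c-dim : ∀ J → Dim (Vec.lookup J) (c J)
    c-dim J = proj₂ (dim-exists (ones J) J refl)

    c-unique : ∀ J {k} → Dim (Vec.lookup J) k → c J ≡ k
    c-unique J = dim-unique (In-sub (Vec.lookup J)) (SQu-sub (Vec.lookup J) (Vec.lookup J)) (c-dim J)

    c-rotate : ∀ J → c (rotV J) ≡ c J
    c-rotate J = c-unique (rotV J) (Dim-cong (λ j → sym (lookup-rotV J j)) (dim-rotate (c-dim J)))

    c-add : ∀ D → c (D Vec.∷ʳ false) ℕ.+ c (D Vec.∷ʳ true) ≡ List.length (rows D)
    c-add D = let k′ , eq , h = dim-step D (P-all noHook (D Vec.∷ʳ false)) (c-dim (D Vec.∷ʳ false)) in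
      trans (cong (c (D Vec.∷ʳ false) ℕ.+_) (c-unique (D Vec.∷ʳ true) h)) eq

    c-empty : ∀ J → ones J ≡ 0 → c J ≡ 0
    c-empty J eq = c-unique J (Dim-cong (λ i → sym (ones-zero J eq i)) (record
      { vec = λ () ; vec∈ = λ () ; indep = λ _ _ ()
      ; spans = λ {v} p → (λ ()) , none (λ u → trans (solve 1 (λ v → v :- con 0ℚ := v) refl (v u)) (In-∅ noHook p u)) }))

-- Shapes in two colours: counting words on a circle.

data Pat : Set where
  inc dec free : Pat

satP : Pat → ℕ → ℕ → Set
satP inc a b = a ℕ.< b
satP dec a b = ¬ (a ℕ.< b)
satP free a b = ⊤

satP? : ∀ p a b → Dec (satP p a b)
satP? inc a b = suc a ℕP.≤? b
satP? dec a b = ¬? (suc a ℕP.≤? b)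
satP? free a b = yes tt

-- The rows of the shape fall into two colour classes which meet no common column.
module Disconnected (ℓ : ℕ) (κ : Fin ℓ → Bool) (lo hi : ℕ → ℕ)
  (sep : ∀ a b → toℕ b ≡ suc (toℕ a) → κ a ≢ κ b → hi (toℕ b) ℕ.≤ lo (toℕ a))
  (oklo : ∀ (i : Fin ℓ) → lo (suc (toℕ i)) ℕ.≤ lo (toℕ i)) (m : ℕ) where
  open Seminormal ℓ κ lo hi sep
  open Basis {suc m} lo oklo

  M n : ℕ
  M = suc m
  n = suc M

  top : Fin n
  top = Fin.fromℕ M

  inv₀ : Inv lo
  inv₀ = oklo , λ _ → ℕP.≤-refl

  ColSupp : ∀ {k} → Vec Bool k → Fun k → Set
  ColSupp S v = ∀ u → colours u ≢ S → v u ≡ 0ℚ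

  -- Exchanging letters of one colour leaves the colour word alone; across colours the coefficient 0
  -- exchanges the letters outright, and the colours with them.
  S-col : ∀ {k} y (i : Fin k) {C} {v : Fun (suc k)} → ColSupp C v → ColSupp (swp i C) (S y i v)
  S-col y zero {c ∷ d ∷ C} {v} h (a ∷ b ∷ u) ne = go (κ a ≟B κ b)
    where
      ne₂ : colours (b ∷ a ∷ u) ≢ c ∷ d ∷ C
      ne₂ refl = ne refl
      go : Dec (κ a ≡ κ b) → mix (ι y a b) (v (a ∷ b ∷ u)) (v (b ∷ a ∷ u)) ≡ 0ℚ
      go (yes eq) = trans (cong₂ (mix (ι y a b)) (h (a ∷ b ∷ u) ne₁) (h (b ∷ a ∷ u) ne₂)) (mix-0 (ι y a b))
        where
          ne₁ : colours (a ∷ b ∷ u) ≢ c ∷ d ∷ C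
          ne₁ refl = ne (cong₂ (λ s t → s ∷ t ∷ colours u) eq (sym eq))
      go (no κ≢) = trans (cong₂ (λ i y → mix i (v (a ∷ b ∷ u)) y) (ι-cross y κ≢) (h (b ∷ a ∷ u) ne₂)) (mix-zero (v (a ∷ b ∷ u)))
  S-col y (suc i) {c ∷ C} {v} h (a ∷ u) ne with κ a ≟B c
  ... | yes refl = S-col (bump y a) i (λ u ne′ → h (a ∷ u) (ne′ ∘ VecP.∷-injectiveʳ)) u (ne ∘ cong (κ a ∷_))
  ... | no κ≢    = S-zero (bump y a) i (λ u → h (a ∷ u) (κ≢ ∘ VecP.∷-injectiveˡ)) u

  swp-invol : ∀ {k} (i : Fin k) (C : Vec Bool (suc k)) → swp i (swp i C) ≡ C
  swp-invol zero    (a ∷ b ∷ u) = refl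
  swp-invol (suc i) (a ∷ u)     = cong (a ∷_) (swp-invol i u)

  later-col : ∀ {k} {H : State → Fun (suc k) → Fun (suc k)} (lin : Linear H) {R : Vec Bool (suc k) → Vec Bool (suc k)} →
    (∀ y {C v} → ColSupp C v → ColSupp (R C) (H y v)) → ∀ y {c C v} → ColSupp (c ∷ C) v → ColSupp (c ∷ R C) (later H y v)
  later-col lin h y {c} {C} {v} cs (a ∷ u) ne with κ a ≟B c
  ... | yes refl = h (bump y a) (λ u ne′ → cs (a ∷ u) (ne′ ∘ VecP.∷-injectiveʳ)) u (ne ∘ cong (κ a ∷_))
  ... | no κ≢    = vanish lin (bump y a) (λ u → cs (a ∷ u) (κ≢ ∘ VecP.∷-injectiveˡ)) u

  rotV-cons : ∀ {k} c (C : Vec Bool (suc k)) → rotV (c ∷ C) ≡ swp zero (c ∷ rotV C)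
  rotV-cons c C with Vec.initLast C
  ... | C′ , b , refl = refl

  g-col : ∀ {k} y {C} {v : Fun (suc k)} → ColSupp C v → ColSupp (rotV C) (g y v)
  g-col {zero}  y {c ∷ []} h = h
  g-col {suc k} y {c ∷ C} {v} h = subst (λ C → ColSupp C (g y v)) (sym (rotV-cons c C))
    (S-col y zero (later-col g-linear g-col y {c} {C} h))

  g⁻¹-col : ∀ {k} y {C} {v : Fun (suc k)} → ColSupp (rotV C) v → ColSupp C (g⁻¹ y v)
  g⁻¹-col {zero}  y {c ∷ []} h = h
  g⁻¹-col {suc k} y {c ∷ C} {v} h = inner
    where
      h′ : ColSupp (c ∷ rotV C) (S y zero v)
      h′ = subst (λ C → ColSupp C (S y zero v)) (swp-invol zero (c ∷ rotV C))
             (S-col y zero (subst (λ C → ColSupp C v) (rotV-cons c C) h))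
      inner : ColSupp (c ∷ C) (later g⁻¹ y (S y zero v))
      inner (a ∷ u) ne with κ a ≟B c
      ... | yes refl = g⁻¹-col (bump y a) (λ u ne′ → h′ (a ∷ u) (ne′ ∘ VecP.∷-injectiveʳ)) u (ne ∘ cong (κ a ∷_))
      ... | no κ≢    = vanish g⁻¹-linear (bump y a) (λ u → h′ (a ∷ u) (κ≢ ∘ VecP.∷-injectiveˡ)) u

  𝕌 : Fin n → V → Set
  𝕌 = U lo

  𝕌-sub : ∀ j → Subspace (𝕌 j)
  𝕌-sub j = record { sub-cong = U-cong {y = lo} j ; sub-zero = U-zero lo j ; sub-+ = U-+ {y = lo} j ; sub-* = λ k → U-* {y = lo} j k }

  Pats : Set
  Pats = Fin n → Pat

  -- The condition at the last position compares the last letter with the first, closing the word to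
  -- a circle.
  Sat : Pats → Word n → Set
  Sat p u = ∀ j → satP (p j) (toℕ (Vec.lookup u j)) (toℕ (Vec.lookup u (nextF j)))

  Counted : Vec Bool n → Pats → Word n → Set
  Counted C p u = Valid lo u × colours u ≡ C × Sat p u

  counted? : ∀ C p u → Dec (Counted C p u)
  counted? C p u = valid? lo u ×-dec (VecP.≡-dec _≟B_ (colours u) C
    ×-dec allF? (λ j → satP? (p j) (toℕ (Vec.lookup u j)) (toℕ (Vec.lookup u (nextF j)))))

  listed : Vec Bool n → Pats → List (Word n)
  listed C p = List.filter (counted? C p) (words↓ n)

  cnt : Vec Bool n → Pats → ℕ
  cnt C p = List.length (listed C p)

  -- functions supported on words with colours C, symmetric at the positions marked dec
  Sp : Vec Bool n → Pats → V → Set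
  Sp C p v = Supp lo v × ColSupp C v × (∀ j → p j ≡ dec → 𝕌 j v)

  Sp-sub : ∀ C p → Subspace (Sp C p)
  Sp-sub C p = record
    { sub-cong = λ eq (s , c , h) → (λ u ¬val → trans (sym (eq u)) (s u ¬val)) , (λ u ne → trans (sym (eq u)) (c u ne)) , λ i f → sub-cong (𝕌-sub i) eq (h i f)
    ; sub-zero = (λ _ _ → refl) , (λ _ _ → refl) , λ i f → sub-zero (𝕌-sub i)
    ; sub-+ = λ (s , c , h) (s′ , c′ , h′) → (λ u ¬val → cong₂ _+_ (s u ¬val) (s′ u ¬val)) , (λ u ne → cong₂ _+_ (c u ne) (c′ u ne)) , λ i f → sub-+ (𝕌-sub i) (h i f) (h′ i f)
    ; sub-* = λ k (s , c , h) → (λ u ¬val → trans (cong (k *_) (s u ¬val)) (ℚP.*-zeroʳ k)) , (λ u ne → trans (cong (k *_) (c u ne)) (ℚP.*-zeroʳ k)) , λ i f → sub-* (𝕌-sub i) k (h i f) }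

  rotP : Pats → Pats
  rotP p = p ∘ prevF

  dim-rotate : ∀ {C p d} → HasDim (Sp C p) Zero d → HasDim (Sp (rotV C) (rotP p)) Zero d
  dim-rotate {C} {p} = dim-map (g lo) (g⁻¹ lo) zero-subspace
    (λ a b v w u → trans (plus g-linear lo (λ u → a * v u) (λ u → b * w u) u) (cong₂ _+_ (scale g-linear lo a v u) (scale g-linear lo b w u)))
    (congᵛ g-linear lo)
    (λ {v} (s , c , h) → supp g-linear inv₀ s , g-col lo c , λ j pj →
      subst (λ i → 𝕌 i (g lo v)) (next-prev j) (U-next inv₀ (prevF j) s (h (prevF j) pj)))
    (vanish g-linear lo)
    (λ {v} _ z u → trans (sym (g⁻¹-g lo v u)) (vanish g⁻¹-linear lo z u))
    (λ {v} (s , c , h) → supp g⁻¹-linear inv₀ s , g⁻¹-col lo c , λ j pj →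
      U-prev inv₀ j (supp g⁻¹-linear inv₀ s) (U-cong {y = lo} (nextF j) (λ u → sym (g-g⁻¹ lo v u)) (h (nextF j) (trans (cong p (prev-next j)) pj))))
    (g-g⁻¹ lo) (Sp-sub C p)

  Same : Vec Bool n → Fin n → Set
  Same C j = Vec.lookup C j ≡ Vec.lookup C (nextF j)

  asc⇔ : ∀ {k} (i : Fin k) (u : Word (suc k)) → Asc i u → toℕ (Vec.lookup u (Fin.inject₁ i)) ℕ.< toℕ (Vec.lookup u (suc i))
  asc⇔ zero    (a ∷ b ∷ u) lt = lt
  asc⇔ (suc i) (a ∷ u)     lt = asc⇔ i u lt

  asc⇔′ : ∀ {k} (i : Fin k) (u : Word (suc k)) → toℕ (Vec.lookup u (Fin.inject₁ i)) ℕ.< toℕ (Vec.lookup u (suc i)) → Asc i u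
  asc⇔′ zero    (a ∷ b ∷ u) lt = lt
  asc⇔′ (suc i) (a ∷ u)     lt = asc⇔′ i u lt

  sameCol : ∀ {k} (i : Fin k) (u : Word (suc k)) → Vec.lookup (colours u) (Fin.inject₁ i) ≡ Vec.lookup (colours u) (suc i) → SameCol i u
  sameCol zero    (a ∷ b ∷ u) eq = eq
  sameCol (suc i) (a ∷ u)     eq = sameCol i u eq

  cases : ∀ (R : Fin n → Set) → R top → (∀ i → R (Fin.inject₁ i)) → ∀ j → R j
  cases R r rs j with view j
  ... | ‵fromℕ     = r
  ... | ‵inject₁ i = rs i

  module _ (C : Vec Bool n) (p : Pats) (noD : ∀ j → p j ≢ inc) (same : ∀ j → p j ≡ dec → Same C j) (wrap : p top ≢ dec) where
    private
      open Selection (listed C p) (AllPairsP.filter⁺ (counted? C p) (words↓-sorted n))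
        (valid-tableaux ∘ proj₁ ∘ proj₂ ∘ ∈P.∈-filter⁻ (counted? C p) {xs = words↓ n})
      Tc : ∀ j → Counted C p (T_ j)
      Tc j = proj₂ (∈P.∈-filter⁻ (counted? C p) {xs = words↓ n} (∈P.∈-lookup {xs = listed C p} j))

      same′ : ∀ i → p (Fin.inject₁ i) ≡ dec → ∀ u → colours u ≡ C → SameCol i u
      same′ i pi u refl = sameCol i u (trans (same (Fin.inject₁ i) pi) (cong (Vec.lookup (colours u)) (next-inject i)))

      lin : ∀ i {v} → (v ∘ swp i ≗ v) → 𝕌 (Fin.inject₁ i) v
      lin i h rewrite view-inject₁ i = h
      unlin : ∀ i {v} → 𝕌 (Fin.inject₁ i) v → (v ∘ swp i ≗ v)
      unlin i h rewrite view-inject₁ i = h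

      xT-Sp : ∀ j → Sp C p (x (T_ j))
      xT-Sp j = x-supp (proj₁ (Tc j))
        , (λ u ne → x-out (λ c → ne (trans (sym (cls-colours lo (T_ j) u c)) (proj₁ (proj₂ (Tc j))))))
        , cases (λ i → p i ≡ dec → 𝕌 i (x (T_ j))) (λ pi → ⊥-elim (wrap pi))
            (λ i pi → lin i (x-swp i (nonBd i (T_ j) (same′ i pi (T_ j) (proj₁ (proj₂ (Tc j))))
              (λ asc → subst (λ q → satP q (toℕ (Vec.lookup (T_ j) (Fin.inject₁ i))) (toℕ (Vec.lookup (T_ j) (nextF (Fin.inject₁ i)))))
                 pi (proj₂ (proj₂ (Tc j)) (Fin.inject₁ i))
                 (subst (λ l → toℕ (Vec.lookup (T_ j) (Fin.inject₁ i)) ℕ.< toℕ (Vec.lookup (T_ j) l)) (sym (next-inject i)) (asc⇔ i (T_ j) asc))))))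

      Φ : V → Word n → ℚ
      Φ = φ tableaux

    -- The basis vectors of the counted tableaux are symmetric at the `dec` positions, as there is
    -- neither ascent nor change of colour. Every other tableau has the wrong colours or an ascent
    -- at a `dec` position, so its coefficient vanishes. The last position carries no condition,
    -- being outside the reach of the basis.
    dim-cnt : HasDim (Sp C p) Zero (cnt C p)
    dim-cnt = record
      { vec = x ∘ T_ ; vec∈ = xT-Sp
      ; indep = λ a z j → trans (sym (coeff a j)) (φ-null tableaux z (T_ j))
      ; spans = λ {v} sv → (λ j → Φ v (T_ j)) , rest-zero v sv }
      where
        rest-zero : ∀ v → Sp C p v → Zero (rest v)
        rest-zero v sv = span-elim {Q = λ _ → ⊥} zero-subspace (λ ()) (expand tableaux (start (proj₁ sr)) (λ T T∈ → inj₁ (null T T∈)))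
          where
            sr : Sp C p (rest v)
            sr = sub-- (Sp-sub C p) sv (comb-in (Sp-sub C p) (λ j → Φ v (T_ j)) xT-Sp)
            null : ∀ T → T ∈ tableaux → Φ (rest v) T ≡ 0ℚ
            null T T∈t with VecP.≡-dec _≟B_ (colours T) C
            ... | no ne = φ-colours tableaux C (proj₁ (proj₂ sr)) T ne
            ... | yes eqC with any? (λ i → dec? (p (Fin.inject₁ i)) ×-dec asc? i T)
              where
                dec? : ∀ q → Dec (q ≡ dec)
                dec? inc = no (λ ())
                dec? dec = yes refl
                dec? free = no (λ ())
            ...   | yes (i , pi , asc) = φ-asc tableaux (start (proj₁ sr)) i (unlin i (proj₂ (proj₂ sr) (Fin.inject₁ i) pi))
                    (λ u nz → same′ i pi u (colour-of u nz)) T asc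
              where
                colour-of : ∀ u → rest v u ≢ 0ℚ → colours u ≡ C
                colour-of u nz with VecP.≡-dec _≟B_ (colours u) C
                ... | yes eq = eq
                ... | no ne  = ⊥-elim (nz (proj₁ (proj₂ sr) u ne))
            ...   | no none′ = rest-null v (∈P.∈-filter⁺ (counted? C p) (words↓-complete T) (tableaux-valid T∈t , eqC , sat))
              where
                sat : Sat p T
                sat = cases (λ j → satP (p j) (toℕ (Vec.lookup T j)) (toℕ (Vec.lookup T (nextF j))))
                  (wild (p top) (noD top) wrap) (λ i → at i (p (Fin.inject₁ i)) refl)
                  where
                    wild : ∀ q → q ≢ inc → q ≢ dec → ∀ {a b} → satP q a b
                    wild inc nd nn = ⊥-elim (nd refl)
                    wild dec nd nn = ⊥-elim (nn refl)
                    wild free nd nn = tt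
                    at : ∀ i q → p (Fin.inject₁ i) ≡ q → satP (p (Fin.inject₁ i)) (toℕ (Vec.lookup T (Fin.inject₁ i))) (toℕ (Vec.lookup T (nextF (Fin.inject₁ i))))
                    at i inc eq = ⊥-elim (noD (Fin.inject₁ i) eq)
                    at i free eq = subst (λ q → satP q _ _) (sym eq) tt
                    at i dec eq = subst (λ q → satP q _ _) (sym eq) (λ lt → none′ (i , eq , asc⇔′ i T
                      (subst (λ l → toℕ (Vec.lookup T (Fin.inject₁ i)) ℕ.< toℕ (Vec.lookup T l)) (next-inject i) lt)))

  dim-unrotate : ∀ {C p d} → HasDim (Sp (rotV C) (rotP p)) Zero d → HasDim (Sp C p) Zero d
  dim-unrotate {C} {p} = dim-map (g⁻¹ lo) (g lo) zero-subspace
    (λ a b v w u → trans (plus g⁻¹-linear lo (λ u → a * v u) (λ u → b * w u) u) (cong₂ _+_ (scale g⁻¹-linear lo a v u) (scale g⁻¹-linear lo b w u)))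
    (congᵛ g⁻¹-linear lo)
    (λ {v} (s , c , h) → supp g⁻¹-linear inv₀ s , g⁻¹-col lo c , λ j pj →
      U-prev inv₀ j (supp g⁻¹-linear inv₀ s) (U-cong {y = lo} (nextF j) (λ u → sym (g-g⁻¹ lo v u)) (h (nextF j) (trans (cong p (prev-next j)) pj))))
    (vanish g⁻¹-linear lo)
    (λ {v} _ z u → trans (sym (g-g⁻¹ lo v u)) (vanish g-linear lo z u))
    (λ {v} (s , c , h) → supp g-linear inv₀ s , g-col lo c , λ j pj →
      subst (λ i → 𝕌 i (g lo v)) (next-prev j) (U-next inv₀ (prevF j) s (h (prevF j) pj)))
    (g⁻¹-g lo) (Sp-sub (rotV C) (rotP p))

  -- Independence of the place where the circle is cut.

  rotPs : ℕ → Pats → Pats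
  rotPs zero    p = p
  rotPs (suc r) p = rotP (rotPs r p)

  rotPs-pr : ∀ r p j → rotPs r p j ≡ p (pr r j)
  rotPs-pr zero    p j = refl
  rotPs-pr (suc r) p j = rotPs-pr r p (prevF j)

  dims-from : ∀ r {C p d} → HasDim (Sp (rotVs r C) (rotPs r p)) Zero d → HasDim (Sp C p) Zero d
  dims-from zero    h = h
  dims-from (suc r) h = dims-from r (dim-unrotate h)

  upd : Pats → Fin n → Pat → Pats
  upd p j q i = if does (i ≟F j) then q else p i

  upd-self : ∀ p j q → upd p j q j ≡ q
  upd-self p j q with j ≟F j
  ... | yes _ = refl
  ... | no ne = ⊥-elim (ne refl)

  upd-other : ∀ p {j} q {i} → i ≢ j → upd p j q i ≡ p i
  upd-other p {j} q {i} ne with i ≟F j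
  ... | yes eq = ⊥-elim (ne eq)
  ... | no _   = refl

  -- The same circular data, cut open after `r` rotations. Validity refers to words read from the
  -- cut, so equality of these counts for different `r` has to come from the spaces, through g.
  cntR : ℕ → Vec Bool n → Pats → ℕ
  cntR r C p = cnt (rotVs r C) (rotPs r p)

  -- the condition at position j of (C , p), for a word read from the rotated starting point
  At : ℕ → Fin n → Pat → Word n → Set
  At r j q u = satP q (toℕ (Vec.lookup u (nx r j))) (toℕ (Vec.lookup u (nextF (nx r j))))

  private
    sat-at : ∀ r p u → Sat (rotPs r p) u → ∀ j → At r j (p j) u
    sat-at r p u s j = subst (λ q → satP q _ _) (trans (rotPs-pr r p (nx r j)) (cong p (pr-nx r j))) (s (nx r j))

    at-sat : ∀ r p u → (∀ j → At r j (p j) u) → Sat (rotPs r p) u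
    at-sat r p u h i = subst (λ q → satP q (toℕ (Vec.lookup u i)) (toℕ (Vec.lookup u (nextF i)))) (sym (rotPs-pr r p i))
      (subst (λ k → satP (p (pr r i)) (toℕ (Vec.lookup u k)) (toℕ (Vec.lookup u (nextF k))))
        (pr-injective r (pr-nx r (pr r i))) (h (pr r i)))

    replace : ∀ r p j q u → At r j q u → Sat (rotPs r p) u → Sat (rotPs r (upd p j q)) u
    replace r p j q u a s = at-sat r (upd p j q) u go
      where
        go : ∀ i → At r i (upd p j q i) u
        go i with i ≟F j
        ... | yes refl = a
        ... | no _     = sat-at r p u s i

    restore : ∀ r p j q u → At r j (p j) u → Sat (rotPs r (upd p j q)) u → Sat (rotPs r p) u
    restore r p j q u a s = at-sat r p u go
      where
        go : ∀ i → At r i (p i) u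
        go i with i ≟F j
        ... | yes refl = a
        ... | no ne    = subst (λ q → At r i q u) (upd-other p q ne) (sat-at r (upd p j q) u s i)

    at-upd : ∀ r p j q u → Sat (rotPs r (upd p j q)) u → At r j q u
    at-upd r p j q u s = subst (λ q → At r j q u) (upd-self p j q) (sat-at r (upd p j q) u s j)

  cnt-cong : ∀ {C p p′} → (∀ j → p j ≡ p′ j) → cnt C p ≡ cnt C p′
  cnt-cong {C} {p} {p′} eq = filter-⇔ (counted? C p) (counted? C p′)
    (λ u (v , c , s) → v , c , λ j → subst (λ q → satP q _ _) (eq j) (s j))
    (λ u (v , c , s) → v , c , λ j → subst (λ q → satP q _ _) (sym (eq j)) (s j)) (words↓ n)

  cnt-split : ∀ r C p j → p j ≡ inc → cntR r C (upd p j free) ≡ cntR r C p ℕ.+ cntR r C (upd p j dec)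
  cnt-split r C p j pj = filter-split (counted? C′ (rotPs r (upd p j free))) (counted? C′ (rotPs r p)) (counted? C′ (rotPs r (upd p j dec)))
    (λ u (v , c , s) → choose u v c s (satP? inc (toℕ (Vec.lookup u (nx r j))) (toℕ (Vec.lookup u (nextF (nx r j))))))
    (λ u (v , c , s) → (v , c , replace r p j free u tt s) , λ (_ , _ , s′) → at-upd r p j dec u s′ (subst (λ q → At r j q u) pj (sat-at r p u s j)))
    (λ u (v , c , s) → (v , c , swap-upd dec free u tt s) , λ (_ , _ , s′) → at-upd r p j dec u s (subst (λ q → At r j q u) pj (sat-at r p u s′ j)))
    (words↓ n)
    where
      C′ = rotVs r C
      swap-upd : ∀ q q′ u → At r j q′ u → Sat (rotPs r (upd p j q)) u → Sat (rotPs r (upd p j q′)) u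
      swap-upd q q′ u a s = at-sat r (upd p j q′) u go
        where
          go : ∀ i → At r i (upd p j q′ i) u
          go i with i ≟F j
          ... | yes refl = a
          ... | no ne    = subst (λ q → At r i q u) (upd-other p q ne) (sat-at r (upd p j q) u s i)
      choose : ∀ u → Valid lo u → colours u ≡ C′ → Sat (rotPs r (upd p j free)) u → Dec (At r j inc u) →
        Counted C′ (rotPs r p) u ⊎ Counted C′ (rotPs r (upd p j dec)) u
      choose u v c s (yes a) = inj₁ (v , c , restore r p j free u (subst (λ q → At r j q u) (sym pj) a) s)
      choose u v c s (no ¬a) = inj₂ (v , c , swap-upd free dec u ¬a s)

  module _ (ord : ∀ a b → κ a ≡ false → κ b ≡ true → toℕ a ℕ.< toℕ b) where

    private
      colour-at : ∀ r (C : Vec Bool n) u → colours u ≡ rotVs r C → ∀ (j : Fin n) → κ (Vec.lookup u (nx r j)) ≡ Vec.lookup C j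
        × κ (Vec.lookup u (nextF (nx r j))) ≡ Vec.lookup C (nextF j)
      colour-at r C u eq j = at (nx r j) j (pr-nx r j)
        , at (nextF (nx r j)) (nextF j) (trans (pr-next r (nx r j)) (cong nextF (pr-nx r j)))
        where
          at : ∀ k j → pr r k ≡ j → κ (Vec.lookup u k) ≡ Vec.lookup C j
          at k j e = trans (sym (VecP.lookup-map k κ u)) (trans (cong (λ S → Vec.lookup S k) eq) (trans (lookup-rotVs r C k) (cong (Vec.lookup C) e)))

      -- across a change of colour the comparison is decided by the colours
      forced : ∀ (C : Vec Bool n) j → ¬ Same C j → (∀ r u → colours u ≡ rotVs r C → At r j inc u) ⊎ (∀ r u → colours u ≡ rotVs r C → At r j dec u)
      forced C j ¬same = go (Vec.lookup C j) (Vec.lookup C (nextF j)) refl refl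
        where
          go : ∀ s t → Vec.lookup C j ≡ s → Vec.lookup C (nextF j) ≡ t →
            (∀ r u → colours u ≡ rotVs r C → At r j inc u) ⊎ (∀ r u → colours u ≡ rotVs r C → At r j dec u)
          go false false es et = ⊥-elim (¬same (trans es (sym et)))
          go true  true  es et = ⊥-elim (¬same (trans es (sym et)))
          go false true  es et = inj₁ λ r u eq → let p , q = colour-at r C u eq j in ord _ _ (trans p es) (trans q et)
          go true  false es et = inj₂ λ r u eq lt → let p , q = colour-at r C u eq j in ℕP.<-asym lt (ord _ _ (trans q et) (trans p es))

      drop-forced : ∀ r C p j → (∀ u → colours u ≡ rotVs r C → At r j (p j) u) → cntR r C p ≡ cntR r C (upd p j free)
      drop-forced r C p j h = filter-⇔ (counted? (rotVs r C) (rotPs r p)) (counted? (rotVs r C) (rotPs r (upd p j free)))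
        (λ u (v , c , s) → v , c , replace r p j free u tt s) (λ u (v , c , s) → v , c , restore r p j free u (h u c) s) (words↓ n)

      none-forced : ∀ r C p j → (∀ u → colours u ≡ rotVs r C → ¬ At r j (p j) u) → cntR r C p ≡ 0
      none-forced r C p j h = filter-none (counted? (rotVs r C) (rotPs r p)) (λ u (v , c , s) → h u c (sat-at r p u s j)) (words↓ n)

    Clean : Vec Bool n → Pats → Fin n → Set
    Clean C p j = p j ≡ free ⊎ (p j ≡ dec × Same C j)

    -- After `r` rotations the position `pr r top` lies at the cut. It must carry no genuine
    -- condition there: either none at all or one decided by the colours.
    Harmless : Vec Bool n → Pats → ℕ → Set
    Harmless C p r = p (pr r top) ≡ free ⊎ ¬ Same C (pr r top)

    private
      clean-cnt : ∀ C p → (∀ j → Clean C p j) → ∀ r → Harmless C p r → HasDim (Sp (rotVs r C) (rotPs r p)) Zero (cntR r C p)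
      clean-cnt C p cl r hm = dim-cnt (rotVs r C) (rotPs r p) noinc same wrap
        where
          noinc : ∀ j → rotPs r p j ≢ inc
          noinc j eq with cl (pr r j)
          ... | inj₁ f       = inc≢free (trans (sym eq) (trans (rotPs-pr r p j) f))
            where
              inc≢free : inc ≢ free
              inc≢free ()
          ... | inj₂ (d , _) = inc≢dec (trans (sym eq) (trans (rotPs-pr r p j) d))
            where
              inc≢dec : inc ≢ dec
              inc≢dec ()
          free≢dec : free ≢ dec
          free≢dec ()
          same : ∀ j → rotPs r p j ≡ dec → Same (rotVs r C) j
          same j eq with cl (pr r j)
          ... | inj₁ f       = ⊥-elim (free≢dec (trans (sym f) (trans (sym (rotPs-pr r p j)) eq)))
          ... | inj₂ (_ , s) = trans (lookup-rotVs r C j) (trans s (trans (cong (Vec.lookup C) (sym (pr-next r j))) (sym (lookup-rotVs r C (nextF j)))))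
          wrap : rotPs r p top ≢ dec
          wrap eq = go hm (cl (pr r top))
            where
              p≡dec : p (pr r top) ≡ dec
              p≡dec = trans (sym (rotPs-pr r p top)) eq
              go : Harmless C p r → Clean C p (pr r top) → ⊥
              go (inj₁ f)  _              = free≢dec (trans (sym f) p≡dec)
              go (inj₂ ¬s) (inj₁ f)       = free≢dec (trans (sym f) p≡dec)
              go (inj₂ ¬s) (inj₂ (_ , s)) = ¬s s

      clean-upd : ∀ C p q j L → Clean C (upd p j q) j → (∀ i → Clean C p i ⊎ i ∈ j ∷ L) → ∀ i → Clean C (upd p j q) i ⊎ i ∈ L
      clean-upd C p q j L cj cl i with i ≟F j | cl i
      ... | yes refl | _ = inj₁ (subst (λ t → t ≡ free ⊎ (t ≡ dec × Same C j)) (upd-self p j q) cj)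
      ... | no ne | inj₁ c = inj₁ c
      ... | no ne | inj₂ (here e) = ⊥-elim (ne e)
      ... | no ne | inj₂ (there m) = inj₂ m

    -- Clean patterns are counted by the dimension of one and the same space, whatever the cut.
    -- Other positions are removed one at a time: a comparison across colours is automatic or
    -- impossible, and within a colour `inc` is `free` minus `dec`.
    cnt-rot : ∀ L C p → (∀ j → Clean C p j ⊎ j ∈ L) → ∀ r r′ → Harmless C p r → Harmless C p r′ → cntR r C p ≡ cntR r′ C p
    cnt-rot [] C p cl r r′ hm hm′ = dim-unique (Sp-sub C p) zero-subspace
      (dims-from r (clean-cnt C p cl′ r hm)) (dims-from r′ (clean-cnt C p cl′ r′ hm′))
      where
        cl′ : ∀ j → Clean C p j
        cl′ j with cl j
        ... | inj₁ c = c
    cnt-rot (j ∷ L) C p cl r r′ hm hm′ = by (p j) refl (Vec.lookup C j ≟B Vec.lookup C (nextF j))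
      where
        open ≡-Reasoning
        keep : ∀ r → p j ≢ free → ∀ q → Same C j → Harmless C p r → Harmless C (upd p j q) r
        keep r nf q s (inj₂ ¬s) = inj₂ ¬s
        keep r nf q s (inj₁ f)  = inj₁ (trans (upd-other p q (λ e → nf (trans (sym (cong p e)) f))) f)
        relax : ∀ r → Harmless C p r → Harmless C (upd p j free) r
        relax r (inj₂ ¬s) = inj₂ ¬s
        relax r (inj₁ f) with pr r top ≟F j
        ... | yes _ = inj₁ refl
        ... | no _  = inj₁ f
        cleared : Clean C (upd p j free) j
        cleared = inj₁ (upd-self p j free)
        skip : Clean C p j → cntR r C p ≡ cntR r′ C p
        skip c = cnt-rot L C p cl′ r r′ hm hm′
          where
            cl′ : ∀ i → Clean C p i ⊎ i ∈ L
            cl′ i with cl i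
            ... | inj₁ ci = inj₁ ci
            ... | inj₂ (here refl) = inj₁ c
            ... | inj₂ (there m) = inj₂ m
        dropped : (∀ r u → colours u ≡ rotVs r C → At r j (p j) u) → cntR r C p ≡ cntR r′ C p
        dropped h = trans (drop-forced r C p j (h r)) (trans
          (cnt-rot L C (upd p j free) (clean-upd C p free j L cleared cl) r r′ (relax r hm) (relax r′ hm′)) (sym (drop-forced r′ C p j (h r′))))
        empty : (∀ r u → colours u ≡ rotVs r C → ¬ At r j (p j) u) → cntR r C p ≡ cntR r′ C p
        empty h = trans (none-forced r C p j (h r)) (sym (none-forced r′ C p j (h r′)))
        by : ∀ q → p j ≡ q → Dec (Same C j) → cntR r C p ≡ cntR r′ C p
        by free pj _       = skip (inj₁ pj)
        by dec  pj (yes s) = skip (inj₂ (pj , s))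
        by dec  pj (no ¬s) with forced C j ¬s
        ... | inj₁ h = empty (λ r u e a → subst (λ q → At r j q u) pj a (h r u e))
        ... | inj₂ h = dropped (λ r u e → subst (λ q → At r j q u) (sym pj) (h r u e))
        by inc  pj (no ¬s) with forced C j ¬s
        ... | inj₁ h = dropped (λ r u e → subst (λ q → At r j q u) (sym pj) (h r u e))
        ... | inj₂ h = empty (λ r u e a → h r u e (subst (λ q → At r j q u) pj a))
        -- The subtraction of counts is performed by cancelling the `dec` count, which is the same
        -- for both cuts by induction.
        by inc  pj (yes s) = ℕP.+-cancelʳ-≡ (cntR r C (upd p j dec)) (cntR r C p) (cntR r′ C p) (begin
          cntR r C p ℕ.+ cntR r C (upd p j dec)    ≡⟨ sym (cnt-split r C p j pj) ⟩
          cntR r C (upd p j free)                  ≡⟨ cnt-rot L C (upd p j free) (clean-upd C p free j L cleared cl) r r′ (relax r hm) (relax r′ hm′) ⟩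
          cntR r′ C (upd p j free)                 ≡⟨ cnt-split r′ C p j pj ⟩
          cntR r′ C p ℕ.+ cntR r′ C (upd p j dec)  ≡⟨ cong (cntR r′ C p ℕ.+_) (sym (cnt-rot L C (upd p j dec)
                                                        (clean-upd C p dec j L (inj₂ (upd-self p j dec , s)) cl) r r′ (keep r nf dec s hm) (keep r′ nf dec s hm′))) ⟩
          cntR r′ C p ℕ.+ cntR r C (upd p j dec)   ∎)
          where
            nf : p j ≢ free
            nf e = inc≢free (trans (sym pj) e)
              where
                inc≢free : inc ≢ free
                inc≢free ()
    -- Only the direction from `false` to `true` is taken. There `ord` forces an increase, so the
    -- pattern of the empty set, which is `dec` everywhere, counts no word.
    Change : Vec Bool n → Fin n → Set
    Change C j = Vec.lookup C j ≡ false × Vec.lookup C (nextF j) ≡ true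

    change? : ∀ C → Dec (∃ (Change C))
    change? C = any? (λ j → (Vec.lookup C j ≟B false) ×-dec (Vec.lookup C (nextF j) ≟B true))

    ¬same : ∀ C j → Change C j → ¬ Same C j
    ¬same C j (f , t) s with trans (sym f) (trans s t)
    ... | ()

    bring : ∀ j → ∃ λ r → pr r top ≡ j
    bring = to-top (λ j → ∃ λ r → pr r top ≡ j)
      (λ l (r , e) → suc r , trans (sym (prev-pr r top)) (trans (cong prevF e) (prev-next l))) (0 , refl)

    -- The first change found serves as the cut; `cnt-rot` makes the choice immaterial. Colour words
    -- without a change contribute 0, and `both-colours` excludes them for valid words.
    share : Vec Bool n → Pats → ℕ
    share C p with change? C
    ... | yes (j , _) = cntR (proj₁ (bring j)) C p
    ... | no _        = 0

    share-at : ∀ {C} → ∃ (Change C) → ∀ p r → Harmless C p r → share C p ≡ cntR r C p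
    share-at {C} ch p r hm with change? C
    ... | no ¬ch = ⊥-elim (¬ch ch)
    ... | yes (j , chj) = let r′ , e = bring j in
      cnt-rot (List.allFin n) C p (λ j → inj₂ (∈P.∈-allFin j)) r′ r (inj₂ (subst (λ k → ¬ Same C k) (sym e) (¬same C j chj))) hm

    share-none : ∀ {C} → ¬ ∃ (Change C) → ∀ p → share C p ≡ 0
    share-none {C} ¬ch p with change? C
    ... | yes ch = ⊥-elim (¬ch ch)
    ... | no _   = refl

    change-rot : ∀ C j → Change (rotV C) j → Change C (prevF j)
    change-rot C j (f , t) = trans (sym (lookup-rotV C j)) f
      , trans (cong (Vec.lookup C) (trans (next-prev j) (sym (prev-next j)))) (trans (sym (lookup-rotV C (nextF j))) t)

    change-rot′ : ∀ C j → Change C j → Change (rotV C) (nextF j)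
    change-rot′ C j (f , t) = trans (lookup-rotV C (nextF j)) (trans (cong (Vec.lookup C) (prev-next j)) f)
      , trans (lookup-rotV C (nextF (nextF j))) (trans (cong (Vec.lookup C) (prev-next (nextF j))) t)

    share-rotate : ∀ C p p′ → (∀ j → p′ j ≡ rotP p j) → share (rotV C) p′ ≡ share C p
    share-rotate C p p′ eq = go (change? (rotV C))
      where
        go : Dec (∃ (Change (rotV C))) → share (rotV C) p′ ≡ share C p
        go (no ¬ch) = trans (share-none {rotV C} ¬ch p′) (sym (share-none {C} (λ (j , ch) → ¬ch (nextF j , change-rot′ C j ch)) p))
        go (yes (j , ch)) =
          let r , e = bring j
              here₁ : ¬ Same C (pr (suc r) top)
              here₁ = subst (λ k → ¬ Same C k) (trans (cong prevF (sym e)) (prev-pr r top)) (¬same C (prevF j) (change-rot C j ch))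
          in begin
          share (rotV C) p′                          ≡⟨ share-at {rotV C} (j , ch) p′ r (inj₂ (subst (λ k → ¬ Same (rotV C) k) (sym e) (¬same (rotV C) j ch))) ⟩
          cnt (rotVs r (rotV C)) (rotPs r p′)        ≡⟨ cong (λ C → cnt C (rotPs r p′)) (rotVs-comm r C) ⟩
          cnt (rotVs (suc r) C) (rotPs r p′)         ≡⟨ cnt-cong (λ i → trans (rotPs-pr r p′ i) (trans (eq (pr r i))
                                                          (trans (cong p (prev-pr r i)) (sym (rotPs-pr (suc r) p i))))) ⟩
          cnt (rotVs (suc r) C) (rotPs (suc r) p)    ≡⟨ sym (share-at {C} (prevF j , change-rot C j ch) p (suc r) (inj₂ here₁)) ⟩
          share C p                                  ∎
          where open ≡-Reasoning

    pattern-of : Vec Bool n → Pats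
    pattern-of J j = if Vec.lookup J j then inc else dec

    c : Vec Bool n → ℕ
    c J = ∑ℕ (allSubsets n) (λ C → share C (pattern-of J))

    c-rotate : ∀ J → c (rotV J) ≡ c J
    c-rotate J = trans
      (sym (∑ℕ-reindex (allSubsets-unique n) allSubsets-complete (VecP.≡-dec _≟B_) rotV rotV⁻¹ rotV-rotV⁻¹ rotV⁻¹-rotV (λ C → share C (pattern-of (rotV J)))))
      (∑ℕ-cong (allSubsets n) (λ C → share-rotate C (pattern-of J) (pattern-of (rotV J))
        (λ j → cong (λ b → if b then inc else dec) (lookup-rotV J j))))

    c-empty : ∀ J → ones J ≡ 0 → c J ≡ 0
    c-empty J J0 = ∑ℕ-zero (allSubsets n) zero-share
      where
        p = pattern-of J
        p≡dec : ∀ j → p j ≡ dec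
        p≡dec j = cong (λ b → if b then inc else dec) (ones-zero J J0 j)
        zero-share : ∀ C → share C p ≡ 0
        zero-share C with change? C
        ... | no _ = refl
        ... | yes (j , (f , t)) = none-forced (proj₁ (bring j)) C p j (λ u eq a →
              subst (λ q → At (proj₁ (bring j)) j q u) (p≡dec j) a
                (let s , s′ = colour-at (proj₁ (bring j)) C u eq j in ord _ _ (trans s f) (trans s′ t)))

    module _ (both-colours : ∀ u → Valid lo u → ∃ (Change (colours u))) where

      private
        lookup-snoc : ∀ {k} (D : Vec Bool k) b i → Vec.lookup (D Vec.∷ʳ b) (Fin.inject₁ i) ≡ Vec.lookup D i
        lookup-snoc (_ ∷ D) b zero    = refl
        lookup-snoc (_ ∷ D) b (suc i) = lookup-snoc D b i
        lookup-snoc-top : ∀ {k} (D : Vec Bool k) b → Vec.lookup (D Vec.∷ʳ b) (Fin.fromℕ k) ≡ b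
        lookup-snoc-top []      b = refl
        lookup-snoc-top (_ ∷ D) b = lookup-snoc-top D b

        satB : ∀ b x y → satP (if b then inc else dec) x y → (x ℕ.<ᵇ y) ≡ b
        satB true  x y lt = Equivalence.to BoolP.T-≡ (ℕP.<⇒<ᵇ lt)
        satB false x y ge with x ℕ.<ᵇ y in eq
        ... | false = refl
        ... | true  = ⊥-elim (ge (ℕP.<ᵇ⇒< x y (subst Bool.T (sym eq) tt)))

        Bsat : ∀ b x y → (x ℕ.<ᵇ y) ≡ b → satP (if b then inc else dec) x y
        Bsat true  x y eq = ℕP.<ᵇ⇒< x y (subst Bool.T (sym eq) tt)
        Bsat false x y eq lt with trans (sym eq) (Equivalence.to BoolP.T-≡ (ℕP.<⇒<ᵇ lt))
        ... | ()

      -- With the cut kept at a change of colour, the patterns of D and D ∪ {n} add up to the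
      -- pattern that is free at the last position. That pattern also allows the cut before the
      -- first letter, where it prescribes exactly the linear descents.
      c-add : ∀ D → c (D Vec.∷ʳ false) ℕ.+ c (D Vec.∷ʳ true) ≡
        List.length (List.filter (λ u → valid? lo u ×-dec VecP.≡-dec _≟B_ (des u) D) (words↓ n))
      c-add D = begin
        c (D Vec.∷ʳ false) ℕ.+ c (D Vec.∷ʳ true) ≡⟨ sym (∑ℕ-+ (allSubsets n) (λ C → share C p₀) (λ C → share C p₁)) ⟩
        ∑ℕ (allSubsets n) (λ C → share C p₀ ℕ.+ share C p₁) ≡⟨ ∑ℕ-cong (allSubsets n) each ⟩
        ∑ℕ (allSubsets n) (λ C → List.length (List.filter (λ u → (valid? lo u ×-dec VecP.≡-dec _≟B_ (des u) D) ×-dec VecP.≡-dec _≟B_ (colours u) C) (words↓ n)))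
          ≡⟨ ∑ℕ-fibre (λ u → valid? lo u ×-dec VecP.≡-dec _≟B_ (des u) D) (VecP.≡-dec _≟B_) colours (allSubsets-unique n) allSubsets-complete (words↓ n) ⟩
        List.length (List.filter (λ u → valid? lo u ×-dec VecP.≡-dec _≟B_ (des u) D) (words↓ n)) ∎
        where
          open ≡-Reasoning
          p₀ p₁ p : Pats
          p₀ = pattern-of (D Vec.∷ʳ false)
          p₁ = pattern-of (D Vec.∷ʳ true)
          p  = upd p₁ top free
          top-p₁ : p₁ top ≡ inc
          top-p₁ = cong (λ b → if b then inc else dec) (lookup-snoc-top D true)
          p-lin : ∀ i → p (Fin.inject₁ i) ≡ (if Vec.lookup D i then inc else dec)
          p-lin i = trans (upd-other p₁ free (λ e → FinP.fromℕ≢inject₁ (sym e))) (cong (λ b → if b then inc else dec) (lookup-snoc D true i))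
          lower-top : ∀ j → p₀ j ≡ upd p₁ top dec j
          lower-top = cases (λ j → p₀ j ≡ upd p₁ top dec j)
            (trans (cong (λ b → if b then inc else dec) (lookup-snoc-top D false)) (sym (upd-self p₁ top dec)))
            (λ i → trans (cong (λ b → if b then inc else dec) (trans (lookup-snoc D false i) (sym (lookup-snoc D true i))))
              (sym (upd-other p₁ dec (λ e → FinP.fromℕ≢inject₁ (sym e)))))
          counted⇒ : ∀ C u → Counted C p u → (Valid lo u × des u ≡ D) × colours u ≡ C
          counted⇒ C u (v , c , s) = (v , vec-ext same) , c
            where
              same : ∀ i → Vec.lookup (des u) i ≡ Vec.lookup D i
              same i = trans (des-at u i) (satB (Vec.lookup D i) _ _
                (subst₂ (λ q k → satP q (toℕ (Vec.lookup u (Fin.inject₁ i))) (toℕ (Vec.lookup u k))) (p-lin i) (next-inject i) (s (Fin.inject₁ i))))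
          counted⇐ : ∀ C u → (Valid lo u × des u ≡ D) × colours u ≡ C → Counted C p u
          counted⇐ C u ((v , refl) , c) = v , c , cases (λ j → satP (p j) (toℕ (Vec.lookup u j)) (toℕ (Vec.lookup u (nextF j))))
            (subst (λ q → satP q (toℕ (Vec.lookup u top)) (toℕ (Vec.lookup u (nextF top)))) (sym (upd-self p₁ top free)) tt)
            (λ i → subst₂ (λ q k → satP q (toℕ (Vec.lookup u (Fin.inject₁ i))) (toℕ (Vec.lookup u k))) (sym (p-lin i)) (sym (next-inject i))
              (Bsat (Vec.lookup (des u) i) _ _ (sym (des-at u i))))
          each : ∀ C → share C p₀ ℕ.+ share C p₁ ≡
            List.length (List.filter (λ u → (valid? lo u ×-dec VecP.≡-dec _≟B_ (des u) D) ×-dec VecP.≡-dec _≟B_ (colours u) C) (words↓ n))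
          each C = go (change? C)
            where
              go : Dec (∃ (Change C)) → _
              go (no ¬ch) = trans (cong₂ ℕ._+_ (share-none {C} ¬ch p₀) (share-none {C} ¬ch p₁))
                (sym (filter-none _ (λ { u ((v , _) , refl) → ¬ch (both-colours u v) }) (words↓ n)))
              go (yes (j , ch)) =
                let r , e = bring j
                    hm : ¬ Same C (pr r top)
                    hm = subst (λ k → ¬ Same C k) (sym e) (¬same C j ch)
                in begin
                share C p₀ ℕ.+ share C p₁ ≡⟨ cong₂ ℕ._+_ (share-at {C} (j , ch) p₀ r (inj₂ hm)) (share-at {C} (j , ch) p₁ r (inj₂ hm)) ⟩
                cntR r C p₀ ℕ.+ cntR r C p₁ ≡⟨ ℕP.+-comm (cntR r C p₀) (cntR r C p₁) ⟩
                cntR r C p₁ ℕ.+ cntR r C p₀ ≡⟨ cong (cntR r C p₁ ℕ.+_) (cnt-cong (λ i → trans (rotPs-pr r p₀ i) (trans (lower-top (pr r i)) (sym (rotPs-pr r (upd p₁ top dec) i))))) ⟩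
                cntR r C p₁ ℕ.+ cntR r C (upd p₁ top dec) ≡⟨ sym (cnt-split r C p₁ top top-p₁) ⟩
                cntR r C p ≡⟨ cnt-rot (List.allFin n) C p (λ j → inj₂ (∈P.∈-allFin j)) r 0 (inj₂ hm) (inj₁ (upd-self p₁ top free)) ⟩
                cnt C p ≡⟨ filter-⇔ (counted? C p) _ (counted⇒ C) (counted⇐ C) (words↓ n) ⟩
                _ ∎

-- The cyclic numbers of a shape, from a square or from a cut.

record CyclicNumbers (ℓ : ℕ) (lo hi : ℕ → ℕ) (m : ℕ) : Set where
  open Shapes ℓ hi
  field
    number : Vec Bool (suc m) → ℕ
    rotated : ∀ J → number (rotV J) ≡ number J
    added : ∀ (D : Vec Bool m) → number (D Vec.∷ʳ false) ℕ.+ number (D Vec.∷ʳ true) ≡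
      List.length (List.filter (λ u → valid? lo u ×-dec VecP.≡-dec _≟B_ (des u) D) (allVecs ℓ (suc m)))
    empty : ∀ J → ones J ≡ 0 → number J ≡ 0

sorted-unique : ∀ {A : Set} {R : A → A → Set} {xs} → AllPairs (λ u v → R v u) xs → (∀ {a} → ¬ R a a) → Unique xs
sorted-unique srt irr = AllPairs.map (λ r → λ { refl → irr r }) srt

all-positions : ∀ {m} (P : Fin (suc m) → Set) → (∀ j → P j → P (nextF j)) → ∀ j → P j → ∀ k → P k
all-positions {m} P forth j pj = FinI.<-weakInduction P p0 (λ i pi → subst P (next-inject i) (forth (Fin.inject₁ i) pi))
  where
    ptop : P (Fin.fromℕ m)
    ptop = to-top (λ l → P l → P (Fin.fromℕ m)) (λ l h pl → h (forth l pl)) (λ p → p) j pj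
    p0 : P zero
    p0 = subst P (next-fromℕ m) (forth (Fin.fromℕ m) ptop)

module TwoByTwo (ℓ : ℕ) (lo hi : ℕ → ℕ) (oklo : ∀ (i : Fin ℓ) → lo (suc (toℕ i)) ℕ.≤ lo (toℕ i))
  (okhi : ∀ i → hi (suc i) ℕ.≤ hi i) (m : ℕ) (a a′ : Fin ℓ) (a′≡ : toℕ a′ ≡ suc (toℕ a)) (2×2 : suc (suc (lo (toℕ a))) ℕ.≤ hi (toℕ a′)) where
  open Square ℓ lo hi oklo m
  open Seminormal ℓ (λ _ → false) lo hi (λ _ _ _ ne → ⊥-elim (ne refl))
  open Basis {suc m} lo oklo using (tableaux; tableaux-sorted; tableaux-valid; valid-tableaux)

  private
    Hook′ : ∀ {k} → Word (suc k) → Set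
    Hook′ {k} T = ∀ (i j : Fin k) → toℕ i ℕ.≤ toℕ j → Asc i T → Asc j T

    -- Past `a` the strictly increasing letters are beyond `a′` from the next one on, so row `a′` is
    -- already complete.
    rising : ∀ {k} y b (w : Word k) → (∀ i → Asc i (b ∷ w)) → toℕ a ℕ.< toℕ b → Valid y w → hi (toℕ a′) ≡ y (toℕ a′)
    rising y b []      asc a<b val = sym (val a′)
    rising y b (z ∷ w) asc a<b (_ , val) = trans (rising (bump y z) z w (asc ∘ suc) (ℕP.<-trans a<b (asc zero)) val)
      (bump-other y (λ { refl → ℕP.<-irrefl (sym a′≡) (ℕP.≤-<-trans a<b (asc zero)) }))

    -- Starting at or above row `a`, the weakly decreasing part avoids `a′`, and the strictly
    -- increasing part contains `a′` at most once.
    once : ∀ {k} y b (w : Word k) → Hook′ (b ∷ w) → toℕ b ℕ.≤ toℕ a → Valid y w → hi (toℕ a′) ℕ.≤ suc (y (toℕ a′))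
    once y b []      hook b≤a val = ℕP.m≤n⇒m≤1+n (ℕP.≤-reflexive (sym (val a′)))
    once y b (z ∷ w) hook b≤a (ok , val) with toℕ z ℕP.≤? toℕ a
    ... | yes z≤a = subst (λ t → hi (toℕ a′) ℕ.≤ suc t) (bump-other y (λ { refl → ℕP.<-irrefl refl (ℕP.≤-trans (ℕP.≤-reflexive (sym a′≡)) z≤a) }))
            (once (bump y z) z w (λ i j le → hook (suc i) (suc j) (s≤s le)) z≤a val)
    ... | no z≰a = ℕP.≤-trans (ℕP.≤-reflexive (rising (bump y z) z w (λ i → hook zero (suc i) z≤n (ℕP.≤-<-trans b≤a (ℕP.≰⇒> z≰a))) (ℕP.≰⇒> z≰a) val)) bound
      where
        bound : bump y z (toℕ a′) ℕ.≤ suc (y (toℕ a′))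
        bound with z ≟F a′
        ... | yes refl = ℕP.≤-reflexive (bump-self y z)
        ... | no z≢a′  = ℕP.m≤n⇒m≤1+n (ℕP.≤-reflexive (bump-other y z≢a′))

    -- When row `a` receives its first cell, row `a′` ends at column lo a at most. Afterwards it
    -- gains at most one cell, too few to reach lo a + 2. If row `a` never receives a cell, it is
    -- too short to lie above row `a′`.
    noHook′ : ∀ {k} y (T : Word (suc k)) → Ok y → y (toℕ a) ≡ lo (toℕ a) → Valid y T → ¬ Hook′ T
    noHook′ {k} y (b ∷ w) oky ya (ok , val) hook with b ≟F a
    ... | yes refl = ℕP.<-irrefl refl (ℕP.≤-trans 2×2 (ℕP.≤-trans (once (bump y b) b w hook ℕP.≤-refl val)
            (s≤s (ℕP.≤-trans (ℕP.≤-reflexive (bump-other y (λ { refl → ℕP.<-irrefl a′≡ ℕP.≤-refl })))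
              (ℕP.≤-trans (subst (λ i → y i ℕ.≤ y (toℕ a)) (sym a′≡) (oky a)) (ℕP.≤-reflexive ya))))))
    noHook′ {zero} y (b ∷ []) oky ya (ok , val) hook | no b≢a = ℕP.<-irrefl refl (ℕP.≤-trans (ℕP.≤-trans (ℕP.m≤n⇒m≤1+n (ℕP.≤-reflexive refl)) 2×2)
            (ℕP.≤-trans (subst (λ i → hi i ℕ.≤ hi (toℕ a)) (sym a′≡) (okhi (toℕ a)))
              (ℕP.≤-reflexive (trans (sym (val a)) (trans (bump-other y b≢a) ya)))))
    noHook′ {suc k} y (b ∷ w) oky ya (ok , val) hook | no b≢a =
      noHook′ (bump y b) w ok (trans (bump-other y b≢a) ya) val (λ i j le → hook (suc i) (suc j) (s≤s le))

    noHook : ∀ T → Valid lo T → ¬ Hook T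
    noHook T val = noHook′ lo T oklo refl val

  numbers : CyclicNumbers ℓ lo hi (suc m)
  numbers = record
    { number = c noHook ; rotated = c-rotate noHook ; empty = c-empty noHook ; added = λ D → trans (c-add noHook D) (rows-count D) }
    where
      rows-count : ∀ D → List.length (rows D) ≡ List.length (List.filter (λ u → valid? lo u ×-dec VecP.≡-dec _≟B_ (des u) D) (allVecs ℓ n))
      rows-count D = ℕP.≤-antisym
        (unique-⊆-length (sorted-unique (AllPairsP.filter⁺ (λ T → VecP.≡-dec _≟B_ (des T) D) tableaux-sorted) <ₗ-irrefl)
          (λ {T} T∈ → let T∈t , eq = ∈P.∈-filter⁻ (λ T → VecP.≡-dec _≟B_ (des T) D) {xs = tableaux} T∈ in
            ∈P.∈-filter⁺ (λ u → valid? lo u ×-dec VecP.≡-dec _≟B_ (des u) D) (allVecs-complete T) (tableaux-valid T∈t , eq)))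
        (unique-⊆-length (UniqueP.filter⁺ (λ u → valid? lo u ×-dec VecP.≡-dec _≟B_ (des u) D) (allVecs-unique ℓ n))
          (λ {T} T∈ → let _ , val , eq = ∈P.∈-filter⁻ (λ u → valid? lo u ×-dec VecP.≡-dec _≟B_ (des u) D) {xs = allVecs ℓ n} T∈ in
            ∈P.∈-filter⁺ (λ T → VecP.≡-dec _≟B_ (des T) D) (valid-tableaux val) eq))

module Cut (ℓ : ℕ) (lo hi : ℕ → ℕ) (oklo : ∀ (i : Fin ℓ) → lo (suc (toℕ i)) ℕ.≤ lo (toℕ i)) (m : ℕ) (r : ℕ)
  (gap : hi (suc r) ℕ.≤ lo r) (a b : Fin ℓ) (a≤r : toℕ a ℕ.≤ r) (r<b : r ℕ.< toℕ b)
  (cell-a : lo (toℕ a) ℕ.< hi (toℕ a)) (cell-b : lo (toℕ b) ℕ.< hi (toℕ b)) where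

  lower : Fin ℓ → Bool
  lower i = r ℕ.<ᵇ toℕ i

  private
    lower-true : ∀ i → lower i ≡ true → r ℕ.< toℕ i
    lower-true i eq = ℕP.<ᵇ⇒< r (toℕ i) (subst Bool.T (sym eq) tt)

    true-lower : ∀ i → r ℕ.< toℕ i → lower i ≡ true
    true-lower i lt = Equivalence.to BoolP.T-≡ (ℕP.<⇒<ᵇ lt)

    lower-false : ∀ i → lower i ≡ false → toℕ i ℕ.≤ r
    lower-false i eq = ℕP.≮⇒≥ (λ lt → f≢t (trans (sym eq) (true-lower i lt)))
      where
        f≢t : false ≢ true
        f≢t ()

    false-lower : ∀ i → toℕ i ℕ.≤ r → lower i ≡ false
    false-lower i le with lower i in eq
    ... | false = refl
    ... | true  = ⊥-elim (ℕP.<-irrefl refl (ℕP.<-≤-trans (lower-true i eq) le))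

    sep : ∀ i j → toℕ j ≡ suc (toℕ i) → lower i ≢ lower j → hi (toℕ j) ℕ.≤ lo (toℕ i)
    sep i j j≡ ne = go (lower i) (lower j) refl refl
      where
        go : ∀ s t → lower i ≡ s → lower j ≡ t → hi (toℕ j) ℕ.≤ lo (toℕ i)
        go false false es et = ⊥-elim (ne (trans es (sym et)))
        go true  true  es et = ⊥-elim (ne (trans es (sym et)))
        go true  false es et = ⊥-elim (ℕP.<-asym (ℕP.<-≤-trans (ℕP.≤-reflexive (sym j≡)) (lower-false j et)) (lower-true i es))
        go false true  es et = subst₂ (λ p q → hi p ℕ.≤ lo q) (trans (cong suc (sym i≡r)) (sym j≡)) (sym i≡r) gap
          where i≡r = ℕP.≤-antisym (lower-false i es) (ℕP.≤-pred (ℕP.≤-trans (lower-true j et) (ℕP.≤-reflexive j≡)))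

  open Disconnected ℓ lower lo hi sep oklo m
  open Seminormal ℓ lower lo hi sep

  private
    ord : ∀ i j → lower i ≡ false → lower j ≡ true → toℕ i ℕ.< toℕ j
    ord i j f t = ℕP.≤-<-trans (lower-false i f) (lower-true j t)

    occurs : ∀ {k} y (u : Word k) → Valid y u → ∀ i → y (toℕ i) ℕ.< hi (toℕ i) → ∃ λ j → Vec.lookup u j ≡ i
    occurs y []      val i lt = ⊥-elim (ℕP.<-irrefl (val i) lt)
    occurs y (z ∷ u) (_ , val) i lt with z ≟F i
    ... | yes eq = zero , eq
    ... | no ne  = let j , e = occurs (bump y z) u val i (subst (ℕ._< hi (toℕ i)) (sym (bump-other y ne)) lt) in suc j , e

    -- The nonempty rows `a` and `b` make both colours occur. Without a change from `false` to
    -- `true`, the colour `false` would propagate around the whole circle.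
    both-colours : ∀ u → Valid lo u → ∃ (Change ord (colours u))
    both-colours u val with change? ord (colours u)
    ... | yes ch = ch
    ... | no ¬ch =
      let ja , ea = occurs lo u val a cell-a
          jb , eb = occurs lo u val b cell-b
      in ⊥-elim (f≢t (trans (sym (all-positions (λ j → Vec.lookup (colours u) j ≡ false) spread ja
           (trans (VecP.lookup-map ja lower u) (trans (cong lower ea) (false-lower a a≤r))) jb))
           (trans (VecP.lookup-map jb lower u) (trans (cong lower eb) (true-lower b r<b)))))
      where
        f≢t : false ≢ true
        f≢t ()
        spread : ∀ j → Vec.lookup (colours u) j ≡ false → Vec.lookup (colours u) (nextF j) ≡ false
        spread j f with Vec.lookup (colours u) (nextF j) in eq
        ... | false = refl
        ... | true  = ⊥-elim (¬ch (j , f , eq))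

  numbers : CyclicNumbers ℓ lo hi (suc m)
  numbers = record
    { number = c ord ; rotated = c-rotate ord ; empty = c-empty ord
    ; added = λ D → trans (c-add ord both-colours D)
        (filter-≡ (λ u → valid? lo u ×-dec VecP.≡-dec _≟B_ (des u) D) (sorted-unique (words↓-sorted (suc (suc m))) <ₗ-irrefl) (allVecs-unique ℓ (suc (suc m))) words↓-complete allVecs-complete) }

-- Semistandard fillings and words of rows.

SubV : ∀ {k} → Vec Bool k → Vec Bool k → Set
SubV D E = ∀ i → Vec.lookup D i ≡ true → Vec.lookup E i ≡ true

subV? : ∀ {k} (D E : Vec Bool k) → Dec (SubV D E)
subV? D E = allF? (λ i → (Vec.lookup D i ≟B true) →-dec (Vec.lookup E i ≟B true))

Mono : ∀ {N k} → Vec (Fin N) k → Set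
Mono s = ∀ t t′ → toℕ t ℕ.≤ toℕ t′ → toℕ (Vec.lookup s t) ℕ.≤ toℕ (Vec.lookup s t′)

cntV : ∀ {N k} → Vec (Fin N) k → Fin N → ℕ
cntV []      b = 0
cntV (x ∷ s) b = 𝟙 (x ≟F b) ℕ.+ cntV s b

count-cntV : ∀ {N k} (s : Vec (Fin N) k) b → count (λ t → Vec.lookup s t ≟F b) ≡ cntV s b
count-cntV {k = k} s b = trans (length-filter (λ t → Vec.lookup s t ≟F b) (List.allFin k)) (go s (λ t → Vec.lookup s t) (λ _ → refl))
  where
    go : ∀ {k} (s : Vec _ k) (f : Fin k → Fin _) → (∀ t → f t ≡ Vec.lookup s t) → ∑ℕ (List.tabulate (λ t → t)) (λ t → 𝟙 (f t ≟F b)) ≡ cntV s b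
    go []      f eq = refl
    go {suc k} (x ∷ s) f eq = cong₂ ℕ._+_ (cong (λ z → 𝟙 (z ≟F b)) (eq zero))
      (trans (cong sum (trans (cong (List.map (λ t → 𝟙 (f t ≟F b))) (sym (ListP.map-tabulate (λ t → t) suc)))
        (sym (ListP.map-∘ (List.tabulate (λ t → t)))))) (go s (f ∘ suc) (eq ∘ suc)))

abstract
  cntV-∃ : ∀ {N k} (s : Vec (Fin N) k) b → cntV s b ≢ 0 → ∃ λ t → Vec.lookup s t ≡ b
  cntV-∃ []      b ne = ⊥-elim (ne refl)
  cntV-∃ (x ∷ s) b ne with x ≟F b
  ... | yes eq = zero , eq
  ... | no _   = let t , e = cntV-∃ s b ne in suc t , e

  filter-∃ : ∀ {A : Set} {P : A → Set} (P? : ∀ a → Dec (P a)) xs → List.length (List.filter P? xs) ≢ 0 → ∃ P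
  filter-∃ P? []       ne = ⊥-elim (ne refl)
  filter-∃ P? (a ∷ xs) ne with P? a
  ... | yes p = a , p
  ... | no _  = filter-∃ P? xs ne

filter-nonzero : ∀ {A : Set} {P : A → Set} (P? : ∀ a → Dec (P a)) {xs a} → a ∈ xs → P a → List.length (List.filter P? xs) ≢ 0
filter-nonzero P? {x ∷ xs} (here refl) p eq with P? x
... | yes _ = ℕP.1+n≢0 eq
... | no ¬p = ¬p p
filter-nonzero P? {x ∷ xs} (there h) p eq with P? x
... | yes _ = ℕP.1+n≢0 eq
... | no _  = filter-nonzero P? h p eq

abstract
  maximal : ∀ {k} {Q : Fin k → Set} → (∀ i → Dec (Q i)) → ∃ Q → ∃ λ i → Q i × (∀ j → toℕ i ℕ.< toℕ j → ¬ Q j)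
  maximal {suc k} Q? (i , q) with any? (Q? ∘ suc)
  ... | yes ex = let j , qj , mx = maximal (Q? ∘ suc) ex in suc j , qj , λ { (suc l) (s≤s lt) → mx l lt }
  maximal {suc k} Q? (zero , q)  | no ¬ex = zero , q , λ { (suc l) _ ql → ¬ex (l , ql) }
  maximal {suc k} Q? (suc i , q) | no ¬ex = ⊥-elim (¬ex (i , q))

module Fillings (lam mu : List ℕ) (plam : IsPartition lam) (pmu : IsPartition mu) (sub : mu ⊆P lam) where

  ℓ : ℕ
  ℓ = List.length lam

  lo hi : ℕ → ℕ
  lo = row mu
  hi = row lam

  open Shapes ℓ hi

  module Cells where
    L = List.length (cells lam mu)
    cell : Fin L → ℕ × ℕ
    cell p = Vec.lookup (Vec.fromList (cells lam mu)) p
    ri ci : Fin L → ℕ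
    ri p = proj₁ (cell p)
    ci p = proj₂ (cell p)

    lookup-fromList : ∀ {A : Set} (xs : List A) p → Vec.lookup (Vec.fromList xs) p ≡ List.lookup xs p
    lookup-fromList (x ∷ xs) zero    = refl
    lookup-fromList (x ∷ xs) (suc p) = lookup-fromList xs p

    line : ℕ → List (ℕ × ℕ)
    line i = List.map (λ t → (i , lo i ℕ.+ t)) (List.upTo (hi i ℕ.∸ lo i))

    abstract
      ∈cells⁺ : ∀ {i j} → i ℕ.< ℓ → lo i ℕ.≤ j → j ℕ.< hi i → (i , j) ∈ cells lam mu
      ∈cells⁺ {i} {j} i<ℓ le lt = ∈P.∈-concatMap⁺ line (Any.map (λ { refl → mem }) (∈P.∈-upTo⁺ i<ℓ))
        where
          mem : (i , j) ∈ line i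
          mem = subst (λ k → (i , k) ∈ line i) (ℕP.m+[n∸m]≡n le)
            (∈P.∈-map⁺ (λ t → (i , lo i ℕ.+ t)) (∈P.∈-upTo⁺ (ℕP.∸-monoˡ-< lt le)))

      ∈cells⁻ : ∀ {i j} → (i , j) ∈ cells lam mu → i ℕ.< ℓ × lo i ℕ.≤ j × j ℕ.< hi i
      ∈cells⁻ {i} {j} h with find (∈P.∈-concatMap⁻ line {xs = List.upTo ℓ} h)
      ... | i′ , i′∈ , h′ with ∈P.∈-map⁻ (λ t → (i′ , lo i′ ℕ.+ t)) h′
      ...   | t , t∈ , refl = ∈P.∈-upTo⁻ i′∈ , ℕP.m≤m+n (lo i′) t
              , ℕP.<-≤-trans (ℕP.+-monoʳ-< (lo i′) (∈P.∈-upTo⁻ t∈)) (ℕP.≤-reflexive (ℕP.m+[n∸m]≡n (sub i′)))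

      cells-unique : Unique (cells lam mu)
      cells-unique = AllPairsP.concat⁺
        (AllP.map⁺ (All.tabulate (λ {i} _ → AllPairsP.map⁺ (AllPairs.map
          (λ ne eq → ne (ℕP.+-cancelˡ-≡ (lo i) _ _ (cong proj₂ eq))) (UniqueP.upTo⁺ (hi i ℕ.∸ lo i))))))
        (AllPairsP.map⁺ (AllPairs.map
          (λ ne → AllP.map⁺ (All.tabulate (λ _ → AllP.map⁺ (All.tabulate (λ _ eq → ne (cong proj₁ eq)))))) (UniqueP.upTo⁺ ℓ)))

      cell-in : ∀ p → ri p ℕ.< ℓ × lo (ri p) ℕ.≤ ci p × ci p ℕ.< hi (ri p)
      cell-in p = ∈cells⁻ (subst (_∈ cells lam mu) (sym (lookup-fromList (cells lam mu) p)) (∈P.∈-lookup p))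

      cell-of : ∀ (i : Fin ℓ) j → lo (toℕ i) ℕ.≤ j → j ℕ.< hi (toℕ i) → ∃ λ p → cell p ≡ (toℕ i , j)
      cell-of i j le lt = let mem = ∈cells⁺ (toℕ<n i) le lt in
        Any.index mem , trans (lookup-fromList (cells lam mu) _) (sym (AnyP.lookup-index mem))

      unique-lookup : ∀ {A : Set} {xs : List A} → Unique xs → ∀ i j → List.lookup xs i ≡ List.lookup xs j → i ≡ j
      unique-lookup (_ ∷ _) zero    zero    eq = refl
      unique-lookup (r ∷ _) zero    (suc j) eq = ⊥-elim (All.lookup r (∈P.∈-lookup j) eq)
      unique-lookup (r ∷ _) (suc i) zero    eq = ⊥-elim (All.lookup r (∈P.∈-lookup i) (sym eq))
      unique-lookup (_ ∷ u) (suc i) (suc j) eq = cong suc (unique-lookup u i j eq)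

      cell-inj : ∀ p q → cell p ≡ cell q → p ≡ q
      cell-inj p q eq = unique-lookup cells-unique p q (trans (sym (lookup-fromList (cells lam mu) p)) (trans eq (lookup-fromList (cells lam mu) q)))

    rowF : Fin L → Fin ℓ
    rowF p = Fin.fromℕ< (proj₁ (cell-in p))

    rowF≡ : ∀ p → toℕ (rowF p) ≡ ri p
    rowF≡ p = FinP.toℕ-fromℕ< (proj₁ (cell-in p))

    oklo : Ok lo
    oklo i = pmu (toℕ i)

    -- the shape before letter t
    st : ∀ {k} → State → Word k → Fin k → State
    st y (a ∷ u) zero    = y
    st y (a ∷ u) (suc t) = st (bump y a) u t

    abstract
      place : ∀ {k} y (u : Word k) → Valid y u → ∀ (i : Fin ℓ) j → y (toℕ i) ℕ.≤ j → j ℕ.< hi (toℕ i) →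
        ∃ λ t → Vec.lookup u t ≡ i × st y u t (toℕ i) ≡ j
      place y []      val i j le lt = ⊥-elim (ℕP.<-irrefl refl (ℕP.≤-<-trans le (subst (j ℕ.<_) (sym (val i)) lt)))
      place y (a ∷ u) (_ , val) i j le lt with a ≟F i
      ... | no ne = let t , e , f = place (bump y a) u val i j (subst (ℕ._≤ j) (sym (bump-other y ne)) le) lt in suc t , e , f
      ... | yes refl with y (toℕ a) ℕP.≟ j
      ...   | yes eq = zero , refl , eq
      ...   | no ne  = let t , e , f = place (bump y a) u val a j (subst (ℕ._≤ j) (sym (bump-self y a)) (ℕP.≤∧≢⇒< le ne)) lt in suc t , e , f

    st-≥ : ∀ {k} y (u : Word k) t i → y i ℕ.≤ st y u t i
    st-≥ y (a ∷ u) zero    i = ℕP.≤-refl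
    st-≥ y (a ∷ u) (suc t) i = ℕP.≤-trans (ℕP.m≤n+m (y i) (δ a i)) (st-≥ (bump y a) u t i)

    st-mono : ∀ {k} y (u : Word k) t t′ → toℕ t ℕ.≤ toℕ t′ → ∀ i → st y u t i ℕ.≤ st y u t′ i
    st-mono y (a ∷ u) zero    t′       le       i = st-≥ y (a ∷ u) t′ i
    st-mono y (a ∷ u) (suc t) (suc t′) (s≤s le) i = st-mono (bump y a) u t t′ le i

    st-strict : ∀ {k} y (u : Word k) t t′ → toℕ t ℕ.< toℕ t′ → st y u t (toℕ (Vec.lookup u t)) ℕ.< st y u t′ (toℕ (Vec.lookup u t))
    st-strict y (a ∷ u) zero    (suc t′) lt       = ℕP.≤-trans (ℕP.≤-reflexive (sym (bump-self y a))) (st-≥ (bump y a) u t′ (toℕ a))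
    st-strict y (a ∷ u) (suc t) (suc t′) (s≤s lt) = st-strict (bump y a) u t t′ lt

    time-unique : ∀ {k} y (u : Word k) t t′ → Vec.lookup u t ≡ Vec.lookup u t′ →
      st y u t (toℕ (Vec.lookup u t)) ≡ st y u t′ (toℕ (Vec.lookup u t′)) → t ≡ t′
    time-unique y u t t′ e f with ℕP.<-cmp (toℕ t) (toℕ t′)
    ... | tri≈ _ eq _ = toℕ-injective eq
    ... | tri< lt _ _ = ⊥-elim (ℕP.<-irrefl (trans f (cong (λ i → st y u t′ (toℕ i)) (sym e))) (st-strict y u t t′ lt))
    ... | tri> _ _ gt = ⊥-elim (ℕP.<-irrefl (trans (sym f) (cong (λ i → st y u t (toℕ i)) e)) (st-strict y u t′ t gt))

    valid-ok : ∀ {k} y (u : Word k) → Valid y u → ∀ t → Ok (bump (st y u t) (Vec.lookup u t))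
    valid-ok y (a ∷ u) (ok , _)  zero    = ok
    valid-ok y (a ∷ u) (_ , val) (suc t) = valid-ok (bump y a) u val t

    valid-<hi : ∀ {k} y (u : Word k) → Valid y u → ∀ t → st y u t (toℕ (Vec.lookup u t)) ℕ.< hi (toℕ (Vec.lookup u t))
    valid-<hi y (a ∷ u) (_ , val) zero    = ℕP.≤-trans (ℕP.≤-reflexive (sym (bump-self y a))) (valid-≤ (bump y a) u val a)
    valid-<hi y (a ∷ u) (_ , val) (suc t) = valid-<hi (bump y a) u val t

    st-prefix : ∀ {k} y (u u′ : Word k) t → (∀ t′ → toℕ t′ ℕ.< toℕ t → Vec.lookup u t′ ≡ Vec.lookup u′ t′) → st y u t ≡ st y u′ t
    st-prefix y (a ∷ u) (a′ ∷ u′) zero    h = refl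
    st-prefix y (a ∷ u) (a′ ∷ u′) (suc t) h with h zero (s≤s z≤n)
    ... | refl = st-prefix (bump y a) u u′ t (λ t′ lt → h (suc t′) (s≤s lt))

    -- Equal values of the monotone `s` at both ends force it to be constant between them; there `s`
    -- has no descent, hence neither has `u`, and its letters weakly decrease.
    block : ∀ {N k} (s : Vec (Fin N) (suc k)) (u : Word (suc k)) → Mono s → SubV (des u) (des s) → ∀ t t′ → toℕ t ℕ.≤ toℕ t′ →
      Vec.lookup s t ≡ Vec.lookup s t′ → toℕ (Vec.lookup u t′) ℕ.≤ toℕ (Vec.lookup u t)
    block s u ms sb zero zero le eq = ℕP.≤-refl
    block (x ∷ z ∷ s) (a ∷ b ∷ u) ms sb zero (suc t′) le eq = ℕP.≤-trans
      (block (z ∷ s) (b ∷ u) (λ t t′ le → ms (suc t) (suc t′) (s≤s le)) (sb ∘ suc) zero t′ z≤n z≡)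
      (ℕP.≮⇒≥ (λ a<b → ℕP.<-irrefl (cong toℕ x≡z) (ℕP.<ᵇ⇒< (toℕ x) (toℕ z) (subst Bool.T (sym (sb zero (Equivalence.to BoolP.T-≡ (ℕP.<⇒<ᵇ a<b)))) tt))))
      where
        x≡z : x ≡ z
        x≡z = toℕ-injective (ℕP.≤-antisym (ms zero (suc zero) z≤n)
          (ℕP.≤-trans (ms (suc zero) (suc t′) (s≤s z≤n)) (ℕP.≤-reflexive (cong toℕ (sym eq)))))
        z≡ : z ≡ Vec.lookup (z ∷ s) t′
        z≡ = trans (sym x≡z) eq
    block {k = suc k} (x ∷ s) (a ∷ b ∷ u) ms sb (suc t) (suc t′) (s≤s le) eq =
      block s (b ∷ u) (λ t t′ le → ms (suc t) (suc t′) (s≤s le)) (tail-sub s ms sb) t t′ le eq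
      where
        tail-sub : ∀ s → Mono (x ∷ s) → SubV (des (a ∷ b ∷ u)) (des (x ∷ s)) → SubV (des (b ∷ u)) (des s)
        tail-sub (z ∷ s) _ sb = sb ∘ suc

  open Cells public

  module Standard {N m : ℕ} (s : Vec (Fin N) (suc m)) (ms : Mono s) where
    private
      n = suc m

      Good : Word n → Set
      Good u = Valid lo u × SubV (des u) (des s)

      -- Inverse standardisation: the cell added at time `t` receives the entry of `s` at `t`.
      module Fill (u : Word n) (good : Good u) where
        val = proj₁ good
        placed : ∀ p → ∃ λ t → Vec.lookup u t ≡ rowF p × st lo u t (toℕ (rowF p)) ≡ ci p
        placed p = place lo u val (rowF p) (ci p)
          (subst (λ i → lo i ℕ.≤ ci p) (sym (rowF≡ p)) (proj₁ (proj₂ (cell-in p))))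
          (subst (λ i → ci p ℕ.< hi i) (sym (rowF≡ p)) (proj₂ (proj₂ (cell-in p))))
        time : Fin L → Fin n
        time p = proj₁ (placed p)
        time-row : ∀ p → toℕ (Vec.lookup u (time p)) ≡ ri p
        time-row p = trans (cong toℕ (proj₁ (proj₂ (placed p)))) (rowF≡ p)
        time-col : ∀ p → st lo u (time p) (ri p) ≡ ci p
        time-col p = subst (λ i → st lo u (time p) i ≡ ci p) (rowF≡ p) (proj₂ (proj₂ (placed p)))
        filling : Vec (Fin N) L
        filling = Vec.tabulate (λ p → Vec.lookup s (time p))
        filling≡ : ∀ p → Vec.lookup filling p ≡ Vec.lookup s (time p)
        filling≡ p = VecP.lookup∘tabulate (λ p → Vec.lookup s (time p)) p
        earlier : ∀ p q → ci p ℕ.< st lo u (time q) (ri p) → toℕ (time p) ℕ.< toℕ (time q)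
        earlier p q lt = ℕP.≰⇒> (λ le → ℕP.<-irrefl refl (ℕP.<-≤-trans lt
          (ℕP.≤-trans (st-mono lo u (time q) (time p) le (ri p)) (ℕP.≤-reflexive (time-col p)))))
        ssyt : IsSSYT lam mu N filling
        ssyt p q = row-cond , col-cond
          where
            row-cond : ri p ≡ ri q → ci p ℕ.< ci q → toℕ (Vec.lookup filling p) ℕ.≤ toℕ (Vec.lookup filling q)
            row-cond er lt = subst₂ (λ x z → toℕ x ℕ.≤ toℕ z) (sym (filling≡ p)) (sym (filling≡ q)) (ms (time p) (time q)
              (ℕP.<⇒≤ (earlier p q (ℕP.<-≤-trans lt (ℕP.≤-reflexive (sym (trans (cong (st lo u (time q)) er) (time-col q))))))))
            col-cond : ci p ≡ ci q → ri p ℕ.< ri q → toℕ (Vec.lookup filling p) ℕ.< toℕ (Vec.lookup filling q)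
            col-cond ec lt = subst₂ (λ x z → toℕ x ℕ.< toℕ z) (sym (filling≡ p)) (sym (filling≡ q))
              (ℕP.≤∧≢⇒< (ms (time p) (time q) (ℕP.<⇒≤ before)) strict)
              where
                tq = time q
                a = Vec.lookup u tq
                y′ = bump (st lo u tq) a
                -- Just after `q` is added the shape is a partition, so the higher row of `p`
                -- already extends past this column, and `p` was filled earlier.
                above : suc (ci q) ℕ.≤ st lo u tq (ri p)
                above = ℕP.≤-trans (ℕP.≤-reflexive (trans (cong suc (sym (time-col q))) (trans (cong (λ i → suc (st lo u tq i)) (sym (time-row q))) (sym (bump-self (st lo u tq) a)))))
                  (ℕP.≤-trans (ℕP.≤-reflexive (cong y′ (trans (time-row q) (sym (ℕP.m+[n∸m]≡n (ℕP.<⇒≤ lt))))))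
                  (ℕP.≤-trans (ok-mono y′ (valid-ok lo u val tq) (ri p) (ri q ℕ.∸ ri p)
                    (ℕP.≤-trans (ℕP.≤-reflexive (ℕP.m+[n∸m]≡n (ℕP.<⇒≤ lt))) (ℕP.<⇒≤ (proj₁ (cell-in q)))))
                  (ℕP.≤-reflexive (cong (ℕ._+ st lo u tq (ri p)) (δ-diff a (λ e → ℕP.<-irrefl (trans (sym e) (time-row q)) lt))))))
                before : toℕ (time p) ℕ.< toℕ tq
                before = earlier p q (ℕP.≤-trans (ℕP.≤-reflexive (cong suc ec)) above)
                -- With equal entries `block` would put the later cell `q` weakly above `p`.
                strict : toℕ (Vec.lookup s (time p)) ≢ toℕ (Vec.lookup s tq)
                strict e = ℕP.<-irrefl refl (ℕP.<-≤-trans lt (subst₂ ℕ._≤_ (time-row q) (time-row p)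
                  (block s u ms (proj₂ good) (time p) tq (ℕP.<⇒≤ before) (toℕ-injective e))))
        cell-at : ∀ t → ∃ λ p → cell p ≡ (toℕ (Vec.lookup u t) , st lo u t (toℕ (Vec.lookup u t)))
        cell-at t = cell-of (Vec.lookup u t) _ (st-≥ lo u t _) (valid-<hi lo u val t)
        time-at : ∀ t p → cell p ≡ (toℕ (Vec.lookup u t) , st lo u t (toℕ (Vec.lookup u t))) → time p ≡ t
        time-at t p e = time-unique lo u (time p) t (toℕ-injective (trans (time-row p) (cong proj₁ e)))
          (trans (trans (cong (st lo u (time p)) (time-row p)) (time-col p)) (cong proj₂ e))
        content : ∀ b → count (λ p → Vec.lookup filling p ≟F b) ≡ cntV s b
        content b = trans (ℕP.≤-antisym
          (filter-≤ (λ p → Vec.lookup filling p ≟F b) (λ t → Vec.lookup s t ≟F b) (UniqueP.allFin⁺ L) ∈P.∈-allFin (λ p _ → time p)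
            (λ p e → trans (sym (filling≡ p)) e)
            (λ p q _ _ e → cell-inj p q (cong₂ _,_ (trans (sym (time-row p)) (trans (cong (toℕ ∘ Vec.lookup u) e) (time-row q)))
              (trans (sym (time-col p)) (trans (cong₂ (st lo u) e (trans (sym (time-row p)) (trans (cong (toℕ ∘ Vec.lookup u) e) (time-row q)))) (time-col q))))))
          (filter-≤ (λ t → Vec.lookup s t ≟F b) (λ p → Vec.lookup filling p ≟F b) (UniqueP.allFin⁺ n) ∈P.∈-allFin (λ t _ → proj₁ (cell-at t))
            (λ t e → trans (filling≡ (proj₁ (cell-at t))) (trans (cong (Vec.lookup s) (time-at t _ (proj₂ (cell-at t)))) e))
            (λ t t′ _ _ e → trans (sym (time-at t _ (proj₂ (cell-at t)))) (trans (cong time e) (time-at t′ _ (proj₂ (cell-at t′)))))))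
          (count-cntV s b)

      word-injective : ∀ u u′ (gu : Good u) (gu′ : Good u′) → Fill.filling u gu ≡ Fill.filling u′ gu′ → u ≡ u′
      word-injective u u′ gu gu′ eq = vec-ext same
        where
          -- At the first difference the cell that `w` adds is added by `w′` at a later time with
          -- the same entry. By `block` its row is at most the row that `w′` chose at time `t`,
          -- contradicting that the latter is smaller.
          no-larger : ∀ w w′ (gw : Good w) (gw′ : Good w′) → Fill.filling w gw ≡ Fill.filling w′ gw′ → ∀ t →
            (∀ t′ → toℕ t′ ℕ.< toℕ t → Vec.lookup w t′ ≡ Vec.lookup w′ t′) → ¬ (toℕ (Vec.lookup w′ t) ℕ.< toℕ (Vec.lookup w t))
          no-larger w w′ gw gw′ feq t pre lt = ℕP.<-irrefl refl (ℕP.<-≤-trans lt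
            (subst (ℕ._≤ toℕ (Vec.lookup w′ t)) row≡ (block s w′ ms (proj₂ gw′) t t″ (ℕP.<⇒≤ later-time) s≡)))
            where
              module W  = Fill w gw
              module W′ = Fill w′ gw′
              a = Vec.lookup w t
              p = proj₁ (W.cell-at t)
              pc : cell p ≡ (toℕ a , st lo w t (toℕ a))
              pc = proj₂ (W.cell-at t)
              t″ = W′.time p
              row≡ : toℕ (Vec.lookup w′ t″) ≡ toℕ a
              row≡ = trans (W′.time-row p) (cong proj₁ pc)
              s≡ : Vec.lookup s t ≡ Vec.lookup s t″
              s≡ = trans (cong (Vec.lookup s) (sym (W.time-at t p pc))) (trans (sym (W.filling≡ p))
                (trans (cong (λ f → Vec.lookup f p) feq) (W′.filling≡ p)))
              col≡ : st lo w′ t″ (toℕ a) ≡ st lo w′ t (toℕ a)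
              col≡ = trans (cong (st lo w′ t″) (sym (cong proj₁ pc))) (trans (W′.time-col p) (trans (cong proj₂ pc)
                (cong (λ f → f (toℕ a)) (st-prefix lo w w′ t pre))))
              later-time : toℕ t ℕ.< toℕ t″
              later-time = ℕP.≤∧≢⇒< (ℕP.≮⇒≥ (λ gt → ℕP.<-irrefl (trans (cong (st lo w′ t″) row≡) (trans col≡ (cong (st lo w′ t) (sym row≡))))
                (st-strict lo w′ t″ t gt))) (λ e → ℕP.<-irrefl (trans (cong (toℕ ∘ Vec.lookup w′) (toℕ-injective e)) row≡) lt)
          same : ∀ t → Vec.lookup u t ≡ Vec.lookup u′ t
          same t = go (suc (toℕ t)) t ℕP.≤-refl
            where
              agree : ∀ t → (∀ t′ → toℕ t′ ℕ.< toℕ t → Vec.lookup u t′ ≡ Vec.lookup u′ t′) → Vec.lookup u t ≡ Vec.lookup u′ t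
              agree t pre with ℕP.<-cmp (toℕ (Vec.lookup u t)) (toℕ (Vec.lookup u′ t))
              ... | tri≈ _ e _ = toℕ-injective e
              ... | tri< lt _ _ = ⊥-elim (no-larger u′ u gu′ gu (sym eq) t (λ t′ l → sym (pre t′ l)) lt)
              ... | tri> _ _ gt = ⊥-elim (no-larger u u′ gu gu′ eq t pre gt)
              go : ∀ k t → toℕ t ℕ.< k → Vec.lookup u t ≡ Vec.lookup u′ t
              go (suc k) t lt = agree t (λ t′ lt′ → go k t′ (ℕP.<-≤-trans lt′ (ℕP.≤-pred lt)))

    -- Reading a tableau back: repeatedly take the lowest row whose next cell has the smallest remaining entry.
    module Read (T : Vec (Fin N) L) (ssyt : IsSSYT lam mu N T) where
      private
        remains? : ∀ (y : State) b p → Dec (y (ri p) ℕ.≤ ci p × Vec.lookup T p ≡ b)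
        remains? y b p = (y (ri p) ℕP.≤? ci p) ×-dec (Vec.lookup T p ≟F b)

        rem : State → Fin N → ℕ
        rem y b = List.length (List.filter (remains? y b) (List.allFin L))

        Next : State → Fin N → Fin ℓ → Set
        Next y a i = y (toℕ i) ℕ.< hi (toℕ i) × ∃ λ p → cell p ≡ (toℕ i , y (toℕ i)) × Vec.lookup T p ≡ a

        next? : ∀ y a i → Dec (Next y a i)
        next? y a i = (suc (y (toℕ i)) ℕP.≤? hi (toℕ i)) ×-dec any? (λ p → cell≟ (cell p) (toℕ i , y (toℕ i)) ×-dec (Vec.lookup T p ≟F a))
          where cell≟ = ProdP.≡-dec ℕP._≟_ ℕP._≟_

        Legal : State → Set
        Legal y = Ok y × (∀ i → lo i ℕ.≤ y i) × (∀ (i : Fin ℓ) → y (toℕ i) ℕ.≤ hi (toℕ i))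

        cell-next : ∀ y → Legal y → ∀ (i : Fin ℓ) → y (toℕ i) ℕ.< hi (toℕ i) → ∃ λ p → cell p ≡ (toℕ i , y (toℕ i))
        cell-next y (_ , ge , _) i lt = cell-of i (y (toℕ i)) (ge (toℕ i)) lt

        stays : ∀ {y p} {i : Fin ℓ} → cell p ≡ (toℕ i , y (toℕ i)) → y (ri p) ℕ.≤ ci p
        stays {y} e = ℕP.≤-reflexive (trans (cong (y ∘ proj₁) e) (sym (cong proj₂ e)))

        Smallest : State → Fin N → Set
        Smallest y a = ∀ p → y (ri p) ℕ.≤ ci p → toℕ a ℕ.≤ toℕ (Vec.lookup T p)

        leftmost : ∀ a p p₁ → ri p₁ ≡ ri p → ci p₁ ℕ.≤ ci p → Vec.lookup T p ≡ a → toℕ (Vec.lookup T p₁) ℕ.≤ toℕ a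
        leftmost a p p₁ er le refl = go (ℕP.m≤n⇒m<n∨m≡n le)
          where
            go : ci p₁ ℕ.< ci p ⊎ ci p₁ ≡ ci p → toℕ (Vec.lookup T p₁) ℕ.≤ toℕ (Vec.lookup T p)
            go (inj₁ l) = proj₁ (ssyt p₁ p) er l
            go (inj₂ e) = ℕP.≤-reflexive (cong (toℕ ∘ Vec.lookup T) (cell-inj p₁ p (cong₂ _,_ er e)))

        -- The next cell of the row of `p` lies weakly left of `p`, so its entry is at most `a`;
        -- minimality of `a` among the remaining entries gives equality.
        exists : ∀ y → Legal y → ∀ a → Smallest y a → ∀ p → y (ri p) ℕ.≤ ci p → Vec.lookup T p ≡ a → Next y a (rowF p)
        exists y legal a small p le Tp = lt , go (cell-next y legal (rowF p) lt)
          where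
            le′ : y (toℕ (rowF p)) ℕ.≤ ci p
            le′ = subst (λ i → y i ℕ.≤ ci p) (sym (rowF≡ p)) le
            lt : y (toℕ (rowF p)) ℕ.< hi (toℕ (rowF p))
            lt = ℕP.≤-<-trans le′ (subst (λ i → ci p ℕ.< hi i) (sym (rowF≡ p)) (proj₂ (proj₂ (cell-in p))))
            go : (∃ λ p₁ → cell p₁ ≡ (toℕ (rowF p) , y (toℕ (rowF p)))) → ∃ λ p₁ → cell p₁ ≡ (toℕ (rowF p) , y (toℕ (rowF p))) × Vec.lookup T p₁ ≡ a
            go (p₁ , e₁) = p₁ , e₁ , toℕ-injective (ℕP.≤-antisym
              (leftmost a p p₁ (trans (cong proj₁ e₁) (rowF≡ p)) (ℕP.≤-trans (ℕP.≤-reflexive (cong proj₂ e₁)) le′) Tp)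
              (small p₁ (stays {y} {p₁} {rowF p} e₁)))

        bump-ok : ∀ (y : State) i → Ok y → (∀ (k : Fin ℓ) → toℕ i ≡ suc (toℕ k) → y (suc (toℕ k)) ≢ y (toℕ k)) → Ok (bump y i)
        bump-ok y i ok ne k with toℕ i ℕP.≟ suc (toℕ k)
        ... | no _   = ℕP.≤-trans (ok k) (ℕP.m≤n+m _ (δ i (toℕ k)))
        ... | yes i≡ = ℕP.≤-trans (ℕP.≤∧≢⇒< (ok k) (ne k i≡)) (ℕP.m≤n+m _ (δ i (toℕ k)))

        bump-hi : ∀ (y : State) i → (∀ (j : Fin ℓ) → y (toℕ j) ℕ.≤ hi (toℕ j)) → y (toℕ i) ℕ.< hi (toℕ i) → ∀ (j : Fin ℓ) → bump y i (toℕ j) ℕ.≤ hi (toℕ j)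
        bump-hi y i le lt j with i ≟F j
        ... | yes refl = ℕP.≤-trans (ℕP.≤-reflexive (bump-self y i)) lt
        ... | no ne    = ℕP.≤-trans (ℕP.≤-reflexive (bump-other y ne)) (le j)

        -- If the row above had the same length, its next cell would still be empty and would lie
        -- directly above the chosen one, with a strictly smaller entry than the smallest remaining.
        no-clash : ∀ y → Legal y → ∀ a → Smallest y a → ∀ (i : Fin ℓ) p₀ → y (toℕ i) ℕ.< hi (toℕ i) → cell p₀ ≡ (toℕ i , y (toℕ i)) → Vec.lookup T p₀ ≡ a →
          ∀ (k : Fin ℓ) → toℕ i ≡ suc (toℕ k) → y (suc (toℕ k)) ≢ y (toℕ k)
        no-clash y legal a small i p₀ lt e₀ T₀ k i≡ e = go (cell-next y legal k
            (ℕP.<-≤-trans (subst (ℕ._< hi (toℕ i)) yi≡yk lt) (subst (λ j → hi j ℕ.≤ hi (toℕ k)) (sym i≡) (plam (toℕ k)))))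
          where
            yi≡yk : y (toℕ i) ≡ y (toℕ k)
            yi≡yk = trans (cong y i≡) e
            go : ¬ ∃ λ p₂ → cell p₂ ≡ (toℕ k , y (toℕ k))
            go (p₂ , e₂) = ℕP.<-irrefl refl (ℕP.<-≤-trans
              (proj₂ (ssyt p₂ p₀) (trans (cong proj₂ e₂) (trans (sym yi≡yk) (sym (cong proj₂ e₀))))
                (subst₂ ℕ._<_ (sym (cong proj₁ e₂)) (sym (cong proj₁ e₀)) (subst (toℕ k ℕ.<_) (sym i≡) ℕP.≤-refl)))
              (ℕP.≤-trans (ℕP.≤-reflexive (cong toℕ T₀)) (small p₂ (stays {y} {p₂} {k} e₂))))

        here-or-later : ∀ (y : State) (i : Fin ℓ) p p₀ → cell p₀ ≡ (toℕ i , y (toℕ i)) → y (ri p) ℕ.≤ ci p → p ≡ p₀ ⊎ bump y i (ri p) ℕ.≤ ci p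
        here-or-later y i p p₀ e₀ le with toℕ i ℕP.≟ ri p
        ... | no _   = inj₂ le
        ... | yes i≡ = go (y (ri p) ℕP.≟ ci p)
          where
            go : Dec (y (ri p) ≡ ci p) → p ≡ p₀ ⊎ suc (y (ri p)) ℕ.≤ ci p
            go (yes y≡) = inj₁ (cell-inj p p₀ (trans (cong₂ _,_ (sym i≡) (trans (sym y≡) (cong y (sym i≡)))) (sym e₀)))
            go (no y≢)  = inj₂ (ℕP.≤∧≢⇒< le y≢)

        only-p₀ : ∀ p₀ b → List.length (List.filter (λ p → (p ≟F p₀) ×-dec (Vec.lookup T p ≟F b)) (List.allFin L)) ≡ 𝟙 (Vec.lookup T p₀ ≟F b)
        only-p₀ p₀ b = trans (length-filter is-p₀? (List.allFin L)) (trans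
          (∑ℕ-pick (UniqueP.allFin⁺ L) (∈P.∈-allFin p₀) (λ p → 𝟙 (is-p₀? p)) off) on)
          where
            is-p₀? : ∀ p → Dec (p ≡ p₀ × Vec.lookup T p ≡ b)
            is-p₀? p = (p ≟F p₀) ×-dec (Vec.lookup T p ≟F b)
            off : ∀ p → p ≢ p₀ → 𝟙 (is-p₀? p) ≡ 0
            off p ne with p ≟F p₀
            ... | yes e = ⊥-elim (ne e)
            ... | no _  = refl
            on : 𝟙 (is-p₀? p₀) ≡ 𝟙 (Vec.lookup T p₀ ≟F b)
            on with p₀ ≟F p₀ | Vec.lookup T p₀ ≟F b
            ... | no ne | _     = ⊥-elim (ne refl)
            ... | yes _ | yes _ = refl
            ... | yes _ | no _  = refl

        rem-bump : ∀ (y : State) (i : Fin ℓ) p₀ → cell p₀ ≡ (toℕ i , y (toℕ i)) → ∀ b → rem y b ≡ 𝟙 (Vec.lookup T p₀ ≟F b) ℕ.+ rem (bump y i) b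
        rem-bump y i p₀ e₀ b = trans
          (filter-split (remains? y b) (λ p → (p ≟F p₀) ×-dec (Vec.lookup T p ≟F b)) (remains? (bump y i) b)
            (λ p (le , e) → go p e (here-or-later y i p p₀ e₀ le))
            (λ { p (refl , e) → (stays {y} {p₀} {i} e₀ , e) , λ (le , _) → past le })
            (λ p (le , e) → (ℕP.≤-trans (ℕP.m≤n+m _ (δ i (ri p))) le , e) , λ { (refl , _) → past le })
            (List.allFin L))
          (cong (ℕ._+ rem (bump y i) b) (only-p₀ p₀ b))
          where
            past : ¬ (bump y i (ri p₀) ℕ.≤ ci p₀)
            past le = ℕP.<-irrefl refl (ℕP.≤-trans (ℕP.≤-reflexive (sym (trans (cong (bump y i) (cong proj₁ e₀))
              (trans (bump-self y i) (cong suc (sym (cong proj₂ e₀))))))) le)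
            go : ∀ p → Vec.lookup T p ≡ b → p ≡ p₀ ⊎ bump y i (ri p) ℕ.≤ ci p →
              (p ≡ p₀ × Vec.lookup T p ≡ b) ⊎ (bump y i (ri p) ℕ.≤ ci p × Vec.lookup T p ≡ b)
            go p e (inj₁ q) = inj₁ (q , e)
            go p e (inj₂ q) = inj₂ (q , e)

        record Choice {k} (y : State) (a : Fin N) (s′ : Vec (Fin N) k) : Set where
          field
            i        : Fin ℓ
            p₀       : Fin L
            e₀       : cell p₀ ≡ (toℕ i , y (toℕ i))
            T₀       : Vec.lookup T p₀ ≡ a
            lowest   : ∀ (j : Fin ℓ) → toℕ i ℕ.< toℕ j → ¬ Next y a j
            ok′      : Ok (bump y i)
            legal′   : Legal (bump y i)
            eq′      : ∀ b → rem (bump y i) b ≡ cntV s′ b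

        abstract
          choose : ∀ {k} y → Legal y → ∀ a (s′ : Vec (Fin N) k) → Mono (a ∷ s′) → (∀ b → rem y b ≡ cntV (a ∷ s′) b) → Choice y a s′
          choose y legal a s′ ms′ eq = build (maximal (next? y a) (start-row (filter-∃ (remains? y a) (List.allFin L) (λ z → cnt≢0 (trans (sym (eq a)) z)))))
            where
              small : Smallest y a
              small p le = go (cntV-∃ (a ∷ s′) (Vec.lookup T p) (λ z → filter-nonzero (remains? y (Vec.lookup T p)) (∈P.∈-allFin p) (le , refl)
                (trans (eq (Vec.lookup T p)) z)))
                where
                  go : (∃ λ t → Vec.lookup (a ∷ s′) t ≡ Vec.lookup T p) → toℕ a ℕ.≤ toℕ (Vec.lookup T p)
                  go (t , e) = subst (λ x → toℕ a ℕ.≤ toℕ x) e (ms′ zero t z≤n)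
              cnt≢0 : cntV (a ∷ s′) a ≢ 0
              cnt≢0 with a ≟F a
              ... | yes _ = λ ()
              ... | no ne = ⊥-elim (ne refl)
              start-row : (∃ λ p → y (ri p) ℕ.≤ ci p × Vec.lookup T p ≡ a) → ∃ (Next y a)
              start-row (p , le , Tp) = rowF p , exists y legal a small p le Tp
              build : (∃ λ i → Next y a i × (∀ (j : Fin ℓ) → toℕ i ℕ.< toℕ j → ¬ Next y a j)) → Choice y a s′
              build (i , (lt , p₀ , e₀ , T₀) , mx) = record
                { i = i ; p₀ = p₀ ; e₀ = e₀ ; T₀ = T₀ ; lowest = mx ; ok′ = ok″
                ; legal′ = ok″ , (λ j → ℕP.≤-trans (proj₁ (proj₂ legal) j) (ℕP.m≤n+m _ (δ i j))) , bump-hi y i (proj₂ (proj₂ legal)) lt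
                ; eq′ = λ b → ℕP.+-cancelˡ-≡ (𝟙 (a ≟F b)) _ _ (trans (cong (λ x → 𝟙 (x ≟F b) ℕ.+ rem (bump y i) b) (sym T₀))
                    (trans (sym (rem-bump y i p₀ e₀ b)) (eq b))) }
                where
                  ok″ : Ok (bump y i)
                  ok″ = bump-ok y i (proj₁ legal) (no-clash y legal a small i p₀ lt e₀ T₀)

        Fills : ∀ {k} → State → Vec (Fin N) k → Word k → Set
        Fills y s u = ∀ t p → cell p ≡ (toℕ (Vec.lookup u t) , st y u t (toℕ (Vec.lookup u t))) → Vec.lookup T p ≡ Vec.lookup s t

        Reads : ∀ {k} → State → Vec (Fin N) k → Set
        Reads {k} y s = Σ (Word k) λ u → Valid y u × Fills y s u × (∀ (t t′ : Fin k) → toℕ t′ ≡ suc (toℕ t) →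
          Vec.lookup s t ≡ Vec.lookup s t′ → toℕ (Vec.lookup u t′) ℕ.≤ toℕ (Vec.lookup u t))

        read : ∀ {k} y (s : Vec (Fin N) k) → Legal y → Mono s → (∀ b → rem y b ≡ cntV s b) → Reads y s
        read y [] legal ms eq = [] , done , (λ ()) , λ ()
          where
            done : End y
            done i with ℕP.m≤n⇒m<n∨m≡n (proj₂ (proj₂ legal) i)
            ... | inj₂ e  = e
            ... | inj₁ lt = let p , e = cell-next y legal i lt in
              ⊥-elim (filter-nonzero (remains? y (Vec.lookup T p)) (∈P.∈-allFin p) (stays {y} {p} {i} e , refl) (eq (Vec.lookup T p)))
        read {suc k} y (a ∷ s) legal ms eq = extend (choose y legal a s ms eq)
          where
            extend : Choice y a s → Reads y (a ∷ s)
            extend ch = join (read (bump y i) s legal′ (λ t t′ le → ms (suc t) (suc t′) (s≤s le)) eq′)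
              where
                open Choice ch
                first : ∀ {k} y (u : Word k) t → toℕ t ≡ 0 → st y u t ≡ y
                first y (a ∷ u) zero _ = refl
                join : Reads (bump y i) s → Reads y (a ∷ s)
                join (u , val , fills , fall) = i ∷ u , (ok′ , val) , fills′ , falling
                  where
                    fills′ : Fills y (a ∷ s) (i ∷ u)
                    fills′ zero    p e = trans (cong (Vec.lookup T) (cell-inj p p₀ (trans e (sym e₀)))) T₀
                    fills′ (suc t) p e = fills t p e
                    -- Were the following letter with the same entry in a lower row, the next cell
                    -- of that row, unaffected by `i`, would have been available already, and `i`
                    -- would not have been the lowest choice.
                    below-i : ∀ t′ → toℕ t′ ≡ 0 → a ≡ Vec.lookup s t′ → ¬ (toℕ i ℕ.< toℕ (Vec.lookup u t′))
                    below-i t′ t′≡0 a≡ i<j = go (cell-of j _ (ℕP.≤-trans (proj₁ (proj₂ legal′) (toℕ j)) (st-≥ (bump y i) u t′ (toℕ j))) bound)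
                      where
                        j = Vec.lookup u t′
                        old : st (bump y i) u t′ (toℕ j) ≡ y (toℕ j)
                        old = trans (cong (λ f → f (toℕ j)) (first (bump y i) u t′ t′≡0)) (bump-other y (λ e → ℕP.<-irrefl (cong toℕ e) i<j))
                        bound : st (bump y i) u t′ (toℕ j) ℕ.< hi (toℕ j)
                        bound = valid-<hi (bump y i) u val t′
                        go : ¬ ∃ λ p → cell p ≡ (toℕ j , st (bump y i) u t′ (toℕ j))
                        go (p , pc) = lowest j i<j (subst (ℕ._< hi (toℕ j)) old bound , p , trans pc (cong (toℕ j ,_) old) , trans (fills t′ p pc) (sym a≡))
                    falling : ∀ (t t′ : Fin (suc k)) → toℕ t′ ≡ suc (toℕ t) → Vec.lookup (a ∷ s) t ≡ Vec.lookup (a ∷ s) t′ →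
                      toℕ (Vec.lookup (i ∷ u) t′) ℕ.≤ toℕ (Vec.lookup (i ∷ u) t)
                    falling (suc t) (suc t′) e eq = fall t t′ (ℕP.suc-injective e) eq
                    falling zero    (suc t′) e a≡ = ℕP.≮⇒≥ (below-i t′ (ℕP.suc-injective e) a≡)

      module _ (content : ∀ b → count (λ p → Vec.lookup T p ≟F b) ≡ cntV s b) where
        private
          result : Reads lo s
          result = read lo s (oklo , (λ _ → ℕP.≤-refl) , (λ i → sub (toℕ i))) ms (λ b → trans
            (filter-⇔ (remains? lo b) (λ p → Vec.lookup T p ≟F b) (λ p → proj₂) (λ p e → proj₁ (proj₂ (cell-in p)) , e) (List.allFin L)) (content b))

        reading : Word n
        reading = proj₁ result

        reading-valid : Valid lo reading
        reading-valid = proj₁ (proj₂ result)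

        reading-des : SubV (des reading) (des s)
        reading-des i eq = by-cases (suc (toℕ (Vec.lookup s (Fin.inject₁ i))) ℕP.≤? toℕ (Vec.lookup s (suc i)))
          where
            asc : toℕ (Vec.lookup reading (Fin.inject₁ i)) ℕ.< toℕ (Vec.lookup reading (suc i))
            asc = ℕP.<ᵇ⇒< _ _ (subst Bool.T (trans (sym eq) (des-at reading i)) tt)
            by-cases : Dec (toℕ (Vec.lookup s (Fin.inject₁ i)) ℕ.< toℕ (Vec.lookup s (suc i))) → Vec.lookup (des s) i ≡ true
            by-cases (yes lt) = trans (des-at s i) (Equivalence.to BoolP.T-≡ (ℕP.<⇒<ᵇ lt))
            by-cases (no nlt) = ⊥-elim (ℕP.<-irrefl refl (ℕP.<-≤-trans asc (proj₂ (proj₂ (proj₂ result)) (Fin.inject₁ i) (suc i)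
              (cong suc (sym (FinP.toℕ-inject₁ i))) (toℕ-injective (ℕP.≤-antisym (ms (Fin.inject₁ i) (suc i) (ℕP.≤-trans (ℕP.≤-reflexive (FinP.toℕ-inject₁ i)) (ℕP.n≤1+n _)))
                (ℕP.≮⇒≥ nlt))))))

        reading-fills : ∀ t p → cell p ≡ (toℕ (Vec.lookup reading t) , st lo reading t (toℕ (Vec.lookup reading t))) → Vec.lookup T p ≡ Vec.lookup s t
        reading-fills = proj₁ (proj₂ (proj₂ result))

    private
      good? : ∀ u → Dec (Good u)
      good? u = valid? lo u ×-dec subV? (des u) (des s)

      reading-injective : ∀ T T′ s₁ s₂ c₁ c₂ → Read.reading T s₁ c₁ ≡ Read.reading T′ s₂ c₂ → T ≡ T′
      reading-injective T T′ s₁ s₂ c₁ c₂ eq = vec-ext same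
        where
          same : ∀ p → Vec.lookup T p ≡ Vec.lookup T′ p
          same p = go (Fill.placed (Read.reading T s₁ c₁) (Read.reading-valid T s₁ c₁ , Read.reading-des T s₁ c₁) p)
            where
              go : (∃ λ t → Vec.lookup (Read.reading T s₁ c₁) t ≡ rowF p × st lo (Read.reading T s₁ c₁) t (toℕ (rowF p)) ≡ ci p) → Vec.lookup T p ≡ Vec.lookup T′ p
              go (t , r≡ , c≡) = trans (Read.reading-fills T s₁ c₁ t p at)
                (sym (Read.reading-fills T′ s₂ c₂ t p (subst (λ u → cell p ≡ (toℕ (Vec.lookup u t) , st lo u t (toℕ (Vec.lookup u t)))) eq at)))
                where
                  at : cell p ≡ (toℕ (Vec.lookup (Read.reading T s₁ c₁) t) , st lo (Read.reading T s₁ c₁) t (toℕ (Vec.lookup (Read.reading T s₁ c₁) t)))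
                  at = cong₂ _,_ (sym (trans (cong toℕ r≡) (rowF≡ p))) (sym (trans (cong (λ i → st lo (Read.reading T s₁ c₁) t (toℕ i)) r≡) c≡))

    -- Standardisation: a filling with content `e` amounts to a standard tableau whose descents all
    -- occur where the sorted word `s` increases strictly.
    skewSchur-words : ∀ e → (∀ b → cntV s b ≡ e b) → skewSchurCoeff lam mu N e ≡
      List.length (List.filter (λ u → valid? lo u ×-dec subV? (des u) (des s)) (allVecs ℓ n))
    skewSchur-words e se = ℕP.≤-antisym
      (filter-≤ (ssytWithContent? lam mu N e) good? (allVecs-unique N L) allVecs-complete
        (λ T (ss , ct) → Read.reading T ss (λ b → trans (ct b) (sym (se b))))
        (λ T (ss , ct) → Read.reading-valid T ss (λ b → trans (ct b) (sym (se b))) , Read.reading-des T ss (λ b → trans (ct b) (sym (se b))))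
        (λ T T′ (ss , ct) (ss′ , ct′) → reading-injective T T′ ss ss′ _ _))
      (filter-≤ good? (ssytWithContent? lam mu N e) (allVecs-unique ℓ n) allVecs-complete
        (λ u g → Fill.filling u g) (λ u g → Fill.ssyt u g , λ b → trans (Fill.content u g b) (se b)) (λ u u′ g g′ → word-injective u u′ g g′))

-- Every shape contains a square, can be cut, or is a connected ribbon.

module Shape (lam mu : List ℕ) (plam : IsPartition lam) (pmu : IsPartition mu) (sub : mu ⊆P lam) where
  open Fillings lam mu plam pmu sub

  private
    row-beyond : ∀ (xs : List ℕ) i → List.length xs ℕ.≤ i → row xs i ≡ 0
    row-beyond []       i       le       = refl
    row-beyond (x ∷ xs) (suc i) (s≤s le) = row-beyond xs i le

    in-rows : ∀ i → 0 ℕ.< hi i → i ℕ.< ℓ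
    in-rows i pos = ℕP.≰⇒> (λ le → ℕP.<-irrefl (sym (row-beyond lam i le)) pos)

    Sh : ℕ × ℕ → Set
    Sh a = InShape lam mu (proj₁ a) (proj₂ a)

    path-trans : ∀ {a b c} → Path lam mu a b → Path lam mu b c → Path lam mu a c
    path-trans here         q = q
    path-trans (step x s p) q = step x s (path-trans p q)

    adj-sym : ∀ {a b} → Adj a b → Adj b a
    adj-sym (right i j) = left i j
    adj-sym (left i j)  = right i j
    adj-sym (down i j)  = up i j
    adj-sym (up i j)    = down i j

    path-sym : ∀ {a b} → Sh a → Path lam mu a b → Path lam mu b a
    path-sym sa here         = here
    path-sym sa (step x s p) = path-trans (path-sym s p) (step (adj-sym x) sa here)

    go-right : ∀ d i j → Sh (i , j) → Sh (i , d ℕ.+ j) → Path lam mu (i , j) (i , d ℕ.+ j)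
    go-right zero    i j s s′ = here
    go-right (suc d) i j s s′ = path-trans (go-right d i j s mid) (step (right i (d ℕ.+ j)) s′ here)
      where
        mid : Sh (i , d ℕ.+ j)
        mid = ℕP.≤-trans (proj₁ s) (ℕP.m≤n+m j d) , ℕP.<-trans ℕP.≤-refl (proj₂ s′)

    along-row : ∀ i j j′ → Sh (i , j) → Sh (i , j′) → Path lam mu (i , j) (i , j′)
    along-row i j j′ s s′ with ℕP.≤-total j j′
    ... | inj₁ le = subst (λ k → Path lam mu (i , j) (i , k)) (ℕP.m∸n+n≡m le)
            (go-right (j′ ℕ.∸ j) i j s (subst (λ k → Sh (i , k)) (sym (ℕP.m∸n+n≡m le)) s′))
    ... | inj₂ ge = path-sym s′ (subst (λ k → Path lam mu (i , j′) (i , k)) (ℕP.m∸n+n≡m ge)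
            (go-right (j ℕ.∸ j′) i j′ s′ (subst (λ k → Sh (i , k)) (sym (ℕP.m∸n+n≡m ge)) s)))

    -- Encodes a 2 × 2 square in columns lo a and lo a + 1: row a begins at lo a, the next row
    -- begins no later, and row a is at least as long.
    Square₂ : Fin ℓ → Set
    Square₂ a = suc (suc (lo (toℕ a))) ℕ.≤ hi (suc (toℕ a))

    Gap : Fin ℓ → Set
    Gap r = hi (suc (toℕ r)) ℕ.≤ lo (toℕ r)
      × (∃ λ (a : Fin ℓ) → toℕ a ℕ.≤ toℕ r × lo (toℕ a) ℕ.< hi (toℕ a))
      × (∃ λ (b : Fin ℓ) → toℕ r ℕ.< toℕ b × lo (toℕ b) ℕ.< hi (toℕ b))

    gap? : ∀ r → Dec (Gap r)
    gap? r = (hi (suc (toℕ r)) ℕP.≤? lo (toℕ r))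
      ×-dec (any? (λ a → (toℕ a ℕP.≤? toℕ r) ×-dec (suc (lo (toℕ a)) ℕP.≤? hi (toℕ a)))
      ×-dec any? (λ b → (suc (toℕ r) ℕP.≤? toℕ b) ×-dec (suc (lo (toℕ b)) ℕP.≤? hi (toℕ b))))

    ribbon : ¬ ∃ Square₂ → IsRibbon lam mu
    ribbon ¬sq i j (s , _ , _ , s′) = ¬sq (Fin.fromℕ< i<ℓ , subst (λ k → suc (suc (lo k)) ℕ.≤ hi (suc k)) (sym (FinP.toℕ-fromℕ< i<ℓ))
      (ℕP.≤-trans (s≤s (s≤s (proj₁ s))) (proj₂ s′)))
      where i<ℓ = in-rows i (ℕP.≤-trans (s≤s z≤n) (proj₂ s))

    module _ (¬gap : ¬ ∃ Gap) where
      linked : ∀ i j i′ j′ → i ℕ.< i′ → Sh (i , j) → Sh (i′ , j′) → lo i ℕ.< hi (suc i)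
      linked i j i′ j′ lt s s′ = ℕP.≰⇒> (λ le → ¬gap (a , subst₂ (λ p q → hi (suc p) ℕ.≤ lo q) (sym a≡) (sym a≡) le
          , (a , ℕP.≤-refl , subst (λ k → lo k ℕ.< hi k) (sym a≡) (nonempty s))
          , (b , subst₂ ℕ._<_ (sym a≡) (sym b≡) lt , subst (λ k → lo k ℕ.< hi k) (sym b≡) (nonempty s′))))
        where
          nonempty : ∀ {i j} → Sh (i , j) → lo i ℕ.< hi i
          nonempty (l , u) = ℕP.≤-<-trans l u
          i<ℓ = in-rows i (ℕP.≤-trans (s≤s z≤n) (proj₂ s))
          i′<ℓ = in-rows i′ (ℕP.≤-trans (s≤s z≤n) (proj₂ s′))
          a = Fin.fromℕ< i<ℓ
          b = Fin.fromℕ< i′<ℓ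
          a≡ = FinP.toℕ-fromℕ< i<ℓ
          b≡ = FinP.toℕ-fromℕ< i′<ℓ

      -- Move to the leftmost cell of the row. The cell below it is in the shape, since `mu`
      -- decreases and `linked` excludes a gap.
      go-down : ∀ d i j j′ → Sh (i , j) → Sh (d ℕ.+ i , j′) → Path lam mu (i , j) (d ℕ.+ i , j′)
      go-down zero    i j j′ s s′ = along-row i j j′ s s′
      go-down (suc d) i j j′ s s′ = path-trans (along-row i j (lo i) s corner)
        (step (down i (lo i)) below (subst (λ k → Path lam mu (suc i , lo i) (k , j′)) (ℕP.+-suc d i)
          (go-down d (suc i) (lo i) j′ below (subst (λ k → Sh (k , j′)) (sym (ℕP.+-suc d i)) s′))))
        where
          link = linked i j (suc d ℕ.+ i) j′ (s≤s (ℕP.m≤n+m i d)) s s′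
          corner : Sh (i , lo i)
          corner = ℕP.≤-refl , ℕP.<-≤-trans link (plam i)
          below : Sh (suc i , lo i)
          below = pmu i , link

      connected : ∃ Sh → IsConnected lam mu
      connected ex = ex , route
        where
          route : ∀ a b → Sh a → Sh b → Path lam mu a b
          route (i , j) (i′ , j′) s s′ with ℕP.≤-total i i′
          ... | inj₁ le = subst (λ k → Path lam mu (i , j) (k , j′)) (ℕP.m∸n+n≡m le)
                  (go-down (i′ ℕ.∸ i) i j j′ s (subst (λ k → Sh (k , j′)) (sym (ℕP.m∸n+n≡m le)) s′))
          ... | inj₂ ge = path-sym s′ (subst (λ k → Path lam mu (i′ , j′) (k , j)) (ℕP.m∸n+n≡m ge)
                  (go-down (i ℕ.∸ i′) i′ j′ j s′ (subst (λ k → Sh (k , j)) (sym (ℕP.m∸n+n≡m ge)) s)))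

    two-cells : ∀ {c d : ℕ × ℕ} → c ∈ cells lam mu → d ∈ cells lam mu → c ≢ d → 2 ℕ.≤ List.length (cells lam mu)
    two-cells {c} {d} c∈ d∈ ne = unique-⊆-length {xs = c ∷ d ∷ []} ((ne ∷ []) ∷ [] ∷ [])
      (λ { (here refl) → c∈ ; (there (here refl)) → d∈ })

    some-cell : ∀ {m} → List.length (cells lam mu) ≡ suc m → ∃ Sh
    some-cell len with cells lam mu in eq
    ... | c ∷ _ = c , proj₂ (∈cells⁻ (subst (c ∈_) (sym eq) (here refl)))

  -- Lack of squares gives a ribbon, and lack of gaps between nonempty rows gives connectedness, so
  -- one of the two constructions applies. Both work with n ≥ 2, which `size` obtains from two
  -- distinct cells.
  cyclic-numbers : ∀ m → List.length (cells lam mu) ≡ suc m → ¬ IsConnectedRibbon lam mu → CyclicNumbers ℓ lo hi m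
  cyclic-numbers m len ¬cr with any? (λ a → suc (suc (lo (toℕ a))) ℕP.≤? hi (suc (toℕ a)))
  ... | yes (a , sq) = size m len
    where
      a′<ℓ = in-rows (suc (toℕ a)) (ℕP.≤-trans (s≤s z≤n) sq)
      a′≡ = FinP.toℕ-fromℕ< a′<ℓ
      size : ∀ m → List.length (cells lam mu) ≡ suc m → CyclicNumbers ℓ lo hi m
      size zero len = ⊥-elim (ℕP.<-irrefl (sym len) (two-cells
        (∈cells⁺ (toℕ<n a) ℕP.≤-refl (ℕP.<-≤-trans (ℕP.<-trans ℕP.≤-refl sq) (plam (toℕ a))))
        (∈cells⁺ (toℕ<n a) (ℕP.n≤1+n _) (ℕP.<-≤-trans sq (plam (toℕ a)))) (λ e → ℕP.1+n≢n (sym (cong proj₂ e)))))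
      size (suc m) len = TwoByTwo.numbers ℓ lo hi oklo plam m a (Fin.fromℕ< a′<ℓ) a′≡ (subst (λ k → suc (suc (lo (toℕ a))) ℕ.≤ hi k) (sym a′≡) sq)
  ... | no ¬sq with any? gap?
  ...   | no ¬gap = ⊥-elim (¬cr (ribbon ¬sq , connected ¬gap (some-cell len)))
  ...   | yes (r , gap , (a , a≤r , ca) , (b , r<b , cb)) = size m len
    where
      size : ∀ m → List.length (cells lam mu) ≡ suc m → CyclicNumbers ℓ lo hi m
      size zero len = ⊥-elim (ℕP.<-irrefl (sym len) (two-cells (∈cells⁺ (toℕ<n a) ℕP.≤-refl ca) (∈cells⁺ (toℕ<n b) ℕP.≤-refl cb)
        (λ e → ℕP.<-irrefl (cong proj₁ e) (ℕP.≤-<-trans a≤r r<b))))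
      size (suc m) len = Cut.numbers ℓ lo hi oklo m (toℕ r) gap a b a≤r r<b ca cb

-- Cyclic shifts, sorted words, and arithmetic modulo n.

nx-next : ∀ {k} r (j : Fin (suc k)) → nx r (nextF j) ≡ nextF (nx r j)
nx-next zero    j = refl
nx-next (suc r) j = cong nextF (nx-next r j)

nx-zero : ∀ {k} (i : Fin (suc k)) → nx (toℕ i) zero ≡ i
nx-zero = FinI.<-weakInduction (λ i → nx (toℕ i) zero ≡ i) refl
  (λ i eq → trans (cong nextF (subst (λ r → nx r zero ≡ Fin.inject₁ i) (FinP.toℕ-inject₁ i) eq)) (next-inject i))

nx-period : ∀ {k} (j : Fin (suc k)) → nx (suc k) j ≡ j
nx-period {k} = all-positions (λ j → nx (suc k) j ≡ j) (λ j eq → trans (nx-next (suc k) j) (cong nextF eq)) zero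
  (trans (cong nextF (subst (λ r → nx r zero ≡ Fin.fromℕ k) (FinP.toℕ-fromℕ k) (nx-zero (Fin.fromℕ k)))) (next-fromℕ k))

pr-period : ∀ {k} (j : Fin (suc k)) → pr (suc k) j ≡ j
pr-period {k} j = trans (cong (pr (suc k)) (sym (nx-period j))) (pr-nx (suc k) j)

nx-pr : ∀ {k} r (j : Fin (suc k)) → nx r (pr r j) ≡ j
nx-pr r j = pr-injective r (pr-nx r (pr r j))

rotV⁻¹s : ∀ {A : Set} {k} → ℕ → Vec A (suc k) → Vec A (suc k)
rotV⁻¹s zero    C = C
rotV⁻¹s (suc r) C = rotV⁻¹ (rotV⁻¹s r C)

lookup-rotV⁻¹ : ∀ {A : Set} {k} (C : Vec A (suc k)) j → Vec.lookup (rotV⁻¹ C) j ≡ Vec.lookup C (nextF j)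
lookup-rotV⁻¹ C j = trans (cong (Vec.lookup (rotV⁻¹ C)) (sym (prev-next j)))
  (trans (sym (lookup-rotV (rotV⁻¹ C) (nextF j))) (cong (λ D → Vec.lookup D (nextF j)) (rotV-rotV⁻¹ C)))

lookup-rotV⁻¹s : ∀ {A : Set} {k} r (C : Vec A (suc k)) j → Vec.lookup (rotV⁻¹s r C) j ≡ Vec.lookup C (nx r j)
lookup-rotV⁻¹s zero    C j = refl
lookup-rotV⁻¹s (suc r) C j = trans (lookup-rotV⁻¹ (rotV⁻¹s r C) j) (trans (lookup-rotV⁻¹s r C (nextF j)) (cong (Vec.lookup C) (nx-next r j)))

rotVs-rotV⁻¹s : ∀ {A : Set} {k} r (C : Vec A (suc k)) → rotVs r (rotV⁻¹s r C) ≡ C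
rotVs-rotV⁻¹s r C = vec-ext (λ j → trans (lookup-rotVs r (rotV⁻¹s r C) j) (trans (lookup-rotV⁻¹s r C (pr r j)) (cong (Vec.lookup C) (nx-pr r j))))

rotV⁻¹s-rotVs : ∀ {A : Set} {k} r (C : Vec A (suc k)) → rotV⁻¹s r (rotVs r C) ≡ C
rotV⁻¹s-rotVs r C = vec-ext (λ j → trans (lookup-rotV⁻¹s r (rotVs r C) j) (trans (lookup-rotVs r C (nx r j)) (cong (Vec.lookup C) (pr-nx r j))))

-- The entries of C read cyclically from position k on.
turn : ∀ {A : Set} {k} → Vec A (suc k) → Fin (suc k) → Vec A (suc k)
turn C k = rotV⁻¹s (toℕ k) C

turn-next : ∀ {A : Set} {m} (C : Vec A (suc m)) k → turn C (nextF k) ≡ rotV⁻¹ (turn C k)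
turn-next {m = m} C k with view k
... | ‵fromℕ     = trans (vec-ext (λ j → sym (trans (lookup-rotV⁻¹s (suc m) C j) (cong (Vec.lookup C) (nx-period j)))))
                     (cong (λ r → rotV⁻¹s (suc r) C) (sym (FinP.toℕ-fromℕ m)))
... | ‵inject₁ i = cong (λ r → rotV⁻¹s (suc r) C) (sym (FinP.toℕ-inject₁ i))

rotV-turn : ∀ {A : Set} {m} (C : Vec A (suc m)) k → rotV (turn C k) ≡ turn C (prevF k)
rotV-turn C k = trans (cong (rotV ∘ turn C) (sym (next-prev k))) (trans (cong rotV (turn-next C (prevF k))) (rotV-rotV⁻¹ (turn C (prevF k))))

rotVs-turn : ∀ {A : Set} {m} r (C : Vec A (suc m)) k → rotVs r (turn C k) ≡ turn C (pr r k)
rotVs-turn zero    C k = refl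
rotVs-turn (suc r) C k = trans (cong rotV (rotVs-turn r C k)) (trans (rotV-turn C (pr r k)) (cong (turn C) (prev-pr r k)))

mod-periodic : ∀ {m} (x : Fin (suc m)) a → a ≡ toℕ x ℕ.+ suc m → a mod suc m ≡ x
mod-periodic {m} x a refl = toℕ-injective (trans (FinP.toℕ-fromℕ< _) (trans (DivMod.[m+n]%n≡m%n (toℕ x) (suc m)) (DivMod.m<n⇒m%n≡m (toℕ<n x))))

mod-small : ∀ {m} (x : Fin (suc m)) a → a ≡ toℕ x → a mod suc m ≡ x
mod-small x a refl = toℕ-injective (trans (FinP.toℕ-fromℕ< _) (DivMod.m<n⇒m%n≡m (toℕ<n x)))

mod-shift : ∀ {m} a → (a ℕ.+ suc m) mod suc m ≡ a mod suc m
mod-shift {m} a = toℕ-injective (trans (FinP.toℕ-fromℕ< _) (trans (DivMod.[m+n]%n≡m%n a (suc m)) (sym (FinP.toℕ-fromℕ< _))))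

-- Adding n - r modulo n means `r` steps back; each step passes to the predecessor, and at position
-- 0 the extra n is absorbed by the modulus.
mod-pr : ∀ {m} r → r ℕ.≤ suc m → ∀ x → (toℕ x ℕ.+ (suc m ℕ.∸ r)) mod suc m ≡ pr r x
mod-pr zero le x = mod-periodic x _ refl
mod-pr {m} (suc r) (s≤s le) zero = trans (sym (mod-shift (m ℕ.∸ r))) (trans (cong (_mod suc m) arith) (mod-pr r (ℕP.m≤n⇒m≤1+n le) (Fin.fromℕ m)))
  where
    arith : m ℕ.∸ r ℕ.+ suc m ≡ toℕ (Fin.fromℕ m) ℕ.+ (suc m ℕ.∸ r)
    arith = trans (ℕP.+-suc (m ℕ.∸ r) m) (trans (cong suc (ℕP.+-comm (m ℕ.∸ r) m)) (trans (sym (ℕP.+-suc m (m ℕ.∸ r)))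
      (cong₂ ℕ._+_ (sym (FinP.toℕ-fromℕ m)) (sym (ℕP.+-∸-assoc 1 le)))))
mod-pr {m} (suc r) (s≤s le) (suc x) = trans (cong (_mod suc m) arith) (mod-pr r (ℕP.m≤n⇒m≤1+n le) (Fin.inject₁ x))
  where
    arith : suc (toℕ x) ℕ.+ (m ℕ.∸ r) ≡ toℕ (Fin.inject₁ x) ℕ.+ (suc m ℕ.∸ r)
    arith = trans (sym (ℕP.+-suc (toℕ x) (m ℕ.∸ r))) (cong₂ ℕ._+_ (sym (FinP.toℕ-inject₁ x)) (sym (ℕP.+-∸-assoc 1 le)))

prevP≡ : ∀ m k → prevP m k ≡ prevF k
prevP≡ m k = mod-pr 1 (s≤s z≤n) k

nextP≡ : ∀ m k → nextP m k ≡ nextF k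
nextP≡ m k with view k
... | ‵fromℕ     = mod-periodic zero (toℕ (Fin.fromℕ m) ℕ.+ 1) (trans (cong (ℕ._+ 1) (FinP.toℕ-fromℕ m)) (ℕP.+-comm m 1))
... | ‵inject₁ i = mod-small (suc i) _ (trans (cong (ℕ._+ 1) (FinP.toℕ-inject₁ i)) (ℕP.+-comm (toℕ i) 1))

shift≡ : ∀ m J i → shift m J i ≡ rotVs (toℕ i) J
shift≡ m J i = vec-ext (λ x → trans (VecP.lookup∘tabulate (λ y → Vec.lookup J ((toℕ y ℕ.+ (suc m ℕ.∸ toℕ i)) mod suc m)) x)
  (trans (cong (Vec.lookup J) (mod-pr (toℕ i) (ℕP.<⇒≤ (toℕ<n i)) x)) (sym (lookup-rotVs (toℕ i) J x))))

shift-next : ∀ m J i → shift m J (nextF i) ≡ rotV (shift m J i)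
shift-next m J i = trans (shift≡ m J (nextF i)) (trans (go i) (cong rotV (sym (shift≡ m J i))))
  where
    go : ∀ i → rotVs (toℕ (nextF i)) J ≡ rotV (rotVs (toℕ i) J)
    go i with view i
    ... | ‵fromℕ     = trans (vec-ext (λ j → sym (trans (lookup-rotVs (suc m) J j) (cong (Vec.lookup J) (pr-period j)))))
                         (cong (λ r → rotVs (suc r) J) (sym (FinP.toℕ-fromℕ m)))
    ... | ‵inject₁ i = cong (λ r → rotVs (suc r) J) (sym (FinP.toℕ-inject₁ i))

turn-is-shift : ∀ m J k → ∃ λ i → turn J k ≡ shift m J i
turn-is-shift m J = all-positions (λ k → ∃ λ i → turn J k ≡ shift m J i)
  (λ k (i , eq) → prevF i , trans (turn-next J k) (trans (cong rotV⁻¹ (trans eq (trans (cong (shift m J) (sym (next-prev i))) (shift-next m J (prevF i)))))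
    (rotV⁻¹-rotV (shift m J (prevF i))))) zero (zero , sym (shift≡ m J zero))

turn-invariant : ∀ {A B : Set} {m} (f : Vec A (suc m) → B) → (∀ C → f (rotV⁻¹ C) ≡ f C) → ∀ C k → f (turn C k) ≡ f C
turn-invariant f inv C k = go (toℕ k)
  where
    go : ∀ r → f (rotV⁻¹s r C) ≡ f C
    go zero    = refl
    go (suc r) = trans (inv (rotV⁻¹s r C)) (go r)

cntV-∷ʳ : ∀ {N k} (D : Vec (Fin N) k) x b → cntV (D Vec.∷ʳ x) b ≡ cntV (x ∷ D) b
cntV-∷ʳ []      x b = refl
cntV-∷ʳ (y ∷ D) x b = trans (cong (𝟙 (y ≟F b) ℕ.+_) (cntV-∷ʳ D x b)) (x∙yz≈y∙xz (𝟙 (y ≟F b)) (𝟙 (x ≟F b)) (cntV D b))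

cntV-turn : ∀ {N m} (w : Vec (Fin N) (suc m)) k b → cntV (turn w k) b ≡ cntV w b
cntV-turn w k b = turn-invariant (λ u → cntV u b) (λ { (x ∷ D) → cntV-∷ʳ D x b }) w k

mono-∷ : ∀ {N k} (x : Fin N) (s : Vec (Fin N) k) → (∀ t → toℕ x ℕ.≤ toℕ (Vec.lookup s t)) → Mono s → Mono (x ∷ s)
mono-∷ x s h ms zero    zero     le       = ℕP.≤-refl
mono-∷ x s h ms zero    (suc t′) le       = h t′
mono-∷ x s h ms (suc t) (suc t′) (s≤s le) = ms t t′ le

mono-tail : ∀ {N k} {x : Fin N} {s : Vec (Fin N) k} → Mono (x ∷ s) → Mono s
mono-tail ms t t′ le = ms (suc t) (suc t′) (s≤s le)

mono-consecutive : ∀ {N k} (s : Vec (Fin N) (suc k)) → (∀ i → toℕ (Vec.lookup s (Fin.inject₁ i)) ℕ.≤ toℕ (Vec.lookup s (suc i))) → Mono s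
mono-consecutive (x ∷ [])    h = mono-∷ x [] (λ ()) (λ ())
mono-consecutive (x ∷ y ∷ s) h = mono-∷ x (y ∷ s) (λ t → ℕP.≤-trans (h zero) (rec zero t z≤n)) rec
  where rec = mono-consecutive (y ∷ s) (h ∘ suc)

mono-unique : ∀ {N k} (s s′ : Vec (Fin N) k) → Mono s → Mono s′ → (∀ b → cntV s b ≡ cntV s′ b) → s ≡ s′
mono-unique []      []        ms ms′ eq = refl
mono-unique (x ∷ s) (x′ ∷ s′) ms ms′ eq = cong₂ _∷_ x≡ (mono-unique s s′ (mono-tail ms) (mono-tail ms′)
    (λ b → ℕP.+-cancelˡ-≡ (𝟙 (x ≟F b)) _ _ (trans (eq b) (cong (λ z → 𝟙 (z ≟F b) ℕ.+ cntV s′ b) (sym x≡)))))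
  where
    self : ∀ {k} (z : Fin _) (u : Vec (Fin _) k) → cntV (z ∷ u) z ≢ 0
    self z u with z ≟F z
    ... | yes _ = ℕP.1+n≢0
    ... | no ne = ⊥-elim (ne refl)
    head-≤ : ∀ {k} z (u : Vec (Fin _) k) z′ (u′ : Vec (Fin _) k) → Mono (z ∷ u) → (∀ b → cntV (z ∷ u) b ≡ cntV (z′ ∷ u′) b) → toℕ z ℕ.≤ toℕ z′
    head-≤ z u z′ u′ m e = let t , at = cntV-∃ (z ∷ u) z′ (λ p → self z′ u′ (trans (sym (e z′)) p)) in
      ℕP.≤-trans (m zero t z≤n) (ℕP.≤-reflexive (cong toℕ at))
    x≡ : x ≡ x′
    x≡ = toℕ-injective (ℕP.≤-antisym (head-≤ x s x′ s′ ms eq) (head-≤ x′ s′ x s ms′ (sym ∘ eq)))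

insert : ∀ {N k} → Fin N → Vec (Fin N) k → Vec (Fin N) (suc k)
insert x []      = x ∷ []
insert x (y ∷ s) with toℕ x ℕP.≤? toℕ y
... | yes _ = x ∷ y ∷ s
... | no _  = y ∷ insert x s

insert-bound : ∀ {N k} (z x : Fin N) (s : Vec (Fin N) k) → toℕ z ℕ.≤ toℕ x → (∀ t → toℕ z ℕ.≤ toℕ (Vec.lookup s t)) →
  ∀ t → toℕ z ℕ.≤ toℕ (Vec.lookup (insert x s) t)
insert-bound z x []      le h zero = le
insert-bound z x (y ∷ s) le h t with toℕ x ℕP.≤? toℕ y
insert-bound z x (y ∷ s) le h zero    | yes _ = le
insert-bound z x (y ∷ s) le h (suc t) | yes _ = h t
insert-bound z x (y ∷ s) le h zero    | no _  = h zero
insert-bound z x (y ∷ s) le h (suc t) | no _  = insert-bound z x s le (h ∘ suc) t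

insert-mono : ∀ {N k} (x : Fin N) (s : Vec (Fin N) k) → Mono s → Mono (insert x s)
insert-mono x []      ms = mono-∷ x [] (λ ()) ms
insert-mono x (y ∷ s) ms with toℕ x ℕP.≤? toℕ y
... | yes le = mono-∷ x (y ∷ s) (λ t → ℕP.≤-trans le (ms zero t z≤n)) ms
... | no nle = mono-∷ y (insert x s) (insert-bound y x s (ℕP.<⇒≤ (ℕP.≰⇒> nle)) (λ t → ms zero (suc t) z≤n)) (insert-mono x s (mono-tail ms))

insert-cntV : ∀ {N k} (x : Fin N) (s : Vec (Fin N) k) b → cntV (insert x s) b ≡ cntV (x ∷ s) b
insert-cntV x []      b = refl
insert-cntV x (y ∷ s) b with toℕ x ℕP.≤? toℕ y
... | yes _ = refl
... | no _  = trans (cong (𝟙 (y ≟F b) ℕ.+_) (insert-cntV x s b)) (x∙yz≈y∙xz (𝟙 (y ≟F b)) (𝟙 (x ≟F b)) (cntV s b))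

sort : ∀ {N k} (w : Vec (Fin N) k) → ∃ λ (s : Vec (Fin N) k) → Mono s × (∀ b → cntV s b ≡ cntV w b)
sort []      = [] , (λ ()) , λ _ → refl
sort (x ∷ w) = let s , ms , eq = sort w in insert x s , insert-mono x s ms , λ b → trans (insert-cntV x s b) (cong (𝟙 (x ≟F b) ℕ.+_) (eq b))

∑ℕ-filter : ∀ {A : Set} {P : A → Set} (P? : ∀ a → Dec (P a)) (xs : List A) (f : A → ℕ) →
  ∑ℕ (List.filter P? xs) f ≡ ∑ℕ xs (λ a → 𝟙 (P? a) ℕ.* f a)
∑ℕ-filter P? []       f = refl
∑ℕ-filter P? (a ∷ xs) f with P? a
... | yes _ = cong₂ ℕ._+_ (sym (ℕP.+-identityʳ (f a))) (∑ℕ-filter P? xs f)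
... | no _  = ∑ℕ-filter P? xs f

∑ℕ-++ : ∀ {A : Set} (xs ys : List A) (f : A → ℕ) → ∑ℕ (xs List.++ ys) f ≡ ∑ℕ xs f ℕ.+ ∑ℕ ys f
∑ℕ-++ []       ys f = refl
∑ℕ-++ (a ∷ xs) ys f = trans (cong (f a ℕ.+_) (∑ℕ-++ xs ys f)) (sym (ℕP.+-assoc (f a) (∑ℕ xs f) (∑ℕ ys f)))

∑ℕ-map : ∀ {A B : Set} (g : A → B) (xs : List A) (f : B → ℕ) → ∑ℕ (List.map g xs) f ≡ ∑ℕ xs (f ∘ g)
∑ℕ-map g xs f = cong sum (sym (ListP.map-∘ xs))

𝟙-yes : ∀ {P : Set} (P? : Dec P) → P → 𝟙 P? ≡ 1
𝟙-yes (yes _) p = refl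
𝟙-yes (no ¬p) p = ⊥-elim (¬p p)

𝟙-no : ∀ {P : Set} (P? : Dec P) → ¬ P → 𝟙 P? ≡ 0
𝟙-no (yes p) ¬p = ⊥-elim (¬p p)
𝟙-no (no _)  ¬p = refl

_≟V_ : ∀ {k} (J J′ : Vec Bool k) → Dec (J ≡ J′)
_≟V_ = VecP.≡-dec _≟B_

-- Present exactly when `e` is the content of some word of length n; all coefficients at `e` are
-- then computed from this one sorted word.
record Content (m N : ℕ) (e : Fin N → ℕ) : Set where
  field
    word   : Vec (Fin N) (suc m)
    mono   : Mono word
    counts : ∀ b → cntV word b ≡ e b

-- Orbit sums and the expansion in the cyclic basis.

module Expansion (m : ℕ) where
  private
    n = suc m

    subsets : List (Vec Bool n)
    subsets = allSubsets n

    turn-inverse : ∀ {A : Set} {C D : Vec A n} k → turn C k ≡ D → C ≡ rotVs (toℕ k) D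
    turn-inverse {C = C} k refl = sym (rotVs-rotV⁻¹s (toℕ k) C)

  -- Rotating the index shows that all fibres of `turn J` over the orbit have the same size, and the
  -- fibre over `J` is the stabilizer.
  stab-count : ∀ J k → List.length (List.filter (λ i → turn J i ≟V turn J k) (List.allFin n)) ≡ stab m J
  stab-count J k = all-positions (λ k → fibre (turn J k) ≡ stab m J) forth zero base k
    where
      fibre : Vec Bool n → ℕ
      fibre J′ = List.length (List.filter (λ i → turn J i ≟V J′) (List.allFin n))
      turn-prev : ∀ i → turn J (prevF i) ≡ rotV (turn J i)
      turn-prev i = sym (rotV-turn J i)
      forth : ∀ k → fibre (turn J k) ≡ stab m J → fibre (turn J (nextF k)) ≡ stab m J
      forth k eq = trans (trans (length-filter _ (List.allFin n)) (trans (sym (∑ℕ-reindex (UniqueP.allFin⁺ n) ∈P.∈-allFin _≟F_ nextF prevF next-prev prev-next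
          (λ i → 𝟙 (turn J i ≟V turn J (nextF k))))) (sym (length-filter _ (List.allFin n)))))
        (trans (filter-⇔ (λ i → turn J (nextF i) ≟V turn J (nextF k)) (λ i → turn J i ≟V turn J k)
          (λ i h → trans (back i) (trans (cong rotV h) (sym (back k))))
          (λ i h → trans (turn-next J i) (trans (cong rotV⁻¹ h) (sym (turn-next J k)))) (List.allFin n)) eq)
        where
          back : ∀ i → turn J i ≡ rotV (turn J (nextF i))
          back i = trans (cong (turn J) (sym (prev-next i))) (turn-prev (nextF i))
      base : fibre (turn J zero) ≡ stab m J
      base = trans (filter-⇔ (λ i → turn J i ≟V J) (λ i → shift m J i ≟V J)
          (λ i h → trans (shift≡ m J i) (sym (turn-inverse i h)))
          (λ i h → trans (cong (rotV⁻¹s (toℕ i)) (sym (trans (sym (shift≡ m J i)) h))) (rotV⁻¹s-rotVs (toℕ i) J)) (List.allFin n))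
        (trans (length-filter (λ i → shift m J i ≟V J) (List.allFin n)) (trans (cong₂ ℕ._+_ (𝟙-yes (shift m J zero ≟V J) (shift≡ m J zero)) tail)
          (cong suc (sym (length-filter (λ i → shift m J (suc i) ≟V J) (List.allFin m))))))
        where
          tail : ∑ℕ (List.tabulate suc) (λ i → 𝟙 (shift m J i ≟V J)) ≡ ∑ℕ (List.allFin m) (λ i → 𝟙 (shift m J (suc i) ≟V J))
          tail = trans (cong (λ xs → ∑ℕ xs (λ i → 𝟙 (shift m J i ≟V J))) (sym (ListP.map-tabulate (λ i → i) suc)))
            (∑ℕ-map suc (List.allFin m) (λ i → 𝟙 (shift m J i ≟V J)))

  Orbit : Vec Bool n → Vec Bool n → Set
  Orbit J J′ = ∃ λ k → turn J k ≡ J′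

  orbit? : ∀ J J′ → Dec (Orbit J J′)
  orbit? J J′ = any? (λ k → turn J k ≟V J′)

  -- Every member of the orbit of J is hit by as many turns as J itself.
  ∑ℕ-turns : ∀ J (f : Vec Bool n → ℕ) → ∑ℕ (List.allFin n) (f ∘ turn J) ≡ stab m J ℕ.* ∑ℕ subsets (λ J′ → 𝟙 (orbit? J J′) ℕ.* f J′)
  ∑ℕ-turns J f = begin
    ∑ℕ (List.allFin n) (f ∘ turn J)
      ≡⟨ ∑ℕ-cong (List.allFin n) (λ k → sym (spread k)) ⟩
    ∑ℕ (List.allFin n) (λ k → ∑ℕ subsets (λ J′ → f J′ ℕ.* 𝟙 (turn J k ≟V J′)))
      ≡⟨ ∑ℕ-swap (List.allFin n) subsets (λ k J′ → f J′ ℕ.* 𝟙 (turn J k ≟V J′)) ⟩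
    ∑ℕ subsets (λ J′ → ∑ℕ (List.allFin n) (λ k → f J′ ℕ.* 𝟙 (turn J k ≟V J′)))
      ≡⟨ ∑ℕ-cong subsets (λ J′ → trans (∑ℕ-* (List.allFin n) (f J′) (λ k → 𝟙 (turn J k ≟V J′)))
           (trans (cong (f J′ ℕ.*_) (sym (length-filter (λ k → turn J k ≟V J′) (List.allFin n)))) (fibre J′))) ⟩
    ∑ℕ subsets (λ J′ → stab m J ℕ.* (𝟙 (orbit? J J′) ℕ.* f J′))
      ≡⟨ ∑ℕ-* subsets (stab m J) (λ J′ → 𝟙 (orbit? J J′) ℕ.* f J′) ⟩
    stab m J ℕ.* ∑ℕ subsets (λ J′ → 𝟙 (orbit? J J′) ℕ.* f J′) ∎
    where
      open ≡-Reasoning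
      spread : ∀ k → ∑ℕ subsets (λ J′ → f J′ ℕ.* 𝟙 (turn J k ≟V J′)) ≡ f (turn J k)
      spread k = trans (∑ℕ-pick (allSubsets-unique n) (allSubsets-complete (turn J k)) (λ J′ → f J′ ℕ.* 𝟙 (turn J k ≟V J′))
          (λ J′ ne → trans (cong (f J′ ℕ.*_) (𝟙-no (turn J k ≟V J′) (ne ∘ sym))) (ℕP.*-zeroʳ (f J′))))
        (trans (cong (f (turn J k) ℕ.*_) (𝟙-yes (turn J k ≟V turn J k) refl)) (ℕP.*-identityʳ (f (turn J k))))
      fibre : ∀ J′ → f J′ ℕ.* List.length (List.filter (λ k → turn J k ≟V J′) (List.allFin n)) ≡ stab m J ℕ.* (𝟙 (orbit? J J′) ℕ.* f J′)
      fibre J′ = go (orbit? J J′)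
        where
          go : ∀ (o : Dec (Orbit J J′)) → f J′ ℕ.* List.length (List.filter (λ k → turn J k ≟V J′) (List.allFin n)) ≡ stab m J ℕ.* (𝟙 o ℕ.* f J′)
          go (yes (k , refl)) = trans (cong (f J′ ℕ.*_) (stab-count J k)) (trans (ℕP.*-comm (f J′) (stab m J)) (cong (stab m J ℕ.*_) (sym (ℕP.*-identityˡ (f J′)))))
          go (no ¬o) = trans (cong (f J′ ℕ.*_) (filter-none (λ k → turn J k ≟V J′) (λ k h → ¬o (k , h)) (List.allFin n)))
            (trans (ℕP.*-zeroʳ (f J′)) (sym (ℕP.*-zeroʳ (stab m J))))

  code-injective : ∀ {k} (J J′ : Vec Bool k) → code m J ≡ code m J′ → J ≡ J′
  code-injective []          []           eq = refl
  code-injective (true ∷ J)  (true ∷ J′)  eq = cong (true ∷_) (code-injective J J′ (ℕP.*-cancelˡ-≡ _ _ 2 (ℕP.suc-injective eq)))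
  code-injective (false ∷ J) (false ∷ J′) eq = cong (false ∷_) (code-injective J J′ (ℕP.*-cancelˡ-≡ _ _ 2 eq))
  code-injective (true ∷ J)  (false ∷ J′) eq = ⊥-elim (ℕP.even≢odd (code m J′) (code m J) (sym eq))
  code-injective (false ∷ J) (true ∷ J′)  eq = ⊥-elim (ℕP.even≢odd (code m J) (code m J′) eq)

  -- Two representatives of one orbit are turns of each other and each has the smallest code among
  -- its shifts; equal codes mean equal sets.
  rep-unique : ∀ {J₀ J₁ J′} → IsOrbitRep m J₀ → IsOrbitRep m J₁ → Orbit J₀ J′ → Orbit J₁ J′ → J₀ ≡ J₁
  rep-unique {J₀} {J₁} r₀ r₁ o₀ o₁ = code-injective J₀ J₁ (ℕP.≤-antisym (below r₀ o₀ o₁) (below r₁ o₁ o₀))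
    where
      below : ∀ {J₀ J₁ J′} → IsOrbitRep m J₀ → Orbit J₀ J′ → Orbit J₁ J′ → code m J₀ ℕ.≤ code m J₁
      below {J₀} {J₁} r (k₀ , refl) (k₁ , eq) with turn-is-shift m J₀ (pr (toℕ k₁) k₀)
      ... | i , is = ℕP.≤-trans (proj₁ r i) (ℕP.≤-reflexive (cong (code m) (sym (trans (turn-inverse k₁ eq) (trans (rotVs-turn (toℕ k₁) J₀ k₀) is)))))

  argmin : ∀ {k} (f : Fin (suc k) → ℕ) → ∃ λ i → ∀ j → f i ℕ.≤ f j
  argmin {zero}  f = zero , λ { zero → ℕP.≤-refl }
  argmin {suc k} f with argmin (f ∘ suc)
  ... | i , mn with f zero ℕP.≤? f (suc i)
  ...   | yes le = zero , λ { zero → ℕP.≤-refl ; (suc j) → ℕP.≤-trans le (mn j) }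
  ...   | no nle = suc i , λ { zero → ℕP.<⇒≤ (ℕP.≰⇒> nle) ; (suc j) → mn j }

  rep-exists : ∀ J′ → ones J′ ≢ 0 → ∃ λ J → IsOrbitRep m J × Orbit J J′
  rep-exists J′ ne with argmin (code m ∘ turn J′)
  ... | k , mn = turn J′ k , ((λ i → ℕP.≤-trans (mn (pr (toℕ i) k)) (ℕP.≤-reflexive (cong (code m) (sym (trans (shift≡ m (turn J′ k) i) (rotVs-turn (toℕ i) J′ k))))))
      , nonempty (ones (turn J′ k)) refl) , back
    where
      nonempty : ∀ o → ones (turn J′ k) ≡ o → ∃ λ j → Vec.lookup (turn J′ k) j ≡ true
      nonempty zero    eq = ⊥-elim (ne (trans (sym (turn-invariant ones (λ { (b ∷ D) → ones-∷ʳ D b }) J′ k)) eq))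
      nonempty (suc o) eq = ones-suc (turn J′ k) eq
      back : Orbit (turn J′ k) J′
      back = all-positions (λ l → Orbit (turn J′ l) J′)
        (λ l (i , eq) → prevF i , trans (sym (rotV-turn (turn J′ (nextF l)) i)) (trans (step-back i l) eq)) zero (zero , refl) k
        where
          step-back : ∀ i l → rotV (turn (turn J′ (nextF l)) i) ≡ turn (turn J′ l) i
          step-back i l = trans (cong (λ D → rotV (turn D i)) (turn-next J′ l)) (trans (cong rotV (sym (comm (toℕ i) (turn J′ l)))) (rotV-rotV⁻¹ (turn (turn J′ l) i)))
            where
              comm : ∀ r (C : Vec Bool n) → rotV⁻¹ (rotV⁻¹s r C) ≡ rotV⁻¹s r (rotV⁻¹ C)
              comm zero    C = refl
              comm (suc r) C = cong rotV⁻¹ (comm r C)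

  module _ {N : ℕ} (e : Fin N → ℕ) (sorted : Content m N e) where
    open Content sorted renaming (word to s; mono to ms)

    private
      E = des s

      Fits : Vec Bool n → Set
      Fits J = SubV (Vec.init J) E

      fits? : ∀ J → Dec (Fits J)
      fits? J = subV? (Vec.init J) E

      pairs : List (Vec (Fin N) n × Fin n)
      pairs = List.concatMap (λ w → List.map (w ,_) (List.allFin n)) (allVecs N n)

      pairs-unique : Unique pairs
      pairs-unique = AllPairsP.concat⁺
        (AllP.map⁺ (All.tabulate (λ _ → AllPairsP.map⁺ (AllPairs.map (λ ne eq → ne (cong proj₂ eq)) (UniqueP.allFin⁺ n)))))
        (AllPairsP.map⁺ (AllPairs.map
          (λ ne → AllP.map⁺ (All.tabulate (λ _ → AllP.map⁺ (All.tabulate (λ _ eq → ne (cong proj₁ eq)))))) (allVecs-unique N n)))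

      pairs-complete : ∀ wk → wk ∈ pairs
      pairs-complete (w , k) = ∈P.∈-concatMap⁺ _ (Any.map (λ { refl → ∈P.∈-map⁺ (w ,_) (∈P.∈-allFin k) }) (allVecs-complete w))

      nx-inject-prev : ∀ (k : Fin n) i → nx (toℕ k) (Fin.inject₁ i) ≢ prevF k
      nx-inject-prev k i eq = ℕP.<-irrefl (FinP.toℕ-fromℕ m) (subst (ℕ._< m) (trans (sym (FinP.toℕ-inject₁ i)) (cong toℕ top)) (toℕ<n i))
        where
          top : Fin.inject₁ i ≡ Fin.fromℕ m
          top = trans (sym (pr-nx (toℕ k) (Fin.inject₁ i))) (trans (cong (pr (toℕ k)) eq) (trans (sym (prev-pr (toℕ k) k))
            (cong prevF (trans (cong (pr (toℕ k)) (sym (nx-zero k))) (pr-nx (toℕ k) zero)))))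

      Cyc : Vec Bool n → Vec (Fin N) n × Fin n → Set
      Cyc J wk = (∀ j → PcycCond m J (proj₁ wk) (proj₂ wk) j) × HasContentW m e (proj₁ wk)

      module _ (J : Vec Bool n) where

        module FromPair (w : Vec (Fin N) n) (k : Fin n) (cyc : Cyc J (w , k)) where
          pos : Fin m → Fin n
          pos i = nx (toℕ k) (Fin.inject₁ i)
          at : ∀ i → Vec.lookup (turn w k) (Fin.inject₁ i) ≡ Vec.lookup w (pos i)
          at i = lookup-rotV⁻¹s (toℕ k) w (Fin.inject₁ i)
          at-next : ∀ i → Vec.lookup (turn w k) (suc i) ≡ Vec.lookup w (nextP m (pos i))
          at-next i = trans (lookup-rotV⁻¹s (toℕ k) w (suc i)) (cong (Vec.lookup w) (trans (cong (nx (toℕ k)) (sym (next-inject i)))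
            (trans (nx-next (toℕ k) (Fin.inject₁ i)) (sym (nextP≡ m (pos i))))))
          inner : ∀ i → pos i ≢ prevP m k
          inner i eq = nx-inject-prev k i (trans eq (prevP≡ m k))
          -- Read from `k`, the word weakly increases, and there is only one such word with content
          -- `e`.
          turned : turn w k ≡ s
          turned = mono-unique (turn w k) s (mono-consecutive (turn w k)
              (λ i → subst₂ (λ x y → toℕ x ℕ.≤ toℕ y) (sym (at i)) (sym (at-next i)) (proj₁ (proj₁ cyc (pos i)) (inner i)))) ms
            (λ b → trans (cntV-turn w k b) (trans (sym (count-cntV w b)) (trans (proj₂ cyc b) (sym (counts b)))))
          fits : Fits (turn J k)
          fits i t = trans (des-at s i) (Equivalence.to BoolP.T-≡ (ℕP.<⇒<ᵇ
            (subst₂ (λ x y → toℕ x ℕ.< toℕ y) (trans (sym (at i)) (cong (λ u → Vec.lookup u (Fin.inject₁ i)) turned))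
              (trans (sym (at-next i)) (cong (λ u → Vec.lookup u (suc i)) turned))
              (proj₂ (proj₁ cyc (pos i)) (inner i) (trans (sym (lookup-rotV⁻¹s (toℕ k) J (Fin.inject₁ i))) (trans (lookup-init (turn J k) i) t))))))

        module FromTurn (k : Fin n) (fits : Fits (turn J k)) where
          w : Vec (Fin N) n
          w = rotVs (toℕ k) s
          place-of : ∀ j → j ≢ prevP m k → ∃ λ i → j ≡ nx (toℕ k) (Fin.inject₁ i)
          place-of j ne with pr (toℕ k) j in eq
          ... | t with view t
          ...   | ‵inject₁ i = i , trans (sym (nx-pr (toℕ k) j)) (cong (nx (toℕ k)) eq)
          ...   | ‵fromℕ     = ⊥-elim (ne (trans (sym (nx-pr (toℕ k) j)) (trans (cong (nx (toℕ k)) eq) (trans top (sym (prevP≡ m k))))))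
            where
              top : nx (toℕ k) (Fin.fromℕ m) ≡ prevF k
              top = trans (sym (prev-next _)) (cong prevF (trans (sym (nx-next (toℕ k) (Fin.fromℕ m)))
                (trans (cong (nx (toℕ k)) (next-fromℕ m)) (nx-zero k))))
          at : ∀ t → Vec.lookup w (nx (toℕ k) t) ≡ Vec.lookup s t
          at t = trans (lookup-rotVs (toℕ k) s (nx (toℕ k) t)) (cong (Vec.lookup s) (pr-nx (toℕ k) t))
          at-next : ∀ i → Vec.lookup w (nextP m (nx (toℕ k) (Fin.inject₁ i))) ≡ Vec.lookup s (suc i)
          at-next i = trans (cong (Vec.lookup w) (trans (nextP≡ m _) (trans (sym (nx-next (toℕ k) (Fin.inject₁ i)))
            (cong (nx (toℕ k)) (next-inject i))))) (at (suc i))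
          cyc : Cyc J (w , k)
          cyc = (λ j → weak j , strict j) , λ b → trans (count-cntV w b) (trans (sym (cntV-turn w k b))
              (trans (cong (λ u → cntV u b) (rotV⁻¹s-rotVs (toℕ k) s)) (counts b)))
            where
              weak : ∀ j → j ≢ prevP m k → toℕ (Vec.lookup w j) ℕ.≤ toℕ (Vec.lookup w (nextP m j))
              weak j ne with place-of j ne
              ... | i , refl = subst₂ (λ x y → toℕ x ℕ.≤ toℕ y) (sym (at (Fin.inject₁ i))) (sym (at-next i))
                      (ms (Fin.inject₁ i) (suc i) (ℕP.≤-trans (ℕP.≤-reflexive (FinP.toℕ-inject₁ i)) (ℕP.n≤1+n (toℕ i))))
              strict : ∀ j → j ≢ prevP m k → Vec.lookup J j ≡ true → toℕ (Vec.lookup w j) ℕ.< toℕ (Vec.lookup w (nextP m j))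
              strict j ne t with place-of j ne
              ... | i , refl = subst₂ (λ x y → toℕ x ℕ.< toℕ y) (sym (at (Fin.inject₁ i))) (sym (at-next i))
                      (ℕP.<ᵇ⇒< _ _ (Equivalence.from BoolP.T-≡ (trans (sym (des-at s i)) (fits i
                        (trans (sym (lookup-init (turn J k) i)) (trans (lookup-rotV⁻¹s (toℕ k) J (Fin.inject₁ i)) t))))))

        -- The word is determined by `k`, so the pairs are counted by `k` alone. The exempt position
        -- k - 1 becomes the last position of the turned set, which `Vec.init` drops.
        FcycCoeff-turns : FcycCoeff m N J e ≡ ∑ℕ (List.allFin n) (λ k → 𝟙 (fits? (turn J k)))
        FcycCoeff-turns = trans (ℕP.≤-antisym
          (filter-≤ (pcycWithContent? m J e) (λ k → fits? (turn J k)) pairs-unique ∈P.∈-allFin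
            (λ wk _ → proj₂ wk) (λ (w , k) cyc → FromPair.fits w k cyc)
            (λ { (w , k) (w′ , .k) cyc cyc′ refl → cong (_, k) (trans (turn-inverse k (trans (FromPair.turned w k cyc) (sym (FromPair.turned w′ k cyc′))))
              (rotVs-rotV⁻¹s (toℕ k) w′)) }))
          (filter-≤ (λ k → fits? (turn J k)) (pcycWithContent? m J e) (UniqueP.allFin⁺ n) pairs-complete
            (λ k f → FromTurn.w k f , k) (λ k f → FromTurn.cyc k f) (λ _ _ _ _ eq → cong proj₂ eq)))
          (length-filter (λ k → fits? (turn J k)) (List.allFin n))

        -- Turning hits each member of the orbit as often as the order of the stabilizer, so the
        -- division is exact and leaves a plain sum over the orbit.
        FcycHat-orbit : FcycHatCoeff m N J e ≡ ∑ℕ subsets (λ J′ → 𝟙 (orbit? J J′) ℕ.* 𝟙 (fits? J′))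
        FcycHat-orbit = trans (cong (λ a → a DivMod./ stab m J) (trans FcycCoeff-turns (trans (∑ℕ-turns J (λ J′ → 𝟙 (fits? J′))) (ℕP.*-comm (stab m J) _))))
          (DivMod.m*n/n≡m _ (stab m J))

    -- As `c` is constant on orbits, the sum over representatives and their orbits visits every
    -- nonempty set once; the empty set, which has no representative, contributes `c = 0`.
    expansion-fits : ∀ (c : Vec Bool n → ℕ) → (∀ J → c (rotV J) ≡ c J) → (∀ J → ones J ≡ 0 → c J ≡ 0) →
      cycExpansionCoeff m c N e ≡ ∑ℕ subsets (λ J → 𝟙 (fits? J) ℕ.* c J)
    expansion-fits c rotated empty = begin
      cycExpansionCoeff m c N e
        ≡⟨ ∑ℕ-filter (isOrbitRep? m) subsets (λ J → c J ℕ.* FcycHatCoeff m N J e) ⟩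
      ∑ℕ subsets (λ J → 𝟙 (isOrbitRep? m J) ℕ.* (c J ℕ.* FcycHatCoeff m N J e))
        ≡⟨ ∑ℕ-cong subsets (λ J → trans (sym (ℕP.*-assoc (𝟙 (isOrbitRep? m J)) (c J) _)) (trans (cong (weight J ℕ.*_) (FcycHat-orbit J))
             (sym (∑ℕ-* subsets (weight J) _)))) ⟩
      ∑ℕ subsets (λ J → ∑ℕ subsets (λ J′ → weight J ℕ.* (𝟙 (orbit? J J′) ℕ.* 𝟙 (fits? J′))))
        ≡⟨ ∑ℕ-swap subsets subsets (λ J J′ → weight J ℕ.* (𝟙 (orbit? J J′) ℕ.* 𝟙 (fits? J′))) ⟩
      ∑ℕ subsets (λ J′ → ∑ℕ subsets (λ J → weight J ℕ.* (𝟙 (orbit? J J′) ℕ.* 𝟙 (fits? J′))))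
        ≡⟨ ∑ℕ-cong subsets (λ J′ → trans (∑ℕ-cong subsets (λ J → trans (sym (ℕP.*-assoc (weight J) (𝟙 (orbit? J J′)) _)) (ℕP.*-comm _ (𝟙 (fits? J′)))))
             (trans (∑ℕ-* subsets (𝟙 (fits? J′)) (λ J → weight J ℕ.* 𝟙 (orbit? J J′))) (cong (𝟙 (fits? J′) ℕ.*_) (one-rep J′)))) ⟩
      ∑ℕ subsets (λ J → 𝟙 (fits? J) ℕ.* c J) ∎
      where
        open ≡-Reasoning
        weight : Vec Bool n → ℕ
        weight J = 𝟙 (isOrbitRep? m J) ℕ.* c J
        c-orbit : ∀ {J J′} → Orbit J J′ → c J ≡ c J′
        c-orbit {J} (k , refl) = sym (turn-invariant c (λ C → trans (sym (rotated (rotV⁻¹ C))) (cong c (rotV-rotV⁻¹ C))) J k)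
        one-rep : ∀ J′ → ∑ℕ subsets (λ J → weight J ℕ.* 𝟙 (orbit? J J′)) ≡ c J′
        one-rep J′ = go (ones J′ ℕP.≟ 0)
          where
            go : Dec (ones J′ ≡ 0) → ∑ℕ subsets (λ J → weight J ℕ.* 𝟙 (orbit? J J′)) ≡ c J′
            go (yes none) = trans (∑ℕ-zero subsets (λ J → vanish J (orbit? J J′))) (sym (empty J′ none))
              where
                vanish : ∀ J (o : Dec (Orbit J J′)) → weight J ℕ.* 𝟙 o ≡ 0
                vanish J (no _)  = ℕP.*-zeroʳ (weight J)
                vanish J (yes o) = trans (ℕP.*-identityʳ (weight J)) (trans (cong (𝟙 (isOrbitRep? m J) ℕ.*_) (trans (c-orbit o) (empty J′ none)))
                  (ℕP.*-zeroʳ (𝟙 (isOrbitRep? m J))))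
            go (no some) = trans (∑ℕ-pick (allSubsets-unique n) (allSubsets-complete J₀) (λ J → weight J ℕ.* 𝟙 (orbit? J J′))
                (λ J ne → off J ne (isOrbitRep? m J) (orbit? J J′)))
              (trans (cong₂ ℕ._*_ (trans (cong (ℕ._* c J₀) (𝟙-yes (isOrbitRep? m J₀) r₀)) (ℕP.*-identityˡ (c J₀))) (𝟙-yes (orbit? J₀ J′) o₀))
                (trans (ℕP.*-identityʳ (c J₀)) (c-orbit o₀)))
              where
                J₀ = proj₁ (rep-exists J′ some)
                r₀ = proj₁ (proj₂ (rep-exists J′ some))
                o₀ = proj₂ (proj₂ (rep-exists J′ some))
                off : ∀ J → J ≢ J₀ → (r : Dec (IsOrbitRep m J)) (o : Dec (Orbit J J′)) → 𝟙 r ℕ.* c J ℕ.* 𝟙 o ≡ 0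
                off J ne (no _)  o       = refl
                off J ne (yes _) (no _)  = ℕP.*-zeroʳ (1 ℕ.* c J)
                off J ne (yes r) (yes o) = ⊥-elim (ne (rep-unique r r₀ o o₀))

    -- The condition ignores the last position, so D and D ∪ {n} can be grouped together.
    fits-sum : ∀ (c : Vec Bool n → ℕ) → ∑ℕ subsets (λ J → 𝟙 (fits? J) ℕ.* c J) ≡
      ∑ℕ (allSubsets m) (λ D → 𝟙 (subV? D E) ℕ.* (c (D Vec.∷ʳ false) ℕ.+ c (D Vec.∷ʳ true)))
    fits-sum c = begin
      ∑ℕ subsets F
        -- Subsets are enumerated by their first entry; rotating moves the last position, by which
        -- they are to be grouped, to the front.
        ≡⟨ sym (∑ℕ-reindex (allSubsets-unique n) allSubsets-complete _≟V_ rotV⁻¹ rotV rotV⁻¹-rotV rotV-rotV⁻¹ F) ⟩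
      ∑ℕ subsets (F ∘ rotV⁻¹)
        ≡⟨ trans (∑ℕ-++ (List.map (true ∷_) (allSubsets m)) (List.map (false ∷_) (allSubsets m) List.++ []) (F ∘ rotV⁻¹))
             (cong₂ ℕ._+_ (∑ℕ-map (true ∷_) (allSubsets m) (F ∘ rotV⁻¹))
               (trans (cong (λ xs → ∑ℕ xs (F ∘ rotV⁻¹)) (ListP.++-identityʳ (List.map (false ∷_) (allSubsets m)))) (∑ℕ-map (false ∷_) (allSubsets m) (F ∘ rotV⁻¹)))) ⟩
      ∑ℕ (allSubsets m) (λ D → F (D Vec.∷ʳ true)) ℕ.+ ∑ℕ (allSubsets m) (λ D → F (D Vec.∷ʳ false))
        ≡⟨ sym (∑ℕ-+ (allSubsets m) (λ D → F (D Vec.∷ʳ true)) (λ D → F (D Vec.∷ʳ false))) ⟩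
      ∑ℕ (allSubsets m) (λ D → F (D Vec.∷ʳ true) ℕ.+ F (D Vec.∷ʳ false))
        ≡⟨ ∑ℕ-cong (allSubsets m) both ⟩
      ∑ℕ (allSubsets m) (λ D → 𝟙 (subV? D E) ℕ.* (c (D Vec.∷ʳ false) ℕ.+ c (D Vec.∷ʳ true))) ∎
      where
        open ≡-Reasoning
        F : Vec Bool n → ℕ
        F J = 𝟙 (fits? J) ℕ.* c J
        at : ∀ D b → F (D Vec.∷ʳ b) ≡ 𝟙 (subV? D E) ℕ.* c (D Vec.∷ʳ b)
        at D b = cong (λ D′ → 𝟙 (subV? D′ E) ℕ.* c (D Vec.∷ʳ b)) (VecP.init-∷ʳ b D)
        both : ∀ D → F (D Vec.∷ʳ true) ℕ.+ F (D Vec.∷ʳ false) ≡ 𝟙 (subV? D E) ℕ.* (c (D Vec.∷ʳ false) ℕ.+ c (D Vec.∷ʳ true))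
        both D = trans (cong₂ ℕ._+_ (at D true) (at D false)) (trans (sym (ℕP.*-distribˡ-+ (𝟙 (subV? D E)) _ _))
          (cong (𝟙 (subV? D E) ℕ.*_) (ℕP.+-comm (c (D Vec.∷ʳ true)) (c (D Vec.∷ʳ false)))))

    words-sum : ∀ {ℓ} {P : Vec (Fin ℓ) n → Set} (P? : ∀ u → Dec (P u)) →
      ∑ℕ (allSubsets m) (λ D → 𝟙 (subV? D E) ℕ.* List.length (List.filter (λ u → P? u ×-dec VecP.≡-dec _≟B_ (des u) D) (allVecs ℓ n))) ≡
      List.length (List.filter (λ u → P? u ×-dec subV? (des u) E) (allVecs ℓ n))
    words-sum {ℓ} {P} P? = trans (∑ℕ-cong (allSubsets m) (λ D → part D (subV? D E)))
        (∑ℕ-fibre (λ u → P? u ×-dec subV? (des u) E) _≟V_ des (allSubsets-unique m) allSubsets-complete (allVecs ℓ n))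
      where
        part : ∀ D (d : Dec (SubV D E)) → 𝟙 d ℕ.* List.length (List.filter (λ u → P? u ×-dec VecP.≡-dec _≟B_ (des u) D) (allVecs ℓ n)) ≡
          List.length (List.filter (λ u → (P? u ×-dec subV? (des u) E) ×-dec (des u ≟V D)) (allVecs ℓ n))
        part D (yes d) = trans (ℕP.*-identityˡ _) (filter-⇔ (λ u → P? u ×-dec VecP.≡-dec _≟B_ (des u) D) (λ u → (P? u ×-dec subV? (des u) E) ×-dec (des u ≟V D))
          (λ { u (p , refl) → (p , d) , refl }) (λ { u ((p , _) , eq) → p , eq }) (allVecs ℓ n))
        part D (no ¬d) = sym (filter-none (λ u → (P? u ×-dec subV? (des u) E) ×-dec (des u ≟V D)) (λ { u ((_ , d) , refl) → ¬d d }) (allVecs ℓ n))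

content? : ∀ m N e → Dec (Content m N e)
content? m N e with Any.any? (λ w → allF? (λ b → cntV w b ℕP.≟ e b)) (allVecs N (suc m))
... | yes some = let w , _ , cw = find some ; s , ms , cs = sort w in yes (record { word = s ; mono = ms ; counts = λ b → trans (cs b) (cw b) })
... | no none  = no (λ ct → none (Any.map (λ { refl → Content.counts ct }) (allVecs-complete (Content.word ct))))

content-of : ∀ {m N e k} → k ≡ suc m → (w : Vec (Fin N) k) → (∀ a → count (λ p → Vec.lookup w p ≟F a) ≡ e a) → Content m N e
content-of refl w cw = let s , ms , cs = sort w in record { word = s ; mono = ms ; counts = λ b → trans (cs b) (trans (sym (count-cntV w b)) (cw b)) }

theorem4p1 : (m : ℕ) (lam mu : List ℕ)
    → IsPartition lam → IsPartition mu → mu ⊆P lam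
    → length (cells lam mu) ≡ suc m
    → ¬ IsConnectedRibbon lam mu
    → Σ (Vec Bool (suc m) → ℕ) (λ c →
        (N : ℕ) (e : Fin N → ℕ) → skewSchurCoeff lam mu N e ≡ cycExpansionCoeff m c N e)
theorem4p1 m lam mu plam pmu sub len ¬cr = number , λ N e → go N e (content? m N e)
  where
    open Fillings lam mu plam pmu sub
    open Shapes ℓ hi using (valid?)
    open Expansion m
    open CyclicNumbers (Shape.cyclic-numbers lam mu plam pmu sub m len ¬cr)
    open ≡-Reasoning

    go : ∀ N (e : Fin N → ℕ) → Dec (Content m N e) → skewSchurCoeff lam mu N e ≡ cycExpansionCoeff m number N e
    -- No word of length n has content `e`, so neither side has anything to count.
    go N e (no none) = trans (filter-none (ssytWithContent? lam mu N e) (λ T (_ , ct) → none (content-of len T ct)) (allVecs N (length (cells lam mu))))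
      (sym (∑ℕ-zero (orbitReps m) (λ J → trans (cong (λ a → number J ℕ.* (a DivMod./ stab m J)) (Fcyc-none J))
        (trans (cong (number J ℕ.*_) (DivMod.0/n≡0 (stab m J))) (ℕP.*-zeroʳ (number J))))))
      where
        Fcyc-none : ∀ J → FcycCoeff m N J e ≡ 0
        Fcyc-none J = filter-none (pcycWithContent? m J e) (λ wk (_ , ct) → none (content-of refl (proj₁ wk) ct))
          (List.concatMap (λ w → List.map (w ,_) (List.allFin (suc m))) (allVecs N (suc m)))
    go N e (yes ct) = begin
      skewSchurCoeff lam mu N e
        ≡⟨ Standard.skewSchur-words s (Content.mono ct) e (Content.counts ct) ⟩
      List.length (List.filter (λ u → valid? lo u ×-dec subV? (des u) (des s)) (allVecs ℓ (suc m)))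
        ≡⟨ sym (words-sum e ct (valid? lo)) ⟩
      ∑ℕ (allSubsets m) (λ D → 𝟙 (subV? D (des s)) ℕ.* List.length (List.filter (λ u → valid? lo u ×-dec VecP.≡-dec _≟B_ (des u) D) (allVecs ℓ (suc m))))
        ≡⟨ ∑ℕ-cong (allSubsets m) (λ D → cong (𝟙 (subV? D (des s)) ℕ.*_) (sym (added D))) ⟩
      ∑ℕ (allSubsets m) (λ D → 𝟙 (subV? D (des s)) ℕ.* (number (D Vec.∷ʳ false) ℕ.+ number (D Vec.∷ʳ true)))
        ≡⟨ sym (fits-sum e ct number) ⟩
      ∑ℕ (allSubsets (suc m)) (λ J → 𝟙 (subV? (Vec.init J) (des s)) ℕ.* number J)
        ≡⟨ sym (expansion-fits e ct number rotated empty) ⟩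
      cycExpansionCoeff m number N e ∎
      where s = Content.word ct
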